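{- Let $p$ be a prime, $s\ge1$, and let $a$ be an integer such that $x^{p^s}-a$ is irreducible over $\mathbb{Q}$ and $|a|$ is $p^s$-th power free, written as $|a|=\prod_{j=1}^{p^s-1}a_j^{\,j}$ with $a_1,\dots,a_{p^s-1}$ squarefree positive integers that are pairwise coprime. Assume that $p$ does not divide $\gcd(a,v_p(a))$ (i.e. either $p\nmid a$, or $p\mid a$ and $p\nmid v_p(a)$). Let $\theta$ be a root of $x^{p^s}-a$ and $K=\mathbb{Q}(\theta)$. Let $r=v_p(a^{p-1}-1)-1$ and $d=\min\{r,s\}$. For $0\le m<p^s$, let $k_m$ be the largest integer with $0\le k_m\le d$ such that $m\ge p^s-p^{s-k_m}$, let $j_m$ be given by $m=p^s-p^{s-k_m}+j_m$, and let $C_m=\prod_{j=1}^{p^s-1}a_j^{\lfloor jm/p^s\rfloor}$. For $m\ge\varphi(p^s)$ (equivalently $k_m\ge1$), fix an integer $a'_m$ congruent modulo $p^{k_m+1}$ to $a^{(p-2)p^{s-k_m-1}}$ if $k_m<s$, and to $a^{p-2}$ if $k_m=s$; let $w_m\in\mathbb{Z}$ satisfy $w_mC_m(a'_m)^{p^{k_m}-1}\equiv1\pmod{p^{k_m}}$, and put $$\delta_m=w_mC_m\theta^{j_m}\sum_{i=0}^{p^{k_m}-2}\left(a'_m\theta^{p^{s-k_m}}\right)^i.$$ Then: (i) if $r=0$ or $r=-1$, then $\{1,\frac{\theta}{C_1},\frac{\theta^2}{C_2},\dots,\frac{\theta^{p^s-1}}{C_{p^s-1}}\}$ is an integral basis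 of $K$; (ii) if $r\ge1$, then $\{1,\frac{\theta}{C_1},\dots,\frac{\theta^{\varphi(p^s)-1}}{C_{\varphi(p^s)-1}}\}\cup\{\frac{\theta^m+\delta_m}{p^{k_m}C_m}\mid \varphi(p^s)\le m\le p^s-1\}$ is an integral basis of $K$.
   Context: $v_p(x)$ denotes the exponent of the highest power of $p$ dividing the nonzero integer $x$ (with $v_p(x)=0$ if $p\nmid x$); $\varphi$ is Euler's totient function; $\lfloor\lambda\rfloor$ is the greatest integer not exceeding $\lambda$. An integral basis of $K$ is a $\mathbb{Z}$-basis of the ring of algebraic integers of $K$. -}

module Defs where

open import Data.Nat as ℕ using (ℕ; zero; suc; _∸_; _≤_; _<_; _≤?_; _⊓_)
open import Data.Nat.Divisibility as ℕD using (_∣?_)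
open import Data.Nat.Coprimality using (coprime?)
open import Data.Integer as ℤ using (ℤ; +_; ∣_∣)
open import Data.Integer.Divisibility as ℤD using ()
open import Data.Rational as ℚ using (ℚ; 0ℚ; 1ℚ)
import Data.Fin
open Data.Fin using (Fin; toℕ)
open import Data.List using (List; length; filter)
open import Data.List.Base using (upTo)
open import Data.Product using (Σ; ∃; ∃-syntax; _×_; _,_)
open import Relation.Nullary using (¬_; yes; no; Dec)
open import Relation.Binary.PropositionalEquality using (_≡_)
open import Data.Nat using (_≟_)

-- floor division ⌊x / y⌋ and remainder (only used with y > 0;
-- the value for y = 0 is an irrelevant convention)
quot : ℕ → ℕ → ℕ
quot x zero    = 0
quot x (suc y) = x ℕ./ suc y

rem : ℕ → ℕ → ℕ
rem x zero    = x
rem x (suc y) = x ℕ.% suc y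

-- 1/d as a rational number (only used with d > 0)
invℕ : ℕ → ℚ
invℕ zero    = 0ℚ
invℕ (suc d) = (+ 1) ℚ./ suc d

toℚ : ℤ → ℚ
toℚ z = z ℚ./ 1

_^ℚ_ : ℚ → ℕ → ℚ
q ^ℚ zero  = 1ℚ
q ^ℚ suc k = q ℚ.* (q ^ℚ k)

-- v_p(x): the largest e ≤ x with p^e ∣ x.  For x ≠ 0 and p ≥ 2 this is
-- the exponent of the highest power of p dividing x (and 0 if p ∤ x).
vpUpTo : ℕ → ℕ → ℕ → ℕ
vpUpTo p x zero    = 0
vpUpTo p x (suc e) with (p ℕ.^ suc e) ∣? x
... | yes _ = suc e
... | no  _ = vpUpTo p x e

vp : ℕ → ℕ → ℕ
vp p x = vpUpTo p x x

vpℤ : ℕ → ℤ → ℕ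
vpℤ p z = vp p ∣ z ∣

φ : ℕ → ℕ
φ N = length (filter (λ k → coprime? (suc k) N) (upTo N))

prodFrom1 : (ℕ → ℕ) → ℕ → ℕ
prodFrom1 f zero          = 1
prodFrom1 f (suc zero)    = 1
prodFrom1 f (suc (suc k)) = prodFrom1 f (suc k) ℕ.* f (suc k)

Squarefree : ℕ → Set
Squarefree x = ∀ m → (m ℕ.* m) ℕD.∣ x → m ≡ 1

PowerFree : ℕ → ℕ → Set
PowerFree N x = ∀ m → (m ℕ.^ N) ℕD.∣ x → m ≡ 1

_≡_[mod_] : ℤ → ℤ → ℕ → Set
x ≡ y [mod M ] = (+ M) ℤD.∣ (x ℤ.- y)

-- Irreducibility of x^n - a over ℚ: x^n - a is not the product of two
-- polynomials over ℚ of positive degree.  A polynomial of degree ≤ d is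
-- given by its coefficients g : Fin (suc d) → ℚ (g i = coefficient of x^i).

sumFinℚ : ∀ {m} → (Fin m → ℚ) → ℚ
sumFinℚ {zero}  f = 0ℚ
sumFinℚ {suc m} f = f Data.Fin.zero ℚ.+ sumFinℚ (λ i → f (Data.Fin.suc i))

polyMulCoeff : ∀ {d₁ d₂} → (Fin (suc d₁) → ℚ) → (Fin (suc d₂) → ℚ) → ℕ → ℚ
polyMulCoeff g h k =
  sumFinℚ (λ i → sumFinℚ (λ j → term (toℕ i ℕ.+ toℕ j ≟ k) (g i ℚ.* h j)))
  where
    term : ∀ {A : Set} → Dec A → ℚ → ℚ
    term (yes _) q = q
    term (no _)  q = 0ℚ

-- coefficient of x^k in x^n - a  (n ≥ 1)
binomCoeff : ℕ → ℤ → ℕ → ℚ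
binomCoeff n a k with k ≟ n
... | yes _ = 1ℚ
... | no _ with k ≟ 0
...   | yes _ = ℚ.- toℚ a
...   | no _  = 0ℚ

IrreducibleBinomial : ℕ → ℤ → Set
IrreducibleBinomial n a =
  ¬ (Σ ℕ λ d₁ → Σ ℕ λ d₂ → Σ (Fin (suc d₁) → ℚ) λ g → Σ (Fin (suc d₂) → ℚ) λ h →
       (1 ≤ d₁) × (1 ≤ d₂) × (d₁ ℕ.+ d₂ ≡ n) ×
       (∀ k → k ≤ n → polyMulCoeff g h k ≡ binomCoeff n a k))

-- The field K = ℚ(θ) ≅ ℚ[x]/(x^n - a) (x^n - a irreducible), with
-- elements written in the ℚ-basis 1, θ, …, θ^(n-1).

module Field (n : ℕ) (a : ℤ) where

  K : Set
  K = Fin n → ℚ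

  _≈_ : K → K → Set
  u ≈ v = ∀ i → u i ≡ v i

  0K : K
  0K _ = 0ℚ

  _+K_ : K → K → K
  (u +K v) i = u i ℚ.+ v i

  _·_ : ℚ → K → K
  (q · u) i = q ℚ.* u i

  -- θ^k = a^⌊k/n⌋ θ^(k mod n)
  θ^ : ℕ → K
  θ^ k i with toℕ i ≟ rem k n
  ... | yes _ = toℚ a ^ℚ quot k n
  ... | no _  = 0ℚ

  1K : K
  1K = θ^ 0

  sumK : ∀ {m} → (Fin m → K) → K
  sumK {zero}  f = 0K
  sumK {suc m} f = f Data.Fin.zero +K sumK (λ i → f (Data.Fin.suc i))

  sumKℕ : ℕ → (ℕ → K) → K
  sumKℕ zero    f = 0K
  sumKℕ (suc m) f = sumKℕ m f +K f m

  _*K_ : K → K → K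
  u *K v = sumK (λ i → sumK (λ j → (u i ℚ.* v j) · θ^ (toℕ i ℕ.+ toℕ j)))

  _^K_ : K → ℕ → K
  u ^K zero  = 1K
  u ^K suc k = u *K (u ^K k)

  IsIntegral : K → Set
  IsIntegral α = Σ ℕ λ d → Σ (Fin d → ℤ) λ c →
    ((α ^K d) +K sumK (λ i → toℚ (c i) · (α ^K toℕ i))) ≈ 0K

  ℤcomb : (Fin n → K) → (Fin n → ℤ) → K
  ℤcomb b z = sumK (λ i → toℚ (z i) · b i)

  IntegralBasis : (Fin n → K) → Set
  IntegralBasis b =
    (∀ i → IsIntegral (b i)) ×
    (∀ α → IsIntegral α → Σ (Fin n → ℤ) λ z → α ≈ ℤcomb b z) ×
    (∀ z → ℤcomb b z ≈ 0K → ∀ i → z i ≡ + 0)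

-- The data of Theorem 1.3.  Parameters: prime p, s, a, and the a_j
-- (given as A : ℕ → ℕ, only A 1, …, A (p^s - 1) matter).

module Thm13 (p s : ℕ) (a : ℤ) (A : ℕ → ℕ) where

  N : ℕ
  N = p ℕ.^ s

  open Field N a public

  -- v_p(a^(p-1) - 1); r = this - 1
  vA : ℕ
  vA = vpℤ p ((a ℤ.^ (p ∸ 1)) ℤ.- ℤ.+ 1)

  -- d = min(r, s)  (only used when r ≥ 1)
  d : ℕ
  d = (vA ∸ 1) ⊓ s

  kSearch : ℕ → ℕ → ℕ
  kSearch m zero = 0
  kSearch m (suc k) with (N ∸ p ℕ.^ (s ∸ suc k)) ≤? m
  ... | yes _ = suc k
  ... | no  _ = kSearch m k

  k : ℕ → ℕ
  k m = kSearch m d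

  j : ℕ → ℕ
  j m = m ∸ (N ∸ p ℕ.^ (s ∸ k m))

  C : ℕ → ℕ
  C m = prodFrom1 (λ i → A i ℕ.^ quot (i ℕ.* m) N) N

  θ/C : ℕ → K
  θ/C m = invℕ (C m) · θ^ m

  A'Cond : ℕ → ℤ → Set
  A'Cond m a' with k m ≟ s
  ... | yes _ = a' ≡ a ℤ.^ (p ∸ 2) [mod p ℕ.^ suc (k m) ]
  ... | no  _ = a' ≡ a ℤ.^ ((p ∸ 2) ℕ.* p ℕ.^ (s ∸ suc (k m))) [mod p ℕ.^ suc (k m) ]

  WCond : ℕ → ℤ → ℤ → Set
  WCond m a' w = (w ℤ.* (+ C m) ℤ.* (a' ℤ.^ (p ℕ.^ k m ∸ 1))) ≡ ℤ.+ 1 [mod p ℕ.^ k m ]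

  δ : ℕ → ℤ → ℤ → K
  δ m a' w = (toℚ (w ℤ.* + C m)) ·
    (θ^ (j m) *K sumKℕ (p ℕ.^ k m ∸ 1)
        (λ i → (toℚ a' · θ^ (p ℕ.^ (s ∸ k m))) ^K i))

  basisI : Fin N → K
  basisI m = θ/C (toℕ m)

  basisII : (ℕ → ℤ) → (ℕ → ℤ) → Fin N → K
  basisII a' w m with φ N ≤? toℕ m
  ... | no  _ = θ/C (toℕ m)
  ... | yes _ = invℕ (p ℕ.^ k (toℕ m) ℕ.* C (toℕ m)) ·
                  (θ^ (toℕ m) +K δ (toℕ m) (a' (toℕ m)) (w (toℕ m)))

{-# OPTIONS --safe #-}
module Submission where

open import Defs
open import Algebra.Bundles using (CommutativeRing; RawRing)
import Algebra.Properties.CommutativeSemiring.Binomial as BinP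
import Algebra.Properties.CommutativeSemiring.Exp as ExpP
import Algebra.Properties.Ring as RingP
import Algebra.Properties.Semiring.Mult as MultP
import Algebra.Properties.Semiring.Sum as SumP
import Algebra.Solver.Ring as RS
import Algebra.Solver.Ring.AlmostCommutativeRing as ACR
open import Algebra.Structures using (IsCommutativeRing)
open import Data.Empty using (⊥; ⊥-elim)
open import Data.Fin as Fin using (Fin; zero; suc; toℕ; fromℕ<; inject₁; fromℕ)
import Data.Fin.Properties as FinP
open import Data.Integer as ℤ using (ℤ; +_; -[1+_])
import Data.Integer.DivMod as ℤD
open import Data.Integer.Divisibility.Signed as ℤS using (divides) renaming (_∣_ to _∣ℤ_)
import Data.Integer.Properties as ℤP
import Data.Integer.Solver as IS
open import Data.List using ([]; _∷_; length; filter; upTo)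
import Data.List.Properties as ListP
open import Data.List.Relation.Unary.All using (_∷_)
open import Data.Maybe using (Maybe; just; nothing)
open import Data.Nat as ℕ using (ℕ; zero; suc; _∸_; _≤_; _<_; _⊓_; _≟_; z≤n; s≤s)
import Data.Nat.Combinatorics as Comb
open import Data.Nat.Combinatorics.Specification using (k>n⇒nCk≡0; nCk≡n!/k![n-k]!)
open import Data.Nat.Coprimality using (Coprime; coprime?; coprime-Bézout; coprime-divisor)
import Data.Nat.DivMod as DM
open import Data.Nat.Divisibility as ℕD using () renaming (_∣_ to _∣ℕ_)
open import Data.Nat.GCD using (gcd; gcd[m,n]∣m; gcd[m,n]∣n; gcd-greatest; gcd-GCD; module Bézout)
open import Data.Nat.Induction using (<-rec; <-wellFounded)
open import Data.Nat.ListAction using (product)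
open import Data.Nat.Primality using (Prime; euclidsLemma; prime⇒irreducible; prime⇒nonTrivial)
open import Data.Nat.Primality.Factorisation using (factorise)
import Data.Nat.Properties as ℕP
import Data.Nat.Solver as NS
open import Data.Product using (Σ; ∃; ∃-syntax; Σ-syntax; _×_; _,_; proj₁; proj₂)
open import Data.Rational as ℚ using (ℚ; mkℚ; 0ℚ; 1ℚ; toℚᵘ)
import Data.Rational.Properties as ℚP
open import Data.Rational.Unnormalised as ℚᵘ using (mkℚᵘ; _≃_; *≡*)
import Data.Rational.Unnormalised.Properties as ℚᵘP
open import Data.Sum using (_⊎_; inj₁; inj₂; [_,_]′)
open import Induction.WellFounded using (Acc; acc)
open import Level using (0ℓ)
import Relation.Binary.PropositionalEquality as ≡
open ≡ using (_≡_; _≢_)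
import Relation.Binary.Reasoning.Setoid as SetoidR
open import Relation.Nullary using (¬_; Dec; yes; no)
open import Relation.Nullary.Decidable using (¬?; _×-dec_; decidable-stable)
open import Relation.Unary using (Decidable)

-- An element α is integral if and only if it is almost integral over ℤ[θ], that is, D α^k is in ℤ[θ] for a fixed
-- D > 0 and all k; one direction is clear and the other holds because ℤ^n is Noetherian.  By Bézout it is enough to
-- find, for each prime ℓ, an order O ⊇ ℤ[θ] inside the lattice Λ spanned by the proposed basis which is maximal at ℓ,
-- meaning that γ is in O whenever γ is almost integral and ℓ γ is in O.
--
-- For ℓ ≠ p, and for ℓ = p if p ∣ a, take the order spanned by the monomials θ^m / C_m.  For ℓ = p ∤ a, put
-- x = a^(p-2) θ, so that x^(p^s) = 1 + p^(d+1) c with p ∤ c if d < s, and take the order spanned by the x^j e_k, where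
-- e_k = p^(-k) Σ_{i < p^k} x^(i p^(s-k)) and k ≤ d.  Both are maximal for the same reason: if t is nilpotent modulo ℓ
-- and γ is almost integral with γ t in O, then γ t is nilpotent modulo ℓ, which forces ℓ to divide its leading
-- coordinates and hence all coordinates of ℓ γ.
--
-- Finally, if b_m is the proposed basis element, then a^((p-2)m) C_m b_m differs from x^j e_k by an element of ℤ[θ],
-- while p^k b_m is in the monomial order.  The multipliers are coprime, so b_m is integral and Λ contains both orders.

-- The monomial order detects nilpotents through the coefficient of `t 0`. This works as long as
-- Frobenius carries no other monomial of weight 0 to a multiple of `t 0`, that is, for ℓ ≠ p, and
-- for p ∣ a since then p ∤ v_p(a). For p ∤ a every monomial has weight 0 at p, and ℤ[x] modulo p is
-- F_p[x]/(x - 1)^(p^s); there the nilpotent element is π = x - 1, and another order is required.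
-- The factor a^(p-2) inverts a modulo p^(r+1), and the valuation of x^(p^s) - 1 at p is again
-- exactly r + 1. Now e_k is the quotient of x^(p^s) - 1 by p^k (x^(p^(s-k)) - 1), so that
-- (x^(p^(s-k)) - 1) e_k = p^(d+1-k) c. The exponent p^(s-k) asks for k ≤ s, and a factor p remains
-- on the right as long as k ≤ r; hence d = min(r, s). This spare factor p makes the products e_k
-- e_l integral. The order at p need not be local. Modulo p and π the e_k form a chain of
-- idempotents, except that for p = 2 the square of e_d may gain a multiple of e_(d-1). Nilpotence
-- is therefore tested by iterating Frobenius, which is triangular on the e_k in all cases.

module ℕS = NS.+-*-Solver
module ℤS′ = IS.+-*-Solver

-- Integers in a commutative ring, and a solver with integer constants

module IntegerEmbedding (R : CommutativeRing 0ℓ 0ℓ) where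
  open CommutativeRing R
  open RingP ring
  open SetoidR setoid

  -- The separate clause for 1 makes `ι (+ 1)` equal to `1#` by computation, so that integer
  -- constants in solver equations denote the expected ring elements.
  ιℕ : ℕ → Carrier
  ιℕ zero          = 0#
  ιℕ (suc zero)    = 1#
  ιℕ (suc (suc n)) = 1# + ιℕ (suc n)

  ι : ℤ → Carrier
  ι (+ n)    = ιℕ n
  ι -[1+ n ] = - ιℕ (suc n)

  ιℕ-suc : ∀ n → ιℕ (suc n) ≈ 1# + ιℕ n
  ιℕ-suc zero    = sym (+-identityʳ 1#)
  ιℕ-suc (suc n) = refl

  ιℕ-+ : ∀ m n → ιℕ (m ℕ.+ n) ≈ ιℕ m + ιℕ n
  ιℕ-+ zero    n = sym (+-identityˡ _)
  ιℕ-+ (suc m) n = begin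
    ιℕ (suc (m ℕ.+ n))   ≈⟨ ιℕ-suc (m ℕ.+ n) ⟩
    1# + ιℕ (m ℕ.+ n)    ≈⟨ +-congˡ (ιℕ-+ m n) ⟩
    1# + (ιℕ m + ιℕ n)   ≈⟨ +-assoc _ _ _ ⟨
    (1# + ιℕ m) + ιℕ n   ≈⟨ +-congʳ (ιℕ-suc m) ⟨
    ιℕ (suc m) + ιℕ n    ∎

  ιℕ-* : ∀ m n → ιℕ (m ℕ.* n) ≈ ιℕ m * ιℕ n
  ιℕ-* zero    n = sym (zeroˡ _)
  ιℕ-* (suc m) n = begin
    ιℕ (n ℕ.+ m ℕ.* n)       ≈⟨ ιℕ-+ n (m ℕ.* n) ⟩
    ιℕ n + ιℕ (m ℕ.* n)      ≈⟨ +-cong (sym (*-identityˡ _)) (ιℕ-* m n) ⟩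
    1# * ιℕ n + ιℕ m * ιℕ n  ≈⟨ distribʳ _ _ _ ⟨
    (1# + ιℕ m) * ιℕ n       ≈⟨ *-congʳ (ιℕ-suc m) ⟨
    ιℕ (suc m) * ιℕ n        ∎

  ι-neg : ∀ z → ι (ℤ.- z) ≈ - ι z
  ι-neg (+ zero)  = sym -0#≈0#
  ι-neg (+ suc n) = refl
  ι-neg -[1+ n ]  = sym (-‿involutive _)

  cancel₁ : ∀ x y → (1# + x) - (1# + y) ≈ x - y
  cancel₁ x y = begin
    (1# + x) + - (1# + y)      ≈⟨ +-cong (+-comm 1# x) (sym (-‿+-comm 1# y)) ⟩
    (x + 1#) + (- 1# + - y)    ≈⟨ +-assoc _ _ _ ⟩
    x + (1# + (- 1# + - y))    ≈⟨ +-congˡ (+-assoc _ _ _) ⟨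
    x + ((1# + - 1#) + - y)    ≈⟨ +-congˡ (+-congʳ (-‿inverseʳ 1#)) ⟩
    x + (0# + - y)             ≈⟨ +-congˡ (+-identityˡ _) ⟩
    x - y                      ∎

  ι-⊖ : ∀ m n → ι (m ℤ.⊖ n) ≈ ιℕ m - ιℕ n
  ι-⊖ m zero = sym (trans (+-congˡ -0#≈0#) (+-identityʳ _))
  ι-⊖ zero (suc n) = sym (+-identityˡ _)
  ι-⊖ (suc m) (suc n) = begin
    ι (suc m ℤ.⊖ suc n)          ≡⟨ ≡.cong ι (ℤP.[1+m]⊖[1+n]≡m⊖n m n) ⟩
    ι (m ℤ.⊖ n)                  ≈⟨ ι-⊖ m n ⟩
    ιℕ m - ιℕ n                  ≈⟨ cancel₁ _ _ ⟨
    (1# + ιℕ m) - (1# + ιℕ n)    ≈⟨ +-cong (ιℕ-suc m) (-‿cong (ιℕ-suc n)) ⟨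
    ιℕ (suc m) - ιℕ (suc n)      ∎

  ι-+ : ∀ x y → ι (x ℤ.+ y) ≈ ι x + ι y
  ι-+ (+ m)    (+ n)    = ιℕ-+ m n
  ι-+ (+ m)    -[1+ n ] = ι-⊖ m (suc n)
  ι-+ -[1+ m ] (+ n)    = trans (ι-⊖ n (suc m)) (+-comm _ _)
  ι-+ -[1+ m ] -[1+ n ] = begin
    - ιℕ (suc (suc (m ℕ.+ n)))      ≡⟨ ≡.cong (λ k → - ιℕ k) (≡.sym (ℕP.+-suc (suc m) n)) ⟩
    - ιℕ (suc m ℕ.+ suc n)          ≈⟨ -‿cong (ιℕ-+ (suc m) (suc n)) ⟩
    - (ιℕ (suc m) + ιℕ (suc n))     ≈⟨ -‿+-comm _ _ ⟨
    - ιℕ (suc m) - ιℕ (suc n)       ∎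

  ι-*-pos : ∀ m y → ι (+ m ℤ.* y) ≈ ιℕ m * ι y
  ι-*-pos m (+ n) = begin
    ι (+ m ℤ.* + n)   ≡⟨ ≡.cong ι (ℤP.pos-* m n) ⟨
    ιℕ (m ℕ.* n)      ≈⟨ ιℕ-* m n ⟩
    ιℕ m * ιℕ n       ∎
  ι-*-pos m -[1+ n ] = begin
    ι (+ m ℤ.* (ℤ.- (+ suc n)))   ≡⟨ ≡.cong ι (ℤP.neg-distribʳ-* (+ m) (+ suc n)) ⟨
    ι (ℤ.- (+ m ℤ.* + suc n))     ≈⟨ ι-neg (+ m ℤ.* + suc n) ⟩
    - ι (+ m ℤ.* + suc n)         ≈⟨ -‿cong (ι-*-pos m (+ suc n)) ⟩
    - (ιℕ m * ιℕ (suc n))         ≈⟨ -‿distribʳ-* _ _ ⟩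
    ιℕ m * - ιℕ (suc n)           ∎

  ι-* : ∀ x y → ι (x ℤ.* y) ≈ ι x * ι y
  ι-* (+ m)    y = ι-*-pos m y
  ι-* -[1+ m ] y = begin
    ι ((ℤ.- (+ suc m)) ℤ.* y)   ≡⟨ ≡.cong ι (ℤP.neg-distribˡ-* (+ suc m) y) ⟨
    ι (ℤ.- (+ suc m ℤ.* y))     ≈⟨ ι-neg (+ suc m ℤ.* y) ⟩
    - ι (+ suc m ℤ.* y)         ≈⟨ -‿cong (ι-*-pos (suc m) y) ⟩
    - (ιℕ (suc m) * ι y)        ≈⟨ -‿distribˡ-* _ _ ⟩
    - ιℕ (suc m) * ι y          ∎

  acr : ACR.AlmostCommutativeRing 0ℓ 0ℓ
  acr = ACR.fromCommutativeRing R

  ℤ-raw : RawRing 0ℓ 0ℓ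
  ℤ-raw = CommutativeRing.rawRing ℤP.+-*-commutativeRing

  ι-morphism : ℤ-raw ACR.-Raw-AlmostCommutative⟶ acr
  ι-morphism = record
    { ⟦_⟧    = ι
    ; +-homo = ι-+
    ; *-homo = ι-*
    ; -‿homo = ι-neg
    ; 0-homo = refl
    ; 1-homo = refl
    }

  ι≟ : ∀ x y → Maybe (ι x ≈ ι y)
  ι≟ x y with x ℤP.≟ y
  ... | yes ≡.refl = just refl
  ... | no  _      = nothing

  module Solver = RS ℤ-raw acr ι-morphism ι≟
    using (solve; _:=_; _:+_; _:*_; _:-_; :-_; con; Polynomial)

-- Primes, Bézout identities and passage from local to global

module NumberTheory where
  open ≡ using (refl; sym; trans; cong; cong₂; subst; module ≡-Reasoning)
  open Comb using (_C_; k![n∸k]!∣n!)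
  open import Data.Nat using (_!)

  prime>1 : ∀ {ℓ} → Prime ℓ → 1 < ℓ
  prime>1 {ℓ} pr = ℕ.nonTrivial⇒n>1 ℓ {{prime⇒nonTrivial pr}}

  prime>0 : ∀ {ℓ} → Prime ℓ → 0 < ℓ
  prime>0 pr = ℕP.<-trans (s≤s z≤n) (prime>1 pr)

  prime∤1 : ∀ {ℓ} → Prime ℓ → ¬ ℓ ∣ℕ 1
  prime∤1 pr d = ℕP.<⇒≱ (prime>1 pr) (ℕD.∣⇒≤ d)

  prime∤! : ∀ {ℓ} → Prime ℓ → ∀ k → k < ℓ → ¬ ℓ ∣ℕ k !
  prime∤! pr zero    _   d = prime∤1 pr d
  prime∤! pr (suc k) k<ℓ d with euclidsLemma (suc k) (k !) pr d
  ... | inj₁ d′ = ℕP.<⇒≱ k<ℓ (ℕD.∣⇒≤ d′)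
  ... | inj₂ d′ = prime∤! pr k (ℕP.<-trans (ℕP.n<1+n k) k<ℓ) d′

  prime∣! : ∀ {ℓ} → 0 < ℓ → ℓ ∣ℕ ℓ !
  prime∣! {suc ℓ} _ = ℕD.m∣m*n (ℓ !)

  prime∣C : ∀ {ℓ} → Prime ℓ → ∀ k → 0 < k → k < ℓ → ℓ ∣ℕ (ℓ C k)
  prime∣C {ℓ} pr k 0<k k<ℓ with euclidsLemma (ℓ C k) (k ! ℕ.* (ℓ ∸ k) !) pr div
    where
    k≤ℓ = ℕP.<⇒≤ k<ℓ
    instance _ = k ℕP.!* (ℓ ∸ k) !≢0
    eq : (ℓ C k) ℕ.* (k ! ℕ.* (ℓ ∸ k) !) ≡ ℓ !
    eq = trans (cong (ℕ._* (k ! ℕ.* (ℓ ∸ k) !)) (nCk≡n!/k![n-k]! k≤ℓ)) (DM.m/n*n≡m (k![n∸k]!∣n! k≤ℓ))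
    div : ℓ ∣ℕ (ℓ C k) ℕ.* (k ! ℕ.* (ℓ ∸ k) !)
    div = subst (ℓ ∣ℕ_) (sym eq) (prime∣! (prime>0 pr))
  ... | inj₁ d = d
  ... | inj₂ d = [ (λ d₁ → ⊥-elim (prime∤! pr k k<ℓ d₁))
                 , (λ d₂ → ⊥-elim (prime∤! pr (ℓ ∸ k) (ℕP.∸-monoʳ-< 0<k (ℕP.<⇒≤ k<ℓ)) d₂)) ]′ (euclidsLemma (k !) ((ℓ ∸ k) !) pr d)

  ∤⇒Coprime : ∀ {ℓ D} → Prime ℓ → ¬ ℓ ∣ℕ D → Coprime ℓ D
  ∤⇒Coprime pr ∤ (d∣ℓ , d∣D) with prime⇒irreducible pr d∣ℓ
  ... | inj₁ d≡1    = d≡1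
  ... | inj₂ refl = ⊥-elim (∤ d∣D)

  bézoutℤ : ∀ {g} m n → Bézout.Identity g m n → ∃[ u ] ∃[ v ] u ℤ.* + m ℤ.+ v ℤ.* + n ≡ + g
  bézoutℤ {g} m n (Bézout.+- x y eq) = + x , ℤ.- (+ y) , (begin
    + x ℤ.* + m ℤ.+ ℤ.- (+ y) ℤ.* + n   ≡⟨ cong₂ ℤ._+_ (sym (ℤP.pos-* x m)) (sym (ℤP.neg-distribˡ-* (+ y) (+ n))) ⟩
    + (x ℕ.* m) ℤ.- (+ y ℤ.* + n)       ≡⟨ cong₂ (λ a b → + a ℤ.- b) (sym eq) (sym (ℤP.pos-* y n)) ⟩
    + (g ℕ.+ y ℕ.* n) ℤ.- + (y ℕ.* n)   ≡⟨ ℤP.+-assoc (+ g) (+ (y ℕ.* n)) (ℤ.- + (y ℕ.* n)) ⟩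
    + g ℤ.+ (+ (y ℕ.* n) ℤ.- + (y ℕ.* n)) ≡⟨ cong (λ z → + g ℤ.+ z) (ℤP.+-inverseʳ (+ (y ℕ.* n))) ⟩
    + g ℤ.+ + 0                         ≡⟨ ℤP.+-identityʳ (+ g) ⟩
    + g ∎) where open ≡-Reasoning
  bézoutℤ m n (Bézout.-+ x y eq) with bézoutℤ n m (Bézout.+- y x eq)
  ... | u , v , e = v , u , trans (ℤP.+-comm (v ℤ.* + m) (u ℤ.* + n)) e

  prime-bézout : ∀ {ℓ D} → Prime ℓ → ¬ ℓ ∣ℕ D → ∃[ u ] ∃[ v ] u ℤ.* + ℓ ℤ.+ v ℤ.* + D ≡ + 1
  prime-bézout {ℓ} {D} pr ∤ = bézoutℤ ℓ D (coprime-Bézout (∤⇒Coprime pr ∤))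

  gcd-bézout : ∀ m n → ∃[ u ] ∃[ v ] u ℤ.* + m ℤ.+ v ℤ.* + n ≡ + gcd m n
  gcd-bézout m n = bézoutℤ m n (Bézout.identity (gcd-GCD m n))

  split-prime : ∀ {ℓ} → Prime ℓ → ∀ D → 0 < D → ∃[ f ] ∃[ D′ ] (D ≡ ℓ ℕ.^ f ℕ.* D′) × ¬ ℓ ∣ℕ D′
  split-prime {ℓ} pr D 0<D = go D 0<D (<-wellFounded D)
    where
    go : ∀ D → 0 < D → Acc _<_ D → ∃[ f ] ∃[ D′ ] (D ≡ ℓ ℕ.^ f ℕ.* D′) × ¬ ℓ ∣ℕ D′
    go D 0<D (acc rec) with ℓ ℕD.∣? D
    ... | no ∤ = 0 , D , sym (ℕP.*-identityˡ D) , ∤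
    ... | yes (ℕD.divides zero eq) = ⊥-elim (ℕP.<⇒≢ 0<D (sym eq))
    ... | yes (ℕD.divides (suc q) eq)
      with go (suc q) (s≤s z≤n) (rec (subst (suc q <_) (sym eq) (ℕP.m<m*n (suc q) ℓ (prime>1 pr))))
    ... | f , D′ , e , ∤ = suc f , D′ , trans eq (trans (cong (ℕ._* ℓ) e) (trans (ℕP.*-comm (ℓ ℕ.^ f ℕ.* D′) ℓ) (sym (ℕP.*-assoc ℓ (ℓ ℕ.^ f) D′)))) , ∤

  prime-divisor : ∀ D → 1 < D → ∃[ ℓ ] Prime ℓ × ℓ ∣ℕ D
  prime-divisor D@(suc _) 1<D with factorise D
  ... | record { factors = [] ; isFactorisation = eq } = ⊥-elim (ℕP.<⇒≢ 1<D (sym eq))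
  ... | record { factors = q ∷ qs ; isFactorisation = eq ; factorsPrime = pr ∷ _ } =
        q , pr , subst (q ∣ℕ_) (sym eq) (ℕD.m∣m*n (product qs))

  -- The `z` with `P z` form an ideal of ℤ. A prime divisor of the current positive member `D` does
  -- not divide the local witness `D′`, so `gcd D D′` is a strictly smaller positive member; the
  -- descent ends at 1.
  local-to-global : (P : ℤ → Set) → (∀ {x y} → P x → P y → P (x ℤ.+ y)) → (∀ z {x} → P x → P (z ℤ.* x)) →
    ∀ D → 0 < D → P (+ D) → (∀ ℓ → Prime ℓ → ∃[ D′ ] (¬ ℓ ∣ℕ D′) × P (+ D′)) → P (+ 1)
  local-to-global P P+ P* D 0<D PD local = go D 0<D PD (<-wellFounded D)
    where
    go : ∀ D → 0 < D → P (+ D) → Acc _<_ D → P (+ 1)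
    go (suc zero) _ PD _ = PD
    go D@(suc (suc _)) 0<D PD (acc rec) with prime-divisor D (s≤s (s≤s z≤n))
    ... | ℓ , pr , ℓ∣D with local ℓ pr
    ... | D′ , ∤ , PD′ with gcd-bézout D D′
    ... | u , v , e = go g 0<g (subst P e (P+ (P* u PD) (P* v PD′))) (rec g<D)
      where
      g = gcd D D′
      g≢D : g ≢ D
      g≢D g≡D = ∤ (ℕD.∣-trans ℓ∣D (subst (_∣ℕ D′) g≡D (gcd[m,n]∣n D D′)))
      g<D : g < D
      g<D = ℕP.≤∧≢⇒< (ℕD.∣⇒≤ (gcd[m,n]∣m D D′)) g≢D
      0<g : 0 < g
      0<g = ℕP.n≢0⇒n>0 (λ g≡0 → ℕP.<⇒≢ 0<D (sym (ℕD.0∣⇒≡0 (subst (_∣ℕ D) g≡0 (gcd[m,n]∣m D D′)))))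

  euclidℤ : ∀ {ℓ} → Prime ℓ → ∀ x y → + ℓ ∣ℤ x ℤ.* y → + ℓ ∣ℤ x ⊎ + ℓ ∣ℤ y
  euclidℤ {ℓ} pr x y d with euclidsLemma ℤ.∣ x ∣ ℤ.∣ y ∣ pr (subst (ℓ ∣ℕ_) (ℤP.abs-* x y) (ℤS.∣⇒∣ᵤ d))
  ... | inj₁ e = inj₁ (ℤS.∣ᵤ⇒∣ e)
  ... | inj₂ e = inj₂ (ℤS.∣ᵤ⇒∣ e)

  prime∤1ℤ : ∀ {ℓ} → Prime ℓ → ¬ + ℓ ∣ℤ + 1
  prime∤1ℤ pr d = prime∤1 pr (ℤS.∣⇒∣ᵤ d)

  euclid^ : ∀ {ℓ} → Prime ℓ → ∀ x n → + ℓ ∣ℤ x ℤ.^ n → + ℓ ∣ℤ x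
  euclid^ pr x zero    d = ⊥-elim (prime∤1ℤ pr d)
  euclid^ pr x (suc n) d with euclidℤ pr x (x ℤ.^ n) d
  ... | inj₁ e = e
  ... | inj₂ e = euclid^ pr x n e

  -- Serves to replace an arbitrary nilpotency exponent by a power of the prime, and to see that the
  -- search bound built into `vp` suffices.
  n<m^n : ∀ {m} → 1 < m → ∀ n → n < m ℕ.^ n
  n<m^n 1<m zero = s≤s z≤n
  n<m^n {m} 1<m (suc n) = ℕP.<-≤-trans (s≤s (n<m^n 1<m n)) (begin
    1 ℕ.+ m ℕ.^ n             ≤⟨ ℕP.+-monoˡ-≤ (m ℕ.^ n) (ℕP.m^n>0 m {{ℕ.>-nonZero (ℕP.<-trans (s≤s z≤n) 1<m)}} n) ⟩
    m ℕ.^ n ℕ.+ m ℕ.^ n       ≡⟨ cong (m ℕ.^ n ℕ.+_) (sym (ℕP.+-identityʳ (m ℕ.^ n))) ⟩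
    2 ℕ.* m ℕ.^ n             ≤⟨ ℕP.*-monoˡ-≤ (m ℕ.^ n) 1<m ⟩
    m ℕ.^ suc n               ∎)
    where open ℕP.≤-Reasoning

  -- Absorbs one further term into a coefficient sequence over `k < d`, so that a statement on a
  -- single sum over `k ≤ d` applies.
  extend : ℕ → (ℕ → ℤ) → ℤ → ℕ → ℤ
  extend d W V k with k ℕ.<? d
  ... | yes _ = W k
  ... | no  _ = V

  extend-< : ∀ d W V {k} → k < d → extend d W V k ≡ W k
  extend-< d W V {k} k<d with k ℕ.<? d
  ... | yes _ = refl
  ... | no ≮  = ⊥-elim (≮ k<d)

  extend-≥ : ∀ d W V {k} → d ≤ k → extend d W V k ≡ V
  extend-≥ d W V {k} d≤k with k ℕ.<? d
  ... | yes k<d = ⊥-elim (ℕP.<⇒≱ k<d d≤k)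
  ... | no _    = refl

open NumberTheory

-- Spans and almost integral elements in a commutative ring

module RingTools (R : CommutativeRing 0ℓ 0ℓ) where
  open CommutativeRing R public
  open IntegerEmbedding R public
  open Solver public
  open ExpP commutativeSemiring using (_^_; ^-congˡ; ^-congʳ; ^-homo-*; ^-assocʳ; ^-distrib-*) public
  open RingP ring using (-‿involutive; -‿+-comm; -0#≈0#; -‿distribˡ-*; -‿distribʳ-*) public
  open SetoidR setoid public
  open MultP semiring using () renaming (_×_ to _×ₙ_)

  Σ< : ℕ → (ℕ → Carrier) → Carrier
  Σ< zero    f = 0#
  Σ< (suc n) f = Σ< n f + f n

  Σ-cong : ∀ n {f g : ℕ → Carrier} → (∀ i → i < n → f i ≈ g i) → Σ< n f ≈ Σ< n g
  Σ-cong zero    e = refl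
  Σ-cong (suc n) e = +-cong (Σ-cong n (λ i i<n → e i (ℕP.m<n⇒m<1+n i<n))) (e n (ℕP.n<1+n n))

  Σ-zero : ∀ n {f : ℕ → Carrier} → (∀ i → i < n → f i ≈ 0#) → Σ< n f ≈ 0#
  Σ-zero zero    e = refl
  Σ-zero (suc n) e = trans (+-cong (Σ-zero n (λ i i<n → e i (ℕP.m<n⇒m<1+n i<n))) (e n (ℕP.n<1+n n))) (+-identityˡ 0#)

  Σ-+ : ∀ n (f g : ℕ → Carrier) → Σ< n (λ i → f i + g i) ≈ Σ< n f + Σ< n g
  Σ-+ zero    f g = sym (+-identityˡ 0#)
  Σ-+ (suc n) f g = trans (+-congʳ (Σ-+ n f g))
    (solve 4 (λ a b c d → (a :+ b) :+ (c :+ d) := (a :+ c) :+ (b :+ d)) refl (Σ< n f) (Σ< n g) (f n) (g n))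

  Σ-*ˡ : ∀ n x (f : ℕ → Carrier) → x * Σ< n f ≈ Σ< n (λ i → x * f i)
  Σ-*ˡ zero    x f = zeroʳ x
  Σ-*ˡ (suc n) x f = trans (distribˡ x _ _) (+-congʳ (Σ-*ˡ n x f))

  Σ-neg : ∀ n (f : ℕ → Carrier) → - Σ< n f ≈ Σ< n (λ i → - f i)
  Σ-neg zero    f = -0#≈0#
  Σ-neg (suc n) f = trans (sym (-‿+-comm _ _)) (+-congʳ (Σ-neg n f))

  Σ-shift : ∀ n (f : ℕ → Carrier) → Σ< (suc n) f ≈ f 0 + Σ< n (λ i → f (suc i))
  Σ-shift zero    f = trans (+-identityˡ _) (sym (+-identityʳ _))
  Σ-shift (suc n) f = trans (+-congʳ (Σ-shift n f)) (+-assoc _ _ _)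

  Σ-split : ∀ m n (f : ℕ → Carrier) → Σ< (m ℕ.+ n) f ≈ Σ< m f + Σ< n (λ i → f (m ℕ.+ i))
  Σ-split m zero    f = trans (reflexive (≡.cong (λ k → Σ< k f) (ℕP.+-identityʳ m))) (sym (+-identityʳ _))
  Σ-split m (suc n) f = trans (reflexive (≡.cong (λ k → Σ< k f) (ℕP.+-suc m n)))
                              (trans (+-congʳ (Σ-split m n f)) (+-assoc _ _ _))

  ×ₙ-ι : ∀ n x → n ×ₙ x ≈ ιℕ n * x
  ×ₙ-ι zero    x = sym (zeroˡ x)
  ×ₙ-ι (suc n) x = trans (+-cong (sym (*-identityˡ x)) (×ₙ-ι n x))
                         (trans (sym (distribʳ x 1# (ιℕ n))) (*-congʳ (sym (ιℕ-suc n))))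

  ι-^ : ∀ z n → ι (z ℤ.^ n) ≈ ι z ^ n
  ι-^ z zero    = refl
  ι-^ z (suc n) = trans (ι-* z (z ℤ.^ n)) (*-congˡ (ι-^ z n))

  ιℕ-^ : ∀ m n → ιℕ (m ℕ.^ n) ≈ ιℕ m ^ n
  ιℕ-^ m zero    = refl
  ιℕ-^ m (suc n) = trans (ιℕ-* m (m ℕ.^ n)) (*-congˡ (ιℕ-^ m n))

  1^ : ∀ n → 1# ^ n ≈ 1#
  1^ zero    = refl
  1^ (suc n) = trans (*-identityˡ _) (1^ n)

  -- Orders are predicates on one ambient ring: the question is always whether an element with
  -- denominators, already present in that ring, belongs to the order.
  record IsSubring (O : Carrier → Set) : Set where
    field
      resp : ∀ {x y} → x ≈ y → O x → O y
      add  : ∀ {x y} → O x → O y → O (x + y)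
      neg  : ∀ {x} → O x → O (- x)
      mul  : ∀ {x y} → O x → O y → O (x * y)
      one  : O 1#

    zer : O 0#
    zer = resp (-‿inverseʳ 1#) (add one (neg one))

    sub : ∀ {x y} → O x → O y → O (x - y)
    sub ox oy = add ox (neg oy)

    intℕ : ∀ n → O (ιℕ n)
    intℕ zero    = zer
    intℕ (suc n) = resp (sym (ιℕ-suc n)) (add one (intℕ n))

    int : ∀ z → O (ι z)
    int (+ n)    = intℕ n
    int -[1+ n ] = neg (intℕ (suc n))

    pow : ∀ {x} n → O x → O (x ^ n)
    pow zero    ox = one
    pow (suc n) ox = mul ox (pow n ox)

    scale-l : ∀ D E {u} → O (ιℕ D * u) → O (ιℕ (D ℕ.* E) * u)
    scale-l D E {u} h = resp (trans (solve 3 (λ d e u → e :* (d :* u) := (d :* e) :* u) refl (ιℕ D) (ιℕ E) u)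
                                    (*-congʳ (sym (ιℕ-* D E)))) (mul (intℕ E) h)

    scale-r : ∀ D E {u} → O (ιℕ E * u) → O (ιℕ (D ℕ.* E) * u)
    scale-r D E {u} h = resp (trans (sym (*-assoc _ _ _)) (*-congʳ (sym (ιℕ-* D E)))) (mul (intℕ D) h)

    sum : ∀ n {f : ℕ → Carrier} → (∀ i → i < n → O (f i)) → O (Σ< n f)
    sum zero    of = zer
    sum (suc n) of = add (sum n (λ i i<n → of i (ℕP.m<n⇒m<1+n i<n))) (of n (ℕP.n<1+n n))

  -- The additive group generated by `G`. The inductive form reduces every additive property to the
  -- generators through `span-map`; integer multiples are derived.
  data Span (G : Carrier → Set) : Carrier → Set where
    gen  : ∀ {x} → G x → Span G x
    span-zer  : Span G 0#
    span-add  : ∀ {x y} → Span G x → Span G y → Span G (x + y)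
    span-neg  : ∀ {x} → Span G x → Span G (- x)
    span-resp : ∀ {x y} → x ≈ y → Span G x → Span G y

  span-map : ∀ {G P : Carrier → Set} → (∀ {x y} → x ≈ y → P x → P y) → P 0# →
    (∀ {x y} → P x → P y → P (x + y)) → (∀ {x} → P x → P (- x)) → (∀ {x} → G x → P x) →
    ∀ {x} → Span G x → P x
  span-map r z a n g (gen x)    = g x
  span-map r z a n g span-zer        = z
  span-map r z a n g (span-add s t)  = a (span-map r z a n g s) (span-map r z a n g t)
  span-map r z a n g (span-neg s)    = n (span-map r z a n g s)
  span-map r z a n g (span-resp e s) = r e (span-map r z a n g s)

  span-mulˡ : ∀ {G H : Carrier → Set} c → (∀ {x} → G x → Span H (c * x)) → ∀ {x} → Span G x → Span H (c * x)
  span-mulˡ {G} {H} c g = span-map (λ e → span-resp (*-congˡ e)) (span-resp (sym (zeroʳ c)) span-zer)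
    (λ p q → span-resp (sym (distribˡ c _ _)) (span-add p q)) (λ p → span-resp (-‿distribʳ-* c _) (span-neg p)) g

  span-mul : ∀ {G H K : Carrier → Set} → (∀ {x y} → G x → H y → Span K (x * y)) →
    ∀ {x y} → Span G x → Span H y → Span K (x * y)
  span-mul {G} {H} {K} g {x} {y} sx sy =
    span-resp (*-comm y x) (span-mulˡ y (λ {x′} gx → span-resp (*-comm x′ y) (span-mulˡ x′ (g gx) sy)) sx)

  span-ιℕ : ∀ {G} n {x} → Span G x → Span G (ιℕ n * x)
  span-ιℕ zero        sx = span-resp (sym (zeroˡ _)) span-zer
  span-ιℕ (suc n) {x} sx = span-resp (sym (trans (*-congʳ (ιℕ-suc n)) (trans (distribʳ x 1# (ιℕ n)) (+-congʳ (*-identityˡ x)))))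
                              (span-add sx (span-ιℕ n sx))

  span-ι : ∀ {G} z {x} → Span G x → Span G (ι z * x)
  span-ι (+ n)    sx = span-ιℕ n sx
  span-ι -[1+ n ] sx = span-resp (-‿distribˡ-* _ _) (span-neg (span-ιℕ (suc n) sx))

  span-sum : ∀ {G} n {f : ℕ → Carrier} → (∀ i → i < n → Span G (f i)) → Span G (Σ< n f)
  span-sum zero    sf = span-zer
  span-sum (suc n) sf = span-add (span-sum n (λ i i<n → sf i (ℕP.m<n⇒m<1+n i<n))) (sf n (ℕP.n<1+n n))

  δ : ℕ → ℕ → ℤ
  δ i j with i ℕ.≟ j
  ... | yes _ = + 1
  ... | no  _ = + 0

  δ-refl : ∀ i → δ i i ≡ + 1
  δ-refl i with i ℕ.≟ i
  ... | yes _ = ≡.refl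
  ... | no ≢  = ⊥-elim (≢ ≡.refl)

  δ-≢ : ∀ {i j} → i ≢ j → δ i j ≡ + 0
  δ-≢ {i} {j} i≢j with i ℕ.≟ j
  ... | yes i≡j = ⊥-elim (i≢j i≡j)
  ... | no _    = ≡.refl

  Σ-δ : ∀ n {j} (f : ℕ → Carrier) → j < n → Σ< n (λ i → ι (δ i j) * f i) ≈ f j
  Σ-δ (suc n) {j} f j<1+n with ℕP.m≤n⇒m<n∨m≡n (ℕP.<⇒≤pred j<1+n)
  ... | inj₁ j<n = trans (+-cong (Σ-δ n f j<n) (trans (*-congʳ (reflexive (≡.cong ι (δ-≢ (ℕP.>⇒≢ j<n))))) (zeroˡ _))) (+-identityʳ _)
  ... | inj₂ ≡.refl = trans (+-cong (Σ-zero n (λ i i<n → trans (*-congʳ (reflexive (≡.cong ι (δ-≢ (ℕP.<⇒≢ i<n))))) (zeroˡ _)))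
                                 (trans (*-congʳ (reflexive (≡.cong ι (δ-refl n)))) (*-identityˡ _))) (+-identityˡ _)

  span-coords : ∀ n (f : ℕ → Carrier) {w} → Span (λ w → ∃[ j ] (j < n) × (w ≈ f j)) w →
    ∃[ z ] w ≈ Σ< n (λ i → ι (z i) * f i)
  span-coords n f = span-map (λ { e (z , h) → z , trans (sym e) h })
    ((λ _ → + 0) , sym (Σ-zero n (λ i _ → zeroˡ _)))
    (λ { (z , h) (z′ , h′) → (λ i → z i ℤ.+ z′ i) , trans (+-cong h h′) (trans (sym (Σ-+ n _ _))
           (Σ-cong n (λ i _ → trans (sym (distribʳ _ _ _)) (*-congʳ (sym (ι-+ (z i) (z′ i))))))) })
    (λ { (z , h) → (λ i → ℤ.- z i) , trans (-‿cong h) (trans (Σ-neg n _)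
           (Σ-cong n (λ i _ → trans (-‿distribˡ-* _ _) (*-congʳ (sym (ι-neg (z i))))))) })
    (λ { (j , j<n , e) → (λ i → δ i j) , trans e (sym (Σ-δ n f j<n)) })

  -- The multipliers that bring `α` into the span form an ideal of ℤ, so membership of `α` can be
  -- verified one prime at a time.
  span-globalise : ∀ {G α} D → 0 < D → Span G (ι (+ D) * α) →
    (∀ ℓ → Prime ℓ → ∃[ D′ ] (¬ ℓ ∣ℕ D′) × Span G (ι (+ D′) * α)) → Span G α
  span-globalise {G} {α} D 0<D h local = span-resp (*-identityˡ α) (local-to-global (λ z → Span G (ι z * α))
    (λ {x} {y} u v → span-resp (trans (sym (distribʳ α (ι x) (ι y))) (*-congʳ (sym (ι-+ x y)))) (span-add u v))
    (λ z {x} u → span-resp (trans (sym (*-assoc _ _ _)) (*-congʳ (sym (ι-* z x)))) (span-ι z u)) D 0<D h local)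

  -- The error terms are exhibited as `ℓ` times elements of `O`: congruences modulo `ℓ` are meant
  -- inside the order, since `ℓ` may be invertible in the ambient ring.
  module Freshman {O : Carrier → Set} (OS : IsSubring O) {ℓ : ℕ} (pr : Prime ℓ) where
    open IsSubring OS
    open Comb using (_C_; nCn≡1)
    open SumP semiring using (sum-init-last) renaming (sum to fsum)

    fsum-lemma : ∀ c m (t : Fin m → Carrier) → (∀ i → ∃[ w ] O w × (t i ≈ c * w)) → ∃[ w ] O w × (fsum t ≈ c * w)
    fsum-lemma c zero    t h = 0# , zer , sym (zeroʳ c)
    fsum-lemma c (suc m) t h with h Fin.zero | fsum-lemma c m (λ i → t (Fin.suc i)) (λ i → h (Fin.suc i))
    ... | w , ow , e | w′ , ow′ , e′ = w + w′ , add ow ow′ , trans (+-cong e e′) (sym (distribˡ c w w′))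

    -- The inner binomial coefficients are divisible by `ℓ` and the inner monomials by `x * y`. The
    -- second factor is recorded as well, because `x-p^` relies on it to keep the error divisible by
    -- `π`.
    fresh′ : ∀ m → ℓ ≡ suc m → ∀ x y → O x → O y → ∃[ w ] O w × ((x + y) ^ ℓ ≈ x ^ ℓ + y ^ ℓ + ι (+ ℓ) * (x * y * w))
    fresh′ m ≡.refl x y ox oy = w , ow , (begin
        (x + y) ^ suc m                      ≈⟨ BinP.theorem commutativeSemiring (suc m) x y ⟩
        T Fin.zero + fsum t                  ≈⟨ +-congˡ (sum-init-last t) ⟩
        T Fin.zero + (fsum (λ i → t (inject₁ i)) + t (fromℕ m))
                                             ≈⟨ +-cong first (+-cong ew last) ⟩
        y ^ suc m + (ι (+ suc m) * (x * y) * w + x ^ suc m)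
          ≈⟨ solve 6 (λ x y yl l w xl → yl :+ (l :* (x :* y) :* w :+ xl) := xl :+ yl :+ l :* (x :* y :* w)) refl
               x y (y ^ suc m) (ι (+ suc m)) w (x ^ suc m) ⟩
        x ^ suc m + y ^ suc m + ι (+ suc m) * (x * y * w) ∎)
      where
      T : Fin (suc (suc m)) → Carrier
      T = BinP.binomialTerm commutativeSemiring x y (suc m)
      t : Fin (suc m) → Carrier
      t i = T (Fin.suc i)
      first : T Fin.zero ≈ y ^ suc m
      first = trans (×ₙ-ι 1 _) (trans (*-identityˡ _) (*-identityˡ _))
      last : t (fromℕ m) ≈ x ^ suc m
      last = begin
        (suc m C suc (toℕ (fromℕ m))) ×ₙ (x ^ suc (toℕ (fromℕ m)) * y ^ (m ∸ toℕ (fromℕ m)))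
          ≡⟨ ≡.cong (λ k → (suc m C suc k) ×ₙ (x ^ suc k * y ^ (m ∸ k))) (FinP.toℕ-fromℕ m) ⟩
        (suc m C suc m) ×ₙ (x ^ suc m * y ^ (m ∸ m))
          ≡⟨ ≡.cong₂ (λ c k → c ×ₙ (x ^ suc m * y ^ k)) (nCn≡1 (suc m)) (ℕP.n∸n≡0 m) ⟩
        1 ×ₙ (x ^ suc m * 1#) ≈⟨ ×ₙ-ι 1 _ ⟩
        1# * (x ^ suc m * 1#) ≈⟨ trans (*-identityˡ _) (*-identityʳ _) ⟩
        x ^ suc m ∎
      middle : ∀ i → ∃[ w ] O w × (t (inject₁ i) ≈ ι (+ suc m) * (x * y) * w)
      middle i = ιℕ q * (x ^ k * y ^ (m ∸ suc k)) , mul (intℕ q) (mul (pow k ox) (pow (m ∸ suc k) oy)) , (begin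
        (suc m C suc (toℕ (inject₁ i))) ×ₙ (x ^ suc (toℕ (inject₁ i)) * y ^ (m ∸ toℕ (inject₁ i)))
          ≡⟨ ≡.cong (λ k → (suc m C suc k) ×ₙ (x ^ suc k * y ^ (m ∸ k))) (FinP.toℕ-inject₁ i) ⟩
        (suc m C suc k) ×ₙ (x ^ suc k * y ^ (m ∸ k))
          ≈⟨ ×ₙ-ι (suc m C suc k) _ ⟩
        ιℕ (suc m C suc k) * (x ^ suc k * y ^ (m ∸ k))
          ≡⟨ ≡.cong₂ (λ c e → ιℕ c * (x ^ suc k * y ^ e)) Cq (ℕP.+-∸-assoc 1 k<m) ⟩
        ιℕ (q ℕ.* suc m) * (x * x ^ k * (y * y ^ (m ∸ suc k)))
          ≈⟨ *-congʳ (ιℕ-* q (suc m)) ⟩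
        ιℕ q * ιℕ (suc m) * (x * x ^ k * (y * y ^ (m ∸ suc k)))
          ≈⟨ solve 6 (λ q l x xk y yk → q :* l :* (x :* xk :* (y :* yk)) := l :* (x :* y) :* (q :* (xk :* yk))) refl
               (ιℕ q) (ιℕ (suc m)) x (x ^ k) y (y ^ (m ∸ suc k)) ⟩
        ι (+ suc m) * (x * y) * (ιℕ q * (x ^ k * y ^ (m ∸ suc k))) ∎)
        where
        k = toℕ i
        k<m : k < m
        k<m = FinP.toℕ<n i
        div : suc m ∣ℕ (suc m C suc k)
        div = prime∣C pr (suc k) (s≤s z≤n) (s≤s k<m)
        q = ℕD.quotient div
        Cq : suc m C suc k ≡ q ℕ.* suc m
        Cq = ℕD._∣_.equality div
      W = fsum-lemma (ι (+ suc m) * (x * y)) m (λ i → t (inject₁ i)) middle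
      w = proj₁ W
      ow = proj₁ (proj₂ W)
      ew = proj₂ (proj₂ W)

    fresh : ∀ x y → O x → O y → ∃[ w ] O w × ((x + y) ^ ℓ ≈ x ^ ℓ + y ^ ℓ + ι (+ ℓ) * (x * y * w))
    fresh = fresh′ (ℕ.pred ℓ) (≡.sym (ℕP.suc-pred ℓ {{ℕ.>-nonZero (prime>0 pr)}}))

    0^ℓ : 0# ^ ℓ ≈ 0#
    0^ℓ = trans (^-congʳ 0# (≡.sym (ℕP.suc-pred ℓ {{ℕ.>-nonZero (prime>0 pr)}}))) (zeroˡ _)

    fresh-Σ : ∀ n (f : ℕ → Carrier) → (∀ i → i < n → O (f i)) →
      ∃[ w ] O w × (Σ< n f ^ ℓ ≈ Σ< n (λ i → f i ^ ℓ) + ι (+ ℓ) * w)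
    fresh-Σ zero    f of = 0# , zer , trans 0^ℓ (sym (trans (+-identityˡ _) (zeroʳ _)))
    fresh-Σ (suc n) f of with fresh-Σ n f (λ i i<n → of i (ℕP.m<n⇒m<1+n i<n))
       | fresh (Σ< n f) (f n) (sum n (λ i i<n → of i (ℕP.m<n⇒m<1+n i<n))) (of n (ℕP.n<1+n n))
    ... | w , ow , e | v , ov , e′ =
      w + S * f n * v , add ow (mul (mul (sum n (λ i i<n → of i (ℕP.m<n⇒m<1+n i<n))) (of n (ℕP.n<1+n n))) ov) , (begin
        (S + f n) ^ ℓ                                          ≈⟨ e′ ⟩
        S ^ ℓ + f n ^ ℓ + L * (S * f n * v)                    ≈⟨ +-congʳ (+-congʳ e) ⟩
        (Σ< n (λ i → f i ^ ℓ) + L * w) + f n ^ ℓ + L * (S * f n * v)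
          ≈⟨ solve 5 (λ s l w fl x → (s :+ l :* w) :+ fl :+ l :* x := (s :+ fl) :+ l :* (w :+ x)) refl
               (Σ< n (λ i → f i ^ ℓ)) L w (f n ^ ℓ) (S * f n * v) ⟩
        Σ< (suc n) (λ i → f i ^ ℓ) + L * (w + S * f n * v) ∎)
      where
      S = Σ< n f
      L = ι (+ ℓ)

  -- Almost integral elements, nilpotence and maximality at a prime

  AI : (Carrier → Set) → Carrier → Set
  AI O α = Σ[ D ∈ ℕ ] ∀ k → O (ι (+ suc D) * α ^ k)

  Mult : ℤ → (Carrier → Set) → Carrier → Set
  Mult m O w = ∃[ v ] O v × (w ≈ ι m * v)

  Nil : ℤ → (Carrier → Set) → Carrier → Set
  Nil m O w = ∃[ n ] Mult m O (w ^ n)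

  TorsionFree : Set
  TorsionFree = ∀ z x → z ≢ + 0 → ι z * x ≈ 0# → x ≈ 0#

  module AlmostIntegral {O : Carrier → Set} (OS : IsSubring O) where
    open IsSubring OS

    AI-resp : ∀ {α β} → α ≈ β → AI O α → AI O β
    AI-resp e (D , h) = D , λ k → resp (*-congˡ (^-congˡ k e)) (h k)

    AI-sub : ∀ {w} → O w → AI O w
    AI-sub ow = 0 , λ k → mul one (pow k ow)

    AI-mul : ∀ {γ t} → AI O γ → O t → AI O (γ * t)
    AI-mul {γ} {t} (D , h) ot = D , λ k →
      resp (trans (*-assoc _ _ _) (*-congˡ (sym (^-distrib-* γ t k)))) (mul (h k) (pow k ot))

    AI-+ : ∀ {α β} → AI O α → AI O β → AI O (α + β)
    AI-+ {α} {β} (D , h) (E , g) = F , λ k → resp (*-congˡ (trans (*-congˡ (trans (*-identityˡ _) refl)) (*-identityʳ _))) (all k 0 0)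
      where
      -- Chosen so that `suc F` is by computation `suc D ℕ.* suc E`.
      F = E ℕ.+ D ℕ.* suc E
      F≈ : ι (+ suc F) ≈ ι (+ suc D) * ι (+ suc E)
      F≈ = ιℕ-* (suc D) (suc E)
      -- The extra monomial lets the induction distribute one factor `α + β` at a time, in place of
      -- a binomial expansion of the power.
      all : ∀ k i j → O (ι (+ suc F) * ((α + β) ^ k * (α ^ i * β ^ j)))
      all zero i j = resp (begin
          (ι (+ suc D) * α ^ i) * (ι (+ suc E) * β ^ j)
            ≈⟨ solve 4 (λ d a e b → d :* a :* (e :* b) := d :* e :* (con (+ 1) :* (a :* b))) refl _ _ _ _ ⟩
          ι (+ suc D) * ι (+ suc E) * (1# * (α ^ i * β ^ j)) ≈⟨ *-congʳ F≈ ⟨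
          ι (+ suc F) * (1# * (α ^ i * β ^ j)) ∎) (mul (h i) (g j))
      all (suc k) i j = resp
        (solve 6 (λ f p a b ai bj → f :* (p :* (a :* ai :* bj)) :+ f :* (p :* (ai :* (b :* bj))) := f :* ((a :+ b) :* p :* (ai :* bj))) refl
           (ι (+ suc F)) ((α + β) ^ k) α β (α ^ i) (β ^ j))
        (add (all k (suc i) j) (all k i (suc j)))

  -- The order enters almost integrality only up to a bounded denominator. This transports the
  -- notion between ℤ[θ] and the orders used at single primes.
  AI-change : ∀ {O₁ O₂ : Carrier → Set} F → (∀ {x y} → x ≈ y → O₂ x → O₂ y) →
    (∀ {w} → O₁ w → O₂ (ι (+ suc F) * w)) → ∀ {α} → AI O₁ α → AI O₂ α
  AI-change F r f (D , h) = D ℕ.+ F ℕ.* suc D , λ k →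
    r (trans (sym (*-assoc _ _ _)) (*-congʳ (sym (ιℕ-* (suc F) (suc D))))) (f (h k))

  module PrimeLocal {O : Carrier → Set} (OS : IsSubring O) (tf : TorsionFree) {ℓ : ℕ} (pr : Prime ℓ) where
    open IsSubring OS
    open AlmostIntegral OS

    L : Carrier
    L = ι (+ ℓ)

    ℓ^≢0 : ∀ f → + (ℓ ℕ.^ f) ≢ + 0
    ℓ^≢0 f e = ℕP.<⇒≢ (ℕP.m^n>0 ℓ {{ℕ.>-nonZero (prime>0 pr)}} f) (≡.sym (ℤP.+-injective e))

    tf-cancel : ∀ z → z ≢ + 0 → ∀ {x y} → ι z * x ≈ ι z * y → x ≈ y
    tf-cancel z z≢0 {x} {y} e = begin
      x           ≈⟨ solve 2 (λ x y → x := (x :- y) :+ y) refl x y ⟩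
      (x - y) + y ≈⟨ +-congʳ (tf z (x - y) z≢0 (begin
          ι z * (x - y)         ≈⟨ solve 3 (λ z x y → z :* (x :- y) := z :* x :- z :* y) refl (ι z) x y ⟩
          ι z * x - ι z * y     ≈⟨ +-congʳ e ⟩
          ι z * y - ι z * y     ≈⟨ -‿inverseʳ _ ⟩
          0#                    ∎)) ⟩
      0# + y      ≈⟨ +-identityˡ y ⟩
      y           ∎

    ℓ-cancel : ∀ {x y} → L * x ≈ L * y → x ≈ y
    ℓ-cancel {x} {y} e = tf-cancel (+ ℓ) (λ e′ → ℕP.<⇒≢ (prime>0 pr) (≡.sym (ℤP.+-injective e′))) e

    -- `D` is invertible modulo `ℓ`. Membership of `w` in `O` takes care of the term of the Bézout
    -- identity that carries the factor `ℓ`.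
    Mult-prime : ∀ {D w} → ¬ ℓ ∣ℕ D → O w → Mult (+ ℓ) O (ι (+ D) * w) → Mult (+ ℓ) O w
    Mult-prime {D} {w} ∤ ow (v , ov , e) with prime-bézout pr ∤
    ... | a , b , bz = ι a * w + ι b * v , add (mul (int a) ow) (mul (int b) ov) , (begin
        w                                         ≈⟨ *-identityˡ w ⟨
        ι (+ 1) * w                               ≡⟨ ≡.cong (λ z → ι z * w) bz ⟨
        ι (a ℤ.* + ℓ ℤ.+ b ℤ.* + D) * w           ≈⟨ *-congʳ (trans (ι-+ (a ℤ.* + ℓ) (b ℤ.* + D)) (+-cong (ι-* a (+ ℓ)) (ι-* b (+ D)))) ⟩
        (ι a * L + ι b * ι (+ D)) * w             ≈⟨ solve 5 (λ a l b d w → (a :* l :+ b :* d) :* w := a :* l :* w :+ b :* (d :* w)) refl _ _ _ _ _ ⟩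
        ι a * L * w + ι b * (ι (+ D) * w)         ≈⟨ +-congˡ (*-congˡ e) ⟩
        ι a * L * w + ι b * (L * v)               ≈⟨ solve 5 (λ a l b v w → a :* l :* w :+ b :* (l :* v) := l :* (a :* w :+ b :* v)) refl _ _ _ _ _ ⟩
        L * (ι a * w + ι b * v)                   ∎)

    -- If D γ^n is in O for all n and ℓ^f is the exact power of ℓ in D, then (γ t)^(M (f+1)) is a multiple
    -- of ℓ up to a factor prime to ℓ, since t^(M (f+1)) is a multiple of ℓ^(f+1).
    AI⇒Nil : ∀ {γ t} M → AI O γ → O t → Mult (+ ℓ) O (t ^ M) → O (γ * t) → Nil (+ ℓ) O (γ * t)
    AI⇒Nil {γ} {t} M (D , h) ot (q , oq , eq) oγt with split-prime pr (suc D) (s≤s z≤n)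
    ... | f , D′ , eD , ∤ = n , Mult-prime ∤ (pow n oγt) (v , ov , tf-cancel (+ (ℓ ℕ.^ f)) (ℓ^≢0 f) final)
      where
      n = M ℕ.* suc f
      w = γ * t
      v = (ι (+ suc D) * γ ^ n) * q ^ suc f
      ov : O v
      ov = mul (h n) (pow (suc f) oq)
      final : ι (+ (ℓ ℕ.^ f)) * (ι (+ D′) * w ^ n) ≈ ι (+ (ℓ ℕ.^ f)) * (L * v)
      final = begin
        ι (+ (ℓ ℕ.^ f)) * (ι (+ D′) * w ^ n)      ≈⟨ *-assoc _ _ _ ⟨
        ι (+ (ℓ ℕ.^ f)) * ι (+ D′) * w ^ n        ≈⟨ *-congʳ (ιℕ-* (ℓ ℕ.^ f) D′) ⟨
        ιℕ (ℓ ℕ.^ f ℕ.* D′) * w ^ n               ≡⟨ ≡.cong (λ k → ιℕ k * w ^ n) eD ⟨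
        ιℕ (suc D) * w ^ n                        ≈⟨ *-congˡ (^-distrib-* γ t n) ⟩
        ιℕ (suc D) * (γ ^ n * t ^ n)              ≈⟨ *-congˡ (*-congˡ (trans (sym (^-assocʳ t M (suc f))) (trans (^-congˡ (suc f) eq) (^-distrib-* L q (suc f))))) ⟩
        ιℕ (suc D) * (γ ^ n * (L * L ^ f * q ^ suc f))
          ≈⟨ *-congˡ (*-congˡ (*-congʳ (*-congˡ (sym (ιℕ-^ ℓ f))))) ⟩
        ιℕ (suc D) * (γ ^ n * (L * ιℕ (ℓ ℕ.^ f) * q ^ suc f))
          ≈⟨ solve 5 (λ d g l lf q → d :* (g :* (l :* lf :* q)) := lf :* (l :* (d :* g :* q))) refl _ _ _ _ _ ⟩
        ι (+ (ℓ ℕ.^ f)) * (L * v) ∎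

    -- Equivalently, the almost integral elements modulo `O` have no `ℓ`-torsion.
    Maximal : Set
    Maximal = ∀ {γ} → AI O γ → O (L * γ) → O γ

    -- The exponent 1 in the definition of almost integrality gives a denominator of `α`; its
    -- `ℓ`-part is removed one factor at a time by maximality.
    localise : Maximal → ∀ {α} → AI O α → ∃[ D ] (¬ ℓ ∣ℕ D) × O (ι (+ D) * α)
    localise max {α} ai@(D , h) with split-prime pr (suc D) (s≤s z≤n)
    ... | f , D′ , eD , ∤ = D′ , ∤ , go f (resp e₀ (h 1))
      where
      α′ = ι (+ D′) * α
      aiα′ : AI O α′
      aiα′ = AI-resp (*-comm _ _) (AI-mul ai (intℕ D′))
      e₀ : ι (+ suc D) * (α * 1#) ≈ ι (+ (ℓ ℕ.^ f)) * α′
      e₀ = begin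
        ιℕ (suc D) * (α * 1#)             ≡⟨ ≡.cong (λ k → ιℕ k * (α * 1#)) eD ⟩
        ιℕ (ℓ ℕ.^ f ℕ.* D′) * (α * 1#)    ≈⟨ *-cong (ιℕ-* (ℓ ℕ.^ f) D′) (*-identityʳ α) ⟩
        ιℕ (ℓ ℕ.^ f) * ιℕ D′ * α          ≈⟨ *-assoc _ _ _ ⟩
        ι (+ (ℓ ℕ.^ f)) * α′ ∎
      go : ∀ f → O (ι (+ (ℓ ℕ.^ f)) * α′) → O α′
      go zero    o = resp (*-identityˡ _) o
      go (suc f) o = go f (max (AI-resp (*-comm _ _) (AI-mul aiα′ (intℕ (ℓ ℕ.^ f))))
                               (resp (trans (*-congʳ (ιℕ-* ℓ (ℓ ℕ.^ f))) (*-assoc _ _ _)) o))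

-- The order at p when p does not divide a

module Geometric (R : CommutativeRing 0ℓ 0ℓ) where
  open RingTools R

  geo : ℕ → Carrier → Carrier
  geo n y = Σ< n (λ i → y ^ i)

  -- The quotient of `geo n y - n` by `y - 1`, as `tri-tele` shows; it controls the difference
  -- between a geometric sum and its number of terms.
  tri : ℕ → Carrier → Carrier
  tri n y = Σ< n (λ i → geo i y)

  geo-suc : ∀ n y → geo (suc n) y ≈ 1# + y * geo n y
  geo-suc n y = trans (Σ-shift n (λ i → y ^ i)) (+-congˡ (sym (Σ-*ˡ n y (λ i → y ^ i))))

  geo-cong : ∀ n {y z} → y ≈ z → geo n y ≈ geo n z
  geo-cong n e = Σ-cong n (λ i _ → ^-congˡ i e)

  geo-tele : ∀ n y → (y - 1#) * geo n y ≈ y ^ n - 1#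
  geo-tele zero    y = solve 1 (λ y → (y :- con (+ 1)) :* con (+ 0) := con (+ 1) :- con (+ 1)) refl y
  geo-tele (suc n) y = begin
    (y - 1#) * (geo n y + y ^ n)          ≈⟨ distribˡ _ _ _ ⟩
    (y - 1#) * geo n y + (y - 1#) * y ^ n ≈⟨ +-congʳ (geo-tele n y) ⟩
    (y ^ n - 1#) + (y - 1#) * y ^ n       ≈⟨ solve 2 (λ y z → (z :- con (+ 1)) :+ (y :- con (+ 1)) :* z := y :* z :- con (+ 1)) refl y (y ^ n) ⟩
    y * y ^ n - 1#                        ∎

  tri-tele : ∀ n y → (y - 1#) * tri n y ≈ geo n y - ιℕ n
  tri-tele zero    y = solve 1 (λ y → (y :- con (+ 1)) :* con (+ 0) := con (+ 0) :- con (+ 0)) refl y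
  tri-tele (suc n) y = begin
    (y - 1#) * (tri n y + geo n y)               ≈⟨ distribˡ _ _ _ ⟩
    (y - 1#) * tri n y + (y - 1#) * geo n y      ≈⟨ +-cong (tri-tele n y) (geo-tele n y) ⟩
    (geo n y - ιℕ n) + (y ^ n - 1#)              ≈⟨ solve 3 (λ g n z → (g :- n) :+ (z :- con (+ 1)) := (g :+ z) :- (con (+ 1) :+ n)) refl _ _ _ ⟩
    (geo n y + y ^ n) - (1# + ιℕ n)              ≈⟨ +-congˡ (-‿cong (ιℕ-suc n)) ⟨
    geo (suc n) y - ιℕ (suc n)                   ∎

  open Comb using (_C_; nCn≡1; nC1≡n; nCk+nC[k+1]≡[n+1]C[k+1])

  -- The expansion of `((1 + η) ^ n - 1) / η`. The recursion `geo-suc` and Pascal's rule give it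
  -- without a division by `η`.
  geo-binomial : ∀ n η → geo n (1# + η) ≈ Σ< n (λ j → ιℕ (n C suc j) * η ^ j)
  geo-binomial zero    η = refl
  geo-binomial (suc n) η = begin
    geo (suc n) (1# + η)                ≈⟨ geo-suc n (1# + η) ⟩
    1# + (1# + η) * geo n (1# + η)      ≈⟨ +-congˡ (*-congˡ (geo-binomial n η)) ⟩
    1# + (1# + η) * S                   ≈⟨ solve 2 (λ e s → con (+ 1) :+ (con (+ 1) :+ e) :* s := (con (+ 1) :* con (+ 1) :+ e :* s) :+ s) refl η S ⟩
    (ιℕ 1 * 1# + η * S) + S             ≈⟨ +-cong lo hi ⟨
    Σ< (suc n) (λ j → ιℕ (n C j) * η ^ j) + Σ< (suc n) (λ j → ιℕ (n C suc j) * η ^ j)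
      ≈⟨ Σ-+ (suc n) _ _ ⟨
    Σ< (suc n) (λ j → ιℕ (n C j) * η ^ j + ιℕ (n C suc j) * η ^ j)
      ≈⟨ Σ-cong (suc n) (λ j _ → trans (sym (distribʳ _ _ _)) (*-congʳ (trans (sym (ιℕ-+ (n C j) (n C suc j)))
            (reflexive (≡.cong ιℕ (nCk+nC[k+1]≡[n+1]C[k+1] n j)))))) ⟩
    Σ< (suc n) (λ j → ιℕ (suc n C suc j) * η ^ j) ∎
    where
    S = Σ< n (λ j → ιℕ (n C suc j) * η ^ j)
    lo : Σ< (suc n) (λ j → ιℕ (n C j) * η ^ j) ≈ ιℕ 1 * 1# + η * S
    lo = trans (Σ-shift n _) (+-congˡ (trans (Σ-cong n (λ j _ →
           solve 3 (λ c e z → c :* (e :* z) := e :* (c :* z)) refl (ιℕ (n C suc j)) η (η ^ j)))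
           (sym (Σ-*ˡ n η _))))
    hi : Σ< (suc n) (λ j → ιℕ (n C suc j) * η ^ j) ≈ S
    hi = trans (+-congˡ (trans (*-congʳ (reflexive (≡.cong ιℕ (k>n⇒nCk≡0 (ℕP.n<1+n n))))) (zeroˡ _))) (+-identityʳ S)

  -- The Eisenstein form of the `p`-th cyclotomic polynomial at `1 + η`: the constant term is
  -- exactly `p`, the leading coefficient is 1, and the coefficients in between are divisible by
  -- `p`.
  geo-prime : ∀ {O} → IsSubring O → ∀ {p} → Prime p → ∀ η → O η →
    ∃[ w ] O w × (geo p (1# + η) ≈ η ^ (p ∸ 1) + ι (+ p) * (1# + η * w))
  geo-prime {O} OS {p} pr η oη = go p pr ≡.refl
    where
    open IsSubring OS
    go : ∀ q → Prime p → q ≡ p → ∃[ w ] O w × (geo p (1# + η) ≈ η ^ (p ∸ 1) + ι (+ p) * (1# + η * w))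
    go zero pr ≡.refl = ⊥-elim (ℕP.<⇒≱ (prime>0 pr) z≤n)
    go (suc zero) pr ≡.refl = ⊥-elim (ℕP.<⇒≱ (prime>1 pr) ℕP.≤-refl)
    go (suc (suc m)) pr ≡.refl = w , proj₁ (proj₂ W) , (begin
        geo p (1# + η)                                          ≈⟨ geo-binomial p η ⟩
        Σ< (suc m) t + ιℕ (p C p) * η ^ suc m                   ≈⟨ +-cong (Σ-shift m t) (trans (*-congʳ (reflexive (≡.cong ιℕ (nCn≡1 p)))) (*-identityˡ _)) ⟩
        (ιℕ (p C 1) * 1# + Σ< m (λ j → t (suc j))) + η ^ suc m  ≈⟨ +-congʳ (+-cong (*-congʳ (reflexive (≡.cong ιℕ (nC1≡n p)))) (proj₂ (proj₂ W))) ⟩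
        (ιℕ p * 1# + ι (+ p) * η * w) + η ^ suc m
          ≈⟨ solve 4 (λ p e w x → (p :* con (+ 1) :+ p :* e :* w) :+ x := x :+ p :* (con (+ 1) :+ e :* w)) refl (ιℕ p) η w (η ^ suc m) ⟩
        η ^ suc m + ι (+ p) * (1# + η * w) ∎)
      where
      t : ℕ → Carrier
      t j = ιℕ (p C suc j) * η ^ j
      sums : ∀ k → k ≤ m → ∃[ w ] O w × (Σ< k (λ j → t (suc j)) ≈ ι (+ p) * η * w)
      sums zero    _   = 0# , zer , sym (zeroʳ _)
      sums (suc k) k<m with sums k (ℕP.<⇒≤ k<m) | prime∣C pr (suc (suc k)) (s≤s z≤n) (s≤s (s≤s k<m))
      ... | w , ow , e | ℕD.divides q eq = w + ιℕ q * η ^ k , add ow (mul (intℕ q) (pow k oη)) , (begin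
          Σ< k (λ j → t (suc j)) + ιℕ (p C suc (suc k)) * (η * η ^ k)
            ≈⟨ +-cong e (*-congʳ (trans (reflexive (≡.cong ιℕ eq)) (ιℕ-* q p))) ⟩
          ι (+ p) * η * w + ιℕ q * ιℕ p * (η * η ^ k)
            ≈⟨ solve 5 (λ p e w q x → p :* e :* w :+ q :* p :* (e :* x) := p :* e :* (w :+ q :* x)) refl (ιℕ p) η w (ιℕ q) (η ^ k) ⟩
          ι (+ p) * η * (w + ιℕ q * η ^ k) ∎)
      W = sums m ℕP.≤-refl
      w = proj₁ W

-- Powers of x expanded at π = x - 1, modulo p

module Uniformizer (R : CommutativeRing 0ℓ 0ℓ) (x : CommutativeRing.Carrier R) (p : ℕ) (pr : Prime p) where
  open RingTools R
  open Geometric R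

  L : Carrier
  L = ι (+ p)

  π : Carrier
  π = x - 1#

  Gx : Carrier → Set
  Gx w = ∃[ i ] w ≈ x ^ i

  Zx : Carrier → Set
  Zx = Span Gx

  Zx-mul : ∀ {u v} → Zx u → Zx v → Zx (u * v)
  Zx-mul = span-mul (λ { (i , ei) (j , ej) → gen (i ℕ.+ j , trans (*-cong ei ej) (sym (^-homo-* x i j))) })

  Zx-one : Zx 1#
  Zx-one = gen (0 , refl)

  ZxS : IsSubring Zx
  ZxS = record { resp = span-resp ; add = span-add ; neg = span-neg ; mul = Zx-mul ; one = Zx-one }

  Zx-x : Zx x
  Zx-x = gen (1 , sym (*-identityʳ x))

  Zx-π : Zx π
  Zx-π = span-add Zx-x (span-neg Zx-one)

  Zx-geo : ∀ m {y} → Zx y → Zx (geo m y)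
  Zx-geo m zy = IsSubring.sum ZxS m (λ i _ → IsSubring.pow ZxS i zy)

  Zx-tri : ∀ m {y} → Zx y → Zx (tri m y)
  Zx-tri m zy = IsSubring.sum ZxS m (λ i _ → Zx-geo i zy)

  open Freshman ZxS pr using () renaming (fresh to freshZ)

  pow-add : ∀ m {u v} → Zx u → Zx v → ∃[ w ] Zx w × ((u + v) ^ m ≈ u ^ m + v * w)
  pow-add zero    zu zv = 0# , span-zer , sym (trans (+-congˡ (zeroʳ _)) (+-identityʳ _))
  pow-add (suc m) {u} {v} zu zv with pow-add m zu zv
  ... | w , zw , h = u ^ m + (u + v) * w , span-add (IsSubring.pow ZxS m zu) (Zx-mul (span-add zu zv) zw) ,
    trans (*-congˡ h) (solve 4 (λ u v x w → (u :+ v) :* (x :+ v :* w) := u :* x :+ v :* (x :+ (u :+ v) :* w)) refl u v (u ^ m) w)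

  π^suc : ∀ m → 0 < m → π ^ m ≈ π * π ^ (m ∸ 1)
  π^suc (suc m) _ = refl

  p^>0 : ∀ f → 0 < p ℕ.^ f
  p^>0 f = ℕP.m^n>0 p {{ℕ.>-nonZero (prime>0 pr)}} f

  Zπ^ : ∀ m → Zx (π ^ m)
  Zπ^ m = IsSubring.pow ZxS m Zx-π

  ZL : ∀ {g} → Zx g → Zx (L * (π * g))
  ZL zg = span-ι (+ p) (Zx-mul Zx-π zg)

  -- Iterated Frobenius applied to `1 + π`. The factor `π` next to `L` in the error survives
  -- division by `p`, so that in `topquot-d` the quotient is still known modulo `π`.
  x-p^ : ∀ f → ∃[ g ] Zx g × (x ^ (p ℕ.^ f) ≈ 1# + (π ^ (p ℕ.^ f) + L * (π * g)))
  x-p^ zero = 0# , span-zer , solve 2 (λ x l → x :* con (+ 1) := con (+ 1) :+ ((x :- con (+ 1)) :* con (+ 1) :+ l :* ((x :- con (+ 1)) :* con (+ 0)))) refl x L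
  x-p^ (suc f) with x-p^ f
  ... | g , zg , h with pow-add p (Zπ^ (p ℕ.^ f)) (ZL zg)
      | freshZ 1# (π ^ (p ℕ.^ f) + L * (π * g)) Zx-one (span-add (Zπ^ (p ℕ.^ f)) (ZL zg))
  ... | v , zv , hv | w , zw , hw = g * v + a * w , span-add (Zx-mul zg zv) (Zx-mul (span-add (Zπ^ (P ∸ 1)) (span-ι (+ p) zg)) zw) , (begin
      x ^ (p ℕ.* P)                            ≈⟨ trans (^-congʳ x (ℕP.*-comm p P)) (sym (^-assocʳ x P p)) ⟩
      (x ^ P) ^ p                              ≈⟨ trans (^-congˡ p h) hw ⟩
      1# ^ p + A ^ p + L * (1# * A * w)        ≈⟨ +-cong (+-cong (1^ p) hv) (*-congˡ (*-congʳ (*-congˡ (+-congʳ (π^suc P (p^>0 f)))))) ⟩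
      1# + ((π ^ P) ^ p + L * (π * g) * v) + L * (1# * (π * π ^ (P ∸ 1) + L * (π * g)) * w)
        ≈⟨ solve 7 (λ x l p g v y w → con (+ 1) :+ (x :+ l :* (p :* g) :* v) :+ l :* (con (+ 1) :* (p :* y :+ l :* (p :* g)) :* w)
                      := con (+ 1) :+ (x :+ l :* (p :* (g :* v :+ (y :+ l :* g) :* w)))) refl ((π ^ P) ^ p) L π g v (π ^ (P ∸ 1)) w ⟩
      1# + ((π ^ P) ^ p + L * (π * (g * v + a * w)))
        ≈⟨ +-congˡ (+-congʳ (trans (^-assocʳ π P p) (^-congʳ π (ℕP.*-comm P p)))) ⟩
      1# + (π ^ (p ℕ.* P) + L * (π * (g * v + a * w))) ∎)
      where
      P = p ℕ.^ f
      A = π ^ P + L * (π * g)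
      a = π ^ (P ∸ 1) + L * g

  -- The Eisenstein form of `geo-prime` rewritten in powers of `π` by means of `x-p^`. After
  -- division by `p` the cofactor `1 + π * g` is 1 modulo `π`, which determines `Top k` for `k < d`.
  geo-π : ∀ f → ∃[ g ] Zx g × (geo p (x ^ (p ℕ.^ f)) ≈ π ^ ((p ∸ 1) ℕ.* p ℕ.^ f) + L * (1# + π * g))
  geo-π f with x-p^ f
  ... | g , zg , h with pow-add (p ∸ 1) (Zπ^ (p ℕ.^ f)) (ZL zg)
      | geo-prime ZxS pr (π ^ (p ℕ.^ f) + L * (π * g)) (span-add (Zπ^ (p ℕ.^ f)) (ZL zg))
  ... | v , zv , hv | w , zw , hw = g * v + a * w , span-add (Zx-mul zg zv) (Zx-mul (span-add (Zπ^ (P ∸ 1)) (span-ι (+ p) zg)) zw) , (begin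
      geo p (x ^ P)                                   ≈⟨ trans (geo-cong p h) hw ⟩
      A ^ (p ∸ 1) + L * (1# + A * w)                  ≈⟨ +-cong hv (*-congˡ (+-congˡ (*-congʳ (+-congʳ (π^suc P (p^>0 f)))))) ⟩
      ((π ^ P) ^ (p ∸ 1) + L * (π * g) * v) + L * (1# + (π * π ^ (P ∸ 1) + L * (π * g)) * w)
        ≈⟨ solve 7 (λ x l p g v y w → (x :+ l :* (p :* g) :* v) :+ l :* (con (+ 1) :+ (p :* y :+ l :* (p :* g)) :* w)
                      := x :+ l :* (con (+ 1) :+ p :* (g :* v :+ (y :+ l :* g) :* w))) refl ((π ^ P) ^ (p ∸ 1)) L π g v (π ^ (P ∸ 1)) w ⟩
      (π ^ P) ^ (p ∸ 1) + L * (1# + π * (g * v + a * w))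
        ≈⟨ +-congʳ (trans (^-assocʳ π P (p ∸ 1)) (^-congʳ π (ℕP.*-comm P (p ∸ 1)))) ⟩
      π ^ ((p ∸ 1) ℕ.* P) + L * (1# + π * (g * v + a * w)) ∎)
      where
      P = p ℕ.^ f
      A = π ^ P + L * (π * g)
      a = π ^ (P ∸ 1) + L * g

-- For x^(p^s) = 1 + p^(d+1) c, the order ℤ[x, e_0, …, e_d] with p e_(k+1) = (1 + Y + … + Y^(p-1)) e_k, Y = x^(p^(s-k-1));
-- it has the ℤ-basis π^j e_k with k ≤ d and j < n k.
module POrderData (R : CommutativeRing 0ℓ 0ℓ) (p s d : ℕ)
    (x : CommutativeRing.Carrier R) (e : ℕ → CommutativeRing.Carrier R) where
  open RingTools R
  open Geometric R

  q : ℕ → ℕ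
  q k = p ℕ.^ (s ∸ k)

  Y : ℕ → Carrier
  Y k = x ^ q k

  -- As a polynomial in `x`, `e k` has degree `p^s - q k`, and `(p ∸ 1) ℕ.* q (suc k)` is the gap up
  -- to the degree of `e (suc k)`. Thus `π ^ j * e k` with `j < n k` meets every degree below `p^s`
  -- once.
  n : ℕ → ℕ
  n k with k ℕ.<? d
  ... | yes _ = (p ∸ 1) ℕ.* q (suc k)
  ... | no  _ = q d

  n-< : ∀ {k} → k < d → n k ≡ (p ∸ 1) ℕ.* q (suc k)
  n-< {k} k<d with k ℕ.<? d
  ... | yes _ = ≡.refl
  ... | no ≮  = ⊥-elim (≮ k<d)

  n-d : n d ≡ q d
  n-d with d ℕ.<? d
  ... | yes d<d = ⊥-elim (ℕP.<-irrefl ≡.refl d<d)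
  ... | no _    = ≡.refl

  π : Carrier
  π = x - 1#

  RS : (ℕ → ℕ → ℤ) → Carrier
  RS z = Σ< (suc d) (λ k → Σ< (n k) (λ j → ι (z k j) * (π ^ j * e k)))

-- For `d < s` the exponent `suc d` is exact, which is what `p∤c` expresses. For `d = s` it may fall
-- short of the valuation of `x ^ (p ℕ.^ s) - 1`, and `V∣` has to argue without any knowledge of
-- `c`.
module POrder (R : CommutativeRing 0ℓ 0ℓ) (p s d : ℕ)
    (x : CommutativeRing.Carrier R) (e : ℕ → CommutativeRing.Carrier R)
    (tf : RingTools.TorsionFree R) (pr : Prime p) (d≤s : d ≤ s) (c : ℤ) (p∤c : d < s → ¬ + p ∣ℤ c)
    (xN : (R CommutativeRing.≈ RingTools._^_ R x (p ℕ.^ s))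
            (CommutativeRing._+_ R (CommutativeRing.1# R) (RingTools.ι R (+ (p ℕ.^ suc d) ℤ.* c))))
    (e0 : (R CommutativeRing.≈ e 0) (CommutativeRing.1# R))
    (eS : ∀ k → k < d → (R CommutativeRing.≈ CommutativeRing._*_ R (RingTools.ι R (+ p)) (e (suc k)))
            (CommutativeRing._*_ R (Geometric.geo R p (POrderData.Y R p s d x e (suc k))) (e k)))
    (free : ∀ z → (R CommutativeRing.≈ POrderData.RS R p s d x e z) (CommutativeRing.0# R) →
            ∀ k j → k ≤ d → j < POrderData.n R p s d x e k → z k j ≡ + 0) where
  open RingTools R
  open Geometric R
  open POrderData R p s d x e

  open Uniformizer R x p pr hiding (π)

  p≢0 : + p ≢ + 0
  p≢0 eq = ℕP.<⇒≢ (prime>0 pr) (≡.sym (ℤP.+-injective eq))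

  L-cancel : ∀ {u v} → L * u ≈ L * v → u ≈ v
  L-cancel {u} {v} eq = begin
    u           ≈⟨ solve 2 (λ x y → x := (x :- y) :+ y) refl u v ⟩
    (u - v) + v ≈⟨ +-congʳ (tf (+ p) (u - v) p≢0 (trans
                     (solve 3 (λ z x y → z :* (x :- y) := z :* x :- z :* y) refl L u v)
                     (trans (+-congʳ eq) (-‿inverseʳ _)))) ⟩
    0# + v      ≈⟨ +-identityˡ v ⟩
    v           ∎

  Go : Carrier → Set
  Go w = ∃[ k ] ∃[ i ] (k ≤ d) × (w ≈ x ^ i * e k)

  O : Carrier → Set
  O = Span Go

  Zx-Y : ∀ k → Zx (Y k)
  Zx-Y k = gen (q k , refl)

  ZxO : ∀ {u v} → Zx u → O v → O (u * v)
  ZxO = span-mul (λ { (i , ei) (k , j , k≤ , ej) →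
    gen (k , i ℕ.+ j , k≤ , trans (*-cong ei ej) (trans (sym (*-assoc _ _ _)) (*-congʳ (sym (^-homo-* x i j))))) })

  Oe : ∀ {k} → k ≤ d → O (e k)
  Oe {k} k≤ = gen (k , 0 , k≤ , sym (*-identityˡ _))

  O-one : O 1#
  O-one = span-resp e0 (Oe z≤n)

  Zx⊂O : ∀ {u} → Zx u → O u
  Zx⊂O zu = span-resp (*-identityʳ _) (ZxO zu O-one)

  q-suc : ∀ k → k < s → q k ≡ q (suc k) ℕ.* p
  q-suc k k<s = ≡.trans (≡.cong (p ℕ.^_) (ℕP.+-∸-assoc 1 k<s)) (ℕP.*-comm p (q (suc k)))

  Y-suc : ∀ k → k < s → Y k ≈ Y (suc k) ^ p
  Y-suc k k<s = trans (^-congʳ x (q-suc k k<s)) (sym (^-assocʳ x (q (suc k)) p))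

  B : ℕ → Carrier
  B k = ι (+ (p ℕ.^ (suc d ∸ k)) ℤ.* c)

  B-suc : ∀ k → k ≤ d → B k ≈ L * (ι (+ (p ℕ.^ (d ∸ k))) * ι c)
  B-suc k k≤d = begin
    ι (+ (p ℕ.^ (suc d ∸ k)) ℤ.* c)              ≡⟨ ≡.cong (λ m → ι (+ (p ℕ.^ m) ℤ.* c)) (ℕP.+-∸-assoc 1 k≤d) ⟩
    ι (+ (p ℕ.* p ℕ.^ (d ∸ k)) ℤ.* c)            ≈⟨ ι-* (+ (p ℕ.* p ℕ.^ (d ∸ k))) c ⟩
    ιℕ (p ℕ.* p ℕ.^ (d ∸ k)) * ι c               ≈⟨ *-congʳ (ιℕ-* p _) ⟩
    (L * ι (+ (p ℕ.^ (d ∸ k)))) * ι c            ≈⟨ *-assoc _ _ _ ⟩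
    L * (ι (+ (p ℕ.^ (d ∸ k))) * ι c)            ∎

  -- Multiplication by `geo p (Y (suc k))` turns `Y (suc k) - 1` into `Y k - 1`, so the identity
  -- descends from `x ^ (p ℕ.^ s) - 1` and loses one factor `p` at each step.
  [Y-1]e : ∀ k → k ≤ d → (Y k - 1#) * e k ≈ B k
  [Y-1]e zero _ = begin
    (Y 0 - 1#) * e 0        ≈⟨ *-cong (+-congʳ xN) e0 ⟩
    ((1# + B 0) - 1#) * 1#  ≈⟨ solve 1 (λ b → ((con (+ 1) :+ b) :- con (+ 1)) :* con (+ 1) := b) refl (B 0) ⟩
    B 0                     ∎
  [Y-1]e (suc k) k<d = L-cancel (begin
    L * ((Y (suc k) - 1#) * e (suc k))              ≈⟨ solve 3 (λ l y e → l :* (y :* e) := y :* (l :* e)) refl L (Y (suc k) - 1#) (e (suc k)) ⟩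
    (Y (suc k) - 1#) * (L * e (suc k))              ≈⟨ *-congˡ (eS k k<d) ⟩
    (Y (suc k) - 1#) * (geo p (Y (suc k)) * e k)    ≈⟨ *-assoc _ _ _ ⟨
    (Y (suc k) - 1#) * geo p (Y (suc k)) * e k      ≈⟨ *-congʳ (geo-tele p (Y (suc k))) ⟩
    (Y (suc k) ^ p - 1#) * e k                      ≈⟨ *-congʳ (+-congʳ (sym (Y-suc k (ℕP.<-≤-trans k<d d≤s)))) ⟩
    (Y k - 1#) * e k                                ≈⟨ [Y-1]e k (ℕP.<⇒≤ k<d) ⟩
    B k                                             ≈⟨ B-suc k (ℕP.<⇒≤ k<d) ⟩
    L * (ι (+ (p ℕ.^ (d ∸ k))) * ι c)               ≈⟨ *-congˡ (ι-* (+ (p ℕ.^ (d ∸ k))) c) ⟨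
    L * B (suc k)                                   ∎)

  -- Constructed to satisfy `G-spec`: the recursion splits `geo p (Y (suc k))` into `p` and a
  -- multiple of `Y (suc k) - 1`. It shows that `p * (e k - 1)` is divisible by `Y k - 1` within
  -- `O`.
  G : ℕ → Carrier
  G zero    = 0#
  G (suc k) = geo p (Y (suc k)) * G k + tri p (Y (suc k)) * e k

  O-G : ∀ k → k ≤ d → O (G k)
  O-G zero    _   = span-zer
  O-G (suc k) k<d = span-add (ZxO (Zx-geo p (Zx-Y (suc k))) (O-G k (ℕP.<⇒≤ k<d)))
                             (ZxO (Zx-tri p (Zx-Y (suc k))) (Oe (ℕP.<⇒≤ k<d)))

  G-spec : ∀ k → k ≤ d → L * (e k - 1#) ≈ (Y k - 1#) * G k
  G-spec zero _ = begin
    L * (e 0 - 1#)  ≈⟨ *-congˡ (+-congʳ e0) ⟩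
    L * (1# - 1#)   ≈⟨ solve 2 (λ l y → l :* (con (+ 1) :- con (+ 1)) := y :* con (+ 0)) refl L (Y 0 - 1#) ⟩
    (Y 0 - 1#) * 0# ∎
  G-spec (suc k) k<d = begin
    L * (e (suc k) - 1#)                          ≈⟨ solve 2 (λ l e → l :* (e :- con (+ 1)) := l :* e :- l) refl L (e (suc k)) ⟩
    L * e (suc k) - L                             ≈⟨ +-congʳ (eS k k<d) ⟩
    Ψ * e k - L                                   ≈⟨ solve 3 (λ g e l → g :* e :- l := (g :- l) :* e :+ l :* (e :- con (+ 1))) refl Ψ (e k) L ⟩
    (Ψ - L) * e k + L * (e k - 1#)                ≈⟨ +-cong (*-congʳ (sym (tri-tele p y))) (G-spec k (ℕP.<⇒≤ k<d)) ⟩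
    (y - 1#) * tri p y * e k + (Y k - 1#) * G k   ≈⟨ +-congˡ (*-congʳ (trans (+-congʳ (Y-suc k (ℕP.<-≤-trans k<d d≤s))) (sym (geo-tele p y)))) ⟩
    (y - 1#) * tri p y * e k + (y - 1#) * Ψ * G k
      ≈⟨ solve 5 (λ y t e g h → y :* t :* e :+ y :* g :* h := y :* (g :* h :+ t :* e)) refl (y - 1#) (tri p y) (e k) Ψ (G k) ⟩
    (y - 1#) * G (suc k)                          ∎
    where
    y = Y (suc k)
    Ψ = geo p y

  Y-pow : ∀ k l → k ≤ l → l ≤ s → Y k ≈ Y l ^ (p ℕ.^ (l ∸ k))
  Y-pow k l k≤l l≤s = trans (^-congʳ x (≡.trans (≡.cong (p ℕ.^_) (ℕP.+-cancelʳ-≡ k (s ∸ k) ((s ∸ l) ℕ.+ (l ∸ k)) eq)) (ℕP.^-distribˡ-+-* p (s ∸ l) (l ∸ k))))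
                          (sym (^-assocʳ x (q l) (p ℕ.^ (l ∸ k))))
    where
    eq : s ∸ k ℕ.+ k ≡ (s ∸ l) ℕ.+ (l ∸ k) ℕ.+ k
    eq = ≡.trans (ℕP.m∸n+n≡m (ℕP.≤-trans k≤l l≤s)) (≡.sym (≡.trans (ℕP.+-assoc (s ∸ l) (l ∸ k) k)
           (≡.trans (≡.cong (s ∸ l ℕ.+_) (ℕP.m∸n+n≡m k≤l)) (ℕP.m∸n+n≡m l≤s))))

  -- For `k ≤ l` the factor `Y k - 1` from `G-spec` is a multiple of `Y l - 1`, and `e l` turns
  -- `Y l - 1` into a multiple of `p`. This cancels the `p` in `G-spec`, so no denominator is left
  -- and `O` is closed under products.
  ee : ∀ k l → k ≤ l → l ≤ d →
    e k * e l ≈ e l + geo (p ℕ.^ (l ∸ k)) (Y l) * (ι (+ (p ℕ.^ (d ∸ l))) * ι c) * G k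
  ee k l k≤l l≤d = begin
    e k * e l                          ≈⟨ solve 2 (λ a b → a :* b := b :+ (a :- con (+ 1)) :* b) refl (e k) (e l) ⟩
    e l + (e k - 1#) * e l             ≈⟨ +-congˡ (L-cancel (begin
        L * ((e k - 1#) * e l)                    ≈⟨ *-assoc _ _ _ ⟨
        L * (e k - 1#) * e l                      ≈⟨ *-congʳ (G-spec k (ℕP.≤-trans k≤l l≤d)) ⟩
        (Y k - 1#) * G k * e l                    ≈⟨ *-congʳ (*-congʳ (trans (+-congʳ (Y-pow k l k≤l (ℕP.≤-trans l≤d d≤s))) (sym (geo-tele m (Y l))))) ⟩
        (Y l - 1#) * geo m (Y l) * G k * e l      ≈⟨ solve 4 (λ y g h e → y :* g :* h :* e := g :* (y :* e) :* h) refl (Y l - 1#) (geo m (Y l)) (G k) (e l) ⟩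
        geo m (Y l) * ((Y l - 1#) * e l) * G k    ≈⟨ *-congʳ (*-congˡ (trans ([Y-1]e l l≤d) (B-suc l l≤d))) ⟩
        geo m (Y l) * (L * b) * G k               ≈⟨ solve 4 (λ g l b h → g :* (l :* b) :* h := l :* (g :* b :* h)) refl (geo m (Y l)) L b (G k) ⟩
        L * (geo m (Y l) * b * G k)               ∎)) ⟩
    e l + geo m (Y l) * b * G k        ∎
    where
    m = p ℕ.^ (l ∸ k)
    b = ι (+ (p ℕ.^ (d ∸ l))) * ι c

  Oee : ∀ k l → k ≤ d → l ≤ d → O (e k * e l)
  Oee k l k≤d l≤d with ℕP.≤-total k l
  ... | inj₁ k≤l = span-resp (sym (ee k l k≤l l≤d)) (span-add (Oe l≤d)
                     (ZxO (Zx-mul (Zx-geo (p ℕ.^ (l ∸ k)) (Zx-Y l)) (Zx-mul (IsSubring.int ZxS (+ (p ℕ.^ (d ∸ l)))) (IsSubring.int ZxS c))) (O-G k k≤d)))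
  ... | inj₂ l≤k = span-resp (trans (sym (ee l k l≤k k≤d)) (*-comm _ _)) (span-add (Oe k≤d)
                     (ZxO (Zx-mul (Zx-geo (p ℕ.^ (k ∸ l)) (Zx-Y k)) (Zx-mul (IsSubring.int ZxS (+ (p ℕ.^ (d ∸ k)))) (IsSubring.int ZxS c))) (O-G l l≤d)))

  O-mul : ∀ {u v} → O u → O v → O (u * v)
  O-mul = span-mul (λ { (k , i , k≤ , ei) (l , j , l≤ , ej) →
    span-resp (sym (trans (*-cong ei ej) (solve 4 (λ a b c d → a :* b :* (c :* d) := a :* c :* (b :* d)) refl (x ^ i) (e k) (x ^ j) (e l))))
         (ZxO (Zx-mul (gen (i , refl)) (gen (j , refl))) (Oee k l k≤ l≤)) })

  OS : IsSubring O
  OS = record { resp = span-resp ; add = span-add ; neg = span-neg ; mul = O-mul ; one = O-one }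

  open IsSubring OS using () renaming (sub to O-sub; int to O-int; pow to O-pow; sum to O-sum)
  open Freshman OS pr using (fresh-Σ) renaming (fresh to freshO)
  open AlmostIntegral OS
  open PrimeLocal OS tf pr using (AI⇒Nil; Maximal; localise)

  n>0 : ∀ k → k ≤ d → 0 < n k
  n>0 k k≤d with ℕP.m≤n⇒m<n∨m≡n k≤d
  ... | inj₁ k<d = ≡.subst (0 <_) (≡.sym (n-< k<d)) (ℕP.*-mono-< (ℕP.m<n⇒0<n∸m (prime>1 pr)) q>0)
    where q>0 = ℕP.m^n>0 p {{ℕ.>-nonZero (prime>0 pr)}} (s ∸ suc k)
  ... | inj₂ ≡.refl = ≡.subst (0 <_) (≡.sym n-d) (ℕP.m^n>0 p {{ℕ.>-nonZero (prime>0 pr)}} (s ∸ d))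

  RS-+ : ∀ a b → RS (λ k j → a k j ℤ.+ b k j) ≈ RS a + RS b
  RS-+ a b = trans (Σ-cong (suc d) (λ k _ → trans (Σ-cong (n k) (λ j _ →
    trans (*-congʳ (ι-+ (a k j) (b k j))) (distribʳ _ _ _))) (Σ-+ (n k) _ _))) (Σ-+ (suc d) _ _)

  RS-* : ∀ m a → RS (λ k j → m ℤ.* a k j) ≈ ι m * RS a
  RS-* m a = sym (trans (Σ-*ˡ (suc d) (ι m) _) (Σ-cong (suc d) (λ k _ → trans (Σ-*ˡ (n k) (ι m) _)
    (Σ-cong (n k) (λ j _ → trans (sym (*-assoc _ _ _)) (*-congʳ (sym (ι-* m (a k j)))))))))

  RS-≡ : ∀ {a b} → RS a ≈ RS b → ∀ k j → k ≤ d → j < n k → a k j ≡ b k j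
  RS-≡ {a} {b} eq k j k≤d j<n = ℤP.i-j≡0⇒i≡j (a k j) (b k j)
    (≡.trans (≡.cong (ℤ._+_ (a k j)) (≡.sym (ℤP.-1*i≡-i (b k j)))) (free (λ k j → a k j ℤ.+ ℤ.- (+ 1) ℤ.* b k j) (begin
      RS (λ k j → a k j ℤ.+ ℤ.- (+ 1) ℤ.* b k j)  ≈⟨ trans (RS-+ a _) (+-congˡ (RS-* (ℤ.- (+ 1)) b)) ⟩
      RS a + - 1# * RS b                        ≈⟨ +-congʳ eq ⟩
      RS b + - 1# * RS b                        ≈⟨ solve 1 (λ b → b :+ :- con (+ 1) :* b := con (+ 0)) refl (RS b) ⟩
      0# ∎) k j k≤d j<n))

  Gb : Carrier → Set
  Gb w = ∃[ k ] ∃[ j ] (k ≤ d) × (j < n k) × (w ≈ π ^ j * e k)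

  RS-coords : ∀ {w} → Span Gb w → ∃[ z ] w ≈ RS z
  RS-coords = span-map (λ { e (z , h) → z , trans (sym e) h })
    ((λ _ _ → + 0) , sym (Σ-zero (suc d) (λ k _ → Σ-zero (n k) (λ j _ → zeroˡ _))))
    (λ { (z , h) (z′ , h′) → (λ k j → z k j ℤ.+ z′ k j) , trans (+-cong h h′) (sym (RS-+ z z′)) })
    (λ { (z , h) → (λ k j → ℤ.- (+ 1) ℤ.* z k j) , trans (-‿cong h) (trans (solve 1 (λ b → :- b := :- con (+ 1) :* b) refl (RS z)) (sym (RS-* (ℤ.- (+ 1)) z))) })
    (λ { (k₀ , j₀ , k≤ , j< , e′) → (λ k j → δ k k₀ ℤ.* δ j j₀) , trans e′ (sym (begin
       RS (λ k j → δ k k₀ ℤ.* δ j j₀)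
         ≈⟨ Σ-cong (suc d) (λ k _ → trans (Σ-cong (n k) (λ j _ → trans (*-congʳ (ι-* (δ k k₀) (δ j j₀))) (*-assoc _ _ _))) (sym (Σ-*ˡ (n k) (ι (δ k k₀)) _))) ⟩
       Σ< (suc d) (λ k → ι (δ k k₀) * Σ< (n k) (λ j → ι (δ j j₀) * (π ^ j * e k)))
         ≈⟨ Σ-δ (suc d) _ (s≤s k≤) ⟩
       Σ< (n k₀) (λ j → ι (δ j j₀) * (π ^ j * e k₀)) ≈⟨ Σ-δ (n k₀) _ j< ⟩
       π ^ j₀ * e k₀ ∎)) })

  Dg : ℕ → Carrier → Set
  Dg m = Span (λ w → ∃[ j ] (j < m) × (w ≈ π ^ j))

  Dg-mono : ∀ {m m′} → m ≤ m′ → ∀ {w} → Dg m w → Dg m′ w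
  Dg-mono m≤ = span-map span-resp span-zer span-add span-neg
    (λ { (j , j<m , e) → gen (j , ℕP.<-≤-trans j<m m≤ , e) })

  x-monic : ∀ i → ∃[ r ] Dg i r × (x ^ i ≈ π ^ i + r)
  x-monic zero = 0# , span-zer , sym (+-identityʳ 1#)
  x-monic (suc i) with x-monic i
  ... | r , dr , h = π * r + π ^ i + r ,
      span-add (span-add (span-mulˡ π (λ { (j , j<i , e) → gen (suc j , s≤s j<i , *-congˡ e) }) dr) (gen (i , ℕP.n<1+n i , refl)))
               (Dg-mono (ℕP.n≤1+n i) dr) , (begin
      x * x ^ i                              ≈⟨ *-congˡ h ⟩
      x * (π ^ i + r)                        ≈⟨ solve 3 (λ x y r → x :* (y :+ r) := (x :- con (+ 1)) :* y :+ ((x :- con (+ 1)) :* r :+ y :+ r)) refl x (π ^ i) r ⟩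
      π * π ^ i + (π * r + π ^ i + r)        ∎)

  Dg-x : ∀ i {m} → i < m → Dg m (x ^ i)
  Dg-x i i<m with x-monic i
  ... | r , dr , h = span-resp (sym h) (span-add (gen (i , i<m , refl)) (Dg-mono (ℕP.<⇒≤ i<m) dr))

  Dg-e : ∀ {k} → k ≤ d → ∀ {r} → Dg (n k) r → Span Gb (r * e k)
  Dg-e {k} k≤d {r} dr = span-resp (*-comm (e k) r)
    (span-mulˡ (e k) (λ { (j , j<n , h) → gen (k , j , k≤d , j<n , trans (*-comm (e k) _) (*-congʳ h)) }) dr)

  Gb-e : ∀ {k} → k ≤ d → Span Gb (e k)
  Gb-e {k} k≤d = gen (k , 0 , k≤d , n>0 k k≤d , sym (*-identityˡ _))

  q>0 : ∀ k → 0 < q k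
  q>0 k = ℕP.m^n>0 p {{ℕ.>-nonZero (prime>0 pr)}} (s ∸ k)

  p-1 : suc (p ∸ 1) ≡ p
  p-1 = ℕP.suc-pred p {{ℕ.>-nonZero (prime>0 pr)}}

  -- For `k < d` the leading term `x ^ n k` is the last summand of `geo p (Y (suc k))`, whose
  -- product with `e k` is `p * e (suc k)`. For `k = d` it is `Y d`, and `[Y-1]e` leads back to a
  -- multiple of `e 0`.
  top : ∀ k → k ≤ d → Span Gb (π ^ n k * e k)
  top k k≤d with ℕP.m≤n⇒m<n∨m≡n k≤d | x-monic (n k)
  ... | inj₁ k<d | r , dr , h = span-resp (sym (begin
        π ^ n k * e k
          ≈⟨ solve 4 (λ t e r g → t :* e := (g :+ (t :+ r)) :* e :- g :* e :- r :* e) refl (π ^ n k) (e k) r g ⟩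
        (g + (π ^ n k + r)) * e k - g * e k - r * e k
          ≈⟨ +-congʳ (+-congʳ (*-congʳ (trans (+-congˡ (trans (sym h) top-x)) (reflexive (≡.cong (λ m → geo m y) p-1))))) ⟩
        geo p y * e k - g * e k - r * e k
          ≈⟨ +-congʳ (+-congʳ (sym (eS k k<d))) ⟩
        L * e (suc k) - g * e k - r * e k ∎))
      (span-add (span-add (span-ι (+ p) (Gb-e k<d)) (span-neg (Dg-e k≤d dg))) (span-neg (Dg-e k≤d dr)))
      where
      y = Y (suc k)
      g = geo (p ∸ 1) y
      top-x : x ^ n k ≈ y ^ (p ∸ 1)
      top-x = trans (^-congʳ x (≡.trans (n-< k<d) (ℕP.*-comm (p ∸ 1) (q (suc k))))) (sym (^-assocʳ x (q (suc k)) (p ∸ 1)))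
      dg : Dg (n k) g
      dg = span-sum (p ∸ 1) (λ i i<p → span-resp (sym (^-assocʳ x (q (suc k)) i))
             (Dg-x (q (suc k) ℕ.* i) (≡.subst (q (suc k) ℕ.* i <_) (≡.trans (ℕP.*-comm (q (suc k)) (p ∸ 1)) (≡.sym (n-< k<d)))
               (ℕP.*-monoʳ-< (q (suc k)) {{ℕ.>-nonZero (q>0 (suc k))}} i<p))))
  ... | inj₂ ≡.refl | r , dr , h = span-resp (sym (begin
        π ^ n d * e d                       ≈⟨ solve 3 (λ t e r → t :* e := ((t :+ r) :- con (+ 1)) :* e :+ e :- r :* e) refl (π ^ n d) (e d) r ⟩
        ((π ^ n d + r) - 1#) * e d + e d - r * e d ≈⟨ +-congʳ (+-congʳ (*-congʳ (+-congʳ (trans (sym h) (^-congʳ x n-d))))) ⟩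
        (Y d - 1#) * e d + e d - r * e d    ≈⟨ +-congʳ (+-congʳ (trans ([Y-1]e d k≤d) (trans (sym (*-identityʳ _)) (*-congˡ (sym e0))))) ⟩
        B d * e 0 + e d - r * e d           ∎))
      (span-add (span-add (span-ι (+ (p ℕ.^ (suc d ∸ d)) ℤ.* c) (Gb-e z≤n)) (Gb-e k≤d)) (span-neg (Dg-e k≤d dr)))

  Gb-π : ∀ {w} → Span Gb w → Span Gb (π * w)
  Gb-π = span-mulˡ π λ { (k , j , k≤d , j<n , h) → span-resp (trans (*-assoc _ _ _) (*-congˡ (sym h))) (step k j k≤d j<n) }
    where
    step : ∀ k j → k ≤ d → j < n k → Span Gb (π ^ suc j * e k)
    step k j k≤d j<n with ℕP.m≤n⇒m<n∨m≡n j<n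
    ... | inj₁ j′<n = gen (k , suc j , k≤d , j′<n , refl)
    ... | inj₂ j′≡n = span-resp (*-congʳ (^-congʳ π (≡.sym j′≡n))) (top k k≤d)

  O⇒Gb : ∀ {w} → O w → Span Gb w
  O⇒Gb = span-map span-resp span-zer span-add span-neg
    (λ { (k , i , k≤d , h) → span-resp (sym h) (go k i k≤d) })
    where
    go : ∀ k i → k ≤ d → Span Gb (x ^ i * e k)
    go k zero    k≤d = span-resp (sym (*-identityˡ _)) (Gb-e k≤d)
    go k (suc i) k≤d = span-resp (solve 3 (λ x y e → (x :- con (+ 1)) :* (y :* e) :+ y :* e := x :* y :* e) refl x (x ^ i) (e k))
                          (span-add (Gb-π (go k i k≤d)) (go k i k≤d))

  abstract
    coords : ∀ {w} → O w → ∃[ z ] w ≈ RS z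
    coords ow = RS-coords (O⇒Gb ow)

  Oπ^e : ∀ j {k} → k ≤ d → O (π ^ j * e k)
  Oπ^e j k≤d = ZxO (IsSubring.pow ZxS j Zx-π) (Oe k≤d)

  -- The ideal of `O` generated by `π` and `p`. Modulo it only the terms with `j = 0` remain
  -- (`RS≋`), and `I⇒∣` shows that `e 0, …, e d` are independent over F_p.
  I : Carrier → Set
  I w = ∃[ u ] ∃[ v ] O u × O v × (w ≈ π * u + L * v)

  I-resp : ∀ {w w′} → w ≈ w′ → I w → I w′
  I-resp eq (u , v , ou , ov , h) = u , v , ou , ov , trans (sym eq) h

  I-add : ∀ {w w′} → I w → I w′ → I (w + w′)
  I-add (u , v , ou , ov , h) (u′ , v′ , ou′ , ov′ , h′) = u + u′ , v + v′ , span-add ou ou′ , span-add ov ov′ ,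
    trans (+-cong h h′) (solve 6 (λ p l u v u′ v′ → (p :* u :+ l :* v) :+ (p :* u′ :+ l :* v′) := p :* (u :+ u′) :+ l :* (v :+ v′)) refl π L u v u′ v′)

  I-mul : ∀ {a w} → O a → I w → I (a * w)
  I-mul {a} oa (u , v , ou , ov , h) = a * u , a * v , O-mul oa ou , O-mul oa ov ,
    trans (*-congˡ h) (solve 5 (λ a p l u v → a :* (p :* u :+ l :* v) := p :* (a :* u) :+ l :* (a :* v)) refl a π L u v)

  I-neg : ∀ {w} → I w → I (- w)
  I-neg iw = I-resp (solve 1 (λ w → :- con (+ 1) :* w := :- w) refl _) (I-mul (O-int (ℤ.- (+ 1))) iw)

  I-π : ∀ {u} → O u → I (π * u)
  I-π {u} ou = u , 0# , ou , span-zer , sym (trans (+-congˡ (zeroʳ L)) (+-identityʳ _))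

  I-L : ∀ {v} → O v → I (L * v)
  I-L {v} ov = 0# , v , span-zer , ov , sym (trans (+-congʳ (zeroʳ π)) (+-identityˡ _))

  I-zer : I 0#
  I-zer = I-resp (zeroʳ π) (I-π span-zer)

  infix 4 _≋_
  _≋_ : Carrier → Carrier → Set
  u ≋ v = I (u - v)

  ≈⇒≋ : ∀ {u v} → u ≈ v → u ≋ v
  ≈⇒≋ {u} {v} h = I-resp (sym (trans (+-congʳ h) (-‿inverseʳ v))) I-zer

  ≋-trans : ∀ {u v w} → u ≋ v → v ≋ w → u ≋ w
  ≋-trans {u} {v} {w} a b = I-resp (solve 3 (λ u v w → (u :- v) :+ (v :- w) := u :- w) refl u v w) (I-add a b)

  ≋-+ : ∀ {u v u′ v′} → u ≋ v → u′ ≋ v′ → u + u′ ≋ v + v′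
  ≋-+ {u} {v} {u′} {v′} a b = I-resp (solve 4 (λ u v u′ v′ → (u :- v) :+ (u′ :- v′) := (u :+ u′) :- (v :+ v′)) refl u v u′ v′) (I-add a b)

  ≋-* : ∀ {u v u′ v′} → O u → O v′ → u ≋ v → u′ ≋ v′ → u * u′ ≋ v * v′
  ≋-* {u} {v} {u′} {v′} ou ov′ a b = I-resp
    (solve 4 (λ u v u′ v′ → u :* (u′ :- v′) :+ v′ :* (u :- v) := u :* u′ :- v :* v′) refl u v u′ v′)
    (I-add (I-mul ou b) (I-mul ov′ a))

  ≋-*ˡ : ∀ a {u v} → O a → u ≋ v → a * u ≋ a * v
  ≋-*ˡ a {u} {v} oa h = I-resp (solve 3 (λ a u v → a :* (u :- v) := a :* u :- a :* v) refl a u v) (I-mul oa h)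

  ≋-pow : ∀ m {u v} → O u → O v → u ≋ v → u ^ m ≋ v ^ m
  ≋-pow zero    ou ov h = ≈⇒≋ refl
  ≋-pow (suc m) ou ov h = ≋-* ou (O-pow m ov) h (≋-pow m ou ov h)

  ≋-Σ : ∀ m {f g : ℕ → Carrier} → (∀ i → i < m → f i ≋ g i) → Σ< m f ≋ Σ< m g
  ≋-Σ zero    h = ≈⇒≋ refl
  ≋-Σ (suc m) h = ≋-+ (≋-Σ m (λ i i<m → h i (ℕP.m<n⇒m<1+n i<m))) (h m (ℕP.n<1+n m))

  I⇒≋0 : ∀ {w} → I w → w ≋ 0#
  I⇒≋0 iw = I-resp (sym (trans (+-congˡ -0#≈0#) (+-identityʳ _))) iw

  Y≡1 : ∀ k → Y k - 1# ≈ π * geo (q k) x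
  Y≡1 k = sym (geo-tele (q k) x)

  geo-res : ∀ m k → ∃[ g ] Zx g × (geo m (Y k) ≈ ιℕ m + π * g)
  geo-res m k = geo (q k) x * tri m (Y k) , Zx-mul (Zx-geo (q k) Zx-x) (Zx-tri m (Zx-Y k)) , (begin
    geo m (Y k)                           ≈⟨ solve 2 (λ g m → g := m :+ (g :- m)) refl (geo m (Y k)) (ιℕ m) ⟩
    ιℕ m + (geo m (Y k) - ιℕ m)           ≈⟨ +-congˡ (trans (sym (tri-tele m (Y k))) (trans (*-congʳ (Y≡1 k)) (*-assoc _ _ _))) ⟩
    ιℕ m + π * (geo (q k) x * tri m (Y k)) ∎)

  -- The triangular number `m * (m - 1) / 2`, which is the value of `tri m` at 1.
  tnum : ℕ → ℕ
  tnum zero    = 0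
  tnum (suc m) = tnum m ℕ.+ m

  tri-res : ∀ m k → ∃[ g ] Zx g × (tri m (Y k) ≈ ιℕ (tnum m) + π * g)
  tri-res zero    k = 0# , span-zer , sym (trans (+-identityˡ _) (zeroʳ π))
  tri-res (suc m) k with tri-res m k | geo-res m k
  ... | g , zg , h | g′ , zg′ , h′ = g + g′ , span-add zg zg′ , (begin
    tri m (Y k) + geo m (Y k)                        ≈⟨ +-cong h h′ ⟩
    (ιℕ (tnum m) + π * g) + (ιℕ m + π * g′)          ≈⟨ solve 5 (λ a p g b g′ → (a :+ p :* g) :+ (b :+ p :* g′) := (a :+ b) :+ p :* (g :+ g′)) refl _ _ _ _ _ ⟩
    (ιℕ (tnum m) + ιℕ m) + π * (g + g′)              ≈⟨ +-congʳ (ιℕ-+ (tnum m) m) ⟨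
    ιℕ (tnum (suc m)) + π * (g + g′)                 ∎)

  tnum-2 : ∀ m → tnum m ℕ.+ tnum m ℕ.+ m ≡ m ℕ.* m
  tnum-2 zero    = ≡.refl
  tnum-2 (suc m) = ≡.trans (ℕS.solve 2 (λ t m → (t ℕS.:+ m) ℕS.:+ (t ℕS.:+ m) ℕS.:+ (ℕS.con 1 ℕS.:+ m) ℕS.:= (t ℕS.:+ t ℕS.:+ m) ℕS.:+ (ℕS.con 1 ℕS.:+ m ℕS.:+ m)) ≡.refl (tnum m) m)
    (≡.trans (≡.cong (ℕ._+ (1 ℕ.+ m ℕ.+ m)) (tnum-2 m))
             (ℕS.solve 1 (λ m → m ℕS.:* m ℕS.:+ (ℕS.con 1 ℕS.:+ m ℕS.:+ m) ℕS.:= (ℕS.con 1 ℕS.:+ m) ℕS.:* (ℕS.con 1 ℕS.:+ m)) ≡.refl m))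

  -- From `2 * tnum p = p * (p - 1)`. The prime 2 is a genuine exception, because `tnum 2` is 1; it
  -- is the reason for the remainder in `frob-d`.
  tnum-p : p ≡ 2 ⊎ p ∣ℕ tnum p
  tnum-p with euclidsLemma 2 (tnum p) pr (ℕD.∣m+n∣m⇒∣n {m = p}
      (≡.subst (p ∣ℕ_) (≡.trans (≡.sym (tnum-2 p)) (ℕS.solve 2 (λ t p → t ℕS.:+ t ℕS.:+ p ℕS.:= p ℕS.:+ (t ℕS.:+ (t ℕS.:+ ℕS.con 0))) ≡.refl (tnum p) p)) (ℕD.m∣m*n p)) ℕD.∣-refl)
  ... | inj₁ p∣2 = inj₁ (ℕP.≤-antisym (ℕD.∣⇒≤ p∣2) (prime>1 pr))
  ... | inj₂ p∣t = inj₂ p∣t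

  p∣ιℕ : ∀ {m} → p ∣ℕ m → ∀ {u} → O u → I (ιℕ m * u)
  p∣ιℕ {m} (ℕD.divides r eq) {u} ou = I-resp (begin
    L * (ιℕ r * u)      ≈⟨ solve 3 (λ l r u → l :* (r :* u) := r :* l :* u) refl L (ιℕ r) u ⟩
    ιℕ r * L * u        ≈⟨ *-congʳ (ιℕ-* r p) ⟨
    ιℕ (r ℕ.* p) * u    ≡⟨ ≡.cong (λ k → ιℕ k * u) eq ⟨
    ιℕ m * u            ∎) (I-L (O-mul (O-int (+ r)) ou))

  geo-I : ∀ {m} → p ∣ℕ m → ∀ k {u} → O u → I (geo m (Y k) * u)
  geo-I {m} p∣m k {u} ou with geo-res m k
  ... | g , zg , h = I-resp (sym (trans (*-congʳ h) (trans (distribʳ _ _ _) (+-congˡ (*-assoc _ _ _)))))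
                       (I-add (p∣ιℕ p∣m ou) (I-π (ZxO zg ou)))

  p∣p^ : ∀ {a b} → a < b → p ∣ℕ p ℕ.^ (b ∸ a)
  p∣p^ {a} {b} a<b = ≡.subst (λ m → p ∣ℕ p ℕ.^ m) (≡.sym (ℕP.+-∸-assoc 1 a<b)) (ℕD.m∣m*n (p ℕ.^ (b ∸ suc a)))

  -- For `l < d` the correction in `ee` contains `p ^ (d ∸ l)`. For `l = d` it contains a sum of
  -- `p ^ (d ∸ k)` powers of `Y d`, each 1 modulo `π`. Hence the `e k` behave like a descending
  -- chain of idempotents.
  ee≋ : ∀ k l → k ≤ l → l ≤ d → k < d → e k * e l ≋ e l
  ee≋ k l k≤l l≤d k<d = I-resp (begin
      rest                      ≈⟨ solve 2 (λ r e → r := (e :+ r) :- e) refl rest (e l) ⟩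
      (e l + rest) - e l        ≈⟨ +-congʳ (ee k l k≤l l≤d) ⟨
      e k * e l - e l           ∎) rest-I
    where
    m = p ℕ.^ (l ∸ k)
    P = ι (+ (p ℕ.^ (d ∸ l)))
    rest = geo m (Y l) * (P * ι c) * G k
    oG = O-G k (ℕP.<⇒≤ k<d)
    og = Zx⊂O (Zx-geo m (Zx-Y l))
    rest-I : I rest
    rest-I with ℕP.m≤n⇒m<n∨m≡n l≤d
    ... | inj₁ l<d = I-resp (solve 4 (λ g p c h → p :* (g :* c :* h) := g :* (p :* c) :* h) refl (geo m (Y l)) P (ι c) (G k))
                       (p∣ιℕ (p∣p^ l<d) (O-mul (O-mul og (O-int c)) oG))
    ... | inj₂ ≡.refl = I-resp (sym (*-assoc _ _ _)) (geo-I (p∣p^ k<d) l (O-mul (O-mul (O-int (+ (p ℕ.^ (d ∸ d)))) (O-int c)) oG))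

  G≋ : ∀ k → k < d → G (suc k) ≋ ιℕ (tnum p) * e k
  G≋ k k<d with tri-res p (suc k)
  ... | g , zg , h = ≋-trans (≋-+ (I⇒≋0 (geo-I ℕD.∣-refl (suc k) (O-G k (ℕP.<⇒≤ k<d)))) (≈⇒≋ (trans (*-congʳ h) (trans (distribʳ _ _ _) (+-congˡ (*-assoc _ _ _))))))
       (≋-trans (≈⇒≋ (+-identityˡ _)) (≋-trans (≋-+ (≈⇒≋ refl) (I⇒≋0 (I-π (ZxO zg (Oe (ℕP.<⇒≤ k<d)))))) (≈⇒≋ (+-identityʳ _))))

  -- The one product that escapes `ee≋`: for `k = l = d` both sources of a factor `p` degenerate to
  -- 1 and `c * G d` survives.
  edd≋ : ∀ k → suc k ≡ d → e d * e d ≋ e d + ι c * (ιℕ (tnum p) * e k)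
  edd≋ k ≡.refl = ≋-trans (≈⇒≋ (trans (ee d d ℕP.≤-refl ℕP.≤-refl) (+-congˡ (*-congʳ simp))))
                     (≋-+ (≈⇒≋ refl) (≋-*ˡ (ι c) (O-int c) (G≋ k (ℕP.n<1+n k))))
    where
    simp : geo (p ℕ.^ (d ∸ d)) (Y d) * (ι (+ (p ℕ.^ (d ∸ d))) * ι c) ≈ ι c
    simp = trans (reflexive (≡.cong (λ m → geo (p ℕ.^ m) (Y d) * (ι (+ (p ℕ.^ m)) * ι c)) (ℕP.n∸n≡0 d)))
                 (solve 1 (λ c → (con (+ 0) :+ con (+ 1)) :* (con (+ 1) :* c) := c) refl (ι c))

  idem-pow : ∀ {u} → O u → u * u ≋ u → ∀ m → u ^ suc m ≋ u
  idem-pow ou h zero    = ≈⇒≋ (*-identityʳ _)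
  idem-pow ou h (suc m) = ≋-trans (≋-*ˡ _ ou (idem-pow ou h m)) h

  idem-p : ∀ {u} → O u → u * u ≋ u → u ^ p ≋ u
  idem-p {u} ou h = ≋-trans (≈⇒≋ (^-congʳ u (≡.sym p-1))) (idem-pow ou h (p ∸ 1))

  frob-< : ∀ k → k < d → e k ^ p ≋ e k
  frob-< k k<d = idem-p (Oe (ℕP.<⇒≤ k<d)) (ee≋ k k ℕP.≤-refl (ℕP.<⇒≤ k<d) k<d)

  Low : Carrier → Set
  Low = Span (λ w → ∃[ k ] (k < d) × (w ≈ e k))

  Low⊂O : ∀ {r} → Low r → O r
  Low⊂O = span-map span-resp span-zer span-add span-neg (λ { (k , k<d , h) → span-resp (sym h) (Oe (ℕP.<⇒≤ k<d)) })

  -- For odd `p` the correction in `edd≋` vanishes and `e d` is idempotent modulo `I`. For `p = 2`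
  -- it may persist, but it only involves a lower `e k`, so Frobenius stays unitriangular.
  frob-d : ∃[ r ] Low r × (e d ^ p ≋ e d + r)
  frob-d = go d ≡.refl
    where
    go : ∀ d′ → d′ ≡ d → ∃[ r ] Low r × (e d ^ p ≋ e d + r)
    go zero ≡.refl = 0# , span-zer , ≋-trans (idem-p (Oe ℕP.≤-refl) (≈⇒≋ (trans (*-congˡ e0) (*-identityʳ _)))) (≈⇒≋ (sym (+-identityʳ _)))
    go (suc k) ≡.refl with tnum-p
    ... | inj₁ ≡.refl = ι c * (ιℕ (tnum p) * e k) , span-ι c (span-ι (+ tnum p) (gen (k , ℕP.n<1+n k , refl))) ,
          ≋-trans (≈⇒≋ (*-congˡ (*-identityʳ _))) (edd≋ k ≡.refl)
    ... | inj₂ p∣t = 0# , span-zer , ≋-trans (idem-p (Oe ℕP.≤-refl) (≋-trans (edd≋ k ≡.refl)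
            (≋-trans (≋-+ (≈⇒≋ refl) (I⇒≋0 (I-mul (O-int c) (p∣ιℕ p∣t (Oe (ℕP.n≤1+n k)))))) (≈⇒≋ (+-identityʳ _))))) (≈⇒≋ (sym (+-identityʳ _)))

  fresh-≋ : ∀ {u v} → O u → O v → (u + v) ^ p ≋ u ^ p + v ^ p
  fresh-≋ {u} {v} ou ov with freshO u v ou ov
  ... | w , ow , h = ≋-trans (≈⇒≋ h) (≋-trans (≋-+ (≈⇒≋ refl) (I⇒≋0 (I-L (O-mul (O-mul ou ov) ow)))) (≈⇒≋ (+-identityʳ _)))

  ι*^ : ∀ z u m → (ι z * u) ^ m ≈ ι (z ℤ.^ m) * u ^ m
  ι*^ z u m = trans (^-distrib-* (ι z) u m) (*-congʳ (sym (ι-^ z m)))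

  frob-Σ : ∀ (W : ℕ → ℤ) → Σ< d (λ k → ι (W k) * e k) ^ p ≋ Σ< d (λ k → ι (W k ℤ.^ p) * e k)
  frob-Σ W with fresh-Σ d (λ k → ι (W k) * e k) (λ k k<d → O-mul (O-int (W k)) (Oe (ℕP.<⇒≤ k<d)))
  ... | w , ow , h = ≋-trans (≈⇒≋ h) (≋-trans (≋-+ (≋-Σ d (λ k k<d → ≋-trans (≈⇒≋ (ι*^ (W k) (e k) p)) (≋-*ˡ (ι (W k ℤ.^ p)) (O-int (W k ℤ.^ p)) (frob-< k k<d)))) (I⇒≋0 (I-L ow)))
                       (≈⇒≋ (+-identityʳ _)))

  low-coords : ∀ {r} → Low r → ∃[ W ] r ≈ Σ< d (λ k → ι (W k) * e k)
  low-coords = span-coords d e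

  low-Σ : ∀ (W : ℕ → ℤ) → Low (Σ< d (λ k → ι (W k) * e k))
  low-Σ W = span-sum d {λ k → ι (W k) * e k} (λ k k<d → span-ι (W k) (gen (k , k<d , refl)))

  frob-step : ∀ {w r} V → O w → Low r → w ≋ ι V * e d + r → ∃[ r′ ] Low r′ × (w ^ p ≋ ι (V ℤ.^ p) * e d + r′)
  frob-step {w} {r} V ow lr h with frob-d | low-coords lr
  ... | r₁ , lr₁ , h₁ | W , hW = ι (V ℤ.^ p) * r₁ + Σ< d (λ k → ι (W k ℤ.^ p) * e k) ,
      span-add (span-ι (V ℤ.^ p) lr₁) (low-Σ (λ k → W k ℤ.^ p)) ,
      ≋-trans (≋-pow p ow (span-add oV (Low⊂O lr)) h)
      (≋-trans (fresh-≋ oV (Low⊂O lr))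
      (≋-trans (≋-+ (≋-trans (≈⇒≋ (ι*^ V (e d) p)) (≋-*ˡ (ι (V ℤ.^ p)) (O-int (V ℤ.^ p)) h₁)) (≋-trans (≈⇒≋ (^-congˡ p hW)) (frob-Σ W)))
      (≈⇒≋ (solve 4 (λ v e r s → v :* (e :+ r) :+ s := v :* e :+ (v :* r :+ s)) refl (ι (V ℤ.^ p)) (e d) r₁ _))))
    where oV = O-mul (O-int V) (Oe ℕP.≤-refl)

  -- Multiplication by `π` shifts coordinates within each block; the last coordinate of a block
  -- overflows into `π ^ n k * e k`, which is treated in `π-RS`.
  sh : (ℕ → ℕ → ℤ) → ℕ → ℕ → ℤ
  sh z k zero    = + 0
  sh z k (suc j) = z k j

  π-RS : ∀ z → π * RS z ≈ RS (sh z) + Σ< (suc d) (λ k → ι (z k (n k ∸ 1)) * (π ^ n k * e k))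
  π-RS z = trans (Σ-*ˡ (suc d) π _) (trans (Σ-cong (suc d) (λ k k< → block k (n k) (n>0 k (ℕP.<⇒≤pred k<)))) (Σ-+ (suc d) _ _))
    where
    block : ∀ k m → 0 < m → π * Σ< m (λ j → ι (z k j) * (π ^ j * e k)) ≈
      Σ< m (λ j → ι (sh z k j) * (π ^ j * e k)) + ι (z k (m ∸ 1)) * (π ^ m * e k)
    block k (suc m) _ = begin
      π * Σ< (suc m) (λ j → ι (z k j) * (π ^ j * e k))
        ≈⟨ trans (Σ-*ˡ (suc m) π _) (Σ-cong (suc m) (λ j _ → solve 4 (λ p z y e → p :* (z :* (y :* e)) := z :* (p :* y :* e)) refl π (ι (z k j)) (π ^ j) (e k))) ⟩
      Σ< m (λ j → ι (z k j) * (π ^ suc j * e k)) + last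
        ≈⟨ +-congʳ (trans (sym (trans (+-congʳ (zeroˡ _)) (+-identityˡ _))) (sym (Σ-shift m (λ j → ι (sh z k j) * (π ^ j * e k))))) ⟩
      Σ< (suc m) (λ j → ι (sh z k j) * (π ^ j * e k)) + last ∎
      where last = ι (z k m) * (π ^ suc m * e k)

  -- `Top k` is the residue modulo `I` of `π ^ n k * e k` divided by `p`. It comes from `geo-π` for
  -- `k < d`, and from `x-p^` together with `[Y-1]e` for `k = d`.
  top-of : ∀ k → Dec (k < d) → Carrier
  top-of k (yes _) = e (suc k) - e k
  top-of k (no  _) = ι c

  Top : ℕ → Carrier
  Top k = top-of k (k ℕ.<? d)

  Top-< : ∀ {k} → k < d → Top k ≈ e (suc k) - e k
  Top-< {k} k<d = go (k ℕ.<? d)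
    where
    go : (D : Dec (k < d)) → top-of k D ≈ e (suc k) - e k
    go (yes _) = refl
    go (no ≮)  = ⊥-elim (≮ k<d)

  Top-d : Top d ≈ ι c
  Top-d = go (d ℕ.<? d)
    where
    go : (D : Dec (d < d)) → top-of d D ≈ ι c
    go (yes d<d) = ⊥-elim (ℕP.<-irrefl ≡.refl d<d)
    go (no _)    = refl

  TopQuot : ℕ → Set
  TopQuot k = ∃[ y ] O y × (π ^ n k * e k ≈ L * y) × (y ≋ Top k)

  ≋-drop : ∀ {a u v} → O u → a ≈ v → a - π * u ≋ v
  ≋-drop {a} {u} {v} ou h = I-resp (sym (trans (+-congˡ (-‿cong (sym h))) (solve 2 (λ a b → (a :- b) :- a := :- b) refl a (π * u)))) (I-neg (I-π ou))

  topquot-< : ∀ k → k < d → ∃[ g ] Zx g × (geo p (Y (suc k)) ≈ π ^ ((p ∸ 1) ℕ.* q (suc k)) + L * (1# + π * g)) → TopQuot k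
  topquot-< k k<d (g , zg , h) = e (suc k) - e k - π * (g * e k) ,
      O-sub (O-sub (Oe k<d) (Oe k≤d)) (ZxO Zx-π og) , (begin
      π ^ n k * e k
        ≈⟨ *-congʳ (^-congʳ π (n-< k<d)) ⟩
      P * e k
        ≈⟨ solve 5 (λ x l p g e → x :* e := (x :+ l :* (con (+ 1) :+ p :* g)) :* e :- l :* e :- l :* (p :* (g :* e))) refl P L π g (e k) ⟩
      (P + L * (1# + π * g)) * e k - L * e k - L * (π * (g * e k))
        ≈⟨ +-congʳ (+-congʳ (trans (*-congʳ (sym h)) (sym (eS k k<d)))) ⟩
      L * e (suc k) - L * e k - L * (π * (g * e k))
        ≈⟨ solve 4 (λ l a b c → l :* a :- l :* b :- l :* c := l :* (a :- b :- c)) refl L (e (suc k)) (e k) (π * (g * e k)) ⟩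
      L * (e (suc k) - e k - π * (g * e k)) ∎) ,
      ≋-drop og (sym (Top-< k<d))
    where
    k≤d = ℕP.<⇒≤ k<d
    P = π ^ ((p ∸ 1) ℕ.* q (suc k))
    og = ZxO zg (Oe k≤d)

  topquot-d : ∃[ g ] Zx g × (Y d ≈ 1# + (π ^ q d + L * (π * g))) → TopQuot d
  topquot-d (g , zg , h) = ι c - π * (g * e d) , O-sub (O-int c) (ZxO Zx-π og) , (begin
      π ^ n d * e d
        ≈⟨ *-congʳ (^-congʳ π n-d) ⟩
      π ^ q d * e d
        ≈⟨ solve 5 (λ x l p g e → x :* e := ((con (+ 1) :+ (x :+ l :* (p :* g))) :- con (+ 1)) :* e :- l :* (p :* (g :* e))) refl (π ^ q d) L π g (e d) ⟩
      ((1# + (π ^ q d + L * (π * g))) - 1#) * e d - L * (π * (g * e d))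
        ≈⟨ +-congʳ (trans (*-congʳ (+-congʳ (sym h))) (trans ([Y-1]e d ℕP.≤-refl) (B-suc d ℕP.≤-refl))) ⟩
      L * (ι (+ (p ℕ.^ (d ∸ d))) * ι c) - L * (π * (g * e d))
        ≈⟨ +-congʳ (*-congˡ (trans (*-congʳ (reflexive (≡.cong (λ m → ιℕ (p ℕ.^ m)) (ℕP.n∸n≡0 d)))) (*-identityˡ _))) ⟩
      L * ι c - L * (π * (g * e d))
        ≈⟨ solve 3 (λ l a b → l :* a :- l :* b := l :* (a :- b)) refl L (ι c) (π * (g * e d)) ⟩
      L * (ι c - π * (g * e d)) ∎) ,
      ≋-drop og (sym Top-d)
    where
    og = ZxO zg (Oe ℕP.≤-refl)

  topquot : ∀ k → k ≤ d → TopQuot k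
  topquot k k≤d with ℕP.m≤n⇒m<n∨m≡n k≤d
  ... | inj₁ k<d   = topquot-< k k<d (geo-π (s ∸ suc k))
  ... | inj₂ k≡d = ≡.subst TopQuot (≡.sym k≡d) (topquot-d (x-p^ (s ∸ d)))

  abstract
    tq : ℕ → Carrier
    tq k with k ℕ.≤? d
    ... | yes k≤d = proj₁ (topquot k k≤d)
    ... | no _    = 0#

    tq-spec : ∀ k → k ≤ d → O (tq k) × (π ^ n k * e k ≈ L * tq k) × (tq k ≋ Top k)
    tq-spec k k≤d with k ℕ.≤? d
    ... | yes k≤d = proj₂ (topquot k k≤d)
    ... | no ≰    = ⊥-elim (≰ k≤d)

  lastΣ : (ℕ → ℕ → ℤ) → Carrier
  lastΣ z = Σ< (suc d) (λ k → ι (z k (n k ∸ 1)) * tq k)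

  O-lastΣ : ∀ z → O (lastΣ z)
  O-lastΣ z = O-sum (suc d) (λ k k< → O-mul (O-int (z k (n k ∸ 1))) (proj₁ (tq-spec k (ℕP.<⇒≤pred k<))))

  π-RS′ : ∀ z → π * RS z ≈ RS (sh z) + L * lastΣ z
  π-RS′ z = trans (π-RS z) (+-congˡ (sym (trans (Σ-*ˡ (suc d) L _) (Σ-cong (suc d) (λ k k< →
    trans (solve 3 (λ l z y → l :* (z :* y) := z :* (l :* y)) refl L (ι (z k (n k ∸ 1))) (tq k))
          (*-congˡ (sym (proj₁ (proj₂ (tq-spec k (ℕP.<⇒≤pred k<)))))))))))

  single : (ℕ → ℤ) → ℕ → ℕ → ℤ
  single W k zero    = W k
  single W k (suc j) = + 0

  RS-single : ∀ W → RS (single W) ≈ Σ< (suc d) (λ k → ι (W k) * e k)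
  RS-single W = Σ-cong (suc d) (λ k k< → block k (n k) (n>0 k (ℕP.<⇒≤pred k<)))
    where
    block : ∀ k m → 0 < m → Σ< m (λ j → ι (single W k j) * (π ^ j * e k)) ≈ ι (W k) * e k
    block k (suc m) _ = trans (Σ-shift m _) (trans (+-cong (*-congˡ (*-identityˡ _)) (Σ-zero m (λ j _ → zeroˡ _))) (+-identityʳ _))

  -- At `j = 0` the shifted sequence `sh U` vanishes and every overflow of the multiplication by `π`
  -- is a multiple of `p`, so comparing coordinates there leaves only multiples of `p`.
  I⇒∣-coords : ∀ (W : ℕ → ℤ) {v} (U V : ℕ → ℕ → ℤ) → Σ< (suc d) (λ k → ι (W k) * e k) ≈ π * RS U + L * v →
    lastΣ U + v ≈ RS V → ∀ k → k ≤ d → + p ∣ℤ W k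
  I⇒∣-coords W {v} U V h hV k k≤d = divides (V k 0) (≡.trans (RS-≡ {single W} {Z} eq k 0 k≤d (n>0 k k≤d))
      (≡.trans (ℤP.+-identityˡ (+ p ℤ.* V k 0)) (ℤP.*-comm (+ p) (V k 0))))
    where
    Z : ℕ → ℕ → ℤ
    Z k j = sh U k j ℤ.+ + p ℤ.* V k j
    eq : RS (single W) ≈ RS Z
    eq = begin
      RS (single W)                          ≈⟨ RS-single W ⟩
      Σ< (suc d) (λ k → ι (W k) * e k)       ≈⟨ trans h (+-congʳ (π-RS′ U)) ⟩
      (RS (sh U) + L * lastΣ U) + L * v      ≈⟨ solve 4 (λ r l a b → (r :+ l :* a) :+ l :* b := r :+ l :* (a :+ b)) refl (RS (sh U)) L (lastΣ U) v ⟩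
      RS (sh U) + L * (lastΣ U + v)          ≈⟨ +-congˡ (trans (*-congˡ hV) (sym (RS-* (+ p) V))) ⟩
      RS (sh U) + RS (λ k j → + p ℤ.* V k j) ≈⟨ RS-+ (sh U) (λ k j → + p ℤ.* V k j) ⟨
      RS Z ∎

  I⇒∣ : ∀ (W : ℕ → ℤ) → I (Σ< (suc d) (λ k → ι (W k) * e k)) → ∀ k → k ≤ d → + p ∣ℤ W k
  I⇒∣ W (u , v , ou , ov , h) = go (coords ou)
    where
    go : ∃[ U ] u ≈ RS U → ∀ k → k ≤ d → + p ∣ℤ W k
    go (U , hU) = go′ (coords (span-add (O-lastΣ U) ov))
      where
      go′ : ∃[ V ] lastΣ U + v ≈ RS V → ∀ k → k ≤ d → + p ∣ℤ W k
      go′ (V , hV) = I⇒∣-coords W U V (trans h (+-congʳ (*-congˡ hU))) hV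

  -- As `p ^ m` is at least `m`, a nilpotency exponent `m` may be raised to a power of `p`;
  -- nilpotence is then visible on iterates of Frobenius.
  Nil⇒I : ∀ {w} → O w → Nil (+ p) O w → ∃[ h ] I (w ^ (p ℕ.^ h))
  Nil⇒I {w} ow (m , v , ov , e) = m , I-resp (begin
      L * (v * w ^ (P ∸ m))      ≈⟨ *-assoc L v (w ^ (P ∸ m)) ⟨
      L * v * w ^ (P ∸ m)        ≈⟨ *-congʳ e ⟨
      w ^ m * w ^ (P ∸ m)        ≈⟨ ^-homo-* w m (P ∸ m) ⟨
      w ^ (m ℕ.+ (P ∸ m))        ≡⟨ ≡.cong (w ^_) (ℕP.m+[n∸m]≡n (ℕP.<⇒≤ (n<m^n (prime>1 pr) m))) ⟩
      w ^ P                      ∎) (I-L (O-mul ov (O-pow (P ∸ m) ow)))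
    where P = p ℕ.^ m

  ^p^suc : ∀ w h → w ^ (p ℕ.^ suc h) ≈ (w ^ (p ℕ.^ h)) ^ p
  ^p^suc w h = trans (^-congʳ w (ℕP.*-comm p (p ℕ.^ h))) (sym (^-assocʳ w (p ℕ.^ h) p))

  frob-iter : ∀ {w r} V → O w → Low r → w ≋ ι V * e d + r → ∀ h →
    ∃[ m ] ∃[ r′ ] Low r′ × (w ^ (p ℕ.^ h) ≋ ι (V ℤ.^ m) * e d + r′)
  frob-iter {w} {r} V ow lr eq zero = 1 , r , lr , ≋-trans (≈⇒≋ (*-identityʳ w))
    (≋-trans eq (≈⇒≋ (+-congʳ (*-congʳ (reflexive (≡.cong ι (≡.sym (ℤP.^-identityʳ V))))))))
  frob-iter {w} V ow lr eq (suc h) = go (frob-iter V ow lr eq h)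
    where
    go : ∃[ m ] ∃[ r′ ] Low r′ × (w ^ (p ℕ.^ h) ≋ ι (V ℤ.^ m) * e d + r′) →
         ∃[ m ] ∃[ r′ ] Low r′ × (w ^ (p ℕ.^ suc h) ≋ ι (V ℤ.^ m) * e d + r′)
    go (m , r₁ , lr₁ , eq₁) = go′ (frob-step (V ℤ.^ m) (O-pow (p ℕ.^ h) ow) lr₁ eq₁)
      where
      go′ : ∃[ r′ ] Low r′ × ((w ^ (p ℕ.^ h)) ^ p ≋ ι ((V ℤ.^ m) ℤ.^ p) * e d + r′) →
            ∃[ m ] ∃[ r′ ] Low r′ × (w ^ (p ℕ.^ suc h) ≋ ι (V ℤ.^ m) * e d + r′)
      go′ (r₂ , lr₂ , eq₂) = m ℕ.* p , r₂ , lr₂ , ≋-trans (≈⇒≋ (^p^suc w h)) (≋-trans eq₂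
         (≈⇒≋ (+-congʳ (*-congʳ (reflexive (≡.cong ι (ℤP.^-*-assoc V m p)))))))

  low-iter : ∀ {w} (W : ℕ → ℤ) → O w → w ≋ Σ< d (λ k → ι (W k) * e k) → ∀ h →
    ∃[ m ] (w ^ (p ℕ.^ h) ≋ Σ< d (λ k → ι (W k ℤ.^ m) * e k))
  low-iter {w} W ow eq zero = 1 , ≋-trans (≈⇒≋ (*-identityʳ w)) (≋-trans eq (≈⇒≋
     (Σ-cong d (λ k _ → *-congʳ (reflexive (≡.cong ι (≡.sym (ℤP.^-identityʳ (W k)))))))))
  low-iter {w} W ow eq (suc h) = go (low-iter W ow eq h)
    where
    go : ∃[ m ] (w ^ (p ℕ.^ h) ≋ Σ< d (λ k → ι (W k ℤ.^ m) * e k)) →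
         ∃[ m ] (w ^ (p ℕ.^ suc h) ≋ Σ< d (λ k → ι (W k ℤ.^ m) * e k))
    go (m , eq₁) = m ℕ.* p , ≋-trans (≈⇒≋ (^p^suc w h))
      (≋-trans (≋-pow p (O-pow (p ℕ.^ h) ow) (Low⊂O (low-Σ (λ k → W k ℤ.^ m))) eq₁)
      (≋-trans (frob-Σ (λ k → W k ℤ.^ m))
      (≈⇒≋ (Σ-cong d (λ k _ → *-congʳ (reflexive (≡.cong ι (ℤP.^-*-assoc (W k) m p))))))))

  Σ-extend : ∀ (W : ℕ → ℤ) V → Σ< (suc d) (λ k → ι (extend d W V k) * e k) ≈ Σ< d (λ k → ι (W k) * e k) + ι V * e d
  Σ-extend W V = +-cong (Σ-cong d (λ k k<d → *-congʳ (reflexive (≡.cong ι (extend-< d W V k<d)))))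
                        (*-congʳ (reflexive (≡.cong ι (extend-≥ d W V ℕP.≤-refl))))

  ≋0⇒I : ∀ {u v} → I u → u ≋ v → I v
  ≋0⇒I {u} {v} iu h = I-resp (solve 2 (λ u v → u :- (u :- v) := v) refl u v) (I-add iu (I-neg h))

  Nil⇒∣-top : ∀ {w r} V → O w → Low r → w ≋ ι V * e d + r → Nil (+ p) O w → + p ∣ℤ V
  Nil⇒∣-top {w} {r} V ow lr eq nil = go (Nil⇒I ow nil)
    where
    go : ∃[ h ] I (w ^ (p ℕ.^ h)) → + p ∣ℤ V
    go (h , iw) = go′ (frob-iter V ow lr eq h)
      where
      go′ : ∃[ m ] ∃[ r′ ] Low r′ × (w ^ (p ℕ.^ h) ≋ ι (V ℤ.^ m) * e d + r′) → + p ∣ℤ V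
      go′ (m , r₁ , lr₁ , eq₁) = go″ (low-coords lr₁)
        where
        go″ : ∃[ W ] r₁ ≈ Σ< d (λ k → ι (W k) * e k) → + p ∣ℤ V
        go″ (W , hW) = euclid^ pr V m (≡.subst (+ p ∣ℤ_) (extend-≥ d W (V ℤ.^ m) ℕP.≤-refl)
          (I⇒∣ (extend d W (V ℤ.^ m)) (I-resp (trans (+-comm _ _) (trans (+-congʳ hW) (sym (Σ-extend W (V ℤ.^ m))))) (≋0⇒I iw eq₁)) d ℕP.≤-refl))

  Nil⇒∣-low : ∀ {w} (W : ℕ → ℤ) → O w → w ≋ Σ< d (λ k → ι (W k) * e k) → Nil (+ p) O w → ∀ k → k < d → + p ∣ℤ W k
  Nil⇒∣-low {w} W ow eq nil k k<d = go (Nil⇒I ow nil)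
    where
    go : ∃[ h ] I (w ^ (p ℕ.^ h)) → + p ∣ℤ W k
    go (h , iw) = go′ (low-iter W ow eq h)
      where
      go′ : ∃[ m ] (w ^ (p ℕ.^ h) ≋ Σ< d (λ k → ι (W k ℤ.^ m) * e k)) → + p ∣ℤ W k
      go′ (m , eq₁) = euclid^ pr (W k) m (≡.subst (+ p ∣ℤ_) (extend-< d Wm (+ 0) k<d)
          (I⇒∣ (extend d Wm (+ 0)) (I-resp (sym (trans (Σ-extend Wm (+ 0)) (trans (+-congˡ (zeroˡ (e d))) (+-identityʳ _)))) (≋0⇒I iw eq₁)) k (ℕP.<⇒≤ k<d)))
        where
        Wm : ℕ → ℤ
        Wm k = W k ℤ.^ m

  ∣⇒I : ∀ {z u} → + p ∣ℤ z → O u → I (ι z * u)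
  ∣⇒I {z} {u} (divides r eq) ou = I-resp (begin
    L * (ι r * u)      ≈⟨ solve 3 (λ l r u → l :* (r :* u) := r :* l :* u) refl L (ι r) u ⟩
    ι r * L * u        ≈⟨ *-congʳ (ι-* r (+ p)) ⟨
    ι (r ℤ.* + p) * u  ≡⟨ ≡.cong (λ z → ι z * u) eq ⟨
    ι z * u            ∎) (I-L (O-mul (O-int r) ou))

  -- The quotient of `O` by `I` is reduced. The coefficient of `e d` is handled before the others,
  -- because for `p = 2` Frobenius of `e d` may disturb a lower one; on the remaining `e k`
  -- Frobenius merely raises coefficients to the power `p`.
  Nil⇒∣ : ∀ {w} (W : ℕ → ℤ) → O w → w ≋ Σ< (suc d) (λ k → ι (W k) * e k) → Nil (+ p) O w → ∀ k → k ≤ d → + p ∣ℤ W k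
  Nil⇒∣ {w} W ow eq nil k k≤d = go (ℕP.m≤n⇒m<n∨m≡n k≤d)
    where
    top∣ : + p ∣ℤ W d
    top∣ = Nil⇒∣-top (W d) ow (low-Σ W) (≋-trans eq (≈⇒≋ (+-comm _ _))) nil
    eq′ : w ≋ Σ< d (λ k → ι (W k) * e k)
    eq′ = ≋-trans eq (≋-trans (≋-+ (≈⇒≋ refl) (I⇒≋0 (∣⇒I top∣ (Oe ℕP.≤-refl)))) (≈⇒≋ (+-identityʳ _)))
    go : k < d ⊎ k ≡ d → + p ∣ℤ W k
    go (inj₁ k<d)  = Nil⇒∣-low W ow eq′ nil k k<d
    go (inj₂ k≡d) = ≡.subst (λ k → + p ∣ℤ W k) (≡.sym k≡d) top∣

  RS≋ : ∀ z → RS z ≋ Σ< (suc d) (λ k → ι (z k 0) * e k)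
  RS≋ z = ≋-Σ (suc d) (λ k k< → block k (ℕP.<⇒≤pred k<) (n k) (n>0 k (ℕP.<⇒≤pred k<)))
    where
    block : ∀ k → k ≤ d → ∀ m → 0 < m → Σ< m (λ j → ι (z k j) * (π ^ j * e k)) ≋ ι (z k 0) * e k
    block k k≤d (suc m) _ = ≋-trans (≈⇒≋ (Σ-shift m (λ j → ι (z k j) * (π ^ j * e k))))
      (≋-trans (≋-+ (≈⇒≋ (*-congˡ (*-identityˡ (e k)))) (≋-trans (≋-Σ m {g = λ _ → 0#} (λ j _ → I⇒≋0 (I-resp
          (solve 4 (λ p z y e → p :* (z :* (y :* e)) := z :* (p :* y :* e)) refl π (ι (z k (suc j))) (π ^ j) (e k))
          (I-π (O-mul (O-int (z k (suc j))) (Oπ^e j k≤d)))))) (≈⇒≋ (Σ-zero m (λ _ _ → refl)))))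
      (≈⇒≋ (+-identityʳ _)))

  topCoeff : (ℕ → ℤ) → ℕ → ℤ
  topCoeff V zero    = c ℤ.* V d
  topCoeff V (suc k) = V k

  -- Summation by parts. The differences `e (suc k) - e k` close up to a cycle, because `Top d` is
  -- `c` times `e 0`; this produces the coefficient `c ℤ.* V d` in position 0.
  Σ-Top : ∀ V → Σ< (suc d) (λ k → ι (V k) * Top k) ≈ Σ< (suc d) (λ k → ι (topCoeff V k ℤ.+ ℤ.- extend d V (+ 0) k) * e k)
  Σ-Top V = begin
    Σ< d (λ k → ι (V k) * Top k) + ι (V d) * Top d
      ≈⟨ +-cong (trans (Σ-cong d (λ k k<d → trans (*-congˡ (Top-< k<d)) (solve 3 (λ v a b → v :* (a :- b) := v :* a :+ (:- (v :* b))) refl (ι (V k)) (e (suc k)) (e k))))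
                       (Σ-+ d _ _)) (*-congˡ Top-d) ⟩
    Σ< d (λ k → ι (V k) * e (suc k)) + Σ< d (λ k → - (ι (V k) * e k)) + ι (V d) * ι c
      ≈⟨ +-congʳ (+-congˡ (Σ-neg d _)) ⟨
    X + - Z + ι (V d) * ι c
      ≈⟨ solve 4 (λ x z v c → x :+ (:- z) :+ v :* c := (c :* v :* con (+ 1) :+ x) :- z) refl X Z (ι (V d)) (ι c) ⟩
    (ι c * ι (V d) * 1# + X) - Z
      ≈⟨ +-cong (+-congʳ (*-cong (ι-* c (V d)) e0)) (-‿cong (trans (Σ-extend V (+ 0)) (trans (+-congˡ (zeroˡ (e d))) (+-identityʳ Z)))) ⟨
    (ι (c ℤ.* V d) * e 0 + X) - Σ< (suc d) (λ k → ι (extend d V (+ 0) k) * e k)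
      ≈⟨ +-cong (sym (Σ-shift d (λ k → ι (topCoeff V k) * e k))) (Σ-neg (suc d) _) ⟩
    Σ< (suc d) (λ k → ι (topCoeff V k) * e k) + Σ< (suc d) (λ k → - (ι (extend d V (+ 0) k) * e k))
      ≈⟨ Σ-+ (suc d) _ _ ⟨
    Σ< (suc d) (λ k → ι (topCoeff V k) * e k + - (ι (extend d V (+ 0) k) * e k))
      ≈⟨ Σ-cong (suc d) (λ k _ → trans (+-congˡ (trans (-‿distribˡ-* _ _) (*-congʳ (sym (ι-neg (extend d V (+ 0) k))))))
           (trans (sym (distribʳ (e k) _ _)) (*-congʳ (sym (ι-+ (topCoeff V k) (ℤ.- extend d V (+ 0) k)))))) ⟩
    Σ< (suc d) (λ k → ι (topCoeff V k ℤ.+ ℤ.- extend d V (+ 0) k) * e k) ∎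
    where
    X = Σ< d (λ k → ι (V k) * e (suc k))
    Z = Σ< d (λ k → ι (V k) * e k)

  ∣-sum : ∀ {a b} → + p ∣ℤ a ℤ.+ ℤ.- b → + p ∣ℤ b → + p ∣ℤ a
  ∣-sum {a} {b} h hb = ≡.subst (+ p ∣ℤ_) (≡.trans (ℤP.+-assoc a (ℤ.- b) b) (≡.trans (≡.cong (λ z → a ℤ.+ z) (ℤP.+-inverseˡ b)) (ℤP.+-identityʳ a)))
                         (ℤS.∣m∣n⇒∣m+n h hb)

  -- Descends from `k = d`, where nothing is subtracted: divisibility of `V (d - 1)` yields that of
  -- `V (d - 2)`, and so on, until `c ℤ.* V d` is reached at `k = 0`.
  topCoeff∣ : ∀ V → (∀ k → k ≤ d → + p ∣ℤ topCoeff V k ℤ.+ ℤ.- extend d V (+ 0) k) → ∀ i k → k ℕ.+ i ≡ d → + p ∣ℤ topCoeff V k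
  topCoeff∣ V h zero k k≡d = ∣-sum (h k k≤d) (≡.subst (+ p ∣ℤ_) (≡.sym (extend-≥ d V (+ 0) (ℕP.≤-reflexive d≡k))) (divides (+ 0) ≡.refl))
    where
    d≡k : d ≡ k
    d≡k = ≡.trans (≡.sym k≡d) (ℕP.+-identityʳ k)
    k≤d = ℕP.≤-reflexive (≡.sym d≡k)
  topCoeff∣ V h (suc i) k k+i≡d = ∣-sum (h k (ℕP.<⇒≤ k<d)) (≡.subst (+ p ∣ℤ_) (≡.sym (extend-< d V (+ 0) k<d)) (topCoeff∣ V h i (suc k) (≡.trans (≡.sym (ℕP.+-suc k i)) k+i≡d)))
    where
    k<d : k < d
    k<d = ≡.subst (k <_) k+i≡d (ℕP.m<m+n k (s≤s z≤n))

  Mult-Σ : ∀ m {f : ℕ → Carrier} → (∀ i → i < m → Mult (+ p) O (f i)) → Mult (+ p) O (Σ< m f)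
  Mult-Σ zero    h = 0# , span-zer , sym (zeroʳ L)
  Mult-Σ (suc m) h = go (Mult-Σ m (λ i i<m → h i (ℕP.m<n⇒m<1+n i<m))) (h m (ℕP.n<1+n m))
    where
    go : ∀ {a b} → Mult (+ p) O a → Mult (+ p) O b → Mult (+ p) O (a + b)
    go (u , ou , eu) (v , ov , ev) = u + v , span-add ou ov , trans (+-cong eu ev) (sym (distribˡ L u v))

  Mult-∣ : ∀ {z u} → + p ∣ℤ z → O u → Mult (+ p) O (ι z * u)
  Mult-∣ {z} {u} (divides r eq) ou = ι r * u , O-mul (O-int r) ou , trans (*-congʳ (trans (reflexive (≡.cong ι eq)) (ι-* r (+ p))))
    (solve 3 (λ l r u → r :* l :* u := l :* (r :* u)) refl L (ι r) u)

  Mult-L : ∀ {γ} → Mult (+ p) O (L * γ) → O γ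
  Mult-L (v , ov , eq) = span-resp (sym (L-cancel eq)) ov

  π^N : Mult (+ p) O (π ^ (p ℕ.^ s))
  π^N = go (x-p^ s)
    where
    N = p ℕ.^ s
    go : ∃[ g ] Zx g × (x ^ N ≈ 1# + (π ^ N + L * (π * g))) → Mult (+ p) O (π ^ N)
    go (g , zg , h) = ι (+ (p ℕ.^ (d ∸ 0))) * ι c - π * g , O-sub (O-mul (O-int (+ (p ℕ.^ (d ∸ 0)))) (O-int c)) (Zx⊂O (Zx-mul Zx-π zg)) , (begin
      π ^ N                                         ≈⟨ solve 3 (λ x l u → x := ((con (+ 1) :+ (x :+ l :* u)) :- con (+ 1)) :- l :* u) refl (π ^ N) L (π * g) ⟩
      ((1# + (π ^ N + L * (π * g))) - 1#) - L * (π * g) ≈⟨ +-congʳ (+-congʳ (trans (sym h) xN)) ⟩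
      ((1# + B 0) - 1#) - L * (π * g)               ≈⟨ +-congʳ (solve 1 (λ b → (con (+ 1) :+ b) :- con (+ 1) := b) refl (B 0)) ⟩
      B 0 - L * (π * g)                             ≈⟨ +-congʳ (B-suc 0 z≤n) ⟩
      L * (ι (+ (p ℕ.^ (d ∸ 0))) * ι c) - L * (π * g)
        ≈⟨ solve 3 (λ l a b → l :* a :- l :* b := l :* (a :- b)) refl L (ι (+ (p ℕ.^ (d ∸ 0))) * ι c) (π * g) ⟩
      L * (ι (+ (p ℕ.^ (d ∸ 0))) * ι c - π * g) ∎)

  -- As π γ is in O, all coordinates of p γ are divisible by p except perhaps those at π^(n_k - 1) e_k;
  -- these are excluded because γ π and γ p are nilpotent modulo p.
  module Step {γ : Carrier} (ai : AI O γ) (oLγ : O (L * γ)) (oγπ : O (γ * π)) where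

    nil-γπ : Nil (+ p) O (γ * π)
    nil-γπ = AI⇒Nil (p ℕ.^ s) ai (Zx⊂O Zx-π) π^N oγπ

    nil-γL : Nil (+ p) O (γ * L)
    nil-γL = AI⇒Nil 1 ai (O-int (+ p)) (1# , O-one , trans (*-identityʳ L) (sym (*-identityʳ L))) (span-resp (*-comm L γ) oLγ)

    module Coords (z z′ : ℕ → ℕ → ℤ) (hz : L * γ ≈ RS z) (hz′ : γ * π - lastΣ z ≈ RS z′) where

      V : ℕ → ℤ
      V k = z k (n k ∸ 1)

      sh≡ : ∀ k j → k ≤ d → j < n k → sh z k j ≡ + p ℤ.* z′ k j
      sh≡ = RS-≡ (begin
        RS (sh z)                                        ≈⟨ solve 2 (λ r l → r := (r :+ l) :- l) refl (RS (sh z)) (L * lastΣ z) ⟩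
        (RS (sh z) + L * lastΣ z) - L * lastΣ z          ≈⟨ +-congʳ (trans (sym (π-RS′ z)) (*-congˡ (sym hz))) ⟩
        π * (L * γ) - L * lastΣ z                        ≈⟨ solve 4 (λ p l g s → p :* (l :* g) :- l :* s := l :* (g :* p :- s)) refl π L γ (lastΣ z) ⟩
        L * (γ * π - lastΣ z)                            ≈⟨ *-congˡ hz′ ⟩
        L * RS z′                                        ≈⟨ RS-* (+ p) z′ ⟨
        RS (λ k j → + p ℤ.* z′ k j)                      ∎)

      -- The shift puts 0 in position `j = 0`. Consequently `RS z′` lies in `I`, and `γ * π` agrees
      -- with the overflow `lastΣ z` modulo `I`.
      z′0 : ∀ k → k ≤ d → z′ k 0 ≡ + 0
      z′0 k k≤d = either (ℤP.i*j≡0⇒i≡0∨j≡0 (+ p) (≡.sym (sh≡ k 0 k≤d (n>0 k k≤d))))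
        where
        either : + p ≡ + 0 ⊎ z′ k 0 ≡ + 0 → z′ k 0 ≡ + 0
        either (inj₁ p≡0) = ⊥-elim (p≢0 p≡0)
        either (inj₂ h)   = h

      γπ≋ : γ * π ≋ Σ< (suc d) (λ k → ι (topCoeff V k ℤ.+ ℤ.- extend d V (+ 0) k) * e k)
      γπ≋ = ≋-trans (≈⇒≋ (trans (solve 2 (λ a b → a := (a :- b) :+ b) refl (γ * π) (lastΣ z)) (+-congʳ hz′)))
        (≋-trans (≋-+ (≋-trans (RS≋ z′) (≈⇒≋ (Σ-zero (suc d) (λ k k< → trans (*-congʳ (reflexive (≡.cong ι (z′0 k (ℕP.<⇒≤pred k<))))) (zeroˡ (e k))))))
                      (≋-Σ (suc d) (λ k k< → ≋-*ˡ (ι (V k)) (O-int (V k)) (proj₂ (proj₂ (tq-spec k (ℕP.<⇒≤pred k<)))))))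
        (≈⇒≋ (trans (+-identityˡ _) (Σ-Top V))))

      top∣ : ∀ k → k ≤ d → + p ∣ℤ topCoeff V k
      top∣ k k≤d = topCoeff∣ V (Nil⇒∣ (λ k → topCoeff V k ℤ.+ ℤ.- extend d V (+ 0) k) oγπ γπ≋ nil-γπ) (d ∸ k) k (ℕP.m+[n∸m]≡n k≤d)

      V∣ : ∀ k → k ≤ d → + p ∣ℤ V k
      V∣ k k≤d = go (ℕP.m≤n⇒m<n∨m≡n k≤d) (ℕP.m≤n⇒m<n∨m≡n d≤s)
        where
        go : k < d ⊎ k ≡ d → d < s ⊎ d ≡ s → + p ∣ℤ V k
        go (inj₁ k<d) _ = top∣ (suc k) k<d
        go (inj₂ k≡d) (inj₁ d<s) = ≡.subst (λ k → + p ∣ℤ V k) (≡.sym k≡d) (either (euclidℤ pr c (V d) (top∣ 0 z≤n)))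
          where
          either : + p ∣ℤ c ⊎ + p ∣ℤ V d → + p ∣ℤ V d
          either (inj₁ p∣c) = ⊥-elim (p∤c d<s p∣c)
          either (inj₂ h)   = h
        -- Here `c` may be divisible by `p`, so `top∣ 0` says nothing about `V d`. But the last
        -- block has length `q s = 1`, its last coordinate is the one at `j = 0`, and nilpotence of
        -- `γ * L` controls that coordinate.
        go (inj₂ k≡d) (inj₂ d≡s) = ≡.subst (λ k → + p ∣ℤ V k) (≡.sym k≡d) (≡.subst (λ j → + p ∣ℤ z d j) (≡.sym last≡0)
            (Nil⇒∣ (λ k → z k 0) (span-resp (*-comm L γ) oLγ) (≋-trans (≈⇒≋ (trans (*-comm γ L) hz)) (RS≋ z)) nil-γL d ℕP.≤-refl))
          where
          last≡0 : n d ∸ 1 ≡ 0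
          last≡0 = ≡.cong (_∸ 1) (≡.trans n-d (≡.cong (p ℕ.^_) (≡.trans (≡.cong (s ∸_) d≡s) (ℕP.n∸n≡0 s))))

      z∣ : ∀ k j → k ≤ d → j < n k → + p ∣ℤ z k j
      z∣ k j k≤d j<n = go (ℕP.m≤n⇒m<n∨m≡n j<n)
        where
        go : suc j < n k ⊎ suc j ≡ n k → + p ∣ℤ z k j
        go (inj₁ j′<n) = divides (z′ k (suc j)) (≡.trans (sh≡ k (suc j) k≤d j′<n) (ℤP.*-comm (+ p) (z′ k (suc j))))
        go (inj₂ j′≡n) = ≡.subst (λ m → + p ∣ℤ z k (m ∸ 1)) (≡.sym j′≡n) (V∣ k k≤d)

      Oγ : O γ
      Oγ = Mult-L (mult-resp (Mult-Σ (suc d) (λ k k< → Mult-Σ (n k) (λ j j<n →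
             Mult-∣ (z∣ k j (ℕP.<⇒≤pred k<) j<n) (Oπ^e j (ℕP.<⇒≤pred k<))))))
        where
        mult-resp : Mult (+ p) O (RS z) → Mult (+ p) O (L * γ)
        mult-resp (v , ov , h) = v , ov , trans hz h

    result : O γ
    result = go (coords oLγ)
      where
      go : ∃[ z ] L * γ ≈ RS z → O γ
      go (z , hz) = go′ (coords (O-sub oγπ (O-lastΣ z)))
        where
        go′ : ∃[ z′ ] γ * π - lastΣ z ≈ RS z′ → O γ
        go′ (z′ , hz′) = Coords.Oγ z z′ hz hz′

  -- `π ^ N` is a multiple of `p`, so `γ * π ^ N` is in `O`; `Step` then lowers the exponent of `π`
  -- by one at a time, applied to the elements `γ * π ^ j`.
  maximal : Maximal
  maximal {γ} ai oLγ = span-resp (*-identityʳ γ) (down (p ℕ.^ s) 0 (ℕP.+-identityʳ (p ℕ.^ s)))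
    where
    N = p ℕ.^ s
    bottom : O (γ * π ^ N)
    bottom = go π^N
      where
      go : Mult (+ p) O (π ^ N) → O (γ * π ^ N)
      go (v , ov , h) = span-resp (sym (trans (*-congˡ h) (solve 3 (λ g l v → g :* (l :* v) := l :* g :* v) refl γ L v))) (O-mul oLγ ov)
    down : ∀ i j → i ℕ.+ j ≡ N → O (γ * π ^ j)
    down zero    j eq = ≡.subst (λ j → O (γ * π ^ j)) (≡.sym eq) bottom
    down (suc i) j eq = Step.result (AI-mul ai oπj) (span-resp (*-assoc _ _ _) (O-mul oLγ oπj))
                          (span-resp (solve 3 (λ g p y → g :* (p :* y) := g :* y :* p) refl γ π (π ^ j)) (down i (suc j) (≡.trans (ℕP.+-suc i j) eq)))
      where
      oπj : O (π ^ j)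
      oπj = Zx⊂O (Zπ^ j)

module ℤR = RingTools ℤP.+-*-commutativeRing

-- The order of monomials

-- `κ` and `KM` are the structure constants of products and powers of the `t m`. A sum of weights
-- reaching `N` forces a factor `ℓ` in them. The condition `frob-inj` is the one that breaks down
-- for `ℓ = p` prime to `a`, where all weights are 0.
record Weights (N ℓ : ℕ) (κ KM : ℕ → ℕ → ℕ) : Set where
  field
    ω         : ℕ → ℕ
    ω<N       : ∀ m → ω m < N
    ω-zero    : ω 0 ≡ 0
    ω-add     : ∀ m n → ω m ℕ.+ ω n < N → ω (m ℕ.+ n) ≡ ω m ℕ.+ ω n
    carry     : ∀ m n → N ≤ ω m ℕ.+ ω n → ℓ ∣ℕ κ m n
    ω-compl   : ∀ m → m < N → 1 ≤ ω m → 1 ≤ ω (N ∸ m)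
    κ-simple  : ∀ m → m < N → 1 ≤ ω m → ∃[ c ] (κ m (N ∸ m) ≡ c ℕ.* ℓ) × ¬ ℓ ∣ℕ c
    κ-unit    : ∀ m → m < N → ω m ≡ 0 → ¬ ℓ ∣ℕ κ m (N ∸ m)
    KM-carry  : ∀ M m → N ≤ M ℕ.* ω m → ℓ ∣ℕ KM M m
    frob-inj  : ∀ m → m < N → N ∣ℕ ℓ ℕ.* m → ω m ≡ 0 → m ≡ 0
    frob-carry : ∀ m → N ∣ℕ ℓ ℕ.* m → 1 ≤ ω m → N ≤ ℓ ℕ.* ω m

-- In the application t_m = θ^m / C_m, and the weight ω_m is N times the fractional ℓ-adic valuation of θ^m.
module MonomialOrder (R : CommutativeRing 0ℓ 0ℓ) (N : ℕ) (0<N : 0 < N) (t : ℕ → CommutativeRing.Carrier R)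
    (κ KM : ℕ → ℕ → ℕ) (σ : ℤ)
    (t0 : (R CommutativeRing.≈ t 0) (CommutativeRing.1# R))
    (tt : ∀ m n → (R CommutativeRing.≈ CommutativeRing._*_ R (t m) (t n)) (CommutativeRing._*_ R (RingTools.ι R (+ κ m n)) (t (m ℕ.+ n))))
    (tN : ∀ m → (R CommutativeRing.≈ t (m ℕ.+ N)) (CommutativeRing._*_ R (RingTools.ι R σ) (t m))) where
  open RingTools R

  O : Carrier → Set
  O = Span (λ w → ∃[ j ] w ≈ t j)

  Ot : ∀ j → O (t j)
  Ot j = gen (j , refl)

  O-mul : ∀ {u v} → O u → O v → O (u * v)
  O-mul = span-mul (λ { (i , ei) (j , ej) → span-resp (sym (trans (*-cong ei ej) (tt i j))) (span-ι (+ κ i j) (Ot (i ℕ.+ j))) })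

  OS : IsSubring O
  OS = record { resp = span-resp ; add = span-add ; neg = span-neg ; mul = O-mul ; one = span-resp t0 (Ot 0) }

  t-qN : ∀ r q → t (r ℕ.+ q ℕ.* N) ≈ ι (σ ℤ.^ q) * t r
  t-qN r zero    = trans (reflexive (≡.cong t (ℕP.+-identityʳ r))) (sym (*-identityˡ _))
  t-qN r (suc q) = trans (reflexive (≡.cong t (≡.trans (≡.cong (r ℕ.+_) (ℕP.+-comm N (q ℕ.* N))) (≡.sym (ℕP.+-assoc r (q ℕ.* N) N)))))
    (trans (tN (r ℕ.+ q ℕ.* N)) (trans (*-congˡ (t-qN r q)) (trans (sym (*-assoc _ _ _)) (*-congʳ (sym (ι-* σ (σ ℤ.^ q)))))))

  private instance
    N≢0 : ℕ.NonZero N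
    N≢0 = ℕ.>-nonZero 0<N

  t-mod : ∀ j → t j ≈ ι (σ ℤ.^ (j ℕ./ N)) * t (j ℕ.% N)
  t-mod j = trans (reflexive (≡.cong t (DM.m≡m%n+[m/n]*n j N))) (t-qN (j ℕ.% N) (j ℕ./ N))

  coords : ∀ {w} → O w → Σ[ z ∈ (ℕ → ℤ) ] w ≈ Σ< N (λ i → ι (z i) * t i)
  coords ow = span-coords N t (span-map span-resp span-zer span-add span-neg
    (λ { (j , e) → span-resp (sym (trans e (t-mod j))) (span-ι (σ ℤ.^ (j ℕ./ N)) (gen (j ℕ.% N , DM.m%n<n j N , refl))) }) ow)

  O-sum : ∀ (z : ℕ → ℤ) → O (Σ< N (λ i → ι (z i) * t i))
  O-sum z = span-sum N {λ i → ι (z i) * t i} (λ i _ → span-ι (z i) (Ot i))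

  module Maximality {ℓ : ℕ} (pr : Prime ℓ) (tf : TorsionFree) (σ∤ : ¬ + ℓ ∣ℤ σ) (W : Weights N ℓ κ KM)
      (tpow : ∀ M m → t m ^ M ≈ ι (+ KM M m) * t (M ℕ.* m))
      (free : ∀ (z : ℕ → ℤ) → Σ< N (λ i → ι (z i) * t i) ≈ 0# → ∀ i → i < N → z i ≡ + 0) where
    open Weights W
    open AlmostIntegral OS
    open PrimeLocal OS tf pr
    open Freshman OS pr using (fresh-Σ)
    open IsSubring OS using () renaming (int to O-int; pow to O-pow)

    -- The coefficient of t_0 in w, modulo M (exact when M = 0).
    record Coeff (M c : ℤ) (w : Carrier) : Set where
      constructor coeff
      field
        z     : ℕ → ℤ
        rep   : w ≈ Σ< N (λ i → ι (z i) * t i)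
        value : M ∣ℤ z 0 ℤ.- c

    Coeff-resp : ∀ {M c w w′} → w ≈ w′ → Coeff M c w → Coeff M c w′
    Coeff-resp e (coeff z h m) = coeff z (trans (sym e) h) m

    Coeff-+ : ∀ {M c c′ w w′} → Coeff M c w → Coeff M c′ w′ → Coeff M (c ℤ.+ c′) (w + w′)
    Coeff-+ {M} {c} {c′} (coeff z h m) (coeff z′ h′ m′) = coeff (λ i → z i ℤ.+ z′ i)
      (trans (+-cong h h′) (trans (sym (Σ-+ N _ _)) (Σ-cong N (λ i _ → trans (sym (distribʳ _ _ _)) (*-congʳ (sym (ι-+ (z i) (z′ i))))))))
      (≡.subst (M ∣ℤ_) (rearrange (z 0) (z′ 0) c c′) (ℤS.∣m∣n⇒∣m+n m m′))
      where
      rearrange : ∀ a b c d → (a ℤ.- c) ℤ.+ (b ℤ.- d) ≡ (a ℤ.+ b) ℤ.- (c ℤ.+ d)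
      rearrange a b c d = ℤR.solve 4 (λ a b c d → (a ℤR.:- c) ℤR.:+ (b ℤR.:- d) ℤR.:= (a ℤR.:+ b) ℤR.:- (c ℤR.:+ d)) ≡.refl a b c d

    Coeff-* : ∀ {M c w} a → Coeff M c w → Coeff M (a ℤ.* c) (ι a * w)
    Coeff-* {M} {c} a (coeff z h m) = coeff (λ i → a ℤ.* z i)
      (trans (*-congˡ h) (trans (Σ-*ˡ N (ι a) _) (Σ-cong N (λ i _ → trans (sym (*-assoc _ _ _)) (*-congʳ (sym (ι-* a (z i))))))))
      (≡.subst (M ∣ℤ_) (ℤR.solve 3 (λ a z c → a ℤR.:* (z ℤR.:- c) ℤR.:= a ℤR.:* z ℤR.:- a ℤR.:* c) ≡.refl a (z 0) c) (ℤS.∣n⇒∣m*n a m))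

    Coeff-mod : ∀ {M c c′ w} → M ∣ℤ c ℤ.- c′ → Coeff M c w → Coeff M c′ w
    Coeff-mod {M} {c} {c′} d (coeff z h m) = coeff z h
      (≡.subst (M ∣ℤ_) (ℤR.solve 3 (λ z c c′ → (z ℤR.:- c) ℤR.:+ (c ℤR.:- c′) ℤR.:= z ℤR.:- c′) ≡.refl (z 0) c c′) (ℤS.∣m∣n⇒∣m+n m d))

    ≡-mod : ∀ {M x y} → x ≡ y → M ∣ℤ x ℤ.- y
    ≡-mod {M} {x} ≡.refl = divides (+ 0) (ℤP.+-inverseʳ x)

    Coeff-O : ∀ {M w} → O w → ∃[ c ] Coeff M c w
    Coeff-O ow = go (coords ow)
      where
      go : ∀ {M w} → Σ[ z ∈ (ℕ → ℤ) ] w ≈ Σ< N (λ i → ι (z i) * t i) → ∃[ c ] Coeff M c w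
      go (z , h) = z 0 , coeff z h (≡-mod {x = z 0} ≡.refl)

    Coeff-unique : ∀ {M c c′ w} → Coeff M c w → Coeff M c′ w → M ∣ℤ c ℤ.- c′
    Coeff-unique {M} {c} {c′} (coeff z h m) (coeff z′ h′ m′) = ≡.subst (M ∣ℤ_)
      (≡.trans (≡.cong (λ x → (x ℤ.- c′) ℤ.- (z 0 ℤ.- c)) (≡.sym z0≡)) (ℤR.solve 3 (λ z c c′ → (z ℤR.:- c′) ℤR.:- (z ℤR.:- c) ℤR.:= c ℤR.:- c′) ≡.refl (z 0) c c′))
      (ℤS.∣m∣n⇒∣m-n m′ m)
      where
      z0≡ : z 0 ≡ z′ 0
      z0≡ = ℤP.i-j≡0⇒i≡j (z 0) (z′ 0) (free (λ i → z i ℤ.- z′ i) (begin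
        Σ< N (λ i → ι (z i ℤ.- z′ i) * t i)
          ≈⟨ Σ-cong N (λ i _ → trans (*-congʳ (trans (ι-+ (z i) (ℤ.- z′ i)) (+-congˡ (ι-neg (z′ i))))) (trans (distribʳ _ _ _) (+-congˡ (sym (-‿distribˡ-* _ _))))) ⟩
        Σ< N (λ i → ι (z i) * t i + - (ι (z′ i) * t i))
          ≈⟨ trans (Σ-+ N _ _) (+-cong (sym h) (trans (sym (Σ-neg N _)) (-‿cong (sym h′)))) ⟩
        _ ≈⟨ -‿inverseʳ _ ⟩
        0# ∎) 0 0<N)

    Coeff-t0 : ∀ {M} → Coeff M (+ 1) (t 0)
    Coeff-t0 = coeff (λ i → δ i 0) (sym (Σ-δ N t 0<N)) (≡-mod {x = + 1} ≡.refl)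

    Coeff-t : ∀ {M} j → ¬ N ∣ℕ j → Coeff M (+ 0) (t j)
    Coeff-t {M} j N∤j = Coeff-resp (sym (t-mod j)) (Coeff-mod (≡-mod (ℤP.*-zeroʳ (σ ℤ.^ (j ℕ./ N)))) (Coeff-* (σ ℤ.^ (j ℕ./ N))
      (coeff (λ i → δ i (j ℕ.% N)) (sym (Σ-δ N t (DM.m%n<n j N))) (≡-mod {x = δ 0 (j ℕ.% N)} {+ 0} (δ-≢ (λ e → N∤j (ℕD.m%n≡0⇒n∣m j N (≡.sym e))))))))

    Coeff-0 : ∀ {M} → Coeff M (+ 0) 0#
    Coeff-0 = coeff (λ _ → + 0) (sym (Σ-zero N (λ i _ → zeroˡ _))) (≡-mod {x = + 0} ≡.refl)

    Coeff-single : ∀ {M c m} k {f : ℕ → Carrier} → m < k → Coeff M c (f m) → (∀ i → i < k → i ≢ m → Coeff M (+ 0) (f i)) → Coeff M c (Σ< k f)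
    Coeff-single {M} {c} {m} (suc k) {f} m<1+k hm h = go (ℕP.m≤n⇒m<n∨m≡n (ℕP.<⇒≤pred m<1+k))
      where
      zeros : ∀ k → (∀ i → i < k → Coeff M (+ 0) (f i)) → Coeff M (+ 0) (Σ< k f)
      zeros zero    h = Coeff-0
      zeros (suc k) h = Coeff-+ (zeros k (λ i i<k → h i (ℕP.m<n⇒m<1+n i<k))) (h k (ℕP.n<1+n k))
      go : m < k ⊎ m ≡ k → Coeff M c (Σ< (suc k) f)
      go (inj₁ m<k) = Coeff-mod (≡-mod (ℤP.+-identityʳ c)) (Coeff-+ (Coeff-single k m<k hm (λ i i<k → h i (ℕP.m<n⇒m<1+n i<k))) (h k (ℕP.n<1+n k) (ℕP.>⇒≢ m<k)))
      go (inj₂ ≡.refl) = Coeff-mod (≡-mod (ℤP.+-identityˡ c)) (Coeff-+ (zeros k (λ i i<k → h i (ℕP.m<n⇒m<1+n i<k) (ℕP.<⇒≢ i<k))) hm)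

    Coeff-ℓ : ∀ {w} → O w → Coeff (+ ℓ) (+ 0) (L * w)
    Coeff-ℓ ow = go (Coeff-O ow)
      where
      go : ∀ {w} → ∃[ c ] Coeff (+ ℓ) c w → Coeff (+ ℓ) (+ 0) (L * w)
      go (c , h) = Coeff-mod (ℤS.∣m∣n⇒∣m-n (ℤS.∣m⇒∣m*n c ℤS.∣-refl) (divides (+ 0) ≡.refl)) (Coeff-* (+ ℓ) h)

    -- Modulo `ℓ` only the `ℓ`-th powers of single terms count. For `i ≠ 0` the power `t i ^ ℓ`
    -- meets `t 0` only if `N` divides `ℓ * i`; then the weight of `i` is positive by `frob-inj`,
    -- and a carry supplies a factor `ℓ`.
    frobenius : ∀ {w c} → Coeff (+ ℓ) c w → ∃[ c′ ] Coeff (+ ℓ) c′ (w ^ ℓ) × (+ ℓ ∣ℤ c′ → + ℓ ∣ℤ c)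
    frobenius {w} {c} (coeff z h m) = z 0 ℤ.^ ℓ , main (fresh-Σ N (λ i → ι (z i) * t i) (λ i _ → O-mul (O-int (z i)) (Ot i))) , back
      where
      back : + ℓ ∣ℤ z 0 ℤ.^ ℓ → + ℓ ∣ℤ c
      back d = ≡.subst (+ ℓ ∣ℤ_) (ℤR.solve 2 (λ z c → z ℤR.:- (z ℤR.:- c) ℤR.:= c) ≡.refl (z 0) c) (ℤS.∣m∣n⇒∣m-n (euclid^ pr (z 0) ℓ d) m)
      term : ∀ i → (ι (z i) * t i) ^ ℓ ≈ ι (z i ℤ.^ ℓ) * t i ^ ℓ
      term i = trans (^-distrib-* (ι (z i)) (t i) ℓ) (*-congʳ (sym (ι-^ (z i) ℓ)))
      first : Coeff (+ ℓ) (z 0 ℤ.^ ℓ) ((ι (z 0) * t 0) ^ ℓ)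
      first = Coeff-resp (sym (trans (term 0) (*-congˡ (trans (^-congˡ ℓ t0) (trans (1^ ℓ) (sym t0))))))
                (Coeff-mod (≡-mod (ℤP.*-identityʳ (z 0 ℤ.^ ℓ))) (Coeff-* (z 0 ℤ.^ ℓ) Coeff-t0))
      other : ∀ i → i < N → i ≢ 0 → Coeff (+ ℓ) (+ 0) ((ι (z i) * t i) ^ ℓ)
      other i i<N i≢0 = Coeff-resp (sym (trans (term i) (*-congˡ (tpow ℓ i))))
          (Coeff-mod (≡-mod (ℤP.*-zeroʳ (z i ℤ.^ ℓ))) (Coeff-* (z i ℤ.^ ℓ) (by (N ℕD.∣? ℓ ℕ.* i) (ω i ℕ.≟ 0))))
        where
        by : Dec (N ∣ℕ ℓ ℕ.* i) → Dec (ω i ≡ 0) → Coeff (+ ℓ) (+ 0) (ι (+ KM ℓ i) * t (ℓ ℕ.* i))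
        by (no N∤)  _ = Coeff-mod (≡-mod (ℤP.*-zeroʳ (+ KM ℓ i))) (Coeff-* (+ KM ℓ i) (Coeff-t (ℓ ℕ.* i) N∤))
        by (yes N∣) (yes ω≡0) = ⊥-elim (i≢0 (frob-inj i i<N N∣ ω≡0))
        by (yes N∣) (no ω≢0) = div (KM-carry ℓ i (frob-carry i N∣ (ℕP.n≢0⇒n>0 ω≢0)))
          where
          div : ℓ ∣ℕ KM ℓ i → Coeff (+ ℓ) (+ 0) (ι (+ KM ℓ i) * t (ℓ ℕ.* i))
          div (ℕD.divides q e) = Coeff-resp (sym (trans (*-congʳ (trans (reflexive (≡.cong ιℕ (≡.trans e (ℕP.*-comm q ℓ)))) (ιℕ-* ℓ q))) (*-assoc _ _ _)))
                                   (Coeff-ℓ (O-mul (O-int (+ q)) (Ot (ℓ ℕ.* i))))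
      main : ∃[ v ] O v × (Σ< N (λ i → ι (z i) * t i) ^ ℓ ≈ Σ< N (λ i → (ι (z i) * t i) ^ ℓ) + ι (+ ℓ) * v) → Coeff (+ ℓ) (z 0 ℤ.^ ℓ) (w ^ ℓ)
      main (v , ov , e) = Coeff-resp (sym (trans (^-congˡ ℓ h) e)) (Coeff-mod (≡-mod (ℤP.+-identityʳ (z 0 ℤ.^ ℓ)))
        (Coeff-+ (Coeff-single N 0<N first other) (Coeff-ℓ ov)))

    frob-iter : ∀ {w c} → Coeff (+ ℓ) c w → ∀ h → ∃[ c′ ] Coeff (+ ℓ) c′ (w ^ (ℓ ℕ.^ h)) × (+ ℓ ∣ℤ c′ → + ℓ ∣ℤ c)
    frob-iter {w} {c} hw zero    = c , Coeff-resp (sym (*-identityʳ w)) hw , λ d → d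
    frob-iter {w} {c} hw (suc h) = go (frob-iter hw h)
      where
      go : ∃[ c′ ] Coeff (+ ℓ) c′ (w ^ (ℓ ℕ.^ h)) × (+ ℓ ∣ℤ c′ → + ℓ ∣ℤ c) → ∃[ c′ ] Coeff (+ ℓ) c′ (w ^ (ℓ ℕ.^ suc h)) × (+ ℓ ∣ℤ c′ → + ℓ ∣ℤ c)
      go (c₁ , h₁ , b₁) = go′ (frobenius h₁)
        where
        go′ : ∃[ c′ ] Coeff (+ ℓ) c′ ((w ^ (ℓ ℕ.^ h)) ^ ℓ) × (+ ℓ ∣ℤ c′ → + ℓ ∣ℤ c₁) → ∃[ c′ ] Coeff (+ ℓ) c′ (w ^ (ℓ ℕ.^ suc h)) × (+ ℓ ∣ℤ c′ → + ℓ ∣ℤ c)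
        go′ (c₂ , h₂ , b₂) = c₂ , Coeff-resp (trans (^-assocʳ w (ℓ ℕ.^ h) ℓ) (^-congʳ w (ℕP.*-comm (ℓ ℕ.^ h) ℓ))) h₂ , λ d → b₁ (b₂ d)

    Nil⇒∣ : ∀ {w c} → O w → Coeff (+ ℓ) c w → Nil (+ ℓ) O w → + ℓ ∣ℤ c
    Nil⇒∣ {w} {c} ow hc (m , v , ov , e) = go (frob-iter hc m)
      where
      P = ℓ ℕ.^ m
      zero-coeff : Coeff (+ ℓ) (+ 0) (w ^ P)
      zero-coeff = Coeff-resp (begin
        L * (v * w ^ (P ∸ m))   ≈⟨ *-assoc _ _ _ ⟨
        L * v * w ^ (P ∸ m)     ≈⟨ *-congʳ e ⟨
        w ^ m * w ^ (P ∸ m)     ≈⟨ ^-homo-* w m (P ∸ m) ⟨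
        w ^ (m ℕ.+ (P ∸ m))     ≡⟨ ≡.cong (w ^_) (ℕP.m+[n∸m]≡n (ℕP.<⇒≤ (n<m^n (prime>1 pr) m))) ⟩
        w ^ P                   ∎) (Coeff-ℓ (O-mul ov (O-pow (P ∸ m) ow)))
      go : ∃[ c′ ] Coeff (+ ℓ) c′ (w ^ P) × (+ ℓ ∣ℤ c′ → + ℓ ∣ℤ c) → + ℓ ∣ℤ c
      go (c′ , h , b) = b (≡.subst (+ ℓ ∣ℤ_) (ℤP.+-identityʳ c′) (Coeff-unique h zero-coeff))

    weaken : ∀ {M c w} → Coeff (+ 0) c w → Coeff M c w
    weaken {M} (coeff z h d) = coeff z h (≡.subst (M ∣ℤ_) (≡.sym (ℤS.0∣⇒≡0 d)) (divides (+ 0) ≡.refl))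

    module Core {γ : Carrier} (ai : AI O γ) (oLγ : O (L * γ)) (oγt : ∀ n → 1 ≤ ω n → O (γ * t n))
        (u : ℕ → ℤ) (hu : L * γ ≈ Σ< N (λ i → ι (u i) * t i)) where

      -- Multiplication by `t (N ∸ m)` moves the coordinate at `m` to position 0 up to the constant
      -- `κ` and `σ`; no other index below `N` is moved to a multiple of `N`.
      expand : ∀ m → m < N → Coeff (+ 0) (u m ℤ.* (+ κ m (N ∸ m) ℤ.* σ)) (L * γ * t (N ∸ m))
      expand m m<N = Coeff-resp (sym (trans (*-congʳ hu) (trans (*-comm _ _) (trans (Σ-*ˡ N (t n) _)
           (Σ-cong N (λ i _ → trans (solve 3 (λ t u s → t :* (u :* s) := u :* (s :* t)) refl (t n) (ι (u i)) (t i)) (*-congˡ (tt i n))))))))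
         (Coeff-single N m<N (Coeff-* (u m) (Coeff-* (+ κ m n) at-N)) (λ i i<N i≢m →
            Coeff-mod (≡-mod (≡.trans (≡.cong (λ x → u i ℤ.* x) (ℤP.*-zeroʳ (+ κ i n))) (ℤP.*-zeroʳ (u i))))
              (Coeff-* (u i) (Coeff-* (+ κ i n) (Coeff-t (i ℕ.+ n) (off i i<N i≢m))))))
        where
        n = N ∸ m
        m+n : m ℕ.+ n ≡ N
        m+n = ℕP.m+[n∸m]≡n (ℕP.<⇒≤ m<N)
        at-N : Coeff (+ 0) σ (t (m ℕ.+ n))
        at-N = Coeff-resp (sym (trans (reflexive (≡.cong t m+n)) (tN 0))) (Coeff-mod (≡-mod (ℤP.*-identityʳ σ)) (Coeff-* σ Coeff-t0))
        off : ∀ i → i < N → i ≢ m → ¬ N ∣ℕ i ℕ.+ n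
        off i i<N i≢m (ℕD.divides zero e) = ℕP.<⇒≢ (ℕP.m<n⇒0<n∸m m<N) (≡.sym (ℕP.m+n≡0⇒n≡0 i e))
        off i i<N i≢m (ℕD.divides (suc zero) e) = i≢m (ℕP.+-cancelʳ-≡ n i m (≡.trans e (≡.trans (ℕP.+-identityʳ N) (≡.sym m+n))))
        off i i<N i≢m (ℕD.divides (suc (suc q)) e) = ℕP.<⇒≱ (ℕP.+-mono-<-≤ i<N (ℕP.m∸n≤m N m))
          (≡.subst (N ℕ.+ N ≤_) (≡.sym e) (ℕP.+-monoʳ-≤ N (ℕP.m≤m+n N (q ℕ.* N))))

      strip : ∀ a b → ¬ ℓ ∣ℕ b → + ℓ ∣ℤ a ℤ.* (+ b ℤ.* σ) → + ℓ ∣ℤ a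
      strip a b ∤b d = go (euclidℤ pr a (+ b ℤ.* σ) d)
        where
        go : + ℓ ∣ℤ a ⊎ + ℓ ∣ℤ + b ℤ.* σ → + ℓ ∣ℤ a
        go (inj₁ h) = h
        go (inj₂ h) = go′ (euclidℤ pr (+ b) σ h)
          where
          go′ : + ℓ ∣ℤ + b ⊎ + ℓ ∣ℤ σ → + ℓ ∣ℤ a
          go′ (inj₁ h) = ⊥-elim (∤b (ℤS.∣⇒∣ᵤ h))
          go′ (inj₂ h) = ⊥-elim (σ∤ h)

      -- In weight 0 the constant `κ m (N ∸ m)` is prime to `ℓ`, so it suffices to use that
      -- `γ * (L * t (N ∸ m))` is nilpotent modulo `ℓ`.
      u∣-zero : ∀ m → m < N → ω m ≡ 0 → + ℓ ∣ℤ u m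
      u∣-zero m m<N ω≡0 = strip (u m) (κ m n) (κ-unit m m<N ω≡0)
          (Nil⇒∣ o (weaken (Coeff-resp swap (expand m m<N))) (AI⇒Nil 1 ai oLt (t n , Ot n , trans (*-identityʳ _) refl) o))
        where
        n = N ∸ m
        swap : L * γ * t n ≈ γ * (L * t n)
        swap = solve 3 (λ l g t → l :* g :* t := g :* (l :* t)) refl L γ (t n)
        oLt : O (L * t n)
        oLt = O-mul (O-int (+ ℓ)) (Ot n)
        o : O (γ * (L * t n))
        o = span-resp swap (O-mul oLγ (Ot n))

      -- In positive weight `κ m (N ∸ m)` has exactly one factor `ℓ`, which cancels the one in
      -- `L * γ`. What remains is the coefficient of `t 0` in `γ * t (N ∸ m)`, and this element is
      -- nilpotent because `t (N ∸ m)` has positive weight too.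
      u∣-pos : ∀ m → m < N → 1 ≤ ω m → + ℓ ∣ℤ u m
      u∣-pos m m<N ω≥1 = go (κ-simple m m<N ω≥1) (Coeff-O o)
        where
        n = N ∸ m
        o : O (γ * t n)
        o = oγt n (ω-compl m m<N ω≥1)
        t^N : Mult (+ ℓ) O (t n ^ N)
        t^N = go (KM-carry N n (ℕP.m≤m*n N (ω n) {{ℕ.>-nonZero (ω-compl m m<N ω≥1)}}))
          where
          go : ℓ ∣ℕ KM N n → Mult (+ ℓ) O (t n ^ N)
          go (ℕD.divides q e) = ι (+ q) * t (N ℕ.* n) , O-mul (O-int (+ q)) (Ot (N ℕ.* n)) ,
            trans (tpow N n) (trans (*-congʳ (trans (reflexive (≡.cong ιℕ (≡.trans e (ℕP.*-comm q ℓ)))) (ιℕ-* ℓ q))) (*-assoc _ _ _))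
        go : ∃[ c ] (κ m (N ∸ m) ≡ c ℕ.* ℓ) × ¬ ℓ ∣ℕ c → ∃[ c ] Coeff (+ 0) c (γ * t n) → + ℓ ∣ℤ u m
        go (κ′ , κ≡ , κ∤) (c , hc) = strip (u m) κ′ κ∤ (≡.subst (+ ℓ ∣ℤ_) c≡ (Nil⇒∣ o (weaken hc) (AI⇒Nil N ai (Ot n) t^N o)))
          where
          ℓc≡ : + ℓ ℤ.* c ≡ + ℓ ℤ.* (u m ℤ.* (+ κ′ ℤ.* σ))
          ℓc≡ = ≡.trans (ℤP.i-j≡0⇒i≡j _ _ (ℤS.0∣⇒≡0 (Coeff-unique (Coeff-* (+ ℓ) hc) (Coeff-resp (*-assoc L γ (t n)) (expand m m<N)))))
            (≡.trans (≡.cong (λ k → u m ℤ.* (k ℤ.* σ)) (≡.trans (≡.cong +_ κ≡) (ℤP.pos-* κ′ ℓ)))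
              (ℤR.solve 4 (λ u k l s → u ℤR.:* (k ℤR.:* l ℤR.:* s) ℤR.:= l ℤR.:* (u ℤR.:* (k ℤR.:* s))) ≡.refl (u m) (+ κ′) (+ ℓ) σ))
          c≡ : c ≡ u m ℤ.* (+ κ′ ℤ.* σ)
          c≡ = ℤP.*-cancelˡ-≡ (+ ℓ) c (u m ℤ.* (+ κ′ ℤ.* σ)) {{ℕ.>-nonZero (prime>0 pr)}} ℓc≡

      u∣ : ∀ m → m < N → + ℓ ∣ℤ u m
      u∣ m m<N = go (ω m ℕ.≟ 0)
        where
        go : Dec (ω m ≡ 0) → + ℓ ∣ℤ u m
        go (yes ω≡0) = u∣-zero m m<N ω≡0
        go (no ω≢0)  = u∣-pos m m<N (ℕP.n≢0⇒n>0 ω≢0)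

      mult : ∀ k → k ≤ N → Mult (+ ℓ) O (Σ< k (λ i → ι (u i) * t i))
      mult zero    _   = 0# , span-zer , sym (zeroʳ L)
      mult (suc k) k<N = go (mult k (ℕP.<⇒≤ k<N)) (u∣ k k<N)
        where
        go : ∀ {a} → Mult (+ ℓ) O a → + ℓ ∣ℤ u k → Mult (+ ℓ) O (a + ι (u k) * t k)
        go (v , ov , e) (divides q eq) = v + ι q * t k , span-add ov (O-mul (O-int q) (Ot k)) ,
          trans (+-cong e (*-congʳ (trans (reflexive (≡.cong ι eq)) (ι-* q (+ ℓ)))))
            (solve 4 (λ l v q t → l :* v :+ q :* l :* t := l :* (v :+ q :* t)) refl L v (ι q) (t k))

      Oγ : O γ
      Oγ = go (mult N ℕP.≤-refl)
        where
        go : Mult (+ ℓ) O (Σ< N (λ i → ι (u i) * t i)) → O γ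
        go (v , ov , e) = span-resp (sym (ℓ-cancel (trans hu e))) ov

    core : ∀ {γ} → AI O γ → O (L * γ) → (∀ n → 1 ≤ ω n → O (γ * t n)) → O γ
    core {γ} ai oLγ oγt = go (coords oLγ)
      where
      go : Σ[ z ∈ (ℕ → ℤ) ] L * γ ≈ Σ< N (λ i → ι (z i) * t i) → O γ
      go (u , hu) = Core.Oγ ai oLγ oγt u hu

    maximal : Maximal
    maximal {γ} ai oLγ = span-resp (trans (*-congˡ t0) (*-identityʳ γ)) (down N 0 (ℕP.+-identityʳ N) 0 z≤n)
      where
      -- Downward induction on a lower bound `j` for the weight; it is vacuous at `N`. A product
      -- with a monomial of positive weight either gains weight or acquires a factor `ℓ` through a
      -- carry, and then `L * γ` in `O` suffices.
      down : ∀ i j → i ℕ.+ j ≡ N → ∀ m → j ≤ ω m → O (γ * t m)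
      down zero    j e m j≤ω = ⊥-elim (ℕP.<⇒≱ (ω<N m) (≡.subst (_≤ ω m) e j≤ω))
      down (suc i) j e m j≤ω = core (AI-mul ai (Ot m)) (span-resp (*-assoc _ _ _) (O-mul oLγ (Ot m))) step
        where
        step : ∀ n → 1 ≤ ω n → O (γ * t m * t n)
        step n ω≥1 = span-resp (sym (trans (*-assoc _ _ _) (trans (*-congˡ (tt m n)) (solve 3 (λ g k t → g :* (k :* t) := k :* (g :* t)) refl γ (ι (+ κ m n)) (t (m ℕ.+ n))))))
            (by (ω m ℕ.+ ω n ℕ.<? N))
          where
          by : Dec (ω m ℕ.+ ω n < N) → O (ι (+ κ m n) * (γ * t (m ℕ.+ n)))
          by (yes lt) = O-mul (O-int (+ κ m n)) (down i (suc j) (≡.trans (ℕP.+-suc i j) e) (m ℕ.+ n)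
                          (≡.subst (suc j ≤_) (≡.sym (ω-add m n lt)) (≡.subst (_≤ ω m ℕ.+ ω n) (ℕP.+-comm j 1) (ℕP.+-mono-≤ j≤ω ω≥1))))
          by (no ≮) = go (carry m n (ℕP.≮⇒≥ ≮))
            where
            go : ℓ ∣ℕ κ m n → O (ι (+ κ m n) * (γ * t (m ℕ.+ n)))
            go (ℕD.divides q eq) = span-resp (sym (trans (*-congʳ (trans (reflexive (≡.cong ιℕ eq)) (ιℕ-* q ℓ)))
                 (solve 4 (λ q l g t → q :* l :* (g :* t) := q :* (l :* g :* t)) refl (ιℕ q) L γ (t (m ℕ.+ n)))))
                 (O-mul (O-int (+ q)) (O-mul oLγ (Ot (m ℕ.+ n))))

-- Exponents in the products C_m

module ProductExponents where
  open ≡ using (refl; sym; trans; cong; cong₂; subst; module ≡-Reasoning)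
  open import Data.Nat using (_+_; _*_; _^_)
  open ℕS using (solve; _:=_; _:+_; _:*_; con)

  rem<n : ∀ k {n} → 0 < n → rem k n < n
  rem<n k {suc n} _ = DM.m%n<n k (suc n)

  rem+quot : ∀ k {n} → 0 < n → k ≡ rem k n ℕ.+ quot k n ℕ.* n
  rem+quot k {suc n} _ = DM.m≡m%n+[m/n]*n k (suc n)

  rem-< : ∀ {k n} → k < n → rem k n ≡ k
  rem-< {k} {suc n} (s≤s k≤n) = DM.m≤n⇒m%n≡m k≤n

  quot-< : ∀ {k n} → k < n → quot k n ≡ 0
  quot-< {k} {suc n} k<n = DM.m<n⇒m/n≡0 k<n

  rem-+n : ∀ k {n} → 0 < n → rem (k ℕ.+ n) n ≡ rem k n
  rem-+n k {suc n} _ = DM.[m+n]%n≡m%n k (suc n)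

  quot-+n : ∀ k {n} → 0 < n → quot (k ℕ.+ n) n ≡ suc (quot k n)
  quot-+n k {suc n} _ = trans (DM.+-distrib-/-∣ʳ k (ℕD.∣-refl {suc n})) (trans (cong ((k ℕ./ suc n) ℕ.+_) (DM.n/n≡1 (suc n))) (ℕP.+-comm (k ℕ./ suc n) 1))

  ^ℕ-distrib-* : ∀ x y n → (x * y) ^ n ≡ x ^ n * y ^ n
  ^ℕ-distrib-* x y zero    = refl
  ^ℕ-distrib-* x y (suc n) = trans (cong (x * y *_) (^ℕ-distrib-* x y n))
    (solve 4 (λ x y a b → x :* y :* (a :* b) := x :* a :* (y :* b)) refl x y (x ^ n) (y ^ n))

  ∣m+n∣n⇒∣m : ∀ {d m n} → d ∣ℕ m + n → d ∣ℕ n → d ∣ℕ m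
  ∣m+n∣n⇒∣m {d} {m} {n} h h′ = ℕD.∣m+n∣m⇒∣n (subst (d ∣ℕ_) (ℕP.+-comm m n) h) h′

  prod-cong : ∀ {f g : ℕ → ℕ} N → (∀ i → 1 ≤ i → i < N → f i ≡ g i) → prodFrom1 f N ≡ prodFrom1 g N
  prod-cong zero          h = refl
  prod-cong (suc zero)    h = refl
  prod-cong (suc (suc k)) h = cong₂ _*_ (prod-cong (suc k) (λ i 1≤i i< → h i 1≤i (ℕP.m<n⇒m<1+n i<))) (h (suc k) (s≤s z≤n) (ℕP.n<1+n _))

  prod-* : ∀ (f g : ℕ → ℕ) N → prodFrom1 (λ i → f i * g i) N ≡ prodFrom1 f N * prodFrom1 g N
  prod-* f g zero          = refl
  prod-* f g (suc zero)    = refl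
  prod-* f g (suc (suc k)) = trans (cong (_* (f (suc k) * g (suc k))) (prod-* f g (suc k)))
    (solve 4 (λ a b c d → (a :* b) :* (c :* d) := (a :* c) :* (b :* d)) refl (prodFrom1 f (suc k)) (prodFrom1 g (suc k)) (f (suc k)) (g (suc k)))

  prod-^ : ∀ (f : ℕ → ℕ) M N → prodFrom1 (λ i → f i ^ M) N ≡ prodFrom1 f N ^ M
  prod-^ f M zero          = sym (ℕP.^-zeroˡ M)
  prod-^ f M (suc zero)    = sym (ℕP.^-zeroˡ M)
  prod-^ f M (suc (suc k)) = trans (cong (_* f (suc k) ^ M) (prod-^ f M (suc k))) (sym (^ℕ-distrib-* (prodFrom1 f (suc k)) (f (suc k)) M))

  prod-1 : ∀ (f : ℕ → ℕ) N → (∀ i → 1 ≤ i → i < N → f i ≡ 1) → prodFrom1 f N ≡ 1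
  prod-1 f zero          h = refl
  prod-1 f (suc zero)    h = refl
  prod-1 f (suc (suc k)) h = trans (cong₂ _*_ (prod-1 f (suc k) (λ i 1≤i i< → h i 1≤i (ℕP.m<n⇒m<1+n i<))) (h (suc k) (s≤s z≤n) (ℕP.n<1+n _))) refl

  prod-pos : ∀ (f : ℕ → ℕ) N → (∀ i → 1 ≤ i → i < N → 0 < f i) → 0 < prodFrom1 f N
  prod-pos f zero          h = s≤s z≤n
  prod-pos f (suc zero)    h = s≤s z≤n
  prod-pos f (suc (suc k)) h = ℕP.*-mono-< (prod-pos f (suc k) (λ i 1≤i i< → h i 1≤i (ℕP.m<n⇒m<1+n i<))) (h (suc k) (s≤s z≤n) (ℕP.n<1+n _))

  prod-∣ : ∀ (f : ℕ → ℕ) {ℓ} N e → 1 ≤ e → e < N → ℓ ∣ℕ f e → ℓ ∣ℕ prodFrom1 f N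
  prod-∣ f (suc zero)    e 1≤e e<N d = ⊥-elim (ℕP.<⇒≱ e<N 1≤e)
  prod-∣ f {ℓ} (suc (suc k)) e 1≤e e<N d = go (λ e< → prod-∣ f (suc k) e 1≤e e< d) (ℕP.m≤n⇒m<n∨m≡n (ℕP.<⇒≤pred e<N))
    where
    go : (e < suc k → ℓ ∣ℕ prodFrom1 f (suc k)) → e < suc k ⊎ e ≡ suc k → ℓ ∣ℕ prodFrom1 f (suc (suc k))
    go ih (inj₁ e<)   = ℕD.∣m⇒∣m*n (f (suc k)) (ih e<)
    go ih (inj₂ refl) = ℕD.∣n⇒∣m*n (prodFrom1 f (suc k)) d

  prod-∤ : ∀ (f : ℕ → ℕ) {ℓ} N → Prime ℓ → (∀ i → 1 ≤ i → i < N → ¬ ℓ ∣ℕ f i) → ¬ ℓ ∣ℕ prodFrom1 f N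
  prod-∤ f zero          pr h d = prime∤1 pr d
  prod-∤ f (suc zero)    pr h d = prime∤1 pr d
  prod-∤ f {ℓ} (suc (suc k)) pr h d =
    go (prod-∤ f (suc k) pr (λ i 1≤i i< → h i 1≤i (ℕP.m<n⇒m<1+n i<))) (euclidsLemma (prodFrom1 f (suc k)) (f (suc k)) pr d)
    where
    go : ¬ ℓ ∣ℕ prodFrom1 f (suc k) → ℓ ∣ℕ prodFrom1 f (suc k) ⊎ ℓ ∣ℕ f (suc k) → ⊥
    go ih (inj₁ d′) = ih d′
    go ih (inj₂ d′) = h (suc k) (s≤s z≤n) (ℕP.n<1+n _) d′

  -- Splits off the only factor of the product that can be divisible by `ℓ`.
  omit : ℕ → (ℕ → ℕ) → ℕ → ℕ
  omit e f i with i ℕ.≟ e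
  ... | yes _ = 1
  ... | no  _ = f i

  omit-≡ : ∀ e f → omit e f e ≡ 1
  omit-≡ e f with e ℕ.≟ e
  ... | yes _ = refl
  ... | no ≢  = ⊥-elim (≢ refl)

  omit-≢ : ∀ e f {i} → i ≢ e → omit e f i ≡ f i
  omit-≢ e f {i} i≢e with i ℕ.≟ e
  ... | yes i≡e = ⊥-elim (i≢e i≡e)
  ... | no _    = refl

  prod-extract : ∀ (f : ℕ → ℕ) N e → 1 ≤ e → e < N → prodFrom1 f N ≡ f e * prodFrom1 (omit e f) N
  prod-extract f (suc zero) e 1≤e e<N = ⊥-elim (ℕP.<⇒≱ e<N 1≤e)
  prod-extract f (suc (suc k)) e 1≤e e<N = go (prod-extract f (suc k) e 1≤e) (ℕP.m≤n⇒m<n∨m≡n (ℕP.<⇒≤pred e<N))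
    where
    go : (e < suc k → prodFrom1 f (suc k) ≡ f e * prodFrom1 (omit e f) (suc k)) →
         e < suc k ⊎ e ≡ suc k → prodFrom1 f (suc (suc k)) ≡ f e * prodFrom1 (omit e f) (suc (suc k))
    go ih (inj₁ e<)   = trans (cong₂ _*_ (ih e<) (sym (omit-≢ e f (ℕP.>⇒≢ e<)))) (ℕP.*-assoc (f e) _ _)
    go ih (inj₂ refl) = trans (ℕP.*-comm (prodFrom1 f (suc k)) (f (suc k))) (cong (f (suc k) *_)
      (trans (prod-cong (suc k) (λ i _ i< → sym (omit-≢ (suc k) f (ℕP.<⇒≢ i<)))) (trans (sym (ℕP.*-identityʳ _)) (cong (prodFrom1 (omit (suc k) f) (suc k) *_) (sym (omit-≡ (suc k) f))))))

  quot-bound : ∀ x {N} k → 0 < N → k * N ≤ x → k ≤ quot x N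
  quot-bound x {suc N} k _ h = subst (_≤ x ℕ./ suc N) (DM.m*n/n≡m k (suc N)) (DM./-monoˡ-≤ (suc N) h)

  rem-unique : ∀ x {N} q r → 0 < N → r < N → x ≡ r + q * N → (rem x N ≡ r) × (quot x N ≡ q)
  rem-unique x {suc N} q r _ r<N refl = trans (DM.[m+kn]%n≡m%n r q (suc N)) (DM.m<n⇒m%n≡m r<N) ,
    trans (DM.+-distrib-/-∣ʳ r (ℕD.n∣m*n q {suc N})) (trans (cong₂ _+_ (DM.m<n⇒m/n≡0 r<N) (DM.m*n/n≡m q (suc N))) refl)

  rem≡0⇒∣ : ∀ {x N} → 0 < N → rem x N ≡ 0 → N ∣ℕ x
  rem≡0⇒∣ {x} {N} 0<N e = ℕD.divides (quot x N) (trans (rem+quot x 0<N) (cong (_+ quot x N * N) e))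

  prime-power-coprime : ∀ {p m} → Prime p → ¬ p ∣ℕ m → ∀ s → Coprime (p ^ s) m
  prime-power-coprime {p} {m} pr ∤ zero    (d∣1 , _) = ℕD.∣1⇒≡1 d∣1
  prime-power-coprime {p} {m} pr ∤ (suc s) {d} (d∣p^ , d∣m) =
    prime-power-coprime pr ∤ s (coprime-divisor (λ {d′} (h , h′) → ∤⇒Coprime pr ∤ (h′ , ℕD.∣-trans h d∣m)) d∣p^ , d∣m)

  module Exponents (N : ℕ) (0<N : 0 < N) (A : ℕ → ℕ) where

    E : ℕ → ℕ → ℕ
    E i m = quot (i * m) N

    w : ℕ → ℕ → ℕ
    w i m = rem (i * m) N

    Cₘ : ℕ → ℕ
    Cₘ m = prodFrom1 (λ i → A i ^ E i m) N

    -- The carry in the addition of the remainders of `i * m` and `i * n` modulo `N`, hence 0 or 1;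
    -- `cM` is the total carry for `M` equal summands.
    cr : ℕ → ℕ → ℕ → ℕ
    cr i m n = E i (m + n) ∸ (E i m + E i n)

    κ : ℕ → ℕ → ℕ
    κ m n = prodFrom1 (λ i → A i ^ cr i m n) N

    cM : ℕ → ℕ → ℕ → ℕ
    cM i M m = E i (M * m) ∸ M * E i m

    KM : ℕ → ℕ → ℕ
    KM M m = prodFrom1 (λ i → A i ^ cM i M m) N

    im : ∀ i m → i * m ≡ w i m + E i m * N
    im i m = rem+quot (i * m) 0<N

    add-no : ∀ i m n → w i m + w i n < N → (w i (m + n) ≡ w i m + w i n) × (E i (m + n) ≡ E i m + E i n)
    add-no i m n lt = rem-unique (i * (m + n)) (E i m + E i n) (w i m + w i n) 0<N lt
      (trans (ℕP.*-distribˡ-+ i m n) (trans (cong₂ _+_ (im i m) (im i n))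
        (solve 5 (λ a b c d n → (a :+ b :* n) :+ (c :+ d :* n) := (a :+ c) :+ (b :+ d) :* n) refl (w i m) (E i m) (w i n) (E i n) N)))

    add-yes : ∀ i m n → N ≤ w i m + w i n → (w i (m + n) ≡ w i m + w i n ∸ N) × (E i (m + n) ≡ suc (E i m + E i n))
    add-yes i m n le = rem-unique (i * (m + n)) (suc (E i m + E i n)) (w i m + w i n ∸ N) 0<N
      (ℕP.+-cancelʳ-< N _ N (subst (_< N + N) (sym (ℕP.m∸n+n≡m le)) (ℕP.+-mono-< (rem<n (i * m) 0<N) (rem<n (i * n) 0<N))))
      (trans (ℕP.*-distribˡ-+ i m n) (trans (cong₂ _+_ (im i m) (im i n))
        (trans (solve 5 (λ a b c d n → (a :+ b :* n) :+ (c :+ d :* n) := (a :+ c) :+ (b :+ d) :* n) refl (w i m) (E i m) (w i n) (E i n) N)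
        (trans (cong (_+ (E i m + E i n) * N) (sym (ℕP.m∸n+n≡m le))) (ℕP.+-assoc (w i m + w i n ∸ N) N _)))))

    E-add : ∀ i m n → E i m + E i n ≤ E i (m + n)
    E-add i m n with w i m + w i n ℕ.<? N
    ... | yes lt = ℕP.≤-reflexive (sym (proj₂ (add-no i m n lt)))
    ... | no ≮   = ℕP.≤-trans (ℕP.n≤1+n _) (ℕP.≤-reflexive (sym (proj₂ (add-yes i m n (ℕP.≮⇒≥ ≮)))))

    E-mul : ∀ i M m → M * E i m ≤ E i (M * m)
    E-mul i M m = quot-bound (i * (M * m)) (M * E i m) 0<N (begin
      M * E i m * N        ≡⟨ ℕP.*-assoc M (E i m) N ⟩
      M * (E i m * N)      ≤⟨ ℕP.*-monoʳ-≤ M (ℕP.m≤n+m (E i m * N) (w i m)) ⟩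
      M * (w i m + E i m * N) ≡⟨ cong (M *_) (im i m) ⟨
      M * (i * m)          ≡⟨ solve 3 (λ M i m → M :* (i :* m) := i :* (M :* m)) refl M i m ⟩
      i * (M * m)          ∎)
      where open ℕP.≤-Reasoning

    C-add : ∀ m n → Cₘ (m + n) ≡ κ m n * (Cₘ m * Cₘ n)
    C-add m n = trans (prod-cong N (λ i _ _ → trans (cong (A i ^_) (sym (ℕP.m∸n+n≡m (E-add i m n))))
        (trans (ℕP.^-distribˡ-+-* (A i) (cr i m n) (E i m + E i n)) (cong (A i ^ cr i m n *_) (ℕP.^-distribˡ-+-* (A i) (E i m) (E i n))))))
      (trans (prod-* (λ i → A i ^ cr i m n) (λ i → A i ^ E i m * A i ^ E i n) N) (cong (κ m n *_) (prod-* (λ i → A i ^ E i m) (λ i → A i ^ E i n) N)))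

    C-mul : ∀ M m → Cₘ (M * m) ≡ KM M m * Cₘ m ^ M
    C-mul M m = trans (prod-cong N (λ i _ _ → trans (cong (A i ^_) (trans (sym (ℕP.m∸n+n≡m (E-mul i M m))) (cong (cM i M m ℕ.+_) (ℕP.*-comm M (E i m)))))
        (trans (ℕP.^-distribˡ-+-* (A i) (cM i M m) (E i m * M)) (cong (A i ^ cM i M m *_) (sym (ℕP.^-*-assoc (A i) (E i m) M))))))
      (trans (prod-* (λ i → A i ^ cM i M m) (λ i → (A i ^ E i m) ^ M) N) (cong (KM M m *_) (prod-^ (λ i → A i ^ E i m) M N)))

    C-0 : Cₘ 0 ≡ 1
    C-0 = prod-1 _ N (λ i _ _ → cong (A i ^_) (trans (cong (λ x → quot x N) (ℕP.*-zeroʳ i)) (quot-< 0<N)))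

    C-N : ∀ m → Cₘ (m + N) ≡ prodFrom1 (λ i → A i ^ i) N * Cₘ m
    C-N m = trans (prod-cong N (λ i _ _ → trans (cong (A i ^_) (proj₂ (rem-unique (i * (m + N)) (i + E i m) (w i m) 0<N (rem<n (i * m) 0<N)
        (trans (ℕP.*-distribˡ-+ i m N) (trans (cong (_+ i * N) (im i m)) (solve 4 (λ w e n i → (w :+ e :* n) :+ i :* n := w :+ (i :+ e) :* n) refl (w i m) (E i m) N i))))))
        (ℕP.^-distribˡ-+-* (A i) i (E i m)))) (prod-* (λ i → A i ^ i) (λ i → A i ^ E i m) N)

    C-pos : (∀ i → 1 ≤ i → i < N → 1 ≤ A i) → ∀ m → 0 < Cₘ m
    C-pos A≥1 m = prod-pos _ N (λ i 1≤i i<N → ℕP.m^n>0 (A i) {{ℕ.>-nonZero (A≥1 i 1≤i i<N)}} (E i m))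

    ^-∤ : ∀ {ℓ} → Prime ℓ → ∀ x k → ¬ ℓ ∣ℕ x → ¬ ℓ ∣ℕ x ^ k
    ^-∤ pr x zero    ∤ d = prime∤1 pr d
    ^-∤ pr x (suc k) ∤ d with euclidsLemma x (x ^ k) pr d
    ... | inj₁ d′ = ∤ d′
    ... | inj₂ d′ = ^-∤ pr x k ∤ d′

    ∣-^ : ∀ {ℓ} x k → ℓ ∣ℕ x → 1 ≤ k → ℓ ∣ℕ x ^ k
    ∣-^ x (suc k) d _ = ℕD.∣m⇒∣m*n (x ^ k) d

    -- e is the exponent of ℓ in a; e = 0 when ℓ divides none of the A_i.
    module _ {ℓ : ℕ} (pr : Prime ℓ) (e : ℕ) (e<N : e < N)
        (others : ∀ i → 1 ≤ i → i < N → i ≢ e → ¬ ℓ ∣ℕ A i)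
        (simple : 1 ≤ e → ∃[ c ] (A e ≡ c * ℓ) × ¬ ℓ ∣ℕ c)
        (inj-ℓ : ∀ m → N ∣ℕ ℓ * m → N ∣ℕ e * m → N ∣ℕ m) where

      ω : ℕ → ℕ
      ω m = w e m

      ω>0⇒e>0 : ∀ {m} → 1 ≤ ω m → 1 ≤ e
      ω>0⇒e>0 {m} h = go e refl
        where
        go : ∀ e′ → e′ ≡ e → 1 ≤ e
        go zero    refl = ⊥-elim (ℕP.<⇒≢ h (sym (rem-< 0<N)))
        go (suc _) refl = s≤s z≤n

      ω-sum : ∀ m → m ≤ N → N ∣ℕ ω m + ω (N ∸ m)
      ω-sum m m≤N = ∣m+n∣n⇒∣m {m = ω m + ω (N ∸ m)} {n = (E e m + E e (N ∸ m)) * N}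
        (subst (N ∣ℕ_) (begin
          e * N                                     ≡⟨ cong (e *_) (ℕP.m+[n∸m]≡n m≤N) ⟨
          e * (m + (N ∸ m))                         ≡⟨ ℕP.*-distribˡ-+ e m (N ∸ m) ⟩
          e * m + e * (N ∸ m)                       ≡⟨ cong₂ _+_ (im e m) (im e (N ∸ m)) ⟩
          (ω m + E e m * N) + (ω (N ∸ m) + E e (N ∸ m) * N)
            ≡⟨ solve 5 (λ a b c d n → (a :+ b :* n) :+ (c :+ d :* n) := (a :+ c) :+ (b :+ d) :* n) refl (ω m) (E e m) (ω (N ∸ m)) (E e (N ∸ m)) N ⟩
          (ω m + ω (N ∸ m)) + (E e m + E e (N ∸ m)) * N ∎) (ℕD.n∣m*n e)) (ℕD.n∣m*n (E e m + E e (N ∸ m)))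
        where open ≡-Reasoning

      -- The sum is a multiple of `N` by `ω-sum`, and it is positive. This forces the carry that
      -- puts a single factor `ℓ` into `κ m (N ∸ m)`.
      ω≥N : ∀ m → m < N → 1 ≤ ω m → N ≤ ω m + ω (N ∸ m)
      ω≥N m m<N h = ℕD.∣⇒≤ {{ℕ.>-nonZero (ℕP.<-≤-trans h (ℕP.m≤m+n (ω m) _))}} (ω-sum m (ℕP.<⇒≤ m<N))

      cr-yes : ∀ i m n → N ≤ w i m + w i n → cr i m n ≡ 1
      cr-yes i m n le = trans (cong (_∸ (E i m + E i n)) (proj₂ (add-yes i m n le))) (ℕP.m+n∸n≡m 1 (E i m + E i n))

      cr-no : ∀ i m n → w i m + w i n < N → cr i m n ≡ 0
      cr-no i m n lt = trans (cong (_∸ (E i m + E i n)) (proj₂ (add-no i m n lt))) (ℕP.n∸n≡0 (E i m + E i n))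

      ℓ∣A : 1 ≤ e → ℓ ∣ℕ A e
      ℓ∣A h = ℕD.divides (proj₁ (simple h)) (proj₁ (proj₂ (simple h)))

      others-prod : ∀ (f : ℕ → ℕ) → ¬ ℓ ∣ℕ prodFrom1 (omit e (λ i → A i ^ f i)) N
      others-prod f = prod-∤ _ N pr (λ i 1≤i i<N → go i 1≤i i<N (i ℕ.≟ e))
        where
        go : ∀ i → 1 ≤ i → i < N → Dec (i ≡ e) → ¬ ℓ ∣ℕ omit e (λ i → A i ^ f i) i
        go i 1≤i i<N (yes refl) d = prime∤1 pr (subst (ℓ ∣ℕ_) (omit-≡ e (λ i → A i ^ f i)) d)
        go i 1≤i i<N (no i≢e)   d = ^-∤ pr (A i) (f i) (others i 1≤i i<N i≢e) (subst (ℓ ∣ℕ_) (omit-≢ e (λ i → A i ^ f i) i≢e) d)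

      weights : Weights N ℓ κ KM
      weights = record
        { ω = ω
        ; ω<N = λ m → rem<n (e * m) 0<N
        ; ω-zero = trans (cong (λ x → rem x N) (ℕP.*-zeroʳ e)) (rem-< 0<N)
        ; ω-add = λ m n lt → proj₁ (add-no e m n lt)
        ; carry = λ m n le → prod-∣ _ N e (pos m n le) e<N (∣-^ (A e) (cr e m n) (ℓ∣A (pos m n le)) (ℕP.≤-reflexive (sym (cr-yes e m n le))))
        ; ω-compl = λ m m<N h → ℕP.n≢0⇒n>0 (λ ω≡0 → ℕP.<⇒≱ (rem<n (e * m) 0<N) (subst (N ≤_) (trans (cong (ω m ℕ.+_) ω≡0) (ℕP.+-identityʳ (ω m))) (ω≥N m m<N h)))
        ; κ-simple = κ-simple
        ; κ-unit = κ-unit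
        ; KM-carry = λ M m le → prod-∣ _ N e (posM M m le) e<N (∣-^ (A e) (cM e M m) (ℓ∣A (posM M m le)) (cM-pos M m le))
        ; frob-inj = λ m m<N N∣ ω≡0 → small m m<N (inj-ℓ m N∣ (rem≡0⇒∣ 0<N ω≡0))
        ; frob-carry = λ m N∣ h → ℕD.∣⇒≤ {{ℕ.>-nonZero (ℕP.*-mono-< (prime>0 pr) h)}} (frob-carry m N∣)
        }
        where
        pos : ∀ m n → N ≤ ω m + ω n → 1 ≤ e
        pos m n le = go (ω m ℕ.≟ 0)
          where
          go : Dec (ω m ≡ 0) → 1 ≤ e
          go (yes ω≡0) = ⊥-elim (ℕP.<⇒≱ (rem<n (e * n) 0<N) (subst (λ x → N ≤ x + ω n) ω≡0 le))
          go (no ω≢0)  = ω>0⇒e>0 (ℕP.n≢0⇒n>0 ω≢0)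
        posM : ∀ M m → N ≤ M * ω m → 1 ≤ e
        posM M m le = ω>0⇒e>0 (ℕP.n≢0⇒n>0 (λ ω≡0 → ℕP.<⇒≱ 0<N (subst (N ≤_) (trans (cong (M *_) ω≡0) (ℕP.*-zeroʳ M)) le)))
        κ-simple : ∀ m → m < N → 1 ≤ ω m → ∃[ c ] (κ m (N ∸ m) ≡ c * ℓ) × ¬ ℓ ∣ℕ c
        κ-simple m m<N h = go (simple e>0)
          where
          e>0 = ω>0⇒e>0 h
          f : ℕ → ℕ
          f i = A i ^ cr i m (N ∸ m)
          go : ∃[ c ] (A e ≡ c * ℓ) × ¬ ℓ ∣ℕ c → ∃[ c ] (κ m (N ∸ m) ≡ c * ℓ) × ¬ ℓ ∣ℕ c
          go (c , eq , ∤) = c * prodFrom1 (omit e f) N , (begin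
              κ m (N ∸ m)                              ≡⟨ prod-extract f N e e>0 e<N ⟩
              A e ^ cr e m (N ∸ m) * prodFrom1 (omit e f) N ≡⟨ cong (λ k → A e ^ k * prodFrom1 (omit e f) N) (cr-yes e m (N ∸ m) (ω≥N m m<N h)) ⟩
              A e * 1 * prodFrom1 (omit e f) N         ≡⟨ cong (λ a → a * 1 * prodFrom1 (omit e f) N) eq ⟩
              c * ℓ * 1 * prodFrom1 (omit e f) N       ≡⟨ solve 3 (λ c l x → c :* l :* con 1 :* x := c :* x :* l) refl c ℓ (prodFrom1 (omit e f) N) ⟩
              c * prodFrom1 (omit e f) N * ℓ           ∎) , λ d → either (euclidsLemma c _ pr d)
            where
            open ≡-Reasoning
            either : ℓ ∣ℕ c ⊎ ℓ ∣ℕ prodFrom1 (omit e f) N → ⊥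
            either (inj₁ d) = ∤ d
            either (inj₂ d) = others-prod (λ i → cr i m (N ∸ m)) d
        κ-unit : ∀ m → m < N → ω m ≡ 0 → ¬ ℓ ∣ℕ κ m (N ∸ m)
        κ-unit m m<N ω≡0 = prod-∤ _ N pr (λ i 1≤i i<N → go i 1≤i i<N (i ℕ.≟ e))
          where
          lt : ω m + ω (N ∸ m) < N
          lt = subst (λ x → x + ω (N ∸ m) < N) (sym ω≡0) (rem<n (e * (N ∸ m)) 0<N)
          go : ∀ i → 1 ≤ i → i < N → Dec (i ≡ e) → ¬ ℓ ∣ℕ A i ^ cr i m (N ∸ m)
          go i 1≤i i<N (yes refl) d = prime∤1 pr (subst (λ k → ℓ ∣ℕ A i ^ k) (cr-no i m (N ∸ m) lt) d)
          go i 1≤i i<N (no i≢e)   d = ^-∤ pr (A i) (cr i m (N ∸ m)) (others i 1≤i i<N i≢e) d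
        cM-pos : ∀ M m → N ≤ M * ω m → 1 ≤ cM e M m
        cM-pos M m le = ℕP.m<n⇒0<n∸m (quot-bound (e * (M * m)) (suc (M * E e m)) 0<N (begin
          N + M * E e m * N          ≤⟨ ℕP.+-monoˡ-≤ _ le ⟩
          M * ω m + M * E e m * N    ≡⟨ solve 4 (λ M w x n → M :* w :+ M :* x :* n := M :* (w :+ x :* n)) refl M (ω m) (E e m) N ⟩
          M * (ω m + E e m * N)      ≡⟨ cong (M *_) (im e m) ⟨
          M * (e * m)                ≡⟨ solve 3 (λ M e m → M :* (e :* m) := e :* (M :* m)) refl M e m ⟩
          e * (M * m)                ∎))
          where open ℕP.≤-Reasoning
        small : ∀ m → m < N → N ∣ℕ m → m ≡ 0
        small zero    _   _ = refl
        small (suc m) m<N d = ⊥-elim (ℕP.<⇒≱ m<N (ℕD.∣⇒≤ d))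
        frob-carry : ∀ m → N ∣ℕ ℓ * m → N ∣ℕ ℓ * ω m
        frob-carry m N∣ = ∣m+n∣n⇒∣m {m = ℓ * ω m} {n = ℓ * E e m * N} (subst (N ∣ℕ_) (begin
          e * (ℓ * m)                ≡⟨ solve 3 (λ e l m → e :* (l :* m) := l :* (e :* m)) refl e ℓ m ⟩
          ℓ * (e * m)                ≡⟨ cong (ℓ *_) (im e m) ⟩
          ℓ * (ω m + E e m * N)      ≡⟨ solve 4 (λ M w x n → M :* (w :+ x :* n) := M :* w :+ M :* x :* n) refl ℓ (ω m) (E e m) N ⟩
          ℓ * ω m + ℓ * E e m * N    ∎) (ℕD.∣n⇒∣m*n e N∣)) (ℕD.n∣m*n (ℓ * E e m))
          where open ≡-Reasoning

open ProductExponents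

*≢0 : ∀ {x y} → x ≢ + 0 → y ≢ + 0 → x ℤ.* y ≢ + 0
*≢0 {x} {y} x≢0 y≢0 e = go (ℤP.i*j≡0⇒i≡0∨j≡0 x e)
  where
  go : x ≡ + 0 ⊎ y ≡ + 0 → ⊥
  go (inj₁ h) = x≢0 h
  go (inj₂ h) = y≢0 h

pos≢0 : ∀ {n} → 0 < n → + n ≢ + 0
pos≢0 0<n e = ℕP.<⇒≢ 0<n (≡.sym (ℤP.+-injective e))

-- Integral bases in a torsion-free ring containing a root of x^N - a

record Radical (R : CommutativeRing 0ℓ 0ℓ) (N : ℕ) (a : ℤ) : Set where
  open RingTools R
  field
    0<N      : 0 < N
    tf       : TorsionFree
    θ        : Carrier
    θN       : θ ^ N ≈ ι a
    inv      : ℕ → Carrier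
    inv-spec : ∀ m → 0 < m → ι (+ m) * inv m ≈ 1#
    θfree    : ∀ (z : ℕ → ℤ) → Σ< N (λ i → ι (z i) * θ ^ i) ≈ 0# → ∀ i → i < N → z i ≡ + 0

module Triangular (R : CommutativeRing 0ℓ 0ℓ) (N : ℕ) (a : ℤ) (rad : Radical R N a) where
  open RingTools R
  open Radical rad

  cancel : ∀ {z u v} → z ≢ + 0 → ι z * u ≈ ι z * v → u ≈ v
  cancel {z} {u} {v} z≢0 e = begin
    u           ≈⟨ solve 2 (λ x y → x := (x :- y) :+ y) refl u v ⟩
    (u - v) + v ≈⟨ +-congʳ (tf z (u - v) z≢0 (trans (solve 3 (λ z x y → z :* (x :- y) := z :* x :- z :* y) refl (ι z) u v)
                     (trans (+-congʳ e) (-‿inverseʳ _)))) ⟩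
    0# + v      ≈⟨ +-identityˡ v ⟩
    v           ∎

  Zθ : Carrier → Set
  Zθ = Span (λ w → ∃[ j ] w ≈ θ ^ j)

  Zθ-θ : ∀ j → Zθ (θ ^ j)
  Zθ-θ j = gen (j , refl)

  ZθS : IsSubring Zθ
  ZθS = record { resp = span-resp ; add = span-add ; neg = span-neg
    ; mul = span-mul (λ { (i , ei) (j , ej) → gen (i ℕ.+ j , trans (*-cong ei ej) (sym (^-homo-* θ i j))) }) ; one = Zθ-θ 0 }

  T : ℕ → Carrier → Set
  T m = Span (λ w → ∃[ j ] (j < m) × (w ≈ θ ^ j))

  T-mono : ∀ {m m′} → m ≤ m′ → ∀ {w} → T m w → T m′ w
  T-mono m≤ = span-map span-resp span-zer span-add span-neg (λ { (j , j<m , e) → gen (j , ℕP.<-≤-trans j<m m≤ , e) })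

  T-θ : ∀ i {m w} → T m w → T (i ℕ.+ m) (θ ^ i * w)
  T-θ i {m} = span-mulˡ (θ ^ i) (λ { (j , j<m , e) → gen (i ℕ.+ j , ℕP.+-monoʳ-< i j<m , trans (*-congˡ e) (sym (^-homo-* θ i j))) })

  -- `B` has degree exactly `m` in `θ`, with leading coefficient `g / c`, expressed with integers
  -- only.
  record Lead (m : ℕ) (B : Carrier) : Set where
    constructor lead
    field
      c g  : ℤ
      c≢0  : c ≢ + 0
      g≢0  : g ≢ + 0
      rest : T m (ι c * B - ι g * θ ^ m)

  record Low (m : ℕ) (w : Carrier) : Set where
    constructor low
    field
      D   : ℤ
      D≢0 : D ≢ + 0
      mem : T m (ι D * w)

  low-mono : ∀ {m m′ w} → m ≤ m′ → Low m w → Low m′ w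
  low-mono m≤ (low D D≢0 t) = low D D≢0 (T-mono m≤ t)

  low-0 : ∀ {m} → Low m 0#
  low-0 = low (+ 1) (λ ()) (span-resp (sym (zeroʳ _)) span-zer)

  low-+ : ∀ {m u v} → Low m u → Low m v → Low m (u + v)
  low-+ {m} {u} {v} (low D D≢0 t) (low E E≢0 t′) = low (D ℤ.* E) (*≢0 D≢0 E≢0)
    (span-resp (trans (solve 4 (λ d e u v → e :* (d :* u) :+ d :* (e :* v) := d :* e :* (u :+ v)) refl (ι D) (ι E) u v) (*-congʳ (sym (ι-* D E))))
      (span-add (span-ι E t) (span-ι D t′)))

  low-ι : ∀ {m u} z → Low m u → Low m (ι z * u)
  low-ι {m} {u} z (low D D≢0 t) = low D D≢0 (span-resp (solve 3 (λ z d u → z :* (d :* u) := d :* (z :* u)) refl (ι z) (ι D) u) (span-ι z t))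

  lead⇒low : ∀ {m B} → Lead m B → Low (suc m) B
  lead⇒low {m} {B} (lead c g c≢0 _ r) = low c c≢0 (span-resp (solve 2 (λ x y → (x :- y) :+ y := x) refl (ι c * B) (ι g * θ ^ m))
    (span-add (T-mono (ℕP.n≤1+n m) r) (span-ι g (gen (m , ℕP.n<1+n m , refl)))))

  T-top : ∀ {m X} → m < N → T m (ι X * θ ^ m) → X ≡ + 0
  T-top {m} {X} m<N t = go (span-coords m (λ i → θ ^ i) t)
    where
    go : Σ[ z ∈ (ℕ → ℤ) ] (ι X * θ ^ m ≈ Σ< m (λ i → ι (z i) * θ ^ i)) → X ≡ + 0
    go (z , h) = ≡.trans (≡.sym (ℤP.neg-involutive X)) (≡.cong ℤ.-_ (≡.trans (≡.sym Z-m) (θfree Z sum-0 m m<N)))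
      where
      z′ Z : ℕ → ℤ
      z′ = extend m z (ℤ.- X)
      Z = extend (suc m) z′ (+ 0)
      Z-m : Z m ≡ ℤ.- X
      Z-m = ≡.trans (extend-< (suc m) z′ (+ 0) (ℕP.n<1+n m)) (extend-≥ m z (ℤ.- X) ℕP.≤-refl)
      term : ℕ → Carrier
      term i = ι (Z i) * θ ^ i
      sum-0 : Σ< N term ≈ 0#
      sum-0 = begin
        Σ< N term                                     ≡⟨ ≡.cong (λ k → Σ< k term) (ℕP.m+[n∸m]≡n m<N) ⟨
        Σ< (suc m ℕ.+ (N ∸ suc m)) term               ≈⟨ Σ-split (suc m) (N ∸ suc m) term ⟩
        (Σ< m term + term m) + Σ< (N ∸ suc m) (λ i → term (suc m ℕ.+ i))
          ≈⟨ +-cong (+-cong (Σ-cong m (λ i i<m → *-congʳ (reflexive (≡.cong ι (≡.trans (extend-< (suc m) z′ (+ 0) (ℕP.m<n⇒m<1+n i<m)) (extend-< m z (ℤ.- X) i<m))))))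
                            (*-congʳ (trans (reflexive (≡.cong ι Z-m)) (ι-neg X))))
                    (Σ-zero (N ∸ suc m) (λ i _ → trans (*-congʳ (reflexive (≡.cong ι (extend-≥ (suc m) z′ (+ 0) (ℕP.m≤m+n (suc m) i))))) (zeroˡ _))) ⟩
        (Σ< m (λ i → ι (z i) * θ ^ i) + - ι X * θ ^ m) + 0#
          ≈⟨ +-congʳ (+-congʳ (sym h)) ⟩
        (ι X * θ ^ m + - ι X * θ ^ m) + 0#
          ≈⟨ solve 2 (λ x y → (x :* y :+ (:- x) :* y) :+ con (+ 0) := con (+ 0)) refl (ι X) (θ ^ m) ⟩
        0# ∎

  -- After clearing the two denominators `c` and `D`, everything but the term in `θ ^ m` has lower
  -- degree, and `T-top` makes its coefficient `z * D * g` vanish.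
  tri-step : ∀ {m B w} z → m < N → Lead m B → Low m w → w + ι z * B ≈ 0# → z ≡ + 0
  tri-step {m} {B} {w} z m<N (lead c g c≢0 g≢0 r) (low D D≢0 t) eq = go (ℤP.i*j≡0⇒i≡0∨j≡0 (z ℤ.* D) (T-top {X = z ℤ.* D ℤ.* g} m<N top))
    where
    top : T m (ι (z ℤ.* D ℤ.* g) * θ ^ m)
    top = span-resp (begin
      - (ι (z ℤ.* D) * (ι c * B - ι g * θ ^ m)) + - (ι c * (ι D * w))
        ≈⟨ +-congʳ (-‿cong (*-congʳ (ι-* z D))) ⟩
      - (ι z * ι D * (ι c * B - ι g * θ ^ m)) + - (ι c * (ι D * w))
        ≈⟨ solve 7 (λ z d c b g y w → (:- (z :* d :* (c :* b :- g :* y))) :+ (:- (c :* (d :* w))) := z :* d :* g :* y :- c :* d :* (w :+ z :* b)) refl (ι z) (ι D) (ι c) B (ι g) (θ ^ m) w ⟩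
      ι z * ι D * ι g * θ ^ m - ι c * ι D * (w + ι z * B)
        ≈⟨ +-cong (*-congʳ (sym (trans (ι-* (z ℤ.* D) g) (*-congʳ (ι-* z D))))) (-‿cong (trans (*-congˡ eq) (zeroʳ _))) ⟩
      ι (z ℤ.* D ℤ.* g) * θ ^ m - 0#
        ≈⟨ trans (+-congˡ -0#≈0#) (+-identityʳ _) ⟩
      ι (z ℤ.* D ℤ.* g) * θ ^ m ∎) (span-add (span-neg (span-ι (z ℤ.* D) r)) (span-neg (span-ι c t)))
    go : z ℤ.* D ≡ + 0 ⊎ g ≡ + 0 → z ≡ + 0
    go (inj₂ g≡0) = ⊥-elim (g≢0 g≡0)
    go (inj₁ zD≡0) = go′ (ℤP.i*j≡0⇒i≡0∨j≡0 z zD≡0)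
      where
      go′ : z ≡ + 0 ⊎ D ≡ + 0 → z ≡ + 0
      go′ (inj₁ h) = h
      go′ (inj₂ h) = ⊥-elim (D≢0 h)

  low-Σ : ∀ n {f : ℕ → Carrier} {m} → (∀ i → i < n → Low m (f i)) → Low m (Σ< n f)
  low-Σ zero    h = low-0
  low-Σ (suc n) h = low-+ (low-Σ n (λ i i<n → h i (ℕP.m<n⇒m<1+n i<n))) (h n (ℕP.n<1+n n))

  tri-indep : ∀ n (B : ℕ → Carrier) (z : ℕ → ℤ) → n ≤ N → (∀ m → m < n → Lead m (B m)) →
    Σ< n (λ i → ι (z i) * B i) ≈ 0# → ∀ i → i < n → z i ≡ + 0
  tri-indep (suc n) B z n<N leads eq i i<1+n = go (ℕP.m≤n⇒m<n∨m≡n (ℕP.<⇒≤pred i<1+n))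
    where
    zn : z n ≡ + 0
    zn = tri-step (z n) n<N (leads n (ℕP.n<1+n n)) (low-Σ n (λ i i<n → low-ι (z i) (low-mono i<n (lead⇒low (leads i (ℕP.m<n⇒m<1+n i<n)))))) eq
    ih : ∀ i → i < n → z i ≡ + 0
    ih = tri-indep n B z (ℕP.<⇒≤ n<N) (λ m m<n → leads m (ℕP.m<n⇒m<1+n m<n))
           (trans (sym (trans (+-congˡ (trans (*-congʳ (reflexive (≡.cong ι zn))) (zeroˡ _))) (+-identityʳ _))) eq)
    go : i < n ⊎ i ≡ n → z i ≡ + 0
    go (inj₁ i<n) = ih i i<n
    go (inj₂ i≡n) = ≡.trans (≡.cong z i≡n) zn

-- The monomials θ^m / C_m and the lattice they span

module MonomialPart (R : CommutativeRing 0ℓ 0ℓ) (N : ℕ) (a : ℤ) (rad : Radical R N a)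
    (A : ℕ → ℕ) (A≥1 : ∀ i → 1 ≤ i → i < N → 1 ≤ A i)
    (σ : ℤ) (a≡ : a ≡ σ ℤ.* + prodFrom1 (λ i → A i ℕ.^ i) N) where
  open RingTools R
  open Radical rad
  open Triangular R N a rad
  open Exponents N 0<N A

  C>0 : ∀ m → 0 < Cₘ m
  C>0 = C-pos A≥1

  t : ℕ → Carrier
  t m = inv (Cₘ m) * θ ^ m

  tC : ∀ m → ι (+ Cₘ m) * t m ≈ θ ^ m
  tC m = trans (sym (*-assoc _ _ _)) (trans (*-congʳ (inv-spec (Cₘ m) (C>0 m))) (*-identityˡ _))

  C≢0 : ∀ m → + Cₘ m ≢ + 0
  C≢0 m = pos≢0 (C>0 m)

  t0 : t 0 ≈ 1#
  t0 = trans (sym (*-identityˡ _)) (trans (*-congʳ (reflexive (≡.cong ιℕ (≡.sym C-0)))) (tC 0))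

  tt : ∀ m n → t m * t n ≈ ι (+ κ m n) * t (m ℕ.+ n)
  tt m n = cancel (C≢0 m) (cancel (C≢0 n) (begin
    ι (+ Cₘ n) * (ι (+ Cₘ m) * (t m * t n))    ≈⟨ solve 4 (λ a b t u → b :* (a :* (t :* u)) := a :* t :* (b :* u)) refl (ι (+ Cₘ m)) (ι (+ Cₘ n)) (t m) (t n) ⟩
    ι (+ Cₘ m) * t m * (ι (+ Cₘ n) * t n)      ≈⟨ trans (*-cong (tC m) (tC n)) (sym (^-homo-* θ m n)) ⟩
    θ ^ (m ℕ.+ n)                              ≈⟨ tC (m ℕ.+ n) ⟨
    ι (+ Cₘ (m ℕ.+ n)) * t (m ℕ.+ n)           ≈⟨ *-congʳ (trans (reflexive (≡.cong ιℕ (C-add m n))) (trans (ιℕ-* (κ m n) _) (*-congˡ (ιℕ-* (Cₘ m) (Cₘ n))))) ⟩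
    ιℕ (κ m n) * (ιℕ (Cₘ m) * ιℕ (Cₘ n)) * t (m ℕ.+ n)
      ≈⟨ solve 4 (λ k a b t → k :* (a :* b) :* t := b :* (a :* (k :* t))) refl (ιℕ (κ m n)) (ιℕ (Cₘ m)) (ιℕ (Cₘ n)) (t (m ℕ.+ n)) ⟩
    ι (+ Cₘ n) * (ι (+ Cₘ m) * (ι (+ κ m n) * t (m ℕ.+ n))) ∎))

  P : ℕ
  P = prodFrom1 (λ i → A i ℕ.^ i) N

  P≢0 : + P ≢ + 0
  P≢0 = pos≢0 (prod-pos _ N (λ i 1≤i i<N → ℕP.m^n>0 (A i) {{ℕ.>-nonZero (A≥1 i 1≤i i<N)}} i))

  -- Passing from `m` to `m + N` multiplies `θ ^ m` by `a` and `Cₘ m` by the absolute value of `a`,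
  -- so only the sign `σ` is left.
  tN : ∀ m → t (m ℕ.+ N) ≈ ι σ * t m
  tN m = cancel P≢0 (cancel (C≢0 m) (begin
    ι (+ Cₘ m) * (ι (+ P) * t (m ℕ.+ N))     ≈⟨ solve 3 (λ c p t → c :* (p :* t) := p :* c :* t) refl (ι (+ Cₘ m)) (ι (+ P)) (t (m ℕ.+ N)) ⟩
    ι (+ P) * ι (+ Cₘ m) * t (m ℕ.+ N)       ≈⟨ *-congʳ (trans (sym (ιℕ-* P (Cₘ m))) (reflexive (≡.cong ιℕ (≡.sym (C-N m))))) ⟩
    ι (+ Cₘ (m ℕ.+ N)) * t (m ℕ.+ N)         ≈⟨ trans (tC (m ℕ.+ N)) (trans (^-homo-* θ m N) (*-cong (sym (tC m)) θN)) ⟩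
    ι (+ Cₘ m) * t m * ι a                   ≈⟨ *-congˡ (trans (reflexive (≡.cong ι a≡)) (ι-* σ (+ P))) ⟩
    ι (+ Cₘ m) * t m * (ι σ * ι (+ P))       ≈⟨ solve 4 (λ c t s p → c :* t :* (s :* p) := c :* (p :* (s :* t))) refl (ι (+ Cₘ m)) (t m) (ι σ) (ι (+ P)) ⟩
    ι (+ Cₘ m) * (ι (+ P) * (ι σ * t m))     ∎))

  tpow : ∀ M m → t m ^ M ≈ ι (+ KM M m) * t (M ℕ.* m)
  tpow M m = cancel (pos≢0 {Cₘ m ℕ.^ M} (ℕP.m^n>0 (Cₘ m) {{ℕ.>-nonZero (C>0 m)}} M)) (begin
    ι (+ (Cₘ m ℕ.^ M)) * t m ^ M         ≈⟨ *-congʳ (ιℕ-^ (Cₘ m) M) ⟩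
    ιℕ (Cₘ m) ^ M * t m ^ M              ≈⟨ ^-distrib-* (ιℕ (Cₘ m)) (t m) M ⟨
    (ιℕ (Cₘ m) * t m) ^ M                ≈⟨ trans (^-congˡ M (tC m)) (trans (^-assocʳ θ m M) (^-congʳ θ (ℕP.*-comm m M))) ⟩
    θ ^ (M ℕ.* m)                        ≈⟨ tC (M ℕ.* m) ⟨
    ι (+ Cₘ (M ℕ.* m)) * t (M ℕ.* m)     ≈⟨ *-congʳ (trans (reflexive (≡.cong ιℕ (C-mul M m))) (ιℕ-* (KM M m) (Cₘ m ℕ.^ M))) ⟩
    ιℕ (KM M m) * ιℕ (Cₘ m ℕ.^ M) * t (M ℕ.* m)
      ≈⟨ solve 3 (λ k c t → k :* c :* t := c :* (k :* t)) refl (ιℕ (KM M m)) (ιℕ (Cₘ m ℕ.^ M)) (t (M ℕ.* m)) ⟩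
    ι (+ (Cₘ m ℕ.^ M)) * (ι (+ KM M m) * t (M ℕ.* m)) ∎)

  lead-t : ∀ m → Lead m (t m)
  lead-t m = lead (+ Cₘ m) (+ 1) (C≢0 m) (λ ()) (span-resp (sym (trans (+-cong (tC m) (-‿cong (*-identityˡ _))) (-‿inverseʳ _))) span-zer)

  t-free : ∀ z → Σ< N (λ i → ι (z i) * t i) ≈ 0# → ∀ i → i < N → z i ≡ + 0
  t-free z = tri-indep N t z ℕP.≤-refl (λ m _ → lead-t m)

  module MO = MonomialOrder R N 0<N t κ KM σ t0 tt tN
  open MO public using () renaming (O to Om; OS to OmS; Ot to Omt; coords to Om-coords)

  Zθ⊂Om : ∀ {w} → Zθ w → Om w
  Zθ⊂Om = span-map span-resp span-zer span-add span-neg (λ { (j , e) → span-resp (trans (tC j) (sym e)) (span-ι (+ Cₘ j) (Omt j)) })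

  -- A common denominator over ℤ[θ] of `t 0` up to `t (m - 1)`.
  Cs : ℕ → ℕ
  Cs zero    = 1
  Cs (suc m) = Cs m ℕ.* Cₘ m

  Cs>0 : ∀ m → 0 < Cs m
  Cs>0 zero    = s≤s z≤n
  Cs>0 (suc m) = ℕP.*-mono-< (Cs>0 m) (C>0 m)

  Cs-t : ∀ k i → i < k → Zθ (ι (+ Cs k) * t i)
  Cs-t (suc k) i i<1+k = go (ℕP.m≤n⇒m<n∨m≡n (ℕP.<⇒≤pred i<1+k))
    where
    go : i < k ⊎ i ≡ k → Zθ (ι (+ Cs (suc k)) * t i)
    go (inj₁ i<k) = IsSubring.scale-l ZθS (Cs k) (Cₘ k) (Cs-t k i i<k)
    go (inj₂ ≡.refl) = IsSubring.scale-r ZθS (Cs k) (Cₘ k) (span-resp (sym (tC k)) (Zθ-θ k))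

  Om⇒Zθ : ∀ {w} → Om w → Zθ (ι (+ Cs N) * w)
  Om⇒Zθ ow = go (Om-coords ow)
    where
    go : ∀ {w} → Σ[ z ∈ (ℕ → ℤ) ] (w ≈ Σ< N (λ i → ι (z i) * t i)) → Zθ (ι (+ Cs N) * w)
    go (z , h) = span-resp (sym (trans (*-congˡ h) (trans (Σ-*ˡ N _ _) (Σ-cong N (λ i _ → solve 3 (λ c z t → c :* (z :* t) := z :* (c :* t)) refl (ι (+ Cs N)) (ι (z i)) (t i))))))
      (span-sum N {λ i → ι (z i) * (ι (+ Cs N) * t i)} (λ i i<N → span-ι (z i) (Cs-t N i i<N)))

  AI-Om : ∀ {w} → Om w → AI Zθ w
  AI-Om ow = AI-change (ℕ.pred (Cs N)) span-resp
    (λ {u} ou → ≡.subst (λ m → Zθ (ιℕ m * u)) (≡.sym (ℕP.suc-pred (Cs N) {{ℕ.>-nonZero (Cs>0 N)}})) (Om⇒Zθ ou)) (AlmostIntegral.AI-sub OmS ow)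

  module At (ℓ : ℕ) (pr : Prime ℓ) (σ∤ : ¬ + ℓ ∣ℤ σ) (e : ℕ) (e<N : e < N)
      (others : ∀ i → 1 ≤ i → i < N → i ≢ e → ¬ ℓ ∣ℕ A i)
      (simple : 1 ≤ e → ∃[ c ] (A e ≡ c ℕ.* ℓ) × ¬ ℓ ∣ℕ c)
      (inj-ℓ : ∀ m → N ∣ℕ ℓ ℕ.* m → N ∣ℕ e ℕ.* m → N ∣ℕ m) where

    local : ∀ {α} → AI Zθ α → ∃[ D ] (¬ ℓ ∣ℕ D) × Om (ι (+ D) * α)
    local ai = PrimeLocal.localise OmS tf pr (MO.Maximality.maximal pr tf σ∤ (weights pr e e<N others simple inj-ℓ) tpow t-free)
      (AI-change 0 span-resp (λ zw → span-resp (sym (*-identityˡ _)) (Zθ⊂Om zw)) ai)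

  ⟨t⟩ : Carrier → Set
  ⟨t⟩ = Span (λ w → ∃[ j ] (j < N) × (w ≈ t j))

  Om⇒⟨t⟩ : ∀ {w} → Om w → ⟨t⟩ w
  Om⇒⟨t⟩ ow = go (Om-coords ow)
    where
    go : ∀ {w} → Σ[ z ∈ (ℕ → ℤ) ] (w ≈ Σ< N (λ i → ι (z i) * t i)) → ⟨t⟩ w
    go (z , h) = span-resp (sym h) (span-sum N {λ i → ι (z i) * t i} (λ i i<N → span-ι (z i) (gen (i , i<N , refl))))

  integral⇒⟨t⟩ : (∀ ℓ → Prime ℓ → ∀ {α} → AI Zθ α → ∃[ D ] (¬ ℓ ∣ℕ D) × Om (ι (+ D) * α)) → ∀ {α} → AI Zθ α → ⟨t⟩ α
  integral⇒⟨t⟩ local {α} ai@(D , h) = span-globalise (suc D) (s≤s z≤n) (span-resp (*-congˡ (*-identityʳ α)) (Om⇒⟨t⟩ (Zθ⊂Om (h 1))))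
    (λ ℓ pr → go (local ℓ pr ai))
    where
    go : ∀ {ℓ} → ∃[ D ] (¬ ℓ ∣ℕ D) × Om (ι (+ D) * α) → ∃[ D ] (¬ ℓ ∣ℕ D) × ⟨t⟩ (ι (+ D) * α)
    go (D′ , ∤ , o) = D′ , ∤ , Om⇒⟨t⟩ o

-- The elements e_k in the pure extension: relations, degrees and independence

module PPart (R : CommutativeRing 0ℓ 0ℓ) (p s : ℕ) (pr : Prime p) (a : ℤ) (rad : Radical R (p ℕ.^ s) a)
    (aa : ℤ) (aa≢0 : aa ≢ + 0) (d : ℕ) (d≤s : d ≤ s) (c : ℤ) (p∤c : d < s → ¬ + p ∣ℤ c)
    (norm : aa ℤ.^ (p ℕ.^ s) ℤ.* a ≡ + 1 ℤ.+ + (p ℕ.^ suc d) ℤ.* c) where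
  open RingTools R
  open Geometric R
  open Radical rad
  open Triangular R (p ℕ.^ s) a rad

  N : ℕ
  N = p ℕ.^ s

  x : Carrier
  x = ι aa * θ

  q : ℕ → ℕ
  q k = p ℕ.^ (s ∸ k)

  e : ℕ → Carrier
  e k = inv (p ℕ.^ k) * geo (p ℕ.^ k) (x ^ q k)

  p^>0 : ∀ k → 0 < p ℕ.^ k
  p^>0 k = ℕP.m^n>0 p {{ℕ.>-nonZero (prime>0 pr)}} k

  p^≢0 : ∀ k → + (p ℕ.^ k) ≢ + 0
  p^≢0 k = pos≢0 (p^>0 k)

  pe : ∀ k → ι (+ (p ℕ.^ k)) * e k ≈ geo (p ℕ.^ k) (x ^ q k)
  pe k = trans (sym (*-assoc _ _ _)) (trans (*-congʳ (inv-spec (p ℕ.^ k) (p^>0 k))) (*-identityˡ _))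

  x^ : ∀ l → x ^ l ≈ ι (aa ℤ.^ l) * θ ^ l
  x^ l = trans (^-distrib-* (ι aa) θ l) (*-congʳ (sym (ι-^ aa l)))

  xN : x ^ N ≈ 1# + ι (+ (p ℕ.^ suc d) ℤ.* c)
  xN = begin
    x ^ N                              ≈⟨ trans (x^ N) (*-congˡ θN) ⟩
    ι (aa ℤ.^ N) * ι a                 ≈⟨ ι-* (aa ℤ.^ N) a ⟨
    ι (aa ℤ.^ N ℤ.* a)                 ≡⟨ ≡.cong ι norm ⟩
    ι (+ 1 ℤ.+ + (p ℕ.^ suc d) ℤ.* c)  ≈⟨ ι-+ (+ 1) (+ (p ℕ.^ suc d) ℤ.* c) ⟩
    1# + ι (+ (p ℕ.^ suc d) ℤ.* c)     ∎

  e0 : e 0 ≈ 1#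
  e0 = trans (*-comm _ _) (trans (*-congʳ (+-identityˡ 1#)) (inv-spec 1 (s≤s z≤n)))

  geo-mul : ∀ m n y → geo (n ℕ.* m) y ≈ geo m y * geo n (y ^ m)
  geo-mul m zero    y = sym (zeroʳ _)
  geo-mul m (suc n) y = begin
    geo (m ℕ.+ n ℕ.* m) y                                 ≡⟨ ≡.cong (λ k → geo k y) (ℕP.+-comm m (n ℕ.* m)) ⟩
    geo (n ℕ.* m ℕ.+ m) y                                 ≈⟨ Σ-split (n ℕ.* m) m (λ i → y ^ i) ⟩
    geo (n ℕ.* m) y + Σ< m (λ i → y ^ (n ℕ.* m ℕ.+ i))    ≈⟨ +-cong (geo-mul m n y) (trans (Σ-cong m (λ i _ → ^-homo-* y (n ℕ.* m) i)) (sym (Σ-*ˡ m (y ^ (n ℕ.* m)) (λ i → y ^ i)))) ⟩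
    geo m y * geo n (y ^ m) + y ^ (n ℕ.* m) * geo m y     ≈⟨ +-congˡ (trans (*-comm _ _) (*-congˡ (trans (^-congʳ y (ℕP.*-comm n m)) (sym (^-assocʳ y m n))))) ⟩
    geo m y * geo n (y ^ m) + geo m y * (y ^ m) ^ n       ≈⟨ distribˡ _ _ _ ⟨
    geo m y * geo (suc n) (y ^ m)                         ∎

  q-suc : ∀ k → k < s → q k ≡ q (suc k) ℕ.* p
  q-suc k k<s = ≡.trans (≡.cong (p ℕ.^_) (ℕP.+-∸-assoc 1 k<s)) (ℕP.*-comm p (q (suc k)))

  eS : ∀ k → k < d → ι (+ p) * e (suc k) ≈ geo p (x ^ q (suc k)) * e k
  eS k k<d = cancel (p^≢0 k) (begin
    ι (+ (p ℕ.^ k)) * (ι (+ p) * e (suc k))        ≈⟨ solve 3 (λ a b e → a :* (b :* e) := b :* a :* e) refl (ι (+ (p ℕ.^ k))) (ι (+ p)) (e (suc k)) ⟩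
    ι (+ p) * ι (+ (p ℕ.^ k)) * e (suc k)          ≈⟨ *-congʳ (ιℕ-* p (p ℕ.^ k)) ⟨
    ι (+ (p ℕ.^ suc k)) * e (suc k)                ≈⟨ pe (suc k) ⟩
    geo (p ℕ.^ suc k) y                            ≡⟨ ≡.cong (λ m → geo m y) (ℕP.*-comm p (p ℕ.^ k)) ⟩
    geo (p ℕ.^ k ℕ.* p) y                          ≈⟨ geo-mul p (p ℕ.^ k) y ⟩
    geo p y * geo (p ℕ.^ k) (y ^ p)                ≈⟨ *-congˡ (geo-cong (p ℕ.^ k) (trans (^-assocʳ x (q (suc k)) p) (^-congʳ x (≡.sym (q-suc k (ℕP.<-≤-trans k<d d≤s)))))) ⟩
    geo p y * geo (p ℕ.^ k) (x ^ q k)              ≈⟨ *-congˡ (pe k) ⟨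
    geo p y * (ι (+ (p ℕ.^ k)) * e k)              ≈⟨ solve 3 (λ g a e → g :* (a :* e) := a :* (g :* e)) refl (geo p y) (ι (+ (p ℕ.^ k))) (e k) ⟩
    ι (+ (p ℕ.^ k)) * (geo p y * e k)              ∎)
    where
    y = x ^ q (suc k)

  open POrderData R p s d x e using (n; n-<; n-d; π; RS)

  T-x : ∀ l {m w} → T m w → T (l ℕ.+ m) (x ^ l * w)
  T-x l {m} {w} t = span-resp (trans (sym (*-assoc _ _ _)) (*-congʳ (sym (x^ l)))) (span-ι (aa ℤ.^ l) (T-θ l t))

  T-x^ : ∀ {l m} → l < m → T m (x ^ l)
  T-x^ {l} l<m = span-resp (sym (x^ l)) (span-ι (aa ℤ.^ l) (gen (l , l<m , refl)))

  T-mul : ∀ {i j u v} → T i u → T j v → T (i ℕ.+ j) (u * v)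
  T-mul = span-mul (λ { (k , k< , ek) (l , l< , el) → gen (k ℕ.+ l , ℕP.+-mono-< k< l< , trans (*-cong ek el) (sym (^-homo-* θ k l))) })

  π-lead : ∀ j → Σ[ r ∈ Carrier ] T j r × (π ^ j ≈ x ^ j + r)
  π-lead zero = 0# , span-zer , sym (+-identityʳ 1#)
  π-lead (suc j) = go (π-lead j)
    where
    go : Σ[ r ∈ Carrier ] T j r × (π ^ j ≈ x ^ j + r) → Σ[ r ∈ Carrier ] T (suc j) r × (π ^ suc j ≈ x ^ suc j + r)
    go (r , t , h) = x ^ 1 * r - x ^ j - r ,
      span-add (span-add (T-x 1 t) (span-neg (T-x^ (ℕP.n<1+n j)))) (span-neg (T-mono (ℕP.n≤1+n j) t)) ,
      trans (*-congˡ h) (solve 3 (λ x y r → (x :- con (+ 1)) :* (y :+ r) := x :* y :+ (x :* con (+ 1) :* r :- y :- r)) refl x (x ^ j) r)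

  -- The degree of `e k` in `θ`. For `k ≤ s` it equals `N ∸ q k`, which is the threshold in the
  -- definition of `k_m`.
  off : ℕ → ℕ
  off k = q k ℕ.* (p ℕ.^ k ∸ 1)

  lead-πe : ∀ k j → Lead (j ℕ.+ off k) (π ^ j * e k)
  lead-πe k j = lead (+ (p ℕ.^ k)) (aa ℤ.^ m) (p^≢0 k) (^≢0 m) (go (π-lead j))
    where
    m = j ℕ.+ off k
    Q = p ℕ.^ k ∸ 1
    y = x ^ q k
    ^≢0 : ∀ m → aa ℤ.^ m ≢ + 0
    ^≢0 zero    ()
    ^≢0 (suc m) = *≢0 aa≢0 (^≢0 m)
    y^ : ∀ i → y ^ i ≈ x ^ (q k ℕ.* i)
    y^ i = ^-assocʳ x (q k) i
    geo-top : geo (p ℕ.^ k) y ≈ geo Q y + x ^ off k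
    geo-top = trans (reflexive (≡.cong (λ m → geo m y) (≡.sym (ℕP.suc-pred (p ℕ.^ k) {{ℕ.>-nonZero (p^>0 k)}})))) (+-congˡ (y^ Q))
    T-geo : T (off k) (geo Q y)
    T-geo = span-sum Q {λ i → y ^ i} (λ i i<Q → span-resp (sym (y^ i)) (T-x^ (ℕP.*-monoʳ-< (q k) {{ℕ.>-nonZero (p^>0 (s ∸ k))}} i<Q)))
    go : Σ[ r ∈ Carrier ] T j r × (π ^ j ≈ x ^ j + r) → T m (ι (+ (p ℕ.^ k)) * (π ^ j * e k) - ι (aa ℤ.^ m) * θ ^ m)
    go (r , t , h) = span-resp (begin
        x ^ j * geo Q y + r * geo Q y + x ^ off k * r
          ≈⟨ solve 4 (λ xj g r xs → xj :* g :+ r :* g :+ xs :* r := (xj :+ r) :* (g :+ xs) :- xj :* xs) refl (x ^ j) (geo Q y) r (x ^ off k) ⟩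
        (x ^ j + r) * (geo Q y + x ^ off k) - x ^ j * x ^ off k
          ≈⟨ +-cong (*-cong (sym h) (trans (sym geo-top) (sym (pe k)))) (-‿cong (trans (sym (^-homo-* x j (off k))) (x^ m))) ⟩
        π ^ j * (ι (+ (p ℕ.^ k)) * e k) - ι (aa ℤ.^ m) * θ ^ m
          ≈⟨ +-congʳ (solve 3 (λ y a e → y :* (a :* e) := a :* (y :* e)) refl (π ^ j) (ι (+ (p ℕ.^ k))) (e k)) ⟩
        ι (+ (p ℕ.^ k)) * (π ^ j * e k) - ι (aa ℤ.^ m) * θ ^ m ∎)
      (span-add (span-add (T-x j T-geo) (T-mul t T-geo)) (T-mono (ℕP.≤-reflexive (ℕP.+-comm (off k) j)) (T-x (off k) t)))

  N≡ : ∀ k → k ≤ s → N ≡ q k ℕ.* p ℕ.^ k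
  N≡ k k≤s = ≡.trans (≡.cong (p ℕ.^_) (≡.sym (ℕP.m∸n+n≡m k≤s))) (ℕP.^-distribˡ-+-* p (s ∸ k) k)

  off+q : ∀ k → k ≤ s → off k ℕ.+ q k ≡ N
  off+q k k≤s = ≡.trans (≡.trans (ℕP.+-comm (off k) (q k)) (≡.sym (ℕP.*-suc (q k) (p ℕ.^ k ∸ 1))))
    (≡.trans (≡.cong (q k ℕ.*_) (ℕP.suc-pred (p ℕ.^ k) {{ℕ.>-nonZero (p^>0 k)}})) (≡.sym (N≡ k k≤s)))

  off-suc : ∀ k → k < d → off k ℕ.+ n k ≡ off (suc k)
  off-suc k k<d = ℕP.+-cancelʳ-≡ (q (suc k)) (off k ℕ.+ n k) (off (suc k))
    (≡.trans (ℕP.+-assoc (off k) (n k) (q (suc k)))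
    (≡.trans (≡.cong (λ m → off k ℕ.+ (m ℕ.+ q (suc k))) (n-< k<d))
    (≡.trans (≡.cong (off k ℕ.+_) q-split)
    (≡.trans (off+q k (ℕP.<⇒≤ k<s)) (≡.sym (off+q (suc k) k<s))))))
    where
    k<s = ℕP.<-≤-trans k<d d≤s
    q-split : (p ∸ 1) ℕ.* q (suc k) ℕ.+ q (suc k) ≡ q k
    q-split = ≡.trans (ℕP.+-comm _ (q (suc k))) (≡.trans (≡.cong (ℕ._* q (suc k)) (ℕP.suc-pred p {{ℕ.>-nonZero (prime>0 pr)}}))
                (≡.trans (ℕP.*-comm p (q (suc k))) (≡.sym (q-suc k k<s))))

  off-d : off d ℕ.+ n d ≡ N
  off-d = ≡.trans (≡.cong (off d ℕ.+_) n-d) (off+q d d≤s)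

  off-mono : ∀ k l → k ≤ l → l ≤ d → off k ≤ off l
  off-mono k zero    z≤n _ = ℕP.≤-refl
  off-mono k (suc l) k≤1+l l<d = go (ℕP.m≤n⇒m<n∨m≡n k≤1+l)
    where
    go : k < suc l ⊎ k ≡ suc l → off k ≤ off (suc l)
    go (inj₁ k≤l) = ℕP.≤-trans (off-mono k l (ℕP.<⇒≤pred k≤l) (ℕP.<⇒≤ l<d)) (ℕP.≤-trans (ℕP.m≤m+n (off l) (n l)) (ℕP.≤-reflexive (off-suc l l<d)))
    go (inj₂ ≡.refl) = ℕP.≤-refl

  off-end : ∀ k → k ≤ d → off k ℕ.+ n k ≤ N
  off-end k k≤d = go (ℕP.m≤n⇒m<n∨m≡n k≤d)
    where
    go : k < d ⊎ k ≡ d → off k ℕ.+ n k ≤ N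
    go (inj₁ k<d) = ℕP.≤-trans (ℕP.≤-reflexive (off-suc k k<d)) (ℕP.≤-trans (ℕP.m≤m+n _ _) (ℕP.≤-reflexive (off+q (suc k) (ℕP.<-≤-trans k<d d≤s))))
    go (inj₂ ≡.refl) = ℕP.≤-reflexive off-d

  block : (ℕ → ℕ → ℤ) → ℕ → ℕ → Carrier
  block z k J = Σ< J (λ j → ι (z k j) * (π ^ j * e k))

  low-term : ∀ (z : ℕ → ℕ → ℤ) k j {M} → suc (j ℕ.+ off k) ≤ M → Low M (ι (z k j) * (π ^ j * e k))
  low-term z k j le = low-ι (z k j) (low-mono le (lead⇒low (lead-πe k j)))

  low-block : ∀ z k J → k ≤ d → Low (off k ℕ.+ J) (block z k J)
  low-block z k J k≤d = low-Σ J (λ j j<J → low-term z k j (≡.subst (suc (j ℕ.+ off k) ≤_) (ℕP.+-comm J (off k)) (ℕP.+-monoˡ-≤ (off k) j<J)))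

  low-blocks : ∀ z K → K ≤ d → Low (off K) (Σ< K (λ k → block z k (n k)))
  low-blocks z K K≤d = low-Σ K (λ k k<K → low-mono (ℕP.≤-trans (ℕP.≤-reflexive (off-suc k (ℕP.<-≤-trans k<K K≤d))) (off-mono (suc k) K k<K K≤d))
                                    (low-block z k (n k) (ℕP.<⇒≤ (ℕP.<-≤-trans k<K K≤d))))

  -- The first `K` blocks and the first `J` elements of block `K` have the degrees from 0 to
  -- `off K + J - 1`, each once. The element of highest degree is eliminated first.
  indep : ∀ (z : ℕ → ℕ → ℤ) K J → K ≤ d → J ≤ n K → Σ< K (λ k → block z k (n k)) + block z K J ≈ 0# →
    (∀ k j → k < K → j < n k → z k j ≡ + 0) × (∀ j → j < J → z K j ≡ + 0)
  indep z zero    zero    K≤d J≤n eq = (λ k j ()) , (λ j ())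
  indep z (suc K) zero    K≤d J≤n eq = go (indep z K (n K) (ℕP.<⇒≤ K≤d) ℕP.≤-refl (trans (sym (+-identityʳ _)) eq))
    where
    go : (∀ k j → k < K → j < n k → z k j ≡ + 0) × (∀ j → j < n K → z K j ≡ + 0) →
         (∀ k j → k < suc K → j < n k → z k j ≡ + 0) × (∀ j → j < 0 → z (suc K) j ≡ + 0)
    go (h , h′) = (λ k j k<1+K → by k j (ℕP.m≤n⇒m<n∨m≡n (ℕP.<⇒≤pred k<1+K))) , (λ j ())
      where
      by : ∀ k j → k < K ⊎ k ≡ K → j < n k → z k j ≡ + 0
      by k j (inj₁ k<K) = h k j k<K
      by k j (inj₂ ≡.refl) = h′ j
  indep z K (suc J) K≤d J<n eq = go (indep z K J K≤d (ℕP.<⇒≤ J<n) (trans (+-congˡ (sym (trans (+-congˡ (trans (*-congʳ (reflexive (≡.cong ι zJ))) (zeroˡ _))) (+-identityʳ _)))) eq))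
    where
    deg : off K ℕ.+ J ≡ J ℕ.+ off K
    deg = ℕP.+-comm (off K) J
    zJ : z K J ≡ + 0
    zJ = tri-step (z K J) (ℕP.<-≤-trans (≡.subst (_< off K ℕ.+ n K) deg (ℕP.+-monoʳ-< (off K) J<n)) (off-end K K≤d)) (lead-πe K J)
      (low-mono (ℕP.≤-reflexive deg) (low-+ (low-mono (ℕP.m≤m+n (off K) J) (low-blocks z K K≤d)) (low-block z K J K≤d)))
      (trans (+-assoc _ _ _) eq)
    go : (∀ k j → k < K → j < n k → z k j ≡ + 0) × (∀ j → j < J → z K j ≡ + 0) →
         (∀ k j → k < K → j < n k → z k j ≡ + 0) × (∀ j → j < suc J → z K j ≡ + 0)
    go (h , h′) = h , λ j j<1+J → by j (ℕP.m≤n⇒m<n∨m≡n (ℕP.<⇒≤pred j<1+J))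
      where
      by : ∀ j → j < J ⊎ j ≡ J → z K j ≡ + 0
      by j (inj₁ j<J) = h′ j j<J
      by j (inj₂ ≡.refl) = zJ

  free : ∀ z → RS z ≈ 0# → ∀ k j → k ≤ d → j < n k → z k j ≡ + 0
  free z eq k j k≤d j<n = go (indep z d (n d) ℕP.≤-refl ℕP.≤-refl eq) (ℕP.m≤n⇒m<n∨m≡n k≤d)
    where
    go : (∀ k j → k < d → j < n k → z k j ≡ + 0) × (∀ j → j < n d → z d j ≡ + 0) → k < d ⊎ k ≡ d → z k j ≡ + 0
    go (h , h′) (inj₁ k<d) = h k j k<d j<n
    go (h , h′) (inj₂ k≡d) = ≡.trans (≡.cong (λ k → z k j) k≡d) (h′ j (≡.subst (λ k → j < n k) k≡d j<n))

  module PO = POrder R p s d x e tf pr d≤s c p∤c xN e0 eS free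
  open PO using (OS; coords; Oe; ZxO) renaming (O to Op) public

  Op-abs : ∀ z {w} → Op (ι z * w) → Op (ι (+ ℤ.∣ z ∣) * w)
  Op-abs (+ _)    o = o
  Op-abs -[1+ m ] o = span-resp (trans (-‿distribˡ-* _ _) (*-congʳ (-‿involutive _))) (span-neg o)

  θ-mod : ∀ r Q → θ ^ (r ℕ.+ Q ℕ.* N) ≈ ι (a ℤ.^ Q) * θ ^ r
  θ-mod r Q = begin
    θ ^ (r ℕ.+ Q ℕ.* N)      ≈⟨ ^-homo-* θ r (Q ℕ.* N) ⟩
    θ ^ r * θ ^ (Q ℕ.* N)    ≈⟨ *-congˡ (trans (^-congʳ θ (ℕP.*-comm Q N)) (trans (sym (^-assocʳ θ N Q)) (^-congˡ Q θN))) ⟩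
    θ ^ r * ι a ^ Q          ≈⟨ trans (*-comm _ _) (*-congʳ (sym (ι-^ a Q))) ⟩
    ι (a ℤ.^ Q) * θ ^ r      ∎

  -- `O` contains `x` rather than `θ`. Reducing the exponent modulo `N` first makes the multiplier
  -- `aa ^ N` independent of `j`, as `AI-change` requires.
  Op-θ : ∀ j → Op (ι (aa ℤ.^ N) * θ ^ j)
  Op-θ j = span-resp (*-congˡ (sym eq)) (span-resp (solve 3 (λ a b c → b :* (a :* c) := a :* (b :* c)) refl (ι (aa ℤ.^ N)) (ι (a ℤ.^ Q)) (θ ^ r)) (span-ι (a ℤ.^ Q) small))
    where
    instance
      N≢0 : ℕ.NonZero N
      N≢0 = ℕ.>-nonZero 0<N
    Q = j ℕ./ N
    r = j ℕ.% N
    eq : θ ^ j ≈ ι (a ℤ.^ Q) * θ ^ r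
    eq = trans (reflexive (≡.cong (θ ^_) (DM.m≡m%n+[m/n]*n j N))) (θ-mod r Q)
    r≤N : r ≤ N
    r≤N = ℕP.<⇒≤ (DM.m%n<n j N)
    small : Op (ι (aa ℤ.^ N) * θ ^ r)
    small = span-resp (begin
      ι (aa ℤ.^ (N ∸ r)) * x ^ r                  ≈⟨ *-congˡ (x^ r) ⟩
      ι (aa ℤ.^ (N ∸ r)) * (ι (aa ℤ.^ r) * θ ^ r) ≈⟨ *-assoc _ _ _ ⟨
      ι (aa ℤ.^ (N ∸ r)) * ι (aa ℤ.^ r) * θ ^ r   ≈⟨ *-congʳ (ι-* (aa ℤ.^ (N ∸ r)) (aa ℤ.^ r)) ⟨
      ι (aa ℤ.^ (N ∸ r) ℤ.* aa ℤ.^ r) * θ ^ r     ≡⟨ ≡.cong (λ z → ι z * θ ^ r) (≡.trans (≡.sym (ℤP.^-distribˡ-+-* aa (N ∸ r) r)) (≡.cong (aa ℤ.^_) (ℕP.m∸n+n≡m r≤N))) ⟩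
      ι (aa ℤ.^ N) * θ ^ r                        ∎) (span-ι (aa ℤ.^ (N ∸ r)) (PO.Zx⊂O (gen (r , refl))))

  aa^N≢0 : aa ℤ.^ N ≢ + 0
  aa^N≢0 = go N
    where
    go : ∀ m → aa ℤ.^ m ≢ + 0
    go zero    ()
    go (suc m) = *≢0 aa≢0 (go m)

  local-p : ∀ {α} → AI Zθ α → ∃[ D ] (¬ p ∣ℕ D) × Op (ι (+ D) * α)
  local-p ai = PrimeLocal.localise OS tf pr PO.maximal (AI-change (ℕ.pred M) span-resp
      (λ {w} zw → ≡.subst (λ m → Op (ιℕ m * w)) (≡.sym (ℕP.suc-pred M {{ℕ.≢-nonZero (λ e → aa^N≢0 (ℤP.∣i∣≡0⇒i≡0 e))}}))
         (Op-abs (aa ℤ.^ N) (span-mulˡ {G = λ w → ∃[ j ] w ≈ θ ^ j} (ι (aa ℤ.^ N)) (λ { (j , e) → span-resp (*-congˡ (sym e)) (Op-θ j) }) zw))) ai)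
    where
    M = ℤ.∣ aa ℤ.^ N ∣

  Zx⊂Zθ : ∀ l → Zθ (x ^ l)
  Zx⊂Zθ l = span-resp (sym (x^ l)) (span-ι (aa ℤ.^ l) (Zθ-θ l))

  Op⇒Zθ : ∀ {w} → Op w → Zθ (ι (+ (p ℕ.^ d)) * w)
  Op⇒Zθ = span-mulˡ (ι (+ (p ℕ.^ d))) (λ { (k , i , k≤d , h) → span-resp (sym (trans (*-congˡ h) (eq k i k≤d)))
      (span-ι (+ (p ℕ.^ (d ∸ k))) (IsSubring.mul ZθS (Zx⊂Zθ i) (span-sum (p ℕ.^ k) {λ l → (x ^ q k) ^ l} (λ l _ → IsSubring.pow ZθS l (Zx⊂Zθ (q k)))))) })
    where
    eq : ∀ k i → k ≤ d → ι (+ (p ℕ.^ d)) * (x ^ i * e k) ≈ ι (+ (p ℕ.^ (d ∸ k))) * (x ^ i * geo (p ℕ.^ k) (x ^ q k))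
    eq k i k≤d = trans (*-congʳ (trans (reflexive (≡.cong ιℕ (≡.trans (≡.cong (p ℕ.^_) (≡.sym (ℕP.m∸n+n≡m k≤d))) (ℕP.^-distribˡ-+-* p (d ∸ k) k)))) (ιℕ-* (p ℕ.^ (d ∸ k)) (p ℕ.^ k))))
      (trans (solve 4 (λ a b x e → a :* b :* (x :* e) := a :* (x :* (b :* e))) refl (ιℕ (p ℕ.^ (d ∸ k))) (ιℕ (p ℕ.^ k)) (x ^ i) (e k)) (*-congˡ (*-congˡ (pe k))))

  AI-Op : ∀ {w} → Op w → AI Zθ w
  AI-Op ow = AI-change (ℕ.pred (p ℕ.^ d)) span-resp
    (λ {u} ou → ≡.subst (λ m → Zθ (ιℕ m * u)) (≡.sym (ℕP.suc-pred (p ℕ.^ d) {{ℕ.>-nonZero (p^>0 d)}})) (Op⇒Zθ ou)) (AlmostIntegral.AI-sub OS ow)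

∣-pow : ∀ {M x y} n → M ∣ℤ x ℤ.- y → M ∣ℤ x ℤ.^ n ℤ.- y ℤ.^ n
∣-pow zero    h = divides (+ 0) ≡.refl
∣-pow {M} {x} {y} (suc n) h = ≡.subst (M ∣ℤ_)
  (ℤS′.solve 4 (λ x y a b → x ℤS′.:* (a ℤS′.:- b) ℤS′.:+ b ℤS′.:* (x ℤS′.:- y) ℤS′.:= x ℤS′.:* a ℤS′.:- y ℤS′.:* b) ≡.refl x y (x ℤ.^ n) (y ℤ.^ n))
  (ℤS.∣m∣n⇒∣m+n (ℤS.∣n⇒∣m*n x (∣-pow n h)) (ℤS.∣n⇒∣m*n (y ℤ.^ n) h))

-- For M = p^k, the congruence behind p^k (x^j e_k) ≡ aa^m p^k C_m b_m, coefficient by coefficient.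
coefficient-congruence : ∀ {M} aa j q Q W a′ i → M ∣ℤ aa ℤ.^ q ℤ.- a′ → M ∣ℤ W ℤ.* a′ ℤ.^ Q ℤ.- + 1 →
  M ∣ℤ aa ℤ.^ (j ℕ.+ q ℕ.* i) ℤ.- aa ℤ.^ (j ℕ.+ q ℕ.* Q) ℤ.* (W ℤ.* a′ ℤ.^ i)
coefficient-congruence {M} aa j q Q W a′ i h hW = ≡.subst (M ∣ℤ_) eq
  (ℤS.∣n⇒∣m*n (aa ℤ.^ j) (ℤS.∣m∣n⇒∣m-n (ℤS.∣m∣n⇒∣m-n (∣-pow i h) (ℤS.∣m⇒∣m*n (W ℤ.* a′ ℤ.^ i) (∣-pow Q h))) (ℤS.∣m⇒∣m*n (a′ ℤ.^ i) hW)))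
  where
  u = aa ℤ.^ q
  pw : ∀ i → aa ℤ.^ (j ℕ.+ q ℕ.* i) ≡ aa ℤ.^ j ℤ.* u ℤ.^ i
  pw i = ≡.trans (ℤP.^-distribˡ-+-* aa j (q ℕ.* i)) (≡.cong (λ z → aa ℤ.^ j ℤ.* z) (≡.sym (ℤP.^-*-assoc aa q i)))
  eq : aa ℤ.^ j ℤ.* (((u ℤ.^ i ℤ.- a′ ℤ.^ i) ℤ.- (u ℤ.^ Q ℤ.- a′ ℤ.^ Q) ℤ.* (W ℤ.* a′ ℤ.^ i)) ℤ.- (W ℤ.* a′ ℤ.^ Q ℤ.- + 1) ℤ.* a′ ℤ.^ i)
     ≡ aa ℤ.^ (j ℕ.+ q ℕ.* i) ℤ.- aa ℤ.^ (j ℕ.+ q ℕ.* Q) ℤ.* (W ℤ.* a′ ℤ.^ i)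
  eq = ≡.trans (ℤS′.solve 6 (λ j ui ai uq aq W → j ℤS′.:* (((ui ℤS′.:- ai) ℤS′.:- (uq ℤS′.:- aq) ℤS′.:* (W ℤS′.:* ai)) ℤS′.:- (W ℤS′.:* aq ℤS′.:- ℤS′.con (+ 1)) ℤS′.:* ai)
         ℤS′.:= j ℤS′.:* ui ℤS′.:- j ℤS′.:* uq ℤS′.:* (W ℤS′.:* ai)) ≡.refl (aa ℤ.^ j) (u ℤ.^ i) (a′ ℤ.^ i) (u ℤ.^ Q) (a′ ℤ.^ Q) W)
       (≡.cong₂ (λ x y → x ℤ.- y ℤ.* (W ℤ.* a′ ℤ.^ i)) (≡.sym (pw i)) (≡.sym (pw Q)))

-- Comparison of the proposed basis with the two orders

module Basis (R : CommutativeRing 0ℓ 0ℓ) (p s : ℕ) (pr : Prime p) (a : ℤ) (rad : Radical R (p ℕ.^ s) a)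
    (A : ℕ → ℕ) (A≥1 : ∀ i → 1 ≤ i → i < p ℕ.^ s → 1 ≤ A i)
    (σ : ℤ) (a≡ : a ≡ σ ℤ.* + prodFrom1 (λ i → A i ℕ.^ i) (p ℕ.^ s))
    (aa : ℤ) (p∤aa : ¬ + p ∣ℤ aa) (d : ℕ) (d≤s : d ≤ s) (c : ℤ) (p∤c : d < s → ¬ + p ∣ℤ c)
    (norm : aa ℤ.^ (p ℕ.^ s) ℤ.* a ≡ + 1 ℤ.+ + (p ℕ.^ suc d) ℤ.* c)
    (p∤A : ∀ i → 1 ≤ i → i < p ℕ.^ s → ¬ p ∣ℕ A i) where
  open RingTools R
  open Geometric R
  open Radical rad
  open Triangular R (p ℕ.^ s) a rad
  open MonomialPart R (p ℕ.^ s) a rad A A≥1 σ a≡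
  open Exponents (p ℕ.^ s) 0<N A using (Cₘ; E; ^-∤)

  aa≢0 : aa ≢ + 0
  aa≢0 e = p∤aa (≡.subst (+ p ∣ℤ_) (≡.sym e) (divides (+ 0) ≡.refl))

  open PPart R p s pr a rad aa aa≢0 d d≤s c p∤c norm
  open POrderData R p s d x e using (n; π; RS)

  p∤C : ∀ m → ¬ p ∣ℕ Cₘ m
  p∤C m = prod-∤ _ N pr (λ i 1≤i i<N → ^-∤ pr (A i) (E i m) (p∤A i 1≤i i<N))

  -- The congruences are stated for all `m < N`; where `kk m = 0` they are modulo 1. This allows
  -- both cases of the theorem to be treated by one family `b`.
  module WithData (kk : ℕ → ℕ) (kk≤d : ∀ m → kk m ≤ d)
      (kk-start : ∀ m → N ∸ q (kk m) ≤ m) (kk-max : ∀ m l → kk m < l → l ≤ d → m < N ∸ q l)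
      (a′ w : ℕ → ℤ)
      (A′≡ : ∀ m → m < N → + (p ℕ.^ kk m) ∣ℤ aa ℤ.^ q (kk m) ℤ.- a′ m)
      (W≡ : ∀ m → m < N → + (p ℕ.^ kk m) ∣ℤ w m ℤ.* + Cₘ m ℤ.* a′ m ℤ.^ (p ℕ.^ kk m ∸ 1) ℤ.- + 1)
      (mono-local : ∀ ℓ → Prime ℓ → ℓ ≢ p → ∀ {α} → AI Zθ α → ∃[ D ] (¬ ℓ ∣ℕ D) × Om (ι (+ D) * α)) where

    jj : ℕ → ℕ
    jj m = m ∸ (N ∸ q (kk m))

    off-∸ : ∀ k → k ≤ d → N ∸ q k ≡ off k
    off-∸ k k≤d = ≡.trans (≡.cong (_∸ q k) (≡.sym (off+q k (ℕP.≤-trans k≤d d≤s)))) (ℕP.m+n∸n≡m (off k) (q k))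

    jj-eq : ∀ m → jj m ℕ.+ off (kk m) ≡ m
    jj-eq m = ≡.trans (≡.cong (jj m ℕ.+_) (≡.sym (off-∸ (kk m) (kk≤d m)))) (ℕP.m∸n+n≡m (kk-start m))

    -- The degree `j + off k` lies before the start of the next block. With `jj-unique` this pairs
    -- the products of powers of `x` with `e k` and the proposed basis elements by degree.
    kk-unique : ∀ k j → k ≤ d → j < n k → kk (j ℕ.+ off k) ≡ k
    kk-unique k j k≤d j<n = ℕP.≤-antisym (ℕP.≮⇒≥ above) (ℕP.≮⇒≥ below)
      where
      m = j ℕ.+ off k
      m<end : m < off k ℕ.+ n k
      m<end = ≡.subst (_< off k ℕ.+ n k) (ℕP.+-comm (off k) j) (ℕP.+-monoʳ-< (off k) j<n)
      below : ¬ kk m < k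
      below lt = ℕP.<⇒≱ (≡.subst (m <_) (off-∸ k k≤d) (kk-max m k lt k≤d)) (ℕP.m≤n+m (off k) j)
      above : ¬ k < kk m
      above lt = ℕP.<⇒≱ (≡.subst (m <_) (off-suc k (ℕP.<-≤-trans lt (kk≤d m))) m<end)
        (ℕP.≤-trans (off-mono (suc k) (kk m) lt (kk≤d m)) (≡.subst (_≤ m) (off-∸ (kk m) (kk≤d m)) (kk-start m)))

    jj-unique : ∀ k j → k ≤ d → j < n k → jj (j ℕ.+ off k) ≡ j
    jj-unique k j k≤d j<n = ≡.trans (≡.cong (λ l → j ℕ.+ off k ∸ (N ∸ q l)) (kk-unique k j k≤d j<n))
      (≡.trans (≡.cong (j ℕ.+ off k ∸_) (off-∸ k k≤d)) (ℕP.m+n∸n≡m j (off k)))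

    Q : ℕ → ℕ
    Q m = p ℕ.^ kk m ∸ 1

    S : ℕ → Carrier
    S m = θ ^ jj m * Σ< (Q m) (λ i → (ι (a′ m) * θ ^ q (kk m)) ^ i)

    -- Defined uniformly: for `kk m = 0` the sum in `S m` is empty, and `b m` reduces to
    -- `θ ^ m / C_m`, see `b≈t`.
    b : ℕ → Carrier
    b m = inv (p ℕ.^ kk m ℕ.* Cₘ m) * (θ ^ m + ι (w m ℤ.* + Cₘ m) * S m)

    S-expand : ∀ m → S m ≈ Σ< (Q m) (λ i → ι (a′ m ℤ.^ i) * θ ^ (jj m ℕ.+ q (kk m) ℕ.* i))
    S-expand m = trans (Σ-*ˡ (Q m) (θ ^ jj m) _) (Σ-cong (Q m) (λ i _ → begin
      θ ^ jj m * (ι (a′ m) * θ ^ q (kk m)) ^ i           ≈⟨ *-congˡ (trans (^-distrib-* (ι (a′ m)) (θ ^ q (kk m)) i) (*-cong (sym (ι-^ (a′ m) i)) (^-assocʳ θ (q (kk m)) i))) ⟩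
      θ ^ jj m * (ι (a′ m ℤ.^ i) * θ ^ (q (kk m) ℕ.* i)) ≈⟨ solve 3 (λ a b c → a :* (b :* c) := b :* (a :* c)) refl (θ ^ jj m) (ι (a′ m ℤ.^ i)) (θ ^ (q (kk m) ℕ.* i)) ⟩
      ι (a′ m ℤ.^ i) * (θ ^ jj m * θ ^ (q (kk m) ℕ.* i)) ≈⟨ *-congˡ (^-homo-* θ (jj m) (q (kk m) ℕ.* i)) ⟨
      ι (a′ m ℤ.^ i) * θ ^ (jj m ℕ.+ q (kk m) ℕ.* i)     ∎))

    pCb : ∀ m → ι (+ (p ℕ.^ kk m)) * (ι (+ Cₘ m) * b m) ≈ θ ^ m + ι (w m ℤ.* + Cₘ m) * S m
    pCb m = trans (sym (*-assoc _ _ _)) (trans (*-congʳ (sym (ιℕ-* (p ℕ.^ kk m) (Cₘ m))))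
      (trans (sym (*-assoc _ _ _)) (trans (*-congʳ (inv-spec _ (ℕP.*-mono-< (p^>0 (kk m)) (C>0 m)))) (*-identityˡ _))))

    pb : ∀ m → ι (+ (p ℕ.^ kk m)) * b m ≈ t m + ι (w m) * S m
    pb m = cancel (C≢0 m) (begin
      ι (+ Cₘ m) * (ι (+ (p ℕ.^ kk m)) * b m)   ≈⟨ solve 3 (λ c p b → c :* (p :* b) := p :* (c :* b)) refl (ι (+ Cₘ m)) (ι (+ (p ℕ.^ kk m))) (b m) ⟩
      ι (+ (p ℕ.^ kk m)) * (ι (+ Cₘ m) * b m)   ≈⟨ pCb m ⟩
      θ ^ m + ι (w m ℤ.* + Cₘ m) * S m          ≈⟨ +-cong (sym (tC m)) (*-congʳ (ι-* (w m) (+ Cₘ m))) ⟩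
      ι (+ Cₘ m) * t m + ι (w m) * ι (+ Cₘ m) * S m
        ≈⟨ solve 4 (λ c t w s → c :* t :+ w :* c :* s := c :* (t :+ w :* s)) refl (ι (+ Cₘ m)) (t m) (ι (w m)) (S m) ⟩
      ι (+ Cₘ m) * (t m + ι (w m) * S m)        ∎)

    b≈t : ∀ m → kk m ≡ 0 → b m ≈ t m
    b≈t m k≡0 = begin
      b m                                ≈⟨ *-identityˡ (b m) ⟨
      ι (+ (p ℕ.^ 0)) * b m              ≡⟨ ≡.cong (λ k → ι (+ (p ℕ.^ k)) * b m) k≡0 ⟨
      ι (+ (p ℕ.^ kk m)) * b m           ≈⟨ pb m ⟩
      t m + ι (w m) * (θ ^ jj m * Σ< (Q m) f)
        ≡⟨ ≡.cong (λ k → t m + ι (w m) * (θ ^ jj m * Σ< (p ℕ.^ k ∸ 1) f)) k≡0 ⟩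
      t m + ι (w m) * (θ ^ jj m * 0#)    ≈⟨ solve 3 (λ t w y → t :+ w :* (y :* con (+ 0)) := t) refl (t m) (ι (w m)) (θ ^ jj m) ⟩
      t m                                ∎
      where
      f : ℕ → Carrier
      f i = (ι (a′ m) * θ ^ q (kk m)) ^ i

    S-low : ∀ m → m < N → T m (S m)
    S-low m m<N = span-resp (sym (S-expand m)) (span-sum (Q m) {λ i → ι (a′ m ℤ.^ i) * θ ^ (jj m ℕ.+ q (kk m) ℕ.* i)} (λ i i<Q →
      span-ι (a′ m ℤ.^ i) (gen (jj m ℕ.+ q (kk m) ℕ.* i , ≡.subst (jj m ℕ.+ q (kk m) ℕ.* i <_) (jj-eq m)
        (ℕP.+-monoʳ-< (jj m) (ℕP.*-monoʳ-< (q (kk m)) {{ℕ.>-nonZero (p^>0 (s ∸ kk m))}} i<Q)) , refl))))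

    lead-b : ∀ m → m < N → Lead m (b m)
    lead-b m m<N = lead (+ (p ℕ.^ kk m) ℤ.* + Cₘ m) (+ 1) (*≢0 (p^≢0 (kk m)) (C≢0 m)) (λ ())
      (span-resp (sym (trans (+-cong (trans (*-congʳ (ι-* (+ (p ℕ.^ kk m)) (+ Cₘ m))) (trans (*-assoc _ _ _) (pCb m))) (-‿cong (*-identityˡ _)))
         (solve 2 (λ t u → (t :+ u) :- t := u) refl (θ ^ m) (ι (w m ℤ.* + Cₘ m) * S m))))
        (span-ι (w m ℤ.* + Cₘ m) (S-low m m<N)))

    b-free : ∀ z → Σ< N (λ i → ι (z i) * b i) ≈ 0# → ∀ i → i < N → z i ≡ + 0
    b-free z = tri-indep N b z ℕP.≤-refl lead-b

    Λ : Carrier → Set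
    Λ = Span (λ w → ∃[ j ] (j < N) × (w ≈ b j))

    Λb : ∀ {m} → m < N → Λ (b m)
    Λb {m} m<N = gen (m , m<N , refl)

    -- Times `p ^ k`, both terms are combinations of the same powers of `θ`. The factor
    -- `aa ^ m * C_m` makes the terms of degree `m` cancel exactly; the other coefficients agree
    -- modulo `p ^ k`, and torsion-freeness permits division.
    difference : ∀ m → m < N → Zθ (x ^ jj m * e (kk m) - ι (aa ℤ.^ m) * (ι (+ Cₘ m) * b m))
    difference m m<N = go (terms (Q m) ℕP.≤-refl)
      where
      k = kk m
      j = jj m
      M = + (p ℕ.^ k)
      W = w m ℤ.* + Cₘ m
      coef : ℕ → ℤ
      coef i = aa ℤ.^ (j ℕ.+ q k ℕ.* i) ℤ.- aa ℤ.^ (j ℕ.+ q k ℕ.* Q m) ℤ.* (W ℤ.* a′ m ℤ.^ i)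
      θi : ℕ → Carrier
      θi i = θ ^ (j ℕ.+ q k ℕ.* i)
      terms : ∀ K → K ≤ Q m → Mult M Zθ (Σ< K (λ i → ι (coef i) * θi i))
      terms zero    _  = 0# , span-zer , sym (zeroʳ _)
      terms (suc K) K< = by (terms K (ℕP.<⇒≤ K<)) (coefficient-congruence aa j (q k) (Q m) W (a′ m) K (A′≡ m m<N) (W≡ m m<N))
        where
        by : ∀ {u} → Mult M Zθ u → M ∣ℤ coef K → Mult M Zθ (u + ι (coef K) * θi K)
        by {u} (v , zv , ev) (divides r er) = v + ι r * θi K , span-add zv (span-ι r (Zθ-θ (j ℕ.+ q k ℕ.* K))) ,
          trans (+-cong ev (*-congʳ (trans (reflexive (≡.cong ι er)) (ι-* r M))))
            (solve 4 (λ m v r t → m :* v :+ r :* m :* t := m :* (v :+ r :* t)) refl (ι M) v (ι r) (θi K))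
      xe : ι M * (x ^ j * e k) ≈ Σ< (Q m) (λ i → ι (aa ℤ.^ (j ℕ.+ q k ℕ.* i)) * θi i) + ι (aa ℤ.^ m) * θ ^ m
      xe = begin
        ι M * (x ^ j * e k)                       ≈⟨ solve 3 (λ m x e → m :* (x :* e) := x :* (m :* e)) refl (ι M) (x ^ j) (e k) ⟩
        x ^ j * (ι M * e k)                       ≈⟨ *-congˡ (trans (pe k) (reflexive (≡.cong (λ m → geo m (x ^ q k)) (≡.sym (ℕP.suc-pred (p ℕ.^ k) {{ℕ.>-nonZero (p^>0 k)}}))))) ⟩
        x ^ j * Σ< (suc (Q m)) (λ i → (x ^ q k) ^ i)
          ≈⟨ trans (Σ-*ˡ (suc (Q m)) (x ^ j) _) (Σ-cong (suc (Q m)) (λ i _ → trans (trans (*-congˡ (^-assocʳ x (q k) i)) (sym (^-homo-* x j (q k ℕ.* i)))) (x^ (j ℕ.+ q k ℕ.* i)))) ⟩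
        Σ< (Q m) (λ i → ι (aa ℤ.^ (j ℕ.+ q k ℕ.* i)) * θi i) + ι (aa ℤ.^ (j ℕ.+ q k ℕ.* Q m)) * θi (Q m)
          ≡⟨ ≡.cong (λ l → Σ< (Q m) (λ i → ι (aa ℤ.^ (j ℕ.+ q k ℕ.* i)) * θi i) + ι (aa ℤ.^ l) * θ ^ l) (jj-eq m) ⟩
        Σ< (Q m) (λ i → ι (aa ℤ.^ (j ℕ.+ q k ℕ.* i)) * θi i) + ι (aa ℤ.^ m) * θ ^ m ∎
      total : ι M * (x ^ j * e k - ι (aa ℤ.^ m) * (ι (+ Cₘ m) * b m)) ≈ Σ< (Q m) (λ i → ι (coef i) * θi i)
      total = begin
        ι M * (x ^ j * e k - κ′ * (ι (+ Cₘ m) * b m))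
          ≈⟨ solve 4 (λ m x k y → m :* (x :- k :* y) := m :* x :- k :* (m :* y)) refl (ι M) (x ^ j * e k) κ′ (ι (+ Cₘ m) * b m) ⟩
        ι M * (x ^ j * e k) - κ′ * (ι M * (ι (+ Cₘ m) * b m))
          ≈⟨ +-cong xe (-‿cong (*-congˡ (trans (pCb m) (+-congˡ (*-congˡ (S-expand m)))))) ⟩
        (X + κ′ * θ ^ m) - κ′ * (θ ^ m + ι W * Y)
          ≈⟨ solve 5 (λ x k t w y → (x :+ k :* t) :- k :* (t :+ w :* y) := x :+ (:- (k :* w :* y))) refl X κ′ (θ ^ m) (ι W) Y ⟩
        X + - (κ′ * ι W * Y)
          ≈⟨ +-congˡ (trans (-‿cong (Σ-*ˡ (Q m) (κ′ * ι W) _)) (Σ-neg (Q m) _)) ⟩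
        X + Σ< (Q m) (λ i → - (κ′ * ι W * (ι (a′ m ℤ.^ i) * θi i)))
          ≈⟨ Σ-+ (Q m) _ _ ⟨
        Σ< (Q m) (λ i → ι (aa ℤ.^ (j ℕ.+ q k ℕ.* i)) * θi i + - (κ′ * ι W * (ι (a′ m ℤ.^ i) * θi i)))
          ≈⟨ Σ-cong (Q m) (λ i _ → term i) ⟩
        Σ< (Q m) (λ i → ι (coef i) * θi i) ∎
        where
        κ′ = ι (aa ℤ.^ m)
        X = Σ< (Q m) (λ i → ι (aa ℤ.^ (j ℕ.+ q k ℕ.* i)) * θi i)
        Y = Σ< (Q m) (λ i → ι (a′ m ℤ.^ i) * θi i)
        term : ∀ i → ι (aa ℤ.^ (j ℕ.+ q k ℕ.* i)) * θi i + - (κ′ * ι W * (ι (a′ m ℤ.^ i) * θi i)) ≈ ι (coef i) * θi i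
        term i = begin
          ι u * θi i + - (κ′ * ι W * (ι (a′ m ℤ.^ i) * θi i))
            ≈⟨ solve 5 (λ u t k w a → u :* t :+ (:- (k :* w :* (a :* t))) := (u :+ (:- (k :* (w :* a)))) :* t) refl (ι u) (θi i) κ′ (ι W) (ι (a′ m ℤ.^ i)) ⟩
          (ι u + - (κ′ * (ι W * ι (a′ m ℤ.^ i)))) * θi i
            ≈⟨ *-congʳ (+-congˡ (-‿cong (trans (*-cong (reflexive (≡.cong (λ l → ι (aa ℤ.^ l)) (≡.sym (jj-eq m)))) (sym (ι-* W (a′ m ℤ.^ i)))) (sym (ι-* v (W ℤ.* a′ m ℤ.^ i)))))) ⟩
          (ι u + - ι (v ℤ.* (W ℤ.* a′ m ℤ.^ i))) * θi i
            ≈⟨ *-congʳ (trans (ι-+ u _) (+-congˡ (ι-neg (v ℤ.* (W ℤ.* a′ m ℤ.^ i))))) ⟨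
          ι (coef i) * θi i ∎
          where
          u = aa ℤ.^ (j ℕ.+ q k ℕ.* i)
          v = aa ℤ.^ (j ℕ.+ q k ℕ.* Q m)
      go : Mult M Zθ (Σ< (Q m) (λ i → ι (coef i) * θi i)) → Zθ (x ^ j * e k - ι (aa ℤ.^ m) * (ι (+ Cₘ m) * b m))
      go (z , zz , h) = span-resp (sym (cancel (p^≢0 k) (trans total h))) zz

    -- By `pb`, a multiple of `b m` differs from `t m` by an element of ℤ[θ] of degree below `m`;
    -- its monomials are integer multiples of earlier `t l`.
    Λt : ∀ m → m < N → Λ (t m)
    Λt = <-rec (λ m → m < N → Λ (t m)) step
      where
      step : ∀ m → (∀ {l} → l < m → l < N → Λ (t l)) → m < N → Λ (t m)
      step m ih m<N = span-resp (trans (+-congʳ (pb m)) (solve 2 (λ t u → (t :+ u) :- u := t) refl (t m) (ι (w m) * S m)))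
        (span-add (span-ι (+ (p ℕ.^ kk m)) (Λb m<N)) (span-neg (span-ι (w m)
          (span-map span-resp span-zer span-add span-neg (λ { (l , l<m , h) → span-resp (trans (tC l) (sym h)) (span-ι (+ Cₘ l) (ih l<m (ℕP.<-trans l<m m<N))) }) (S-low m m<N)))))

    Om⊂Λ : ∀ {u} → Om u → Λ u
    Om⊂Λ ou = go (Om-coords ou)
      where
      go : ∀ {u} → Σ[ z ∈ (ℕ → ℤ) ] (u ≈ Σ< N (λ i → ι (z i) * t i)) → Λ u
      go (z , h) = span-resp (sym h) (span-sum N {λ i → ι (z i) * t i} (λ i i<N → span-ι (z i) (Λt i i<N)))

    Zθ⊂Λ : ∀ {u} → Zθ u → Λ u
    Zθ⊂Λ zu = Om⊂Λ (Zθ⊂Om zu)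

    Λxe : ∀ k j → k ≤ d → j < n k → Λ (x ^ j * e k)
    Λxe k j k≤d j<n = ≡.subst₂ (λ k j → Λ (x ^ j * e k)) (kk-unique k j k≤d j<n) (jj-unique k j k≤d j<n)
      (span-resp (solve 2 (λ u v → (u :- v) :+ v := u) refl (x ^ jj m * e (kk m)) (ι (aa ℤ.^ m) * (ι (+ Cₘ m) * b m)))
        (span-add (Zθ⊂Λ (difference m m<N)) (span-ι (aa ℤ.^ m) (span-ι (+ Cₘ m) (Λb m<N)))))
      where
      m = j ℕ.+ off k
      m<N : m < N
      m<N = ℕP.<-≤-trans (≡.subst (_< off k ℕ.+ n k) (ℕP.+-comm (off k) j) (ℕP.+-monoʳ-< (off k) j<n)) (off-end k k≤d)

    -- The exponents of `x` do not exceed `j`, so the expansion of `π ^ j * e k` stays inside block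
    -- `k`, to which `Λxe` applies.
    π-x : ∀ j → Span (λ w → ∃[ i ] (i < suc j) × (w ≈ x ^ i)) (π ^ j)
    π-x zero    = gen (0 , s≤s z≤n , refl)
    π-x (suc j) = span-resp (solve 2 (λ x y → x :* y :- y := (x :- con (+ 1)) :* y) refl x (π ^ j))
      (span-add (span-mulˡ x (λ { (i , i< , h) → gen (suc i , s≤s i< , *-congˡ h) }) (π-x j))
                (span-neg (span-map span-resp span-zer span-add span-neg (λ { (i , i< , h) → gen (i , ℕP.m<n⇒m<1+n i< , h) }) (π-x j))))

    Op⊂Λ : ∀ {u} → Op u → Λ u
    Op⊂Λ ou = go (coords ou)
      where
      term : ∀ k j → k ≤ d → j < n k → Λ (π ^ j * e k)
      term k j k≤d j<n = span-resp (*-comm _ _) (span-mulˡ {G = λ w → ∃[ i ] (i < suc j) × (w ≈ x ^ i)} (e k)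
        (λ { (i , i< , h) → span-resp (trans (*-comm _ _) (*-congˡ (sym h))) (Λxe k i k≤d (ℕP.≤-<-trans (ℕP.<⇒≤pred i<) j<n)) }) (π-x j))
      go : ∀ {u} → Σ[ z ∈ (ℕ → ℕ → ℤ) ] (u ≈ RS z) → Λ u
      go (z , h) = span-resp (sym h) (span-sum (suc d) {λ k → Σ< (n k) (λ j → ι (z k j) * (π ^ j * e k))} (λ k k< →
        span-sum (n k) {λ j → ι (z k j) * (π ^ j * e k)} (λ j j<n → span-ι (z k j) (term k j (ℕP.<⇒≤pred k<) j<n))))

    integral⇒Λ : ∀ {α} → AI Zθ α → Λ α
    integral⇒Λ {α} ai@(D , h) = span-globalise (suc D) (s≤s z≤n) (span-resp (*-congˡ (*-identityʳ α)) (Zθ⊂Λ (h 1)))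
      (λ ℓ prℓ → local ℓ prℓ (ℓ ℕ.≟ p))
      where
      local : ∀ ℓ → Prime ℓ → Dec (ℓ ≡ p) → ∃[ D′ ] (¬ ℓ ∣ℕ D′) × Λ (ι (+ D′) * α)
      local ℓ prℓ (yes ≡.refl) = go (local-p ai)
        where
        go : ∃[ D ] (¬ p ∣ℕ D) × Op (ι (+ D) * α) → ∃[ D′ ] (¬ p ∣ℕ D′) × Λ (ι (+ D′) * α)
        go (D′ , ∤ , o) = D′ , ∤ , Op⊂Λ o
      local ℓ prℓ (no ℓ≢p) = go (mono-local ℓ prℓ ℓ≢p ai)
        where
        go : ∃[ D ] (¬ ℓ ∣ℕ D) × Om (ι (+ D) * α) → ∃[ D′ ] (¬ ℓ ∣ℕ D′) × Λ (ι (+ D′) * α)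
        go (D′ , ∤ , o) = D′ , ∤ , Om⊂Λ o

    -- b_m is integral since both p^k b_m and (aa^m C_m) b_m are, with coprime multipliers.
    b-integral : ∀ m → m < N → AI Zθ (b m)
    b-integral m m<N = go (prime-power-bézout (kk m))
      where
      open AlmostIntegral ZθS
      K = aa ℤ.^ m ℤ.* + Cₘ m
      p∤K : ¬ + p ∣ℤ K
      p∤K h = by (euclidℤ pr (aa ℤ.^ m) (+ Cₘ m) h)
        where
        by : + p ∣ℤ aa ℤ.^ m ⊎ + p ∣ℤ + Cₘ m → ⊥
        by (inj₁ h) = p∤aa (euclid^ pr aa m h)
        by (inj₂ h) = p∤C m (ℤS.∣⇒∣ᵤ h)
      p-bézout : ∃[ u ] ∃[ v ] u ℤ.* + p ℤ.+ v ℤ.* K ≡ + 1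
      p-bézout = by (prime-bézout {D = ℤ.∣ K ∣} pr (λ h → p∤K (ℤS.∣ᵤ⇒∣ h)))
        where
        sg : ∃[ τ ] + ℤ.∣ K ∣ ≡ τ ℤ.* K
        sg = sign K
          where
          sign : ∀ z → ∃[ τ ] + ℤ.∣ z ∣ ≡ τ ℤ.* z
          sign (+ n)    = + 1 , ≡.sym (ℤP.*-identityˡ (+ n))
          sign -[1+ n ] = ℤ.- (+ 1) , ≡.sym (ℤP.-1*i≡-i -[1+ n ])
        by : ∃[ u ] ∃[ v ] u ℤ.* + p ℤ.+ v ℤ.* + ℤ.∣ K ∣ ≡ + 1 → ∃[ u ] ∃[ v ] u ℤ.* + p ℤ.+ v ℤ.* K ≡ + 1
        by (u , v , eq) = u , v ℤ.* proj₁ sg , ≡.trans (≡.cong (λ z → u ℤ.* + p ℤ.+ z) (≡.trans (ℤP.*-assoc v (proj₁ sg) K) (≡.cong (v ℤ.*_) (≡.sym (proj₂ sg))))) eq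
      prime-power-bézout : ∀ k → ∃[ u ] ∃[ v ] u ℤ.* + (p ℕ.^ k) ℤ.+ v ℤ.* K ≡ + 1
      prime-power-bézout zero    = + 1 , + 0 , ≡.refl
      prime-power-bézout (suc k) = by p-bézout (prime-power-bézout k)
        where
        by : ∃[ u ] ∃[ v ] u ℤ.* + p ℤ.+ v ℤ.* K ≡ + 1 → ∃[ u ] ∃[ v ] u ℤ.* + (p ℕ.^ k) ℤ.+ v ℤ.* K ≡ + 1 → ∃[ u ] ∃[ v ] u ℤ.* + (p ℕ.^ suc k) ℤ.+ v ℤ.* K ≡ + 1
        by (u , v , e₁) (u′ , v′ , e₂) = u ℤ.* u′ , u ℤ.* + p ℤ.* v′ ℤ.+ v , (≡.trans
          (≡.cong (λ z → u ℤ.* u′ ℤ.* z ℤ.+ (u ℤ.* + p ℤ.* v′ ℤ.+ v) ℤ.* K) (ℤP.pos-* p (p ℕ.^ k)))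
          (≡.trans (ℤS′.solve 7 (λ u v u′ v′ p q K → u ℤS′.:* u′ ℤS′.:* (p ℤS′.:* q) ℤS′.:+ (u ℤS′.:* p ℤS′.:* v′ ℤS′.:+ v) ℤS′.:* K ℤS′.:= u ℤS′.:* p ℤS′.:* (u′ ℤS′.:* q ℤS′.:+ v′ ℤS′.:* K) ℤS′.:+ v ℤS′.:* K)
              ≡.refl u v u′ v′ (+ p) (+ (p ℕ.^ k)) K)
          (≡.trans (≡.cong (λ z → u ℤ.* + p ℤ.* z ℤ.+ v ℤ.* K) e₂) (≡.trans (≡.cong (ℤ._+ v ℤ.* K) (ℤP.*-identityʳ (u ℤ.* + p))) e₁))))
      AI-ι : ∀ z {u} → AI Zθ u → AI Zθ (ι z * u)
      AI-ι z ai = AI-resp (*-comm _ _) (AI-mul ai (IsSubring.int ZθS z))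
      pb-AI : AI Zθ (ι (+ (p ℕ.^ kk m)) * b m)
      pb-AI = AI-resp (sym (pb m)) (AI-Om (span-add (Omt m) (span-ι (w m) (Zθ⊂Om (span-map span-resp span-zer span-add span-neg (λ { (l , _ , h) → gen (l , h) }) (S-low m m<N))))))
      Kb-AI : AI Zθ (ι K * b m)
      Kb-AI = AI-resp (trans (solve 2 (λ u v → u :+ (:- (u :- v)) := v) refl (x ^ jj m * e (kk m)) (ι (aa ℤ.^ m) * (ι (+ Cₘ m) * b m)))
                         (trans (sym (*-assoc _ _ _)) (*-congʳ (sym (ι-* (aa ℤ.^ m) (+ Cₘ m))))))
        (AI-+ (AI-Op (ZxO (gen (jj m , refl)) (Oe (kk≤d m)))) (AI-sub (span-neg (difference m m<N))))
      go : ∃[ u ] ∃[ v ] u ℤ.* + (p ℕ.^ kk m) ℤ.+ v ℤ.* K ≡ + 1 → AI Zθ (b m)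
      go (u , v , eq) = AI-resp (begin
        ι u * (ι (+ (p ℕ.^ kk m)) * b m) + ι v * (ι K * b m)
          ≈⟨ solve 5 (λ u p v k b → u :* (p :* b) :+ v :* (k :* b) := (u :* p :+ v :* k) :* b) refl (ι u) (ι (+ (p ℕ.^ kk m))) (ι v) (ι K) (b m) ⟩
        (ι u * ι (+ (p ℕ.^ kk m)) + ι v * ι K) * b m
          ≈⟨ *-congʳ (trans (+-cong (sym (ι-* u (+ (p ℕ.^ kk m)))) (sym (ι-* v K))) (sym (ι-+ (u ℤ.* + (p ℕ.^ kk m)) (v ℤ.* K)))) ⟩
        ι (u ℤ.* + (p ℕ.^ kk m) ℤ.+ v ℤ.* K) * b m   ≡⟨ ≡.cong (λ z → ι z * b m) eq ⟩
        1# * b m                                     ≈⟨ *-identityˡ _ ⟩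
        b m ∎) (AI-+ (AI-ι u pb-AI) (AI-ι v Kb-AI))

open ≡ using (refl; sym; trans; cong; cong₂; subst; module ≡-Reasoning)
open import Data.Unit using (⊤; tt)

-- The field ℚ[x]/(x^n - a)

toℚᵘ-toℚ : ∀ z → toℚᵘ (toℚ z) ≃ mkℚᵘ z 0
toℚᵘ-toℚ z = ℚP.toℚᵘ-fromℚᵘ (mkℚᵘ z 0)

toℚ-+ : ∀ x y → toℚ (x ℤ.+ y) ≡ toℚ x ℚ.+ toℚ y
toℚ-+ x y = ℚP.toℚᵘ-injective (begin
  toℚᵘ (toℚ (x ℤ.+ y))             ≈⟨ toℚᵘ-toℚ (x ℤ.+ y) ⟩
  mkℚᵘ (x ℤ.+ y) 0                 ≈⟨ *≡* (cong (ℤ._* + 1) (cong₂ ℤ._+_ (sym (ℤP.*-identityʳ x)) (sym (ℤP.*-identityʳ y)))) ⟩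
  mkℚᵘ x 0 ℚᵘ.+ mkℚᵘ y 0           ≈⟨ ℚᵘP.+-cong (toℚᵘ-toℚ x) (toℚᵘ-toℚ y) ⟨
  toℚᵘ (toℚ x) ℚᵘ.+ toℚᵘ (toℚ y)   ≈⟨ ℚP.toℚᵘ-homo-+ (toℚ x) (toℚ y) ⟨
  toℚᵘ (toℚ x ℚ.+ toℚ y)           ∎)
  where open import Relation.Binary.Reasoning.Setoid ℚᵘP.≃-setoid

toℚ-* : ∀ x y → toℚ (x ℤ.* y) ≡ toℚ x ℚ.* toℚ y
toℚ-* x y = ℚP.toℚᵘ-injective (begin
  toℚᵘ (toℚ (x ℤ.* y))             ≈⟨ toℚᵘ-toℚ (x ℤ.* y) ⟩
  mkℚᵘ (x ℤ.* y) 0                 ≈⟨ *≡* refl ⟩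
  mkℚᵘ x 0 ℚᵘ.* mkℚᵘ y 0           ≈⟨ ℚᵘP.*-cong (toℚᵘ-toℚ x) (toℚᵘ-toℚ y) ⟨
  toℚᵘ (toℚ x) ℚᵘ.* toℚᵘ (toℚ y)   ≈⟨ ℚP.toℚᵘ-homo-* (toℚ x) (toℚ y) ⟨
  toℚᵘ (toℚ x ℚ.* toℚ y)           ∎)
  where open import Relation.Binary.Reasoning.Setoid ℚᵘP.≃-setoid

toℚ-neg : ∀ x → toℚ (ℤ.- x) ≡ ℚ.- toℚ x
toℚ-neg x = begin
  toℚ (ℤ.- x)                                   ≡⟨ ℚP.+-identityʳ _ ⟨
  toℚ (ℤ.- x) ℚ.+ 0ℚ                            ≡⟨ cong (toℚ (ℤ.- x) ℚ.+_) (ℚP.+-inverseʳ (toℚ x)) ⟨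
  toℚ (ℤ.- x) ℚ.+ (toℚ x ℚ.+ ℚ.- toℚ x)         ≡⟨ ℚP.+-assoc (toℚ (ℤ.- x)) (toℚ x) (ℚ.- toℚ x) ⟨
  (toℚ (ℤ.- x) ℚ.+ toℚ x) ℚ.+ ℚ.- toℚ x         ≡⟨ cong (ℚ._+ ℚ.- toℚ x) (trans (sym (toℚ-+ (ℤ.- x) x)) (cong toℚ (ℤP.+-inverseˡ x))) ⟩
  0ℚ ℚ.+ ℚ.- toℚ x                              ≡⟨ ℚP.+-identityˡ _ ⟩
  ℚ.- toℚ x                                     ∎
  where open ≡-Reasoning

toℚ-injective : ∀ {x y} → toℚ x ≡ toℚ y → x ≡ y
toℚ-injective {x} {y} e with ℚᵘP.≃-trans (ℚᵘP.≃-sym (toℚᵘ-toℚ x)) (ℚᵘP.≃-trans (ℚᵘP.≃-reflexive (cong toℚᵘ e)) (toℚᵘ-toℚ y))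
... | *≡* h = trans (sym (ℤP.*-identityʳ x)) (trans h (ℤP.*-identityʳ y))

ℚ-field : ∀ {q r} → q ≢ 0ℚ → q ℚ.* r ≡ 0ℚ → r ≡ 0ℚ
ℚ-field {q} {r} q≢0 e = begin
  r                        ≡⟨ ℚP.*-identityˡ r ⟨
  1ℚ ℚ.* r                 ≡⟨ cong (ℚ._* r) (ℚP.*-inverseˡ q) ⟨
  (ℚ.1/ q) ℚ.* q ℚ.* r     ≡⟨ ℚP.*-assoc (ℚ.1/ q) q r ⟩
  (ℚ.1/ q) ℚ.* (q ℚ.* r)   ≡⟨ cong ((ℚ.1/ q) ℚ.*_) e ⟩
  (ℚ.1/ q) ℚ.* 0ℚ          ≡⟨ ℚP.*-zeroʳ (ℚ.1/ q) ⟩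
  0ℚ                       ∎
  where
  open ≡-Reasoning
  instance _ = ℚ.≢-nonZero q≢0

denominator : ∀ q → ∃[ D ] ∃[ z ] toℚ (+ suc D) ℚ.* q ≡ toℚ z
denominator q@(mkℚ n d-1 _) = d-1 , n , ℚP.toℚᵘ-injective (begin
  toℚᵘ (toℚ (+ suc d-1) ℚ.* q)            ≈⟨ ℚP.toℚᵘ-homo-* (toℚ (+ suc d-1)) q ⟩
  toℚᵘ (toℚ (+ suc d-1)) ℚᵘ.* toℚᵘ q      ≈⟨ ℚᵘP.*-congʳ {toℚᵘ q} (toℚᵘ-toℚ (+ suc d-1)) ⟩
  mkℚᵘ (+ suc d-1) 0 ℚᵘ.* mkℚᵘ n d-1      ≈⟨ *≡* (trans (ℤP.*-identityʳ _) (trans (ℤP.*-comm (+ suc d-1) n) (cong (λ m → n ℤ.* + suc m) (sym (ℕP.+-identityʳ d-1))))) ⟩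
  mkℚᵘ n 0                                ≈⟨ toℚᵘ-toℚ n ⟨
  toℚᵘ (toℚ n)                            ∎)
  where open import Relation.Binary.Reasoning.Setoid ℚᵘP.≃-setoid

invℕ-inverse : ∀ m → 0 < m → toℚ (+ m) ℚ.* invℕ m ≡ 1ℚ
invℕ-inverse (suc m) _ = ℚP.toℚᵘ-injective (begin
  toℚᵘ (toℚ (+ suc m) ℚ.* invℕ (suc m))            ≈⟨ ℚP.toℚᵘ-homo-* (toℚ (+ suc m)) (invℕ (suc m)) ⟩
  toℚᵘ (toℚ (+ suc m)) ℚᵘ.* toℚᵘ (invℕ (suc m))    ≈⟨ ℚᵘP.*-cong (toℚᵘ-toℚ (+ suc m)) (ℚP.toℚᵘ-fromℚᵘ (mkℚᵘ (+ 1) m)) ⟩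
  mkℚᵘ (+ suc m) 0 ℚᵘ.* mkℚᵘ (+ 1) m               ≈⟨ *≡* (trans (ℤP.*-identityʳ _) (trans (ℤP.*-identityʳ (+ suc m)) (trans (cong (λ m → + suc m) (sym (ℕP.+-identityʳ m))) (sym (ℤP.*-identityˡ _))))) ⟩
  mkℚᵘ (+ 1) 0                                     ∎)
  where open import Relation.Binary.Reasoning.Setoid ℚᵘP.≃-setoid

module ℚR = RingTools ℚP.+-*-commutativeRing

sumQ-cong : ∀ {m} {f g : Fin m → ℚ} → (∀ i → f i ≡ g i) → sumFinℚ f ≡ sumFinℚ g
sumQ-cong {zero}  h = refl
sumQ-cong {suc m} h = cong₂ ℚ._+_ (h zero) (sumQ-cong (λ i → h (suc i)))

sumQ-0 : ∀ {m} (f : Fin m → ℚ) → (∀ i → f i ≡ 0ℚ) → sumFinℚ f ≡ 0ℚ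
sumQ-0 {zero}  f h = refl
sumQ-0 {suc m} f h = trans (cong₂ ℚ._+_ (h zero) (sumQ-0 _ (λ i → h (suc i)))) (ℚP.+-identityˡ 0ℚ)

sumQ-+ : ∀ {m} (f g : Fin m → ℚ) → sumFinℚ (λ i → f i ℚ.+ g i) ≡ sumFinℚ f ℚ.+ sumFinℚ g
sumQ-+ {zero}  f g = sym (ℚP.+-identityˡ 0ℚ)
sumQ-+ {suc m} f g = trans (cong ((f zero ℚ.+ g zero) ℚ.+_) (sumQ-+ (λ i → f (suc i)) (λ i → g (suc i))))
  (ℚR.solve 4 (λ a b c d → (a ℚR.:+ b) ℚR.:+ (c ℚR.:+ d) ℚR.:= (a ℚR.:+ c) ℚR.:+ (b ℚR.:+ d)) refl (f zero) (g zero) _ _)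

sumQ-* : ∀ {m} q (f : Fin m → ℚ) → sumFinℚ (λ i → q ℚ.* f i) ≡ q ℚ.* sumFinℚ f
sumQ-* {zero}  q f = sym (ℚP.*-zeroʳ q)
sumQ-* {suc m} q f = trans (cong (q ℚ.* f zero ℚ.+_) (sumQ-* q (λ i → f (suc i)))) (sym (ℚP.*-distribˡ-+ q _ _))

sumQ-δ : ∀ {m} (j : Fin m) (f : Fin m → ℚ) → (∀ i → i ≢ j → f i ≡ 0ℚ) → sumFinℚ f ≡ f j
sumQ-δ zero    f h = trans (cong (f zero ℚ.+_) (sumQ-0 _ (λ i → h (suc i) (λ ())))) (ℚP.+-identityʳ _)
sumQ-δ (suc j) f h = trans (cong₂ ℚ._+_ (h zero (λ ())) (sumQ-δ j (λ i → f (suc i)) (λ i i≢j → h (suc i) (λ e → i≢j (FinP.suc-injective e)))))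
                           (ℚP.+-identityˡ _)

dsum : ∀ {m m′} → (Fin m → Fin m′ → ℚ) → ℚ
dsum f = sumFinℚ (λ i → sumFinℚ (f i))

dsum-cong : ∀ {m m′} {f g : Fin m → Fin m′ → ℚ} → (∀ i j → f i j ≡ g i j) → dsum f ≡ dsum g
dsum-cong h = sumQ-cong (λ i → sumQ-cong (h i))

dsum-+ : ∀ {m m′} (f g : Fin m → Fin m′ → ℚ) → dsum (λ i j → f i j ℚ.+ g i j) ≡ dsum f ℚ.+ dsum g
dsum-+ f g = trans (sumQ-cong (λ i → sumQ-+ (f i) (g i))) (sumQ-+ (λ i → sumFinℚ (f i)) (λ i → sumFinℚ (g i)))

dsum-* : ∀ {m m′} q (f : Fin m → Fin m′ → ℚ) → dsum (λ i j → q ℚ.* f i j) ≡ q ℚ.* dsum f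
dsum-* q f = trans (sumQ-cong (λ i → sumQ-* q (f i))) (sumQ-* q (λ i → sumFinℚ (f i)))

dsum-swap : ∀ {m m′} (f : Fin m → Fin m′ → ℚ) → dsum f ≡ dsum (λ j i → f i j)
dsum-swap {zero}  {m′} f = sym (sumQ-0 {m′} (λ _ → 0ℚ) (λ _ → refl))
dsum-swap {suc m} f = trans (cong (sumFinℚ (f zero) ℚ.+_) (dsum-swap (λ i → f (suc i))))
                            (sym (sumQ-+ (f zero) (λ j → sumFinℚ (λ i → f (suc i) j))))

module KTheory (n : ℕ) (0<n : 0 < n) (a : ℤ) where
  open Field n a

  -- Pointwise equality wrapped in a record, so that both sides can be recovered by unification.
  record _≈ᴷ_ (u v : K) : Set where
    constructor pointwise
    field at : ∀ i → u i ≡ v i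
  open _≈ᴷ_ public
  infix 4 _≈ᴷ_

  sumK-at : ∀ {m} (f : Fin m → K) l → sumK f l ≡ sumFinℚ (λ i → f i l)
  sumK-at {zero}  f l = refl
  sumK-at {suc m} f l = cong (f zero l ℚ.+_) (sumK-at (λ i → f (suc i)) l)

  terms : K → K → Fin n → Fin n → Fin n → ℚ
  terms u v l i j = (u i ℚ.* v j) ℚ.* θ^ (toℕ i ℕ.+ toℕ j) l

  *K-at : ∀ u v l → (u *K v) l ≡ dsum (terms u v l)
  *K-at u v l = trans (sumK-at (λ i → sumK (λ j → (u i ℚ.* v j) · θ^ (toℕ i ℕ.+ toℕ j))) l)
                      (sumQ-cong (λ i → sumK-at (λ j → (u i ℚ.* v j) · θ^ (toℕ i ℕ.+ toℕ j)) l))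

  -K_ : K → K
  (-K u) i = ℚ.- u i

  *K-cong : ∀ {u u′ v v′} → u ≈ᴷ u′ → v ≈ᴷ v′ → (u *K v) ≈ᴷ (u′ *K v′)
  *K-cong {u} {u′} {v} {v′} e f .at l = trans (*K-at u v l) (trans
    (dsum-cong {f = terms u v l} {g = terms u′ v′ l} (λ i j → cong (ℚ._* θ^ (toℕ i ℕ.+ toℕ j) l) (cong₂ ℚ._*_ (e .at i) (f .at j))))
    (sym (*K-at u′ v′ l)))

  *K-comm : ∀ u v → (u *K v) ≈ᴷ (v *K u)
  *K-comm u v .at l = trans (*K-at u v l) (trans (dsum-swap (terms u v l))
    (trans (dsum-cong {f = λ j i → terms u v l i j} {g = terms v u l} (λ i j → cong₂ ℚ._*_ (ℚP.*-comm (u j) (v i)) (cong (λ k → θ^ k l) (ℕP.+-comm (toℕ j) (toℕ i)))))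
    (sym (*K-at v u l))))

  *K-+ˡ : ∀ u u′ v → ((u +K u′) *K v) ≈ᴷ ((u *K v) +K (u′ *K v))
  *K-+ˡ u u′ v .at l = trans (*K-at (u +K u′) v l) (trans
    (trans (dsum-cong {f = terms (u +K u′) v l} {g = λ i j → terms u v l i j ℚ.+ terms u′ v l i j} (λ i j →
        ℚR.solve 4 (λ a b v t → ((a ℚR.:+ b) ℚR.:* v) ℚR.:* t ℚR.:= (a ℚR.:* v) ℚR.:* t ℚR.:+ (b ℚR.:* v) ℚR.:* t) refl (u i) (u′ i) (v j) (θ^ (toℕ i ℕ.+ toℕ j) l)))
        (dsum-+ (terms u v l) (terms u′ v l)))
    (sym (cong₂ ℚ._+_ (*K-at u v l) (*K-at u′ v l))))

  *K-·ˡ : ∀ q u v → ((q · u) *K v) ≈ᴷ (q · (u *K v))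
  *K-·ˡ q u v .at l = trans (*K-at (q · u) v l) (trans
    (trans (dsum-cong {f = terms (q · u) v l} {g = λ i j → q ℚ.* terms u v l i j} (λ i j →
        ℚR.solve 4 (λ q a v t → ((q ℚR.:* a) ℚR.:* v) ℚR.:* t ℚR.:= q ℚR.:* ((a ℚR.:* v) ℚR.:* t)) refl q (u i) (v j) (θ^ (toℕ i ℕ.+ toℕ j) l)))
        (dsum-* q (terms u v l)))
    (sym (cong (q ℚ.*_) (*K-at u v l))))

  ≈ᴷ-trans : ∀ {u v w} → u ≈ᴷ v → v ≈ᴷ w → u ≈ᴷ w
  ≈ᴷ-trans e f .at i = trans (e .at i) (f .at i)

  ≈ᴷ-sym : ∀ {u v} → u ≈ᴷ v → v ≈ᴷ u
  ≈ᴷ-sym e .at i = sym (e .at i)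

  ≈ᴷ-refl : ∀ {u} → u ≈ᴷ u
  ≈ᴷ-refl .at i = refl

  -- Linearity over ℚ reduces the ring laws to powers of `θ` with exponent below `n`, where they
  -- become statements on sums of exponents.
  record Linear (F : K → K) : Set where
    field
      l-cong : ∀ {u v} → u ≈ᴷ v → F u ≈ᴷ F v
      l-+    : ∀ u v → F (u +K v) ≈ᴷ (F u +K F v)
      l-·    : ∀ q u → F (q · u) ≈ᴷ (q · F u)
  open Linear

  +K-cong : ∀ {u u′ v v′} → u ≈ᴷ u′ → v ≈ᴷ v′ → (u +K v) ≈ᴷ (u′ +K v′)
  +K-cong e f .at i = cong₂ ℚ._+_ (e .at i) (f .at i)

  ·-cong : ∀ q {u v} → u ≈ᴷ v → (q · u) ≈ᴷ (q · v)
  ·-cong q e .at i = cong (q ℚ.*_) (e .at i)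

  mulˡ : ∀ v → Linear (λ u → u *K v)
  mulˡ v = record { l-cong = λ e → *K-cong {v = v} e ≈ᴷ-refl ; l-+ = λ u u′ → *K-+ˡ u u′ v ; l-· = λ q u → *K-·ˡ q u v }

  mulʳ : ∀ v → Linear (λ u → v *K u)
  mulʳ v = record
    { l-cong = λ e → *K-cong {v} {v} ≈ᴷ-refl e
    ; l-+ = λ u u′ → ≈ᴷ-trans (*K-comm v (u +K u′)) (≈ᴷ-trans (*K-+ˡ u u′ v) (+K-cong (*K-comm u v) (*K-comm u′ v)))
    ; l-· = λ q u → ≈ᴷ-trans (*K-comm v (q · u)) (≈ᴷ-trans (*K-·ˡ q u v) (·-cong q (*K-comm u v))) }

  comp : ∀ {F G} → Linear F → Linear G → Linear (λ u → F (G u))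
  comp lF lG = record
    { l-cong = λ e → l-cong lF (l-cong lG e)
    ; l-+ = λ u v → ≈ᴷ-trans (l-cong lF (l-+ lG u v)) (l-+ lF _ _)
    ; l-· = λ q u → ≈ᴷ-trans (l-cong lF (l-· lG q u)) (l-· lF q _) }

  l-0 : ∀ {F} → Linear F → F 0K ≈ᴷ 0K
  l-0 {F} lF = ≈ᴷ-trans (l-cong lF (pointwise (λ i → sym (ℚP.*-zeroˡ 0ℚ)))) (≈ᴷ-trans (l-· lF 0ℚ 0K) (pointwise (λ i → ℚP.*-zeroˡ (F 0K i))))

  l-sum : ∀ {F} → Linear F → ∀ {m} (q : Fin m → ℚ) (b : Fin m → K) →
    F (sumK (λ i → q i · b i)) ≈ᴷ sumK (λ i → q i · F (b i))
  l-sum lF {zero}  q b = l-0 lF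
  l-sum lF {suc m} q b = ≈ᴷ-trans (l-+ lF _ _) (+K-cong (l-· lF (q zero) (b zero)) (l-sum lF (λ i → q (suc i)) (λ i → b (suc i))))

  sumK-cong : ∀ {m} {f g : Fin m → K} → (∀ i → f i ≈ᴷ g i) → sumK f ≈ᴷ sumK g
  sumK-cong {zero}  h = ≈ᴷ-refl
  sumK-cong {suc m} h = +K-cong (h zero) (sumK-cong (λ i → h (suc i)))

  θ-at-≡ : ∀ k (i : Fin n) → toℕ i ≡ rem k n → θ^ k i ≡ toℚ a ^ℚ quot k n
  θ-at-≡ k i e with toℕ i ℕ.≟ rem k n
  ... | yes _ = refl
  ... | no ≢  = ⊥-elim (≢ e)

  θ-at-≢ : ∀ k (i : Fin n) → toℕ i ≢ rem k n → θ^ k i ≡ 0ℚ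
  θ-at-≢ k i ne with toℕ i ℕ.≟ rem k n
  ... | yes e = ⊥-elim (ne e)
  ... | no _  = refl

  θ-basis-≡ : ∀ (j : Fin n) → θ^ (toℕ j) j ≡ 1ℚ
  θ-basis-≡ j = trans (θ-at-≡ (toℕ j) j (sym (rem-< (FinP.toℕ<n j)))) (cong (toℚ a ^ℚ_) (quot-< (FinP.toℕ<n j)))

  θ-basis-≢ : ∀ (i j : Fin n) → i ≢ j → θ^ (toℕ j) i ≡ 0ℚ
  θ-basis-≢ i j ne = θ-at-≢ (toℕ j) i (λ e → ne (FinP.toℕ-injective (trans e (rem-< (FinP.toℕ<n j)))))

  expand : ∀ u → u ≈ᴷ sumK (λ i → u i · θ^ (toℕ i))
  expand u .at l = sym (trans (sumK-at (λ i → u i · θ^ (toℕ i)) l) (trans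
    (sumQ-δ l (λ i → u i ℚ.* θ^ (toℕ i) l) (λ i i≢l → trans (cong (u i ℚ.*_) (θ-basis-≢ l i (λ e → i≢l (sym e)))) (ℚP.*-zeroʳ (u i))))
    (trans (cong (u l ℚ.*_) (θ-basis-≡ l)) (ℚP.*-identityʳ (u l)))))

  lin-ext : ∀ {F G} → Linear F → Linear G → (∀ (i : Fin n) → F (θ^ (toℕ i)) ≈ᴷ G (θ^ (toℕ i))) → ∀ u → F u ≈ᴷ G u
  lin-ext lF lG h u = ≈ᴷ-trans (l-cong lF (expand u)) (≈ᴷ-trans (l-sum lF u (λ i → θ^ (toℕ i)))
    (≈ᴷ-trans (sumK-cong (λ i → ·-cong (u i) (h i))) (≈ᴷ-trans (≈ᴷ-sym (l-sum lG u (λ i → θ^ (toℕ i)))) (l-cong lG (≈ᴷ-sym (expand u))))))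

  mul-basis : ∀ (i j : Fin n) → (θ^ (toℕ i) *K θ^ (toℕ j)) ≈ᴷ θ^ (toℕ i ℕ.+ toℕ j)
  mul-basis i j .at l = trans (*K-at (θ^ (toℕ i)) (θ^ (toℕ j)) l) (trans
    (sumQ-δ i _ (λ i′ ne → sumQ-0 _ (λ j′ → trans (cong (λ q → (q ℚ.* θ^ (toℕ j) j′) ℚ.* θ^ (toℕ i′ ℕ.+ toℕ j′) l) (θ-basis-≢ i′ i ne))
       (ℚR.solve 2 (λ x y → (ℚR.con (+ 0) ℚR.:* x) ℚR.:* y ℚR.:= ℚR.con (+ 0)) refl (θ^ (toℕ j) j′) (θ^ (toℕ i′ ℕ.+ toℕ j′) l)))))
    (trans (sumQ-δ j _ (λ j′ ne → trans (cong (λ q → (θ^ (toℕ i) i ℚ.* q) ℚ.* θ^ (toℕ i ℕ.+ toℕ j′) l) (θ-basis-≢ j′ j ne))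
       (ℚR.solve 2 (λ x y → (x ℚR.:* ℚR.con (+ 0)) ℚR.:* y ℚR.:= ℚR.con (+ 0)) refl (θ^ (toℕ i) i) (θ^ (toℕ i ℕ.+ toℕ j′) l))))
    (trans (cong₂ (λ q r → (q ℚ.* r) ℚ.* θ^ (toℕ i ℕ.+ toℕ j) l) (θ-basis-≡ i) (θ-basis-≡ j))
       (ℚR.solve 1 (λ x → (ℚR.con (+ 1) ℚR.:* ℚR.con (+ 1)) ℚR.:* x ℚR.:= x) refl (θ^ (toℕ i ℕ.+ toℕ j) l)))))

  θ-+n : ∀ k → θ^ (k ℕ.+ n) ≈ᴷ (toℚ a · θ^ k)
  θ-+n k .at i = go (toℕ i ℕ.≟ rem k n)
    where
    go : Dec (toℕ i ≡ rem k n) → θ^ (k ℕ.+ n) i ≡ toℚ a ℚ.* θ^ k i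
    go (yes e) = trans (θ-at-≡ (k ℕ.+ n) i (trans e (sym (rem-+n k 0<n))))
      (trans (cong (toℚ a ^ℚ_) (quot-+n k 0<n)) (cong (toℚ a ℚ.*_) (sym (θ-at-≡ k i e))))
    go (no ne) = trans (θ-at-≢ (k ℕ.+ n) i (λ e → ne (trans e (rem-+n k 0<n))))
      (sym (trans (cong (toℚ a ℚ.*_) (θ-at-≢ k i ne)) (ℚP.*-zeroʳ (toℚ a))))

  ≡⇒≈ : ∀ {u v} → u ≡ v → u ≈ᴷ v
  ≡⇒≈ refl = ≈ᴷ-refl

  -- θ^k * u is determined by its values at k < n, since multiplication is ℚ-linear and θ^(k+n) = a θ^k.
  reduce : ∀ {F} → Linear F → (G : ℕ → K) → (∀ k → G (k ℕ.+ n) ≈ᴷ (toℚ a · G k)) →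
    (∀ (i : Fin n) → F (θ^ (toℕ i)) ≈ᴷ G (toℕ i)) → ∀ k → F (θ^ k) ≈ᴷ G k
  reduce {F} lF G G-+n h k = subst (λ k → F (θ^ k) ≈ᴷ G k) (sym (rem+quot k 0<n)) (go (quot k n))
    where
    r = rem k n
    base : F (θ^ r) ≈ᴷ G r
    base = subst (λ r → F (θ^ r) ≈ᴷ G r) (FinP.toℕ-fromℕ< (rem<n k 0<n)) (h (fromℕ< (rem<n k 0<n)))
    go : ∀ q → F (θ^ (r ℕ.+ q ℕ.* n)) ≈ᴷ G (r ℕ.+ q ℕ.* n)
    go zero    = subst (λ r → F (θ^ r) ≈ᴷ G r) (sym (ℕP.+-identityʳ r)) base
    go (suc q) = subst (λ r → F (θ^ r) ≈ᴷ G r) (trans (ℕP.+-assoc r (q ℕ.* n) n) (cong (r ℕ.+_) (ℕP.+-comm (q ℕ.* n) n)))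
      (≈ᴷ-trans (l-cong lF (θ-+n (r ℕ.+ q ℕ.* n))) (≈ᴷ-trans (l-· lF (toℚ a) (θ^ (r ℕ.+ q ℕ.* n)))
      (≈ᴷ-trans (·-cong (toℚ a) (go q)) (≈ᴷ-sym (G-+n (r ℕ.+ q ℕ.* n))))))

  mul-θ : ∀ k l → (θ^ k *K θ^ l) ≈ᴷ θ^ (k ℕ.+ l)
  mul-θ k l = reduce (mulˡ (θ^ l)) (λ k → θ^ (k ℕ.+ l)) (λ k → ≈ᴷ-trans (≡⇒≈ (cong θ^ (swap k l n))) (θ-+n (k ℕ.+ l)))
    (λ i → reduce (mulʳ (θ^ (toℕ i))) (λ l → θ^ (toℕ i ℕ.+ l)) (λ l → ≈ᴷ-trans (≡⇒≈ (cong θ^ (sym (ℕP.+-assoc (toℕ i) l n)))) (θ-+n (toℕ i ℕ.+ l)))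
      (λ j → mul-basis i j) l) k
    where
    swap : ∀ k l n → k ℕ.+ n ℕ.+ l ≡ k ℕ.+ l ℕ.+ n
    swap k l n = trans (ℕP.+-assoc k n l) (trans (cong (k ℕ.+_) (ℕP.+-comm n l)) (sym (ℕP.+-assoc k l n)))

  *K-assoc : ∀ u v w → ((u *K v) *K w) ≈ᴷ (u *K (v *K w))
  *K-assoc u v w = lin-ext (comp (mulˡ w) (mulˡ v)) (mulˡ (v *K w)) (λ i →
    lin-ext (comp (mulˡ w) (mulʳ (θ^ (toℕ i)))) (comp (mulʳ (θ^ (toℕ i))) (mulˡ w)) (λ j →
      lin-ext (mulʳ (θ^ (toℕ i) *K θ^ (toℕ j))) (comp (mulʳ (θ^ (toℕ i))) (mulʳ (θ^ (toℕ j)))) (λ k → base (toℕ i) (toℕ j) (toℕ k)) w) v) u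
    where
    base : ∀ i j k → ((θ^ i *K θ^ j) *K θ^ k) ≈ᴷ (θ^ i *K (θ^ j *K θ^ k))
    base i j k = ≈ᴷ-trans (*K-cong {v = θ^ k} (mul-θ i j) ≈ᴷ-refl) (≈ᴷ-trans (mul-θ (i ℕ.+ j) k) (≈ᴷ-trans (≡⇒≈ (cong θ^ (ℕP.+-assoc i j k)))
      (≈ᴷ-sym (≈ᴷ-trans (*K-cong {θ^ i} {θ^ i} ≈ᴷ-refl (mul-θ j k)) (mul-θ i (j ℕ.+ k))))))

  *K-identityˡ : ∀ u → (1K *K u) ≈ᴷ u
  *K-identityˡ = lin-ext (mulʳ 1K) (record { l-cong = λ e → e ; l-+ = λ _ _ → ≈ᴷ-refl ; l-· = λ _ _ → ≈ᴷ-refl }) (λ i → mul-θ 0 (toℕ i))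

  abstract
    _⊞_ _⊠_ : K → K → K
    _⊞_ = _+K_
    _⊠_ = _*K_
    ⊟_ : K → K
    ⊟_ = -K_

    ⊞-def : ∀ u v → (u ⊞ v) ≈ᴷ (u +K v)
    ⊞-def u v = ≈ᴷ-refl
    ⊠-def : ∀ u v → (u ⊠ v) ≈ᴷ (u *K v)
    ⊠-def u v = ≈ᴷ-refl

    isCommutativeRing : IsCommutativeRing _≈ᴷ_ _⊞_ _⊠_ ⊟_ 0K 1K
    isCommutativeRing = record
      { isRing = record
        { +-isAbelianGroup = record
          { isGroup = record
            { isMonoid = record
              { isSemigroup = record
                { isMagma = record
                  { isEquivalence = record { refl = ≈ᴷ-refl ; sym = ≈ᴷ-sym ; trans = ≈ᴷ-trans }
                  ; ∙-cong = +K-cong }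
                ; assoc = λ u v w → pointwise (λ i → ℚP.+-assoc (u i) (v i) (w i)) }
              ; identity = (λ u → pointwise (λ i → ℚP.+-identityˡ (u i))) , (λ u → pointwise (λ i → ℚP.+-identityʳ (u i))) }
            ; inverse = (λ u → pointwise (λ i → ℚP.+-inverseˡ (u i))) , (λ u → pointwise (λ i → ℚP.+-inverseʳ (u i)))
            ; ⁻¹-cong = λ e → pointwise (λ i → cong ℚ.-_ (e .at i)) }
          ; comm = λ u v → pointwise (λ i → ℚP.+-comm (u i) (v i)) }
        ; *-cong = *K-cong
        ; *-assoc = *K-assoc
        ; *-identity = *K-identityˡ , (λ u → ≈ᴷ-trans (*K-comm u 1K) (*K-identityˡ u))
        ; distrib = (λ u v w → l-+ (mulʳ u) v w) , (λ u v w → *K-+ˡ v w u) }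
      ; *-comm = *K-comm }

  Kring : CommutativeRing 0ℓ 0ℓ
  Kring = record { isCommutativeRing = isCommutativeRing }

  module T = RingTools Kring

  ⊞-at : ∀ u v i → (u ⊞ v) i ≡ u i ℚ.+ v i
  ⊞-at u v i = ⊞-def u v .at i

  ·-⊠ : ∀ q u v → ((q · u) ⊠ v) ≈ᴷ (q · (u ⊠ v))
  ·-⊠ q u v = ≈ᴷ-trans (⊠-def (q · u) v) (≈ᴷ-trans (*K-·ˡ q u v) (·-cong q (≈ᴷ-sym (⊠-def u v))))

  ⊠-θ : ∀ k l → (θ^ k ⊠ θ^ l) ≈ᴷ θ^ (k ℕ.+ l)
  ⊠-θ k l = ≈ᴷ-trans (⊠-def (θ^ k) (θ^ l)) (mul-θ k l)

  ιℕ-def : ∀ m → T.ιℕ m ≈ᴷ (toℚ (+ m) · 1K)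
  ιℕ-def zero = pointwise (λ i → sym (ℚP.*-zeroˡ (1K i)))
  ιℕ-def (suc m) = ≈ᴷ-trans (T.ιℕ-suc m) (pointwise (λ i → trans (⊞-at 1K (T.ιℕ m) i) (trans (cong (1K i ℚ.+_) (ιℕ-def m .at i))
    (trans (ℚR.solve 2 (λ o x → o ℚR.:+ x ℚR.:* o ℚR.:= (ℚR.con (+ 1) ℚR.:+ x) ℚR.:* o) refl (1K i) (toℚ (+ m)))
           (cong (ℚ._* 1K i) (sym (toℚ-+ (+ 1) (+ m))))))))

  ⊟-at : ∀ u i → (⊟ u) i ≡ ℚ.- u i
  ⊟-at u i = trans (sym (ℚP.+-identityʳ _)) (trans (cong ((⊟ u) i ℚ.+_) (sym (ℚP.+-inverseʳ (u i)))) (trans (sym (ℚP.+-assoc ((⊟ u) i) (u i) (ℚ.- u i)))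
    (trans (cong (ℚ._+ ℚ.- u i) (trans (sym (⊞-at (⊟ u) u i)) (T.-‿inverseˡ u .at i))) (ℚP.+-identityˡ _))))

  ι-def : ∀ z → T.ι z ≈ᴷ (toℚ z · 1K)
  ι-def (+ m)    = ιℕ-def m
  ι-def -[1+ m ] = pointwise (λ i → trans (⊟-at (T.ιℕ (suc m)) i) (trans (cong ℚ.-_ (ιℕ-def (suc m) .at i))
    (trans (ℚP.neg-distribˡ-* (toℚ (+ suc m)) (1K i)) (cong (ℚ._* 1K i) (sym (toℚ-neg (+ suc m)))))))

  ι-· : ∀ z u → (T.ι z ⊠ u) ≈ᴷ (toℚ z · u)
  ι-· z u = ≈ᴷ-trans (T.*-congʳ {u} (ι-def z)) (≈ᴷ-trans (·-⊠ (toℚ z) 1K u) (·-cong (toℚ z) (T.*-identityˡ u)))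

  torsionFree : T.TorsionFree
  torsionFree z u z≢0 e = pointwise (λ i → ℚ-field (λ z≡0 → z≢0 (toℚ-injective z≡0)) (≈ᴷ-trans (≈ᴷ-sym (ι-· z u)) e .at i))

  θ-pow : ∀ k m → (θ^ k T.^ m) ≈ᴷ θ^ (k ℕ.* m)
  θ-pow k zero    = ≡⇒≈ (cong θ^ (sym (ℕP.*-zeroʳ k)))
  θ-pow k (suc m) = ≈ᴷ-trans (T.*-congˡ {θ^ k} (θ-pow k m)) (≈ᴷ-trans (⊠-θ k (k ℕ.* m)) (≡⇒≈ (cong θ^ (sym (ℕP.*-suc k m)))))

  ^K-def : ∀ u m → (u ^K m) ≈ᴷ (u T.^ m)
  ^K-def u zero    = ≈ᴷ-refl
  ^K-def u (suc m) = ≈ᴷ-trans (*K-cong {u} {u} ≈ᴷ-refl (^K-def u m)) (≈ᴷ-sym (⊠-def u (u T.^ m)))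

  Σ-at : ∀ m (f : ℕ → K) i → T.Σ< m f i ≡ ℚR.Σ< m (λ k → f k i)
  Σ-at zero    f i = refl
  Σ-at (suc m) f i = trans (⊞-at (T.Σ< m f) (f m) i) (cong (ℚ._+ f m i) (Σ-at m f i))

  sumKℕ-def : ∀ m f → sumKℕ m f ≈ᴷ T.Σ< m f
  sumKℕ-def zero    f = ≈ᴷ-refl
  sumKℕ-def (suc m) f = ≈ᴷ-trans (+K-cong {v = f m} (sumKℕ-def m f) ≈ᴷ-refl) (≈ᴷ-sym (⊞-def (T.Σ< m f) (f m)))

  sumK-def : ∀ m (f : ℕ → K) → sumK {m} (λ i → f (toℕ i)) ≈ᴷ T.Σ< m f
  sumK-def zero    f = ≈ᴷ-refl
  sumK-def (suc m) f = ≈ᴷ-trans (+K-cong {f 0} ≈ᴷ-refl (sumK-def m (λ i → f (suc i)))) (≈ᴷ-trans (≈ᴷ-sym (⊞-def (f 0) (T.Σ< m (λ i → f (suc i))))) (≈ᴷ-sym (T.Σ-shift m f)))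

-- Integral and almost integral elements

-- The ℤ-span of `v 0` up to `v (t - 1)`. Since vectors are functions, each constructor takes its
-- equality pointwise.
data InSpan {n : ℕ} (v : ℕ → Fin n → ℤ) (t : ℕ) : (Fin n → ℤ) → Set where
  mem   : ∀ {l w} → l < t → (∀ i → w i ≡ v l i) → InSpan v t w
  nil   : ∀ {w} → (∀ i → w i ≡ + 0) → InSpan v t w
  _⊕ₛ_  : ∀ {u w x} → InSpan v t u → InSpan v t w → {e : ∀ i → x i ≡ u i ℤ.+ w i} → InSpan v t x
  scale : ∀ {u x} z → InSpan v t u → (∀ i → x i ≡ z ℤ.* u i) → InSpan v t x

span-mono : ∀ {n} {v : ℕ → Fin n → ℤ} {t t′ w} → t ≤ t′ → InSpan v t w → InSpan v t′ w
span-mono t≤ (mem l< e)      = mem (ℕP.<-≤-trans l< t≤) e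
span-mono t≤ (nil e)         = nil e
span-mono t≤ (_⊕ₛ_ s s′ {e}) = _⊕ₛ_ (span-mono t≤ s) (span-mono t≤ s′) {e}
span-mono t≤ (scale z s e)   = scale z (span-mono t≤ s) e

search : (P : ℕ → Set) → (∀ i → Dec (P i)) → ∀ m → (∃[ i ] (i < m) × ¬ P i) ⊎ (∀ i → i < m → P i)
search P P? zero = inj₂ (λ i ())
search P P? (suc m) with search P P? m | P? m
... | inj₁ (i , i<m , h) | _     = inj₁ (i , ℕP.m<n⇒m<1+n i<m , h)
... | inj₂ _             | no h  = inj₁ (m , ℕP.n<1+n m , h)
... | inj₂ all           | yes h = inj₂ (λ i i<1+m → go i (ℕP.m≤n⇒m<n∨m≡n (ℕP.<⇒≤pred i<1+m)))
  where
  go : ∀ i → i < m ⊎ i ≡ m → P i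
  go i (inj₁ i<m) = all i i<m
  go i (inj₂ refl) = h

cons0 : ∀ {n} → (Fin n → ℤ) → Fin (suc n) → ℤ
cons0 w zero    = + 0
cons0 w (suc i) = w i

lift : ∀ {n} {z : ℕ → Fin n → ℤ} {k} {v : ℕ → Fin (suc n) → ℤ} {t} →
  (∀ i → i < k → InSpan v t (cons0 (z i))) → ∀ {w} → InSpan z k w → InSpan v t (cons0 w)
lift h (mem {l} l< e) = scale (+ 1) (h l l<) (λ { zero → refl ; (suc i) → trans (e i) (sym (ℤP.*-identityˡ _)) })
lift h (nil e)        = nil (λ { zero → refl ; (suc i) → e i })
lift h (_⊕ₛ_ s s′ {e}) = _⊕ₛ_ (lift h s) (lift h s′) {λ { zero → refl ; (suc i) → e i }}
lift h (scale z s e)  = scale z (lift h s) (λ { zero → sym (ℤP.*-zeroʳ z) ; (suc i) → e i })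

-- For ℤ^(1+n), the first coordinates are cleared by an element y of the span; if some first
-- coordinate is not a multiple of that of y, division with remainder yields a smaller y.
noetherian : ∀ n (v : ℕ → Fin n → ℤ) → ∃[ k ] InSpan v k (v k)
noetherian zero    v = 0 , nil (λ ())
noetherian (suc n) v with noetherian n (λ k i → v k (suc i))
... | k , s with search (λ i → v i zero ≡ + 0) (λ i → v i zero ℤP.≟ + 0) (suc k)
... | inj₂ all = k , scale (+ 1) (lift {v = v} (λ i i<k → scale (+ 1) (mem i<k (λ _ → refl))
        (λ { zero → trans (sym (all i (ℕP.m<n⇒m<1+n i<k))) (sym (ℤP.*-identityˡ _)) ; (suc _) → sym (ℤP.*-identityˡ _) })) s)
      (λ { zero → trans (all k (ℕP.n<1+n k)) refl ; (suc _) → sym (ℤP.*-identityˡ _) })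
... | inj₁ (i , _ , v≢0) = stage (suc i) (v i) (mem (ℕP.n<1+n i) (λ _ → refl)) v≢0 (<-wellFounded _)
  where
  -- As `y` is in the span of the vectors before `t`, each later vector `v (t + i)` may be reduced
  -- by `y` without leaving the span of its predecessors and itself.
  stage : ∀ t y → InSpan v t y → y zero ≢ + 0 → Acc _<_ ℤ.∣ y zero ∣ → ∃[ k ] InSpan v k (v k)
  stage t y sy y≢0 (acc rec) = go (noetherian n z)
    where
    instance nz = ℤ.≢-nonZero y≢0
    q : ℕ → ℤ
    q i = v (t ℕ.+ i) zero ℤ./ y zero
    w : ℕ → Fin (suc n) → ℤ
    w i j = v (t ℕ.+ i) j ℤ.+ ℤ.- q i ℤ.* y j
    z : ℕ → Fin n → ℤ
    z i j = w i (suc j)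
    w0 : ∀ i → w i zero ≡ + (v (t ℕ.+ i) zero ℤ.% y zero)
    w0 i = trans (cong (ℤ._+ ℤ.- q i ℤ.* y zero) (ℤD.a≡a%n+[a/n]*n (v (t ℕ.+ i) zero) (y zero)))
      (ℤR.solve 3 (λ r q y → (r ℤR.:+ q ℤR.:* y) ℤR.:+ (ℤR.:- q) ℤR.:* y ℤR.:= r) refl (+ (v (t ℕ.+ i) zero ℤ.% y zero)) (q i) (y zero))
    w∈ : ∀ i t′ → t ℕ.+ i < t′ → InSpan v t′ (w i)
    w∈ i t′ lt = _⊕ₛ_ (mem lt (λ _ → refl)) (scale (ℤ.- q i) (span-mono (ℕP.≤-trans (ℕP.m≤m+n t i) (ℕP.<⇒≤ lt)) sy) (λ _ → refl)) {λ _ → refl}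
    go : ∃[ k ] InSpan z k (z k) → ∃[ k ] InSpan v k (v k)
    go (k , s) with search (λ i → w i zero ≡ + 0) (λ i → w i zero ℤP.≟ + 0) (suc k)
    ... | inj₁ (i , _ , w≢0) = stage (suc (t ℕ.+ i)) (w i) (w∈ i _ (ℕP.n<1+n _)) w≢0
          (rec (subst (_< ℤ.∣ y zero ∣) (sym (cong ℤ.∣_∣ (w0 i))) (ℤD.n%d<d (v (t ℕ.+ i) zero) (y zero))))
    ... | inj₂ all = t ℕ.+ k , _⊕ₛ_ (lift {v = v} (λ i i<k → scale (+ 1) (w∈ i (t ℕ.+ k) (ℕP.+-monoʳ-< t i<k))
              (λ { zero → trans (sym (all i (ℕP.m<n⇒m<1+n i<k))) (sym (ℤP.*-identityˡ _)) ; (suc _) → sym (ℤP.*-identityˡ _) })) s)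
            (scale (q k) (span-mono (ℕP.m≤m+n t k) sy) (λ _ → refl))
            {λ { zero → trans (eq zero) (cong (ℤ._+ q k ℤ.* y zero) (all k (ℕP.n<1+n k))) ; (suc j) → eq (suc j) }}
      where
      eq : ∀ j → v (t ℕ.+ k) j ≡ w k j ℤ.+ q k ℤ.* y j
      eq j = ℤR.solve 3 (λ v q y → v ℤR.:= (v ℤR.:+ (ℤR.:- q) ℤR.:* y) ℤR.:+ q ℤR.:* y) refl (v (t ℕ.+ k) j) (q k) (y j)

span⇒coeffs : ∀ {n} {v : ℕ → Fin n → ℤ} {t w} → InSpan v t w → ∃[ c ] ∀ i → w i ≡ ℤR.Σ< t (λ l → c l ℤ.* v l i)
span⇒coeffs {v = v} {t} (mem {l} l<t e) = (λ i → ℤR.δ i l) , λ i → trans (e i) (sym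
  (trans (ℤR.Σ-cong t (λ k _ → cong (ℤ._* v k i) (sym (ι-id (ℤR.δ k l))))) (ℤR.Σ-δ t (λ k → v k i) l<t)))
  where
  ιℕ-id : ∀ m → ℤR.ιℕ m ≡ + m
  ιℕ-id zero = refl
  ιℕ-id (suc zero) = refl
  ιℕ-id (suc (suc m)) = cong (ℤ._+_ (+ 1)) (ιℕ-id (suc m))
  ι-id : ∀ z → ℤR.ι z ≡ z
  ι-id (+ m) = ιℕ-id m
  ι-id -[1+ m ] = cong ℤ.-_ (ιℕ-id (suc m))
span⇒coeffs {v = v} {t} (nil e) = (λ _ → + 0) , λ i → trans (e i) (sym (ℤR.Σ-zero t (λ l _ → ℤP.*-zeroˡ (v l i))))
span⇒coeffs {v = v} {t} (_⊕ₛ_ s s′ {e}) with span⇒coeffs s | span⇒coeffs s′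
... | c , h | c′ , h′ = (λ l → c l ℤ.+ c′ l) , λ i → trans (e i) (trans (cong₂ ℤ._+_ (h i) (h′ i))
   (trans (sym (ℤR.Σ-+ t _ _)) (ℤR.Σ-cong t (λ l _ → sym (ℤP.*-distribʳ-+ (v l i) (c l) (c′ l))))))
span⇒coeffs {v = v} {t} (scale z s e) with span⇒coeffs s
... | c , h = (λ l → z ℤ.* c l) , λ i → trans (e i) (trans (cong (z ℤ.*_) (h i))
   (trans (ℤR.Σ-*ˡ t z _) (ℤR.Σ-cong t (λ l _ → sym (ℤP.*-assoc z (c l) (v l i))))))

IsInt : ℚ → Set
IsInt q = ∃[ z ] q ≡ toℚ z

int-+ : ∀ {q r} → IsInt q → IsInt r → IsInt (q ℚ.+ r)
int-+ (x , refl) (y , refl) = x ℤ.+ y , sym (toℚ-+ x y)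

int-* : ∀ {q r} → IsInt q → IsInt r → IsInt (q ℚ.* r)
int-* (x , refl) (y , refl) = x ℤ.* y , sym (toℚ-* x y)

int-sum : ∀ {m} {f : Fin m → ℚ} → (∀ i → IsInt (f i)) → IsInt (sumFinℚ f)
int-sum {zero}  h = + 0 , refl
int-sum {suc m} h = int-+ (h zero) (int-sum (λ i → h (suc i)))

common-denominator : ∀ {m} (q : Fin m → ℚ) → ∃[ D ] ∀ i → IsInt (toℚ (+ suc D) ℚ.* q i)
common-denominator {zero}  q = 0 , λ ()
common-denominator {suc m} q with denominator (q zero) | common-denominator (λ i → q (suc i))
... | D , z , e | E , h = E ℕ.+ D ℕ.* suc E , λ { zero → fst ; (suc i) → rest i }
  where
  split : toℚ (+ (suc D ℕ.* suc E)) ≡ toℚ (+ suc D) ℚ.* toℚ (+ suc E)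
  split = trans (cong toℚ (ℤP.pos-* (suc D) (suc E))) (toℚ-* (+ suc D) (+ suc E))
  fst : IsInt (toℚ (+ (suc D ℕ.* suc E)) ℚ.* q zero)
  fst = subst IsInt (sym (trans (cong (ℚ._* q zero) split) (ℚR.solve 3 (λ d e q → d ℚR.:* e ℚR.:* q ℚR.:= e ℚR.:* (d ℚR.:* q)) refl (toℚ (+ suc D)) (toℚ (+ suc E)) (q zero))))
          (int-* (+ suc E , refl) (z , e))
  rest : ∀ i → IsInt (toℚ (+ (suc D ℕ.* suc E)) ℚ.* q (suc i))
  rest i = subst IsInt (sym (trans (cong (ℚ._* q (suc i)) split) (ℚP.*-assoc (toℚ (+ suc D)) (toℚ (+ suc E)) (q (suc i)))))
          (int-* (+ suc D , refl) (h i))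

module Integrality (n : ℕ) (0<n : 0 < n) (a : ℤ) where
  open Field n a
  open KTheory n 0<n a
  open T using (AI; IsSubring)

  Zθ : K → Set
  Zθ u = ∀ i → IsInt (u i)

  int-^ : ∀ q → IsInt (toℚ a ^ℚ q)
  int-^ zero    = + 1 , refl
  int-^ (suc q) = int-* (a , refl) (int-^ q)

  Zθ-θ : ∀ k → Zθ (θ^ k)
  Zθ-θ k i with toℕ i ℕ.≟ rem k n
  ... | yes _ = int-^ (quot k n)
  ... | no _  = + 0 , refl

  Zθ-resp : ∀ {u v} → u ≈ᴷ v → Zθ u → Zθ v
  Zθ-resp e zu i = subst IsInt (e .at i) (zu i)

  ZθS : IsSubring Zθ
  ZθS = record
    { resp = Zθ-resp
    ; add = λ {u} {v} zu zv i → subst IsInt (sym (⊞-at u v i)) (int-+ (zu i) (zv i))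
    ; neg = λ {u} zu i → subst IsInt (sym (trans (⊟-at u i) (trans (cong ℚ.-_ (sym (ℚP.*-identityˡ (u i)))) (ℚP.neg-distribˡ-* 1ℚ (u i))))) (int-* (ℤ.- (+ 1) , refl) (zu i))
    ; mul = λ {u} {v} zu zv i → subst IsInt (sym (trans (⊠-def u v .at i) (*K-at u v i)))
        (int-sum (λ j → int-sum (λ k → int-* (int-* (zu j) (zv k)) (Zθ-θ (toℕ j ℕ.+ toℕ k) i))))
    ; one = Zθ-θ 0 }

  clear : ∀ u → ∃[ D ] Zθ (T.ι (+ suc D) ⊠ u)
  clear u with common-denominator u
  ... | D , h = D , λ i → subst IsInt (sym (ι-· (+ suc D) u .at i)) (h i)

  toℚ-Σ : ∀ m (f : ℕ → ℤ) → toℚ (ℤR.Σ< m f) ≡ ℚR.Σ< m (λ k → toℚ (f k))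
  toℚ-Σ zero    f = refl
  toℚ-Σ (suc m) f = trans (toℚ-+ (ℤR.Σ< m f) (f m)) (cong (ℚ._+ toℚ (f m)) (toℚ-Σ m f))

  toℚ-suc≢0 : ∀ D → toℚ (+ suc D) ≢ 0ℚ
  toℚ-suc≢0 D e with toℚ-injective {+ suc D} {+ 0} e
  ... | ()

  ℚ-cancel : ∀ {q x y} → q ≢ 0ℚ → q ℚ.* x ≡ q ℚ.* y → x ≡ y
  ℚ-cancel {q} {x} {y} q≢0 e = begin
    x                  ≡⟨ ℚR.solve 2 (λ x y → x ℚR.:= (x ℚR.:- y) ℚR.:+ y) refl x y ⟩
    (x ℚ.+ ℚ.- y) ℚ.+ y ≡⟨ cong (ℚ._+ y) (ℚ-field q≢0 (trans (ℚR.solve 3 (λ q x y → q ℚR.:* (x ℚR.:- y) ℚR.:= q ℚR.:* x ℚR.:- q ℚR.:* y) refl q x y)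
                            (trans (cong (ℚ._+ ℚ.- (q ℚ.* y)) e) (ℚP.+-inverseʳ (q ℚ.* y))))) ⟩
    0ℚ ℚ.+ y           ≡⟨ ℚP.+-identityˡ y ⟩
    y                  ∎
    where open ≡-Reasoning

  -- The coordinates of `suc D` times the powers of `α` form a sequence in ℤ^n. A member that
  -- depends on its predecessors becomes, after cancellation of `suc D`, a monic equation for `α`.
  AI⇒integral : ∀ {α} → AI Zθ α → IsIntegral α
  AI⇒integral {α} (D , h) = finish (noetherian n (λ k i → proj₁ (h k i)))
    where
    v : ℕ → Fin n → ℤ
    v k i = proj₁ (h k i)
    v-def : ∀ k i → toℚ (v k i) ≡ toℚ (+ suc D) ℚ.* (α T.^ k) i
    v-def k i = trans (sym (proj₂ (h k i))) (ι-· (+ suc D) (α T.^ k) .at i)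
    finish : ∃[ k ] InSpan v k (v k) → IsIntegral α
    finish (k , s) = go (span⇒coeffs s)
      where
      go : ∃[ c ] (∀ i → v k i ≡ ℤR.Σ< k (λ l → c l ℤ.* v l i)) → IsIntegral α
      go (c , e) = k , (λ i → ℤ.- c (toℕ i)) , λ i → begin
        (α ^K k) i ℚ.+ sumK {k} (λ j → toℚ (ℤ.- c (toℕ j)) · (α ^K toℕ j)) i
          ≡⟨ cong₂ ℚ._+_ (trans (^K-def α k .at i) (key i)) (trans (sumK-def k (λ j → toℚ (ℤ.- c j) · (α ^K j)) .at i) (trans (Σ-at k _ i)
               (trans (ℚR.Σ-cong k (λ l _ → trans (cong₂ ℚ._*_ (toℚ-neg (c l)) (^K-def α l .at i)) (sym (ℚP.neg-distribˡ-* (toℚ (c l)) _)))) (sym (ℚR.Σ-neg k _))))) ⟩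
        ℚR.Σ< k (λ l → toℚ (c l) ℚ.* (α T.^ l) i) ℚ.+ ℚ.- ℚR.Σ< k (λ l → toℚ (c l) ℚ.* (α T.^ l) i)
          ≡⟨ ℚP.+-inverseʳ (ℚR.Σ< k (λ l → toℚ (c l) ℚ.* (α T.^ l) i)) ⟩
        0ℚ ∎
        where
        open ≡-Reasoning
        key : ∀ i → (α T.^ k) i ≡ ℚR.Σ< k (λ l → toℚ (c l) ℚ.* (α T.^ l) i)
        key i = ℚ-cancel (toℚ-suc≢0 D) (begin
          toℚ (+ suc D) ℚ.* (α T.^ k) i                          ≡⟨ v-def k i ⟨
          toℚ (v k i)                                            ≡⟨ cong toℚ (e i) ⟩
          toℚ (ℤR.Σ< k (λ l → c l ℤ.* v l i))                    ≡⟨ toℚ-Σ k _ ⟩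
          ℚR.Σ< k (λ l → toℚ (c l ℤ.* v l i))                    ≡⟨ ℚR.Σ-cong k (λ l _ → trans (toℚ-* (c l) (v l i)) (trans (cong (toℚ (c l) ℚ.*_) (v-def l i))
                 (ℚR.solve 3 (λ c d x → c ℚR.:* (d ℚR.:* x) ℚR.:= d ℚR.:* (c ℚR.:* x)) refl (toℚ (c l)) (toℚ (+ suc D)) ((α T.^ l) i)))) ⟩
          ℚR.Σ< k (λ l → toℚ (+ suc D) ℚ.* (toℚ (c l) ℚ.* (α T.^ l) i)) ≡⟨ ℚR.Σ-*ˡ k (toℚ (+ suc D)) _ ⟨
          toℚ (+ suc D) ℚ.* ℚR.Σ< k (λ l → toℚ (c l) ℚ.* (α T.^ l) i) ∎)

  clear-all : ∀ m (f : ℕ → K) → ∃[ D ] ∀ k → k < m → Zθ (T.ι (+ suc D) ⊠ f k)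
  clear-all zero    f = 0 , λ k ()
  clear-all (suc m) f = combine (clear-all m f) (clear (f m))
    where
    combine : ∃[ D ] (∀ k → k < m → Zθ (T.ι (+ suc D) ⊠ f k)) → ∃[ E ] Zθ (T.ι (+ suc E) ⊠ f m) →
      ∃[ D ] ∀ k → k < suc m → Zθ (T.ι (+ suc D) ⊠ f k)
    combine (D , h) (E , g) = E ℕ.+ D ℕ.* suc E , λ k k< → go k (ℕP.m≤n⇒m<n∨m≡n (ℕP.<⇒≤pred k<))
      where
      go : ∀ k → k < m ⊎ k ≡ m → Zθ (T.ιℕ (suc D ℕ.* suc E) ⊠ f k)
      go k (inj₁ k<m) = IsSubring.scale-l ZθS (suc D) (suc E) (h k k<m)
      go k (inj₂ k≡m) = subst (λ k → Zθ (T.ιℕ (suc D ℕ.* suc E) ⊠ f k)) (sym k≡m) (IsSubring.scale-r ZθS (suc D) (suc E) g)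

  -- The finitely many powers below the degree `d` have a common denominator, and the monic equation
  -- expresses every higher power through lower ones with integer coefficients, so this denominator
  -- serves for all powers.
  integral⇒AI : ∀ {α} → IsIntegral α → AI Zθ α
  integral⇒AI {α} (d , c , e) = go (clear-all d (λ k → α T.^ k))
    where
    open IsSubring ZθS
    rel : (α T.^ d) ≈ᴷ (⊟ (sumK {d} (λ i → toℚ (c i) · (α ^K toℕ i))))
    rel = pointwise (λ i → trans (ℚR.solve 2 (λ x y → x ℚR.:= (x ℚR.:+ y) ℚR.:- y) refl ((α T.^ d) i) (s i))
       (trans (cong (ℚ._+ ℚ.- s i) (trans (cong (ℚ._+ s i) (sym (^K-def α d .at i))) (e i))) (trans (ℚP.+-identityˡ _) (sym (⊟-at s i)))))
      where
      s : K
      s = sumK {d} (λ i → toℚ (c i) · (α ^K toℕ i))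
    go : ∃[ D ] (∀ k → k < d → Zθ (T.ι (+ suc D) ⊠ (α T.^ k))) → AI Zθ α
    go (D , h) = D , λ k → all (suc k) k (ℕP.n<1+n k)
      where
      W : K
      W = T.ι (+ suc D)
      sum-in : ∀ m {l} (f : Fin l → ℤ) (b : Fin l → ℕ) → (∀ i → Zθ (W ⊠ (α T.^ (m ℕ.+ b i)))) →
        Zθ (W ⊠ ((α T.^ m) ⊠ sumK (λ i → toℚ (f i) · (α ^K b i))))
      sum-in m {zero} f b h = resp (T.solve 2 (λ w x → T.con (+ 0) T.:= w T.:* (x T.:* T.con (+ 0))) T.refl W (α T.^ m)) zer
      sum-in m {suc l} f b h = resp eq (add (mul (int (f zero)) (h zero)) (sum-in m (λ i → f (suc i)) (λ i → b (suc i)) (λ i → h (suc i))))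
        where
        r : K
        r = sumK (λ i → toℚ (f (suc i)) · (α ^K b (suc i)))
        eq : (((T.ι (f zero)) ⊠ (W ⊠ (α T.^ (m ℕ.+ b zero)))) ⊞ (W ⊠ ((α T.^ m) ⊠ r))) ≈ᴷ
             (W ⊠ ((α T.^ m) ⊠ ((toℚ (f zero) · (α ^K b zero)) +K r)))
        eq = T.trans (T.+-congʳ (T.*-congˡ (T.*-congˡ (T.^-homo-* α m (b zero)))))
          (T.trans (T.solve 5 (λ z w x y r → z T.:* (w T.:* (x T.:* y)) T.:+ w T.:* (x T.:* r) T.:= w T.:* (x T.:* (z T.:* y T.:+ r))) T.refl
             (T.ι (f zero)) W (α T.^ m) (α T.^ b zero) r)
          (T.*-congˡ (T.*-congˡ (T.trans (T.+-congʳ {r} (T.trans (ι-· (f zero) (α T.^ b zero)) (·-cong (toℚ (f zero)) (T.sym (^K-def α (b zero))))))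
             (⊞-def (toℚ (f zero) · (α ^K b zero)) r)))))
      -- The bound `b` turns this into a strong induction: the equation leads from `k` to all the
      -- exponents from `k ∸ d` up to `k - 1`.
      all : ∀ b k → k < b → Zθ (W ⊠ (α T.^ k))
      all (suc b) k k<1+b = by (k ℕ.<? d)
        where
        by : Dec (k < d) → Zθ (W ⊠ (α T.^ k))
        by (yes k<d) = h k k<d
        by (no k≮d) = resp (T.trans (T.solve 3 (λ w x s → T.:- (w T.:* (x T.:* s)) T.:= w T.:* (x T.:* (T.:- s))) T.refl W (α T.^ m) S)
            (T.*-congˡ {W} (T.trans (T.*-congˡ {α T.^ m} (T.sym rel)) (T.trans (T.sym (T.^-homo-* α m d)) (≡⇒≈ (cong (α T.^_) m+d≡k))))))
            (neg (sum-in m c toℕ (λ i → all b (m ℕ.+ toℕ i) (below i))))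
          where
          m = k ℕ.∸ d
          S : K
          S = sumK {d} (λ i → toℚ (c i) · (α ^K toℕ i))
          m+d≡k : m ℕ.+ d ≡ k
          m+d≡k = ℕP.m∸n+n≡m (ℕP.≮⇒≥ k≮d)
          below : (i : Fin d) → m ℕ.+ toℕ i < b
          below i = ℕP.<-≤-trans (subst (m ℕ.+ toℕ i <_) m+d≡k (ℕP.+-monoʳ-< m (FinP.toℕ<n i))) (ℕP.<⇒≤pred k<1+b)

-- Valuations and congruences

vpUpTo-spec : ∀ p x e → (p ℕ.^ vpUpTo p x e ∣ℕ x) × (∀ j → vpUpTo p x e < j → j ≤ e → ¬ p ℕ.^ j ∣ℕ x)
vpUpTo-spec p x zero = ℕD.1∣ x , λ j 0<j j≤0 → ⊥-elim (ℕP.<⇒≱ 0<j j≤0)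
vpUpTo-spec p x (suc e) with (p ℕ.^ suc e) ℕD.∣? x
... | yes d = d , λ j lt le → ⊥-elim (ℕP.<⇒≱ lt le)
... | no ∤  = proj₁ (vpUpTo-spec p x e) , λ j lt le → go j lt (ℕP.m≤n⇒m<n∨m≡n le)
  where
  go : ∀ j → vpUpTo p x e < j → j < suc e ⊎ j ≡ suc e → ¬ p ℕ.^ j ∣ℕ x
  go j lt (inj₁ j<)   = proj₂ (vpUpTo-spec p x e) j lt (ℕP.<⇒≤pred j<)
  go j lt (inj₂ refl) = ∤

vp-∣ : ∀ p x → p ℕ.^ vp p x ∣ℕ x
vp-∣ p x = proj₁ (vpUpTo-spec p x x)

vp-∤ : ∀ {p x} → 1 < p → 0 < x → ¬ p ℕ.^ suc (vp p x) ∣ℕ x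
vp-∤ {p} {x} 1<p 0<x d with suc (vp p x) ℕ.≤? x
... | yes le = proj₂ (vpUpTo-spec p x x) (suc (vp p x)) (ℕP.n<1+n _) le d
... | no ≰   = ℕP.<⇒≱ (ℕP.<-trans (ℕP.≰⇒> ≰) (n<m^n 1<p (suc (vp p x)))) (ℕD.∣⇒≤ {{ℕ.>-nonZero 0<x}} d)

vp-unique : ∀ {p e y} → Prime p → 0 < y → ¬ p ∣ℕ y → vp p (p ℕ.^ e ℕ.* y) ≡ e
vp-unique {p} {e} {y} pr 0<y ∤ = ℕP.≤-antisym upper lower
  where
  x = p ℕ.^ e ℕ.* y
  instance
    p≢0 : ℕ.NonZero p
    p≢0 = ℕ.>-nonZero (prime>0 pr)
  0<x : 0 < x
  0<x = ℕP.*-mono-< (ℕP.m^n>0 p e) 0<y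
  bad : ∀ {k} → e < k → ¬ p ℕ.^ k ∣ℕ x
  bad {k} e<k d = ∤ (ℕD.*-cancelˡ-∣ (p ℕ.^ e) {{ℕP.m^n≢0 p e}} (ℕD.∣-trans
     (subst (_∣ℕ p ℕ.^ k) (ℕP.*-comm p (p ℕ.^ e)) (pow∣ e<k)) d))
    where
    pow∣ : ∀ {i j} → i < j → p ℕ.^ suc i ∣ℕ p ℕ.^ j
    pow∣ {i} {j} i<j = subst (p ℕ.^ suc i ∣ℕ_) (trans (sym (ℕP.^-distribˡ-+-* p (suc i) (j ∸ suc i))) (cong (p ℕ.^_) (ℕP.m+[n∸m]≡n i<j))) (ℕD.m∣m*n _)
  upper : vp p x ≤ e
  upper = ℕP.≮⇒≥ (λ lt → bad lt (vp-∣ p x))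
  lower : e ≤ vp p x
  lower = ℕP.≮⇒≥ (λ lt → proj₂ (vpUpTo-spec p x x) e lt (ℕP.<⇒≤ (ℕP.<-≤-trans (n<m^n (prime>1 pr) e) (ℕP.m≤m*n (p ℕ.^ e) y {{ℕ.>-nonZero 0<y}}))) (ℕD.m∣m*n y))

count : ∀ {P : ℕ → Set} → Decidable P → ℕ → ℕ
count P? n = length (filter P? (upTo n))

count-suc : ∀ {P : ℕ → Set} (P? : Decidable P) n → count P? (suc n) ≡ count P? n ℕ.+ length (filter P? (n ∷ []))
count-suc P? n = trans (cong (λ xs → length (filter P? xs)) (sym (ListP.upTo-∷ʳ n)))
  (trans (cong length (ListP.filter-++ P? (upTo n) (n ∷ []))) (ListP.length-++ (filter P? (upTo n))))

count-step : ∀ {P : ℕ → Set} (P? : Decidable P) n → count P? (suc n) ≤ suc (count P? n)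
count-step P? n = ℕP.≤-trans (ℕP.≤-reflexive (count-suc P? n))
  (ℕP.≤-trans (ℕP.+-monoʳ-≤ (count P? n) (ListP.length-filter P? (n ∷ []))) (ℕP.≤-reflexive (ℕP.+-comm (count P? n) 1)))

count-no : ∀ {P : ℕ → Set} (P? : Decidable P) n → ¬ P n → count P? (suc n) ≡ count P? n
count-no P? n ¬p = trans (count-suc P? n) (trans (cong (λ xs → count P? n ℕ.+ length xs) (ListP.filter-reject P? {n} {[]} ¬p)) (ℕP.+-identityʳ _))

-- Among `p` consecutive candidates the last one is a multiple of `p` and is not counted. The bound
-- places every `m` with `k m ≥ 1` in the range of the second family of basis elements.
φ-bound : ∀ {p s} → Prime p → 1 ≤ s → φ (p ℕ.^ s) ≤ p ℕ.^ s ∸ p ℕ.^ (s ∸ 1)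
φ-bound {p} {suc s} pr _ = subst (φ (p ℕ.^ suc s) ≤_) eq (blocks (p ℕ.^ s))
  where
  N = p ℕ.^ suc s
  P? = λ k → coprime? (suc k) N
  p-1 : suc (p ∸ 1) ≡ p
  p-1 = ℕP.suc-pred p {{ℕ.>-nonZero (prime>0 pr)}}
  run : ∀ a i → count P? (a ℕ.+ i) ≤ count P? a ℕ.+ i
  run a zero    = ℕP.≤-reflexive (trans (cong (count P?) (ℕP.+-identityʳ a)) (sym (ℕP.+-identityʳ _)))
  run a (suc i) = subst (λ m → count P? m ≤ count P? a ℕ.+ suc i) (sym (ℕP.+-suc a i))
    (ℕP.≤-trans (count-step P? (a ℕ.+ i)) (ℕP.≤-trans (s≤s (run a i)) (ℕP.≤-reflexive (sym (ℕP.+-suc _ i)))))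
  blocks : ∀ m → count P? (p ℕ.* m) ≤ (p ∸ 1) ℕ.* m
  blocks zero    = subst (λ x → count P? x ≤ (p ∸ 1) ℕ.* 0) (sym (ℕP.*-zeroʳ p)) z≤n
  blocks (suc m) = begin
    count P? (p ℕ.* suc m)                     ≡⟨ cong (count P?) split ⟩
    count P? (suc (p ℕ.* m ℕ.+ (p ∸ 1)))       ≡⟨ count-no P? (p ℕ.* m ℕ.+ (p ∸ 1)) notcop ⟩
    count P? (p ℕ.* m ℕ.+ (p ∸ 1))             ≤⟨ run (p ℕ.* m) (p ∸ 1) ⟩
    count P? (p ℕ.* m) ℕ.+ (p ∸ 1)             ≤⟨ ℕP.+-monoˡ-≤ (p ∸ 1) (blocks m) ⟩
    (p ∸ 1) ℕ.* m ℕ.+ (p ∸ 1)                  ≡⟨ trans (ℕP.+-comm _ (p ∸ 1)) (sym (ℕP.*-suc (p ∸ 1) m)) ⟩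
    (p ∸ 1) ℕ.* suc m                          ∎
    where
    open ℕP.≤-Reasoning
    split : p ℕ.* suc m ≡ suc (p ℕ.* m ℕ.+ (p ∸ 1))
    split = trans (ℕP.*-suc p m) (trans (ℕP.+-comm p (p ℕ.* m)) (trans (cong (p ℕ.* m ℕ.+_) (sym p-1)) (ℕP.+-suc (p ℕ.* m) (p ∸ 1))))
    notcop : ¬ Coprime (suc (p ℕ.* m ℕ.+ (p ∸ 1))) N
    notcop cop = ℕP.<⇒≢ (prime>1 pr) (sym (cop (subst (p ∣ℕ_) split (ℕD.m∣m*n (suc m)) , ℕD.m∣m*n (p ℕ.^ s))))
  eq : (p ∸ 1) ℕ.* p ℕ.^ s ≡ N ∸ p ℕ.^ s
  eq = trans (ℕP.*-distribʳ-∸ (p ℕ.^ s) p 1) (cong (p ℕ.* p ℕ.^ s ∸_) (ℕP.*-identityˡ (p ℕ.^ s)))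

-- All of ℤ, so that the binomial theorem modulo `p` can be used for integers.
trivialS : ℤR.IsSubring (λ _ → ⊤)
trivialS = record { resp = λ _ _ → tt ; add = λ _ _ → tt ; neg = λ _ → tt ; mul = λ _ _ → tt ; one = tt }

ιℤ : ∀ z → ℤR.ι z ≡ z
ιℤ (+ m) = go m
  where
  go : ∀ m → ℤR.ιℕ m ≡ + m
  go zero = refl
  go (suc zero) = refl
  go (suc (suc m)) = cong (ℤ._+_ (+ 1)) (go (suc m))
ιℤ -[1+ m ] = trans (ℤR.ι-neg (+ suc m)) (cong ℤ.-_ (ιℤ (+ suc m)))

^ℤ : ∀ z n → z ℤR.^ n ≡ z ℤ.^ n
^ℤ z zero    = refl
^ℤ z (suc n) = cong (z ℤ.*_) (^ℤ z n)

-- By induction on z in both directions from (x+1)^p ≡ x^p + 1.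
fermat : ∀ {p} → Prime p → ∀ z → + p ∣ℤ z ℤ.^ p ℤ.- z
fermat {p} pr = main
  where
  step : ∀ x → + p ∣ℤ ((x ℤ.+ + 1) ℤ.^ p ℤ.- (x ℤ.+ + 1)) ℤ.- (x ℤ.^ p ℤ.- x)
  step x with ℤR.Freshman.fresh trivialS pr x (+ 1) tt tt
  ... | w , _ , h = divides (x ℤ.* + 1 ℤ.* w) (trans (cong (λ y → (y ℤ.- (x ℤ.+ + 1)) ℤ.- (x ℤ.^ p ℤ.- x)) h′)
       (ℤS′.solve 4 (λ xp x l u → ((xp ℤS′.:+ ℤS′.con (+ 1) ℤS′.:+ l ℤS′.:* u) ℤS′.:- (x ℤS′.:+ ℤS′.con (+ 1))) ℤS′.:- (xp ℤS′.:- x) ℤS′.:= u ℤS′.:* l) refl (x ℤ.^ p) x (+ p) (x ℤ.* + 1 ℤ.* w)))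
    where
    h′ : (x ℤ.+ + 1) ℤ.^ p ≡ x ℤ.^ p ℤ.+ + 1 ℤ.+ + p ℤ.* (x ℤ.* + 1 ℤ.* w)
    h′ = trans (sym (^ℤ (x ℤ.+ + 1) p)) (trans h (cong₂ ℤ._+_ (cong₂ ℤ._+_ (^ℤ x p) (trans (^ℤ (+ 1) p) (ℤP.^-zeroˡ p))) (cong (ℤ._* (x ℤ.* + 1 ℤ.* w)) (ιℤ (+ p)))))
  up : ∀ x → + p ∣ℤ x ℤ.^ p ℤ.- x → + p ∣ℤ (x ℤ.+ + 1) ℤ.^ p ℤ.- (x ℤ.+ + 1)
  up x h = subst (+ p ∣ℤ_) (ℤS′.solve 2 (λ a b → (a ℤS′.:- b) ℤS′.:+ b ℤS′.:= a) refl ((x ℤ.+ + 1) ℤ.^ p ℤ.- (x ℤ.+ + 1)) (x ℤ.^ p ℤ.- x)) (ℤS.∣m∣n⇒∣m+n (step x) h)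
  down : ∀ x → + p ∣ℤ (x ℤ.+ + 1) ℤ.^ p ℤ.- (x ℤ.+ + 1) → + p ∣ℤ x ℤ.^ p ℤ.- x
  down x h = subst (+ p ∣ℤ_) (ℤS′.solve 2 (λ a b → a ℤS′.:- (a ℤS′.:- b) ℤS′.:= b) refl ((x ℤ.+ + 1) ℤ.^ p ℤ.- (x ℤ.+ + 1)) (x ℤ.^ p ℤ.- x)) (ℤS.∣m∣n⇒∣m-n h (step x))
  zero-case : + p ∣ℤ (+ 0) ℤ.^ p ℤ.- + 0
  zero-case = subst (λ n → + p ∣ℤ (+ 0) ℤ.^ n ℤ.- + 0) (ℕP.suc-pred p {{ℕ.>-nonZero (prime>0 pr)}}) (divides (+ 0) refl)
  main : ∀ z → + p ∣ℤ z ℤ.^ p ℤ.- z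
  main (+ zero)      = zero-case
  main (+ suc m)     = subst (λ z → + p ∣ℤ z ℤ.^ p ℤ.- z) (cong +_ (ℕP.+-comm m 1)) (up (+ m) (main (+ m)))
  main -[1+ zero ]   = down -[1+ zero ] zero-case
  main -[1+ suc m ]  = down -[1+ suc m ] (main -[1+ m ])

fermat′ : ∀ {p} → Prime p → ∀ z → ¬ + p ∣ℤ z → + p ∣ℤ z ℤ.^ (p ∸ 1) ℤ.- + 1
fermat′ {p} pr z ∤ = go (euclidℤ pr z (z ℤ.^ (p ∸ 1) ℤ.- + 1) (subst (+ p ∣ℤ_) eq (fermat pr z)))
  where
  eq : z ℤ.^ p ℤ.- z ≡ z ℤ.* (z ℤ.^ (p ∸ 1) ℤ.- + 1)
  eq = trans (cong (λ n → z ℤ.^ n ℤ.- z) (sym (ℕP.suc-pred p {{ℕ.>-nonZero (prime>0 pr)}})))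
         (ℤS′.solve 2 (λ z y → z ℤS′.:* y ℤS′.:- z ℤS′.:= z ℤS′.:* (y ℤS′.:- ℤS′.con (+ 1))) refl z (z ℤ.^ (p ∸ 1)))
  go : + p ∣ℤ z ⊎ + p ∣ℤ z ℤ.^ (p ∸ 1) ℤ.- + 1 → + p ∣ℤ z ℤ.^ (p ∸ 1) ℤ.- + 1
  go (inj₁ d) = ⊥-elim (∤ d)
  go (inj₂ d) = d

geoℤ : ℕ → ℤ → ℤ
geoℤ zero    y = + 0
geoℤ (suc n) y = geoℤ n y ℤ.+ y ℤ.^ n

geoℤ-tele : ∀ n y → y ℤ.^ n ℤ.- + 1 ≡ (y ℤ.- + 1) ℤ.* geoℤ n y
geoℤ-tele zero    y = sym (ℤP.*-zeroʳ (y ℤ.- + 1))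
geoℤ-tele (suc n) y = trans (ℤS′.solve 2 (λ y z → y ℤS′.:* z ℤS′.:- ℤS′.con (+ 1) ℤS′.:= (z ℤS′.:- ℤS′.con (+ 1)) ℤS′.:+ (y ℤS′.:- ℤS′.con (+ 1)) ℤS′.:* z) refl y (y ℤ.^ n))
  (trans (cong (ℤ._+ (y ℤ.- + 1) ℤ.* y ℤ.^ n) (geoℤ-tele n y)) (sym (ℤP.*-distribˡ-+ (y ℤ.- + 1) (geoℤ n y) (y ℤ.^ n))))

∣y-1⇒∣y^n-1 : ∀ {m y} n → m ∣ℤ y ℤ.- + 1 → m ∣ℤ y ℤ.^ n ℤ.- + 1
∣y-1⇒∣y^n-1 {m} {y} n d = subst (m ∣ℤ_) (sym (geoℤ-tele n y)) (ℤS.∣m⇒∣m*n (geoℤ n y) d)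

geoℤ-mod : ∀ {m y} n → m ∣ℤ y ℤ.- + 1 → m ∣ℤ geoℤ n y ℤ.- + n
geoℤ-mod {m} zero    d = divides (+ 0) refl
geoℤ-mod {m} {y} (suc n) d = subst (m ∣ℤ_)
  (trans (ℤS′.solve 3 (λ g n z → (g ℤS′.:- n) ℤS′.:+ (z ℤS′.:- ℤS′.con (+ 1)) ℤS′.:= (g ℤS′.:+ z) ℤS′.:- (ℤS′.con (+ 1) ℤS′.:+ n)) refl (geoℤ n y) (+ n) (y ℤ.^ n)) refl)
  (ℤS.∣m∣n⇒∣m+n (geoℤ-mod n d) (∣y-1⇒∣y^n-1 n d))

-- The quotient `(p ^ s - 1) / (p - 1)`, by `geoℕ-spec`.
geoℕ : ℕ → ℕ → ℕ
geoℕ p zero    = 0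
geoℕ p (suc s) = suc (p ℕ.* geoℕ p s)

geoℕ-spec : ∀ p′ s → suc p′ ℕ.^ s ≡ suc (p′ ℕ.* geoℕ (suc p′) s)
geoℕ-spec p′ zero    = cong suc (sym (ℕP.*-zeroʳ p′))
geoℕ-spec p′ (suc s) = trans (cong (suc p′ ℕ.*_) (geoℕ-spec p′ s))
  (ℕS.solve 2 (λ p g → (ℕS.con 1 ℕS.:+ p) ℕS.:* (ℕS.con 1 ℕS.:+ p ℕS.:* g) ℕS.:= ℕS.con 1 ℕS.:+ p ℕS.:* (ℕS.con 1 ℕS.:+ (ℕS.con 1 ℕS.:+ p) ℕS.:* g)) refl p′ (geoℕ (suc p′) s))

-- With aa = a^(p-2), (aa θ)^N = aa^N a = a^((p-1)E) where E = (p-2)(N-1)/(p-1) + 1 ≡ -1 mod p.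
module UnitNorm {p s : ℕ} (pr : Prime p) (1≤s : 1 ≤ s) (a : ℤ) (p∤a : ¬ + p ∣ℤ a) (a^≢1 : a ℤ.^ (p ∸ 1) ≢ + 1) where

  y : ℤ
  y = a ℤ.^ (p ∸ 1) ℤ.- + 1

  vA : ℕ
  vA = vpℤ p y

  d : ℕ
  d = (vA ∸ 1) ⊓ s

  b : ℤ
  b = (a ℤ.^ (p ∸ 2)) ℤ.^ (p ℕ.^ s) ℤ.* a

  ∣y∣>0 : 0 < ℤ.∣ y ∣
  ∣y∣>0 = ℕP.n≢0⇒n>0 (λ e → a^≢1 (ℤP.i-j≡0⇒i≡j _ _ (ℤP.∣i∣≡0⇒i≡0 e)))

  p^vA∣y : + (p ℕ.^ vA) ∣ℤ y
  p^vA∣y = ℤS.∣ᵤ⇒∣ (vp-∣ p ℤ.∣ y ∣)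

  vA≥1 : 1 ≤ vA
  vA≥1 = ℕP.n≢0⇒n>0 (λ vA≡0 → vp-∤ (prime>1 pr) ∣y∣>0 (subst (λ k → p ℕ.^ suc k ∣ℕ ℤ.∣ y ∣) (sym vA≡0)
     (subst (_∣ℕ ℤ.∣ y ∣) (sym (ℕP.*-identityʳ p)) (ℤS.∣⇒∣ᵤ (fermat′ pr a p∤a)))))

  d≤s : d ≤ s
  d≤s = ℕP.m⊓n≤n (vA ∸ 1) s

  1+d≤vA : suc d ≤ vA
  1+d≤vA = ℕP.≤-trans (s≤s (ℕP.m⊓n≤m (vA ∸ 1) s)) (ℕP.≤-reflexive (ℕP.m+[n∸m]≡n vA≥1))

  p^1+d∣y : + (p ℕ.^ suc d) ∣ℤ y
  p^1+d∣y = ℤS.∣-trans (ℤS.∣ᵤ⇒∣ (subst (p ℕ.^ suc d ∣ℕ_) (trans (sym (ℕP.^-distribˡ-+-* p (suc d) (vA ∸ suc d))) (cong (p ℕ.^_) (ℕP.m+[n∸m]≡n 1+d≤vA))) (ℕD.m∣m*n _))) p^vA∣y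

  -- If `d < s`, the minimum that defines `d` is `vA ∸ 1`, so `p ^ suc d` is the exact power of `p`
  -- in `y`.
  unit-part : d < s → ∀ u → y ≡ u ℤ.* + (p ℕ.^ suc d) → ¬ + p ∣ℤ u
  unit-part d<s u e (divides r e′) = vp-∤ (prime>1 pr) ∣y∣>0 (ℤS.∣⇒∣ᵤ (divides r (trans e (trans (cong (ℤ._* + (p ℕ.^ suc d)) e′)
      (trans (ℤP.*-assoc r (+ p) (+ (p ℕ.^ suc d))) (cong (r ℤ.*_) (trans (sym (ℤP.pos-* p (p ℕ.^ suc d))) (cong (λ k → + (p ℕ.^ suc k)) 1+d≡vA))))))))
    where
    1+d≡vA : suc d ≡ vA
    1+d≡vA = trans (cong suc (ℕP.m≤n⇒m⊓n≡m (ℕP.≮⇒≥ (λ s< → ℕP.<-irrefl (ℕP.m≥n⇒m⊓n≡n (ℕP.<⇒≤ s<)) d<s)))) (ℕP.m+[n∸m]≡n vA≥1)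

  g : ℕ
  g = geoℕ p s

  E : ℕ
  E = suc ((p ∸ 2) ℕ.* g)

  exponent : (p ∸ 2) ℕ.* p ℕ.^ s ℕ.+ 1 ≡ (p ∸ 1) ℕ.* E
  exponent = go p (prime>1 pr)
    where
    go : ∀ p → 1 < p → (p ∸ 2) ℕ.* p ℕ.^ s ℕ.+ 1 ≡ (p ∸ 1) ℕ.* suc ((p ∸ 2) ℕ.* geoℕ p s)
    go (suc (suc p′)) _ = trans (cong (λ n → p′ ℕ.* n ℕ.+ 1) (geoℕ-spec (suc p′) s))
      (ℕS.solve 2 (λ p g → p ℕS.:* (ℕS.con 1 ℕS.:+ (ℕS.con 1 ℕS.:+ p) ℕS.:* g) ℕS.:+ ℕS.con 1 ℕS.:= (ℕS.con 1 ℕS.:+ p) ℕS.:* (ℕS.con 1 ℕS.:+ p ℕS.:* g)) refl p′ (geoℕ (suc (suc p′)) s))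
    go (suc zero) (s≤s ())

  -- As `s ≥ 1`, the number `g` is 1 modulo `p`, and so `E` is congruent to `p - 1`.
  p∤E : ¬ p ∣ℕ E
  p∤E = go p s 1≤s (prime>1 pr)
    where
    go : ∀ p s → 1 ≤ s → 1 < p → ¬ p ∣ℕ suc ((p ∸ 2) ℕ.* geoℕ p s)
    go (suc zero) s _ (s≤s ())
    go (suc (suc p′)) (suc s) _ _ d = ℕP.<⇒≱ (ℕP.n<1+n (suc p′)) (ℕD.∣⇒≤ (ℕD.∣m+n∣m⇒∣n
      (subst (suc (suc p′) ∣ℕ_) (ℕS.solve 3 (λ p q g → ℕS.con 1 ℕS.:+ p ℕS.:* (ℕS.con 1 ℕS.:+ q ℕS.:* g) ℕS.:= q ℕS.:* (p ℕS.:* g) ℕS.:+ (ℕS.con 1 ℕS.:+ p)) refl p′ (suc (suc p′)) (geoℕ (suc (suc p′)) s)) d)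
      (ℕD.m∣m*n (p′ ℕ.* geoℕ (suc (suc p′)) s))))

  b-pow : b ≡ (a ℤ.^ (p ∸ 1)) ℤ.^ E
  b-pow = begin
    (a ℤ.^ (p ∸ 2)) ℤ.^ (p ℕ.^ s) ℤ.* a        ≡⟨ cong₂ ℤ._*_ (ℤP.^-*-assoc a (p ∸ 2) (p ℕ.^ s)) (sym (ℤP.^-identityʳ a)) ⟩
    a ℤ.^ ((p ∸ 2) ℕ.* p ℕ.^ s) ℤ.* a ℤ.^ 1    ≡⟨ ℤP.^-distribˡ-+-* a ((p ∸ 2) ℕ.* p ℕ.^ s) 1 ⟨
    a ℤ.^ ((p ∸ 2) ℕ.* p ℕ.^ s ℕ.+ 1)          ≡⟨ cong (a ℤ.^_) exponent ⟩
    a ℤ.^ ((p ∸ 1) ℕ.* E)                      ≡⟨ ℤP.^-*-assoc a (p ∸ 1) E ⟨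
    (a ℤ.^ (p ∸ 1)) ℤ.^ E                      ∎
    where open ≡-Reasoning

  p∤geo : ¬ + p ∣ℤ geoℤ E (a ℤ.^ (p ∸ 1))
  p∤geo h = p∤E (ℤS.∣⇒∣ᵤ (subst (+ p ∣ℤ_) (ℤS′.solve 2 (λ g n → g ℤS′.:- (g ℤS′.:- n) ℤS′.:= n) refl (geoℤ E (a ℤ.^ (p ∸ 1))) (+ E))
      (ℤS.∣m∣n⇒∣m-n h (geoℤ-mod E (fermat′ pr a p∤a)))))

  -- Lifting the exponent: `b - 1` is `y` times a geometric sum of `E` powers of an integer that is
  -- 1 modulo `p`. The sum is `E` modulo `p`, hence prime to `p`, and the valuation is that of `y`.
  norm : ∃[ c ] (b ≡ + 1 ℤ.+ + (p ℕ.^ suc d) ℤ.* c) × (d < s → ¬ + p ∣ℤ c)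
  norm = go p^1+d∣y
    where
    G = geoℤ E (a ℤ.^ (p ∸ 1))
    go : + (p ℕ.^ suc d) ∣ℤ y → ∃[ c ] (b ≡ + 1 ℤ.+ + (p ℕ.^ suc d) ℤ.* c) × (d < s → ¬ + p ∣ℤ c)
    go (divides u e) = u ℤ.* G , (begin
        b                                        ≡⟨ b-pow ⟩
        (a ℤ.^ (p ∸ 1)) ℤ.^ E                    ≡⟨ ℤS′.solve 1 (λ x → x ℤS′.:= ℤS′.con (+ 1) ℤS′.:+ (x ℤS′.:- ℤS′.con (+ 1))) refl ((a ℤ.^ (p ∸ 1)) ℤ.^ E) ⟩
        + 1 ℤ.+ ((a ℤ.^ (p ∸ 1)) ℤ.^ E ℤ.- + 1)  ≡⟨ cong (λ x → + 1 ℤ.+ x) (trans (geoℤ-tele E (a ℤ.^ (p ∸ 1))) (cong (ℤ._* G) e)) ⟩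
        + 1 ℤ.+ u ℤ.* + (p ℕ.^ suc d) ℤ.* G      ≡⟨ cong (λ x → + 1 ℤ.+ x) (ℤS′.solve 3 (λ u q g → u ℤS′.:* q ℤS′.:* g ℤS′.:= q ℤS′.:* (u ℤS′.:* g)) refl u (+ (p ℕ.^ suc d)) G) ⟩
        + 1 ℤ.+ + (p ℕ.^ suc d) ℤ.* (u ℤ.* G)    ∎) , λ d<s h → either d<s (euclidℤ pr u G h)
      where
      open ≡-Reasoning
      either : d < s → + p ∣ℤ u ⊎ + p ∣ℤ G → ⊥
      either d<s (inj₁ h) = unit-part d<s u e h
      either d<s (inj₂ h) = p∤geo h

-- Irreducibility excludes a^(p-1) = 1

select : ∀ {P : Set} → Dec P → ℚ → ℚ
select (yes _) q = q
select (no _)  q = 0ℚ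

-- polyMulCoeff uses a local copy of select which has no name outside Defs; the underscores below stand for
-- its values.  The case split on k makes the leading terms reduce, so that these values can be inferred.
polyMulCoeff-select : ∀ {d} (g : Fin 2 → ℚ) (h : Fin (suc d) → ℚ) k →
  polyMulCoeff g h k ≡ dsum (λ i j → select (toℕ i ℕ.+ toℕ j ≟ k) (g i ℚ.* h j))
row₀-1 : ∀ {d} (g : Fin 2 → ℚ) (h : Fin (suc d) → ℚ) j → _ ≡ select (toℕ (suc j) ≟ 1) (g zero ℚ.* h (suc j))
row₀-2 : ∀ {d} (g : Fin 2 → ℚ) (h : Fin (suc d) → ℚ) k j → _ ≡ select (toℕ (suc j) ≟ suc (suc k)) (g zero ℚ.* h (suc j))
row₁-2 : ∀ {d} (g : Fin 2 → ℚ) (h : Fin (suc d) → ℚ) k j → _ ≡ select (suc (toℕ (suc j)) ≟ suc (suc k)) (g (suc zero) ℚ.* h (suc j))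
polyMulCoeff-select g h zero = refl
polyMulCoeff-select g h (suc zero) = cong₂ ℚ._+_ (cong (0ℚ ℚ.+_) (sumQ-cong (λ j → row₀-1 g h j))) refl
polyMulCoeff-select g h (suc (suc k)) = cong₂ ℚ._+_ (cong (0ℚ ℚ.+_) (sumQ-cong (λ j → row₀-2 g h k j)))
  (cong (ℚ._+ 0ℚ) (cong (0ℚ ℚ.+_) (sumQ-cong (λ j → row₁-2 g h k j))))
row₀-1 g h j with toℕ (suc j) ≟ 1
... | yes _ = refl
... | no _  = refl
row₀-2 g h k j with toℕ (suc j) ≟ suc (suc k)
... | yes _ = refl
... | no _  = refl
row₁-2 g h k j with suc (toℕ (suc j)) ≟ suc (suc k)
... | yes _ = refl
... | no _  = refl

select-yes : ∀ {P : Set} (D : Dec P) q → P → select D q ≡ q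
select-yes (yes _) q _ = refl
select-yes (no ¬p) q p = ⊥-elim (¬p p)

select-no : ∀ {P : Set} (D : Dec P) q → ¬ P → select D q ≡ 0ℚ
select-no (yes p) q ¬p = ⊥-elim (¬p p)
select-no (no _)  q _  = refl

select-sum : ∀ {m} (f : Fin m → ℚ) c k → k < m → (F : ℕ → ℚ) → (∀ j → f j ≡ F (toℕ j)) →
  sumFinℚ (λ j → select (c ℕ.+ toℕ j ≟ c ℕ.+ k) (f j)) ≡ F k
select-sum f c k k<m F eq = trans (sumQ-δ (fromℕ< k<m) _ (λ j ne → select-no (c ℕ.+ toℕ j ≟ c ℕ.+ k) (f j)
     (λ e → ne (FinP.toℕ-injective (trans (ℕP.+-cancelˡ-≡ c (toℕ j) k e) (sym (FinP.toℕ-fromℕ< k<m)))))))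
  (trans (select-yes (c ℕ.+ toℕ (fromℕ< k<m) ≟ c ℕ.+ k) _ (cong (c ℕ.+_) (FinP.toℕ-fromℕ< k<m)))
         (trans (eq (fromℕ< k<m)) (cong F (FinP.toℕ-fromℕ< k<m))))

select-none : ∀ {m} (f : Fin m → ℚ) c k → (∀ (j : Fin m) → c ℕ.+ toℕ j ≢ k) → sumFinℚ (λ j → select (c ℕ.+ toℕ j ≟ k) (f j)) ≡ 0ℚ
select-none f c k ne = sumQ-0 _ (λ j → select-no (c ℕ.+ toℕ j ≟ k) (f j) (ne j))

binom-top : ∀ n a → binomCoeff n a n ≡ 1ℚ
binom-top n a with n ≟ n
... | yes _ = refl
... | no ne = ⊥-elim (ne refl)

binom-0 : ∀ n a → 0 ≢ n → binomCoeff n a 0 ≡ ℚ.- toℚ a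
binom-0 n a 0≢n with 0 ≟ n
... | yes e = ⊥-elim (0≢n e)
... | no _  = refl

binom-mid : ∀ n a k → k ≢ n → k ≢ 0 → binomCoeff n a k ≡ 0ℚ
binom-mid n a k k≢n k≢0 with k ≟ n
... | yes e = ⊥-elim (k≢n e)
... | no _ with k ≟ 0
... | yes e = ⊥-elim (k≢0 e)
... | no _  = refl

-- If a^n = a then x - a divides x^n - a.
root⇒reducible : ∀ m a → a ℤ.^ suc (suc m) ≡ a → ¬ IrreducibleBinomial (suc (suc m)) a
root⇒reducible m a root irr = irr (1 , suc m , g , h , s≤s z≤n , s≤s z≤n , refl , λ k k≤n → trans (polyMulCoeff-select g h k) (check k k≤n))
  where
  n = suc (suc m)
  -- Coefficients of the quotient of `x^n - a^n` by `x - a`; by `root` the dividend is `x^n - a`.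
  H : ℕ → ℚ
  H j = toℚ (a ℤ.^ (suc m ∸ j))
  h : Fin (suc (suc m)) → ℚ
  h j = H (toℕ j)
  g : Fin 2 → ℚ
  g zero       = ℚ.- toℚ a
  g (suc zero) = 1ℚ
  row₀ row₁ : ℕ → ℚ
  row₀ k = sumFinℚ (λ j → select (0 ℕ.+ toℕ j ≟ k) (g zero ℚ.* h j))
  row₁ k = sumFinℚ (λ j → select (1 ℕ.+ toℕ j ≟ k) (g (suc zero) ℚ.* h j))
  row₀-val : ∀ k → k < n → row₀ k ≡ (ℚ.- toℚ a) ℚ.* H k
  row₀-val k k<n = select-sum (λ j → g zero ℚ.* h j) 0 k k<n (λ j → (ℚ.- toℚ a) ℚ.* H j) (λ _ → refl)
  row₁-val : ∀ k → k < n → row₁ (suc k) ≡ 1ℚ ℚ.* H k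
  row₁-val k k<n = select-sum (λ j → g (suc zero) ℚ.* h j) 1 k k<n (λ j → 1ℚ ℚ.* H j) (λ _ → refl)
  check : ∀ k → k ≤ n → row₀ k ℚ.+ (row₁ k ℚ.+ 0ℚ) ≡ binomCoeff n a k
  check zero _ = begin
    row₀ 0 ℚ.+ (row₁ 0 ℚ.+ 0ℚ)      ≡⟨ cong₂ (λ x y → x ℚ.+ (y ℚ.+ 0ℚ)) (row₀-val 0 (s≤s z≤n)) (select-none (λ j → g (suc zero) ℚ.* h j) 1 0 (λ j ())) ⟩
    (ℚ.- toℚ a) ℚ.* H 0 ℚ.+ (0ℚ ℚ.+ 0ℚ) ≡⟨ trans (cong ((ℚ.- toℚ a) ℚ.* H 0 ℚ.+_) (ℚP.+-identityʳ 0ℚ)) (ℚP.+-identityʳ _) ⟩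
    (ℚ.- toℚ a) ℚ.* H 0             ≡⟨ ℚP.neg-distribˡ-* (toℚ a) (H 0) ⟨
    ℚ.- (toℚ a ℚ.* H 0)             ≡⟨ cong ℚ.-_ (trans (sym (toℚ-* a (a ℤ.^ suc m))) (cong toℚ root)) ⟩
    ℚ.- toℚ a                       ≡⟨ binom-0 n a (λ ()) ⟨
    binomCoeff n a 0                ∎
    where open ≡-Reasoning
  check (suc k) k<n = go (ℕP.m≤n⇒m<n∨m≡n k<n)
    where
    open ≡-Reasoning
    go : suc k < n ⊎ suc k ≡ n → row₀ (suc k) ℚ.+ (row₁ (suc k) ℚ.+ 0ℚ) ≡ binomCoeff n a (suc k)
    go (inj₁ k′<n) = begin
      row₀ (suc k) ℚ.+ (row₁ (suc k) ℚ.+ 0ℚ)  ≡⟨ cong₂ (λ x y → x ℚ.+ (y ℚ.+ 0ℚ)) (row₀-val (suc k) k′<n) (row₁-val k k<n) ⟩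
      (ℚ.- toℚ a) ℚ.* H (suc k) ℚ.+ (1ℚ ℚ.* H k ℚ.+ 0ℚ)
        ≡⟨ cong (λ y → (ℚ.- toℚ a) ℚ.* H (suc k) ℚ.+ (1ℚ ℚ.* y ℚ.+ 0ℚ)) (trans (cong (λ e → toℚ (a ℤ.^ e)) (ℕP.+-∸-assoc 1 (ℕP.<⇒≤pred k′<n))) (toℚ-* a (a ℤ.^ (m ∸ k)))) ⟩
      (ℚ.- toℚ a) ℚ.* H (suc k) ℚ.+ (1ℚ ℚ.* (toℚ a ℚ.* H (suc k)) ℚ.+ 0ℚ)
        ≡⟨ ℚR.solve 2 (λ a y → (ℚR.:- a) ℚR.:* y ℚR.:+ (ℚR.con (+ 1) ℚR.:* (a ℚR.:* y) ℚR.:+ ℚR.con (+ 0)) ℚR.:= ℚR.con (+ 0)) refl (toℚ a) (H (suc k)) ⟩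
      0ℚ                                      ≡⟨ binom-mid n a (suc k) (ℕP.<⇒≢ k′<n) (λ ()) ⟨
      binomCoeff n a (suc k)                  ∎
    go (inj₂ refl) = begin
      row₀ n ℚ.+ (row₁ n ℚ.+ 0ℚ)              ≡⟨ cong₂ (λ x y → x ℚ.+ (y ℚ.+ 0ℚ)) (select-none (λ j → g zero ℚ.* h j) 0 n (λ j → ℕP.<⇒≢ (FinP.toℕ<n j))) (row₁-val (suc m) ℕP.≤-refl) ⟩
      0ℚ ℚ.+ (1ℚ ℚ.* H (suc m) ℚ.+ 0ℚ)        ≡⟨ cong (λ e → 0ℚ ℚ.+ (1ℚ ℚ.* toℚ (a ℤ.^ e) ℚ.+ 0ℚ)) (ℕP.n∸n≡0 (suc m)) ⟩
      1ℚ                                      ≡⟨ binom-top n a ⟨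
      binomCoeff n a n                        ∎

-- As `p - 1` divides `p^s - 1`, the equation would make `a` itself a root of the binomial. The
-- result guarantees that `vA` is the valuation of a nonzero integer.
irreducible⇒a^[p-1]≢1 : ∀ {p s} → Prime p → 1 ≤ s → ∀ a → IrreducibleBinomial (p ℕ.^ s) a → a ℤ.^ (p ∸ 1) ≢ + 1
irreducible⇒a^[p-1]≢1 {p} {s} pr 1≤s a irr eq = finish (p ℕ.^ s) N>1 root irr
  where
  N>1 : 1 < p ℕ.^ s
  N>1 = ℕP.<-≤-trans (s≤s 1≤s) (n<m^n (prime>1 pr) s)
  N≡ : p ℕ.^ s ≡ suc ((p ∸ 1) ℕ.* geoℕ p s)
  N≡ = subst (λ q → q ℕ.^ s ≡ suc ((p ∸ 1) ℕ.* geoℕ q s)) p-1 (geoℕ-spec (p ∸ 1) s)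
    where
    p-1 : suc (p ∸ 1) ≡ p
    p-1 = ℕP.suc-pred p {{ℕ.>-nonZero (prime>0 pr)}}
  root : a ℤ.^ (p ℕ.^ s) ≡ a
  root = trans (cong (a ℤ.^_) N≡) (trans (cong (a ℤ.*_) (trans (sym (ℤP.^-*-assoc a (p ∸ 1) (geoℕ p s))) (trans (cong (ℤ._^ geoℕ p s) eq) (ℤP.^-zeroˡ (geoℕ p s))))) (ℤP.*-identityʳ a))
  finish : ∀ N → 1 < N → a ℤ.^ N ≡ a → ¬ IrreducibleBinomial N a
  finish (suc (suc m)) _ = root⇒reducible m a
  finish (suc zero) (s≤s ())

-- The integral bases of the pure extension

ΣQ-single : ∀ n {j} (f : ℕ → ℚ) → j < n → (∀ i → i < n → i ≢ j → f i ≡ 0ℚ) → ℚR.Σ< n f ≡ f j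
ΣQ-single (suc n) {j} f j<1+n h = go (ℕP.m≤n⇒m<n∨m≡n (ℕP.<⇒≤pred j<1+n))
  where
  go : j < n ⊎ j ≡ n → ℚR.Σ< (suc n) f ≡ f j
  go (inj₁ j<n)  = trans (cong₂ ℚ._+_ (ΣQ-single n f j<n (λ i i<n → h i (ℕP.m<n⇒m<1+n i<n))) (h n (ℕP.n<1+n n) (ℕP.>⇒≢ j<n))) (ℚP.+-identityʳ _)
  go (inj₂ refl) = trans (cong (ℚ._+ f n) (ℚR.Σ-zero n (λ i i<n → h i (ℕP.m<n⇒m<1+n i<n) (ℕP.<⇒≢ i<n)))) (ℚP.+-identityˡ _)

module NumberField (n : ℕ) (0<n : 0 < n) (a : ℤ) where
  open Field n a
  open KTheory n 0<n a
  private module I = Integrality n 0<n a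

  θ₁^ : ∀ j → (θ^ 1 T.^ j) ≈ᴷ θ^ j
  θ₁^ j = ≈ᴷ-trans (θ-pow 1 j) (≡⇒≈ (cong θ^ (ℕP.*-identityˡ j)))

  invK : ℕ → K
  invK m = invℕ m · 1K

  invK-· : ∀ m u → (invK m ⊠ u) ≈ᴷ (invℕ m · u)
  invK-· m u = ≈ᴷ-trans (·-⊠ (invℕ m) 1K u) (·-cong (invℕ m) (T.*-identityˡ u))

  coordinate : ∀ (z : ℕ → ℤ) {l} (l<n : l < n) → T.Σ< n (λ i → T.ι (z i) ⊠ (θ^ 1 T.^ i)) (fromℕ< l<n) ≡ toℚ (z l)
  coordinate z {l} l<n = trans (Σ-at n (λ i → T.ι (z i) ⊠ (θ^ 1 T.^ i)) L) (trans
    (ℚR.Σ-cong n (λ i _ → trans (ι-· (z i) (θ^ 1 T.^ i) .at L) (cong (toℚ (z i) ℚ.*_) (θ₁^ i .at L))))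
    (trans (ΣQ-single n (λ i → toℚ (z i) ℚ.* θ^ i L) l<n off) (trans (cong (toℚ (z l) ℚ.*_) on) (ℚP.*-identityʳ _))))
    where
    L = fromℕ< l<n
    on : θ^ l L ≡ 1ℚ
    on = trans (θ-at-≡ l L (trans (FinP.toℕ-fromℕ< l<n) (sym (rem-< l<n)))) (cong (toℚ a ^ℚ_) (quot-< l<n))
    off : ∀ i → i < n → i ≢ l → toℚ (z i) ℚ.* θ^ i L ≡ 0ℚ
    off i i<n i≢l = trans (cong (toℚ (z i) ℚ.*_) (θ-at-≢ i L (λ e → i≢l (sym (trans (sym (FinP.toℕ-fromℕ< l<n)) (trans e (rem-< i<n))))))) (ℚP.*-zeroʳ (toℚ (z i)))

  radical : Radical Kring n a
  radical = record
    { 0<N = 0<n ; tf = torsionFree ; θ = θ^ 1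
    ; θN = ≈ᴷ-trans (θ₁^ n) (≈ᴷ-trans (θ-+n 0) (≈ᴷ-sym (ι-def a)))
    ; inv = invK
    ; inv-spec = λ m 0<m → ≈ᴷ-trans (ι-· (+ m) (invK m)) (pointwise (λ i → trans (sym (ℚP.*-assoc (toℚ (+ m)) (invℕ m) (1K i)))
        (trans (cong (ℚ._* 1K i) (invℕ-inverse m 0<m)) (ℚP.*-identityˡ (1K i)))))
    ; θfree = λ z e l l<n → toℚ-injective {z l} {+ 0} (trans (sym (coordinate z l<n)) (e .at (fromℕ< l<n)))
    }

  open Triangular Kring n a radical using (Zθ)

  span-sumK : ∀ {G : K → Set} {m} {f : Fin m → K} → (∀ i → T.Span G (f i)) → T.Span G (sumK f)
  span-sumK {m = zero}  h = T.span-zer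
  span-sumK {m = suc m} {f} h = T.span-resp (⊞-def (f zero) (sumK (λ i → f (suc i)))) (T.span-add (h zero) (span-sumK (λ i → h (suc i))))

  integer⇒Zθ : ∀ {u} → I.Zθ u → Zθ u
  integer⇒Zθ {u} h = T.span-resp (≈ᴷ-sym (expand u)) (span-sumK (λ i → T.span-resp
    (≈ᴷ-trans (ι-· (proj₁ (h i)) (θ^ (toℕ i))) (≡⇒≈ (cong (_· θ^ (toℕ i)) (sym (proj₂ (h i))))))
    (T.span-ι (proj₁ (h i)) (T.gen (toℕ i , ≈ᴷ-sym (θ₁^ (toℕ i)))))))

  Zθ⇒integer : ∀ {u} → Zθ u → I.Zθ u
  Zθ⇒integer = T.span-map resp zer add neg (λ { (j , e) → resp (≈ᴷ-sym (≈ᴷ-trans e (θ₁^ j))) (I.Zθ-θ j) })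
    where open T.IsSubring I.ZθS

  AI⇒integral : ∀ {α} → T.AI Zθ α → IsIntegral α
  AI⇒integral (D , h) = I.AI⇒integral (D , λ k → Zθ⇒integer (h k))

  integral⇒AI : ∀ {α} → IsIntegral α → T.AI Zθ α
  integral⇒AI i = go (I.integral⇒AI i)
    where
    go : ∀ {α} → T.AI I.Zθ α → T.AI Zθ α
    go (D , h) = D , λ k → integer⇒Zθ (h k)

  onℕ : (Fin n → ℤ) → ℕ → ℤ
  onℕ z i with i ℕ.<? n
  ... | yes i<n = z (fromℕ< i<n)
  ... | no _    = + 0

  onℕ-toℕ : ∀ z i → onℕ z (toℕ i) ≡ z i
  onℕ-toℕ z i with toℕ i ℕ.<? n
  ... | yes i<n = cong z (FinP.fromℕ<-toℕ i i<n)
  ... | no ≮    = ⊥-elim (≮ (FinP.toℕ<n i))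

  ℤcomb-Σ : ∀ (B : ℕ → K) (z : ℕ → ℤ) (b : Fin n → K) (z′ : Fin n → ℤ) → (∀ i → b i ≈ᴷ B (toℕ i)) → (∀ i → z′ i ≡ z (toℕ i)) →
    ℤcomb b z′ ≈ᴷ T.Σ< n (λ i → T.ι (z i) ⊠ B i)
  ℤcomb-Σ B z b z′ hb hz = ≈ᴷ-trans (sumK-cong (λ i → ≈ᴷ-trans (·-cong (toℚ (z′ i)) (hb i)) (≡⇒≈ (cong (λ y → toℚ y · B (toℕ i)) (hz i)))))
    (≈ᴷ-trans (sumK-def n (λ i → toℚ (z i) · B i)) (T.Σ-cong n (λ i _ → ≈ᴷ-sym (ι-· (z i) (B i)))))

  integral-basis : (B : ℕ → K) → (∀ m → m < n → T.AI Zθ (B m)) →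
    (∀ {α} → T.AI Zθ α → T.Span (λ w → ∃[ j ] (j < n) × (w ≈ᴷ B j)) α) →
    (∀ z → T.Σ< n (λ i → T.ι (z i) ⊠ B i) ≈ᴷ 0K → ∀ i → i < n → z i ≡ + 0) →
    (b : Fin n → K) → (∀ i → b i ≈ᴷ B (toℕ i)) → IntegralBasis b
  integral-basis B B-AI spans free b hb =
    (λ i → AI⇒integral (T.AlmostIntegral.AI-resp (Triangular.ZθS Kring n a radical) (≈ᴷ-sym (hb i)) (B-AI (toℕ i) (FinP.toℕ<n i)))) ,
    (λ α i → go (T.span-coords n B (spans (integral⇒AI i)))) ,
    (λ z e i → trans (sym (onℕ-toℕ z i)) (free (onℕ z)
       (≈ᴷ-trans (≈ᴷ-sym (ℤcomb-Σ B (onℕ z) b z hb (λ i → sym (onℕ-toℕ z i)))) (pointwise e)) (toℕ i) (FinP.toℕ<n i)))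
    where
    go : ∀ {α} → Σ[ z ∈ (ℕ → ℤ) ] (α ≈ᴷ T.Σ< n (λ i → T.ι (z i) ⊠ B i)) → Σ (Fin n → ℤ) λ z → α ≈ ℤcomb b z
    go (z , h) = (λ i → z (toℕ i)) , ≈ᴷ-trans h (≈ᴷ-sym (ℤcomb-Σ B z b (λ i → z (toℕ i)) hb (λ i → refl))) .at

∣-^ℕ : ∀ {ℓ} x k → ℓ ∣ℕ x → 1 ≤ k → ℓ ∣ℕ x ℕ.^ k
∣-^ℕ x (suc k) d _ = ℕD.∣m⇒∣m*n (x ℕ.^ k) d

∤-^ℕ : ∀ {ℓ} → Prime ℓ → ∀ x k → ¬ ℓ ∣ℕ x → ¬ ℓ ∣ℕ x ℕ.^ k
∤-^ℕ pr x k = Exponents.^-∤ 1 (s≤s z≤n) (λ _ → 0) pr x k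

omit-∤ : ∀ (f : ℕ → ℕ) {ℓ} N e → Prime ℓ → (∀ i → 1 ≤ i → i < N → i ≢ e → ¬ ℓ ∣ℕ f i) → ¬ ℓ ∣ℕ prodFrom1 (omit e f) N
omit-∤ f {ℓ} N e pr h = prod-∤ (omit e f) N pr (λ i 1≤i i<N → go i 1≤i i<N (i ℕ.≟ e))
  where
  go : ∀ i → 1 ≤ i → i < N → Dec (i ≡ e) → ¬ ℓ ∣ℕ omit e f i
  go i 1≤i i<N (yes refl) d = prime∤1 pr (subst (ℓ ∣ℕ_) (omit-≡ e f) d)
  go i 1≤i i<N (no i≢e)   d = h i 1≤i i<N i≢e (subst (ℓ ∣ℕ_) (omit-≢ e f i≢e) d)

sign-split : ∀ a → ∃[ σ ] (a ≡ σ ℤ.* + ℤ.∣ a ∣) × (∀ {ℓ} → Prime ℓ → ¬ + ℓ ∣ℤ σ)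
sign-split (+ n)      = + 1 , sym (ℤP.*-identityˡ (+ n)) , λ pr h → prime∤1 pr (ℤS.∣⇒∣ᵤ h)
sign-split -[1+ n ]   = ℤ.- (+ 1) , sym (ℤP.-1*i≡-i (+ suc n)) , λ pr h → prime∤1 pr (ℤS.∣⇒∣ᵤ h)

-- For squarefree, pairwise coprime A_i, a prime divides at most one of them, the one with index e (e = 0 if none).
record Index (N : ℕ) (A : ℕ → ℕ) (ℓ : ℕ) : Set where
  field
    e      : ℕ
    e<N    : e < N
    others : ∀ i → 1 ≤ i → i < N → i ≢ e → ¬ ℓ ∣ℕ A i
    simple : 1 ≤ e → ∃[ c ] (A e ≡ c ℕ.* ℓ) × ¬ ℓ ∣ℕ c

index : ∀ {N A} → 0 < N → (∀ j → 1 ≤ j → j < N → Squarefree (A j) × 1 ≤ A j) →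
  (∀ i j → 1 ≤ i → i < N → 1 ≤ j → j < N → i ≢ j → Coprime (A i) (A j)) →
  ∀ {ℓ} → Prime ℓ → Index N A ℓ
index {N} {A} 0<N sf cop {ℓ} pr = go (search (λ i → ¬ (1 ≤ i × ℓ ∣ℕ A i)) (λ i → ¬? ((1 ℕ.≤? i) ×-dec (ℓ ℕD.∣? A i))) N)
  where
  go : (∃[ i ] (i < N) × ¬ ¬ (1 ≤ i × ℓ ∣ℕ A i)) ⊎ (∀ i → i < N → ¬ (1 ≤ i × ℓ ∣ℕ A i)) → Index N A ℓ
  go (inj₂ none) = record { e = 0 ; e<N = 0<N ; others = λ i 1≤i i<N _ d → none i i<N (1≤i , d) ; simple = λ () }
  go (inj₁ (e , e<N , ¬¬)) = found (decidable-stable ((1 ℕ.≤? e) ×-dec (ℓ ℕD.∣? A e)) ¬¬)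
    where
    found : 1 ≤ e × ℓ ∣ℕ A e → Index N A ℓ
    found (1≤e , d@(ℕD.divides c eq)) = record { e = e ; e<N = e<N
      ; others = λ i 1≤i i<N i≢e d′ → ℕP.<⇒≢ (prime>1 pr) (sym (cop i e 1≤i i<N 1≤e e<N i≢e (d′ , d)))
      ; simple = λ _ → c , eq , λ { (ℕD.divides b eq′) → ℕP.<⇒≢ (prime>1 pr) (sym (proj₁ (sf e 1≤e e<N) ℓ
          (ℕD.divides b (trans eq (trans (cong (ℕ._* ℓ) eq′) (ℕP.*-assoc b ℓ ℓ)))))) } }

prime∤prime : ∀ {p ℓ} → Prime p → Prime ℓ → ℓ ≢ p → ¬ p ∣ℕ ℓ
prime∤prime {p} {ℓ} pr prℓ ℓ≢p d = go (prime⇒irreducible prℓ d)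
  where
  go : p ≡ 1 ⊎ p ≡ ℓ → ⊥
  go (inj₁ p≡1) = ℕP.<⇒≢ (prime>1 pr) (sym p≡1)
  go (inj₂ p≡ℓ) = ℓ≢p (sym p≡ℓ)

-- The exponent of p in a = ± ∏ A_i^i is the index e with p ∣ A_e, so the hypothesis on gcd(a, v_p(a)) says p ∤ e.
index-prime : ∀ {p N A} (a : ℤ) → Prime p → (∀ i → 1 ≤ i → i < N → 1 ≤ A i) → ℤ.∣ a ∣ ≡ prodFrom1 (λ j → A j ℕ.^ j) N →
  ¬ (p ∣ℕ gcd ℤ.∣ a ∣ (vpℤ p a)) → p ∣ℕ ℤ.∣ a ∣ → (I : Index N A p) → ¬ p ∣ℕ Index.e I
index-prime {p} {N} {A} a pr A≥1 a≡ ∤gcd p∣a I p∣e = ∤gcd (gcd-greatest p∣a (subst (p ∣ℕ_) (sym vp≡e) p∣e))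
  where
  open Index I
  f : ℕ → ℕ
  f i = A i ℕ.^ i
  1≤e : 1 ≤ e
  1≤e = ℕP.n≢0⇒n>0 (λ e≡0 → prod-∤ f N pr (λ i 1≤i i<N → ∤-^ℕ pr (A i) i (others i 1≤i i<N (λ i≡e → ℕP.<⇒≢ 1≤i (sym (trans i≡e e≡0)))))
    (subst (p ∣ℕ_) a≡ p∣a))
  vp≡e : vpℤ p a ≡ e
  vp≡e = go (simple 1≤e)
    where
    go : ∃[ c ] (A e ≡ c ℕ.* p) × ¬ p ∣ℕ c → vpℤ p a ≡ e
    go (c , eq , ∤c) = trans (cong (vp p) factor) (vp-unique {e = e} pr 0<y ∤y)
      where
      y = prodFrom1 (omit e f) N ℕ.* c ℕ.^ e
      factor : ℤ.∣ a ∣ ≡ p ℕ.^ e ℕ.* y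
      factor = trans a≡ (trans (prod-extract f N e 1≤e e<N) (trans (cong (λ x → x ℕ.^ e ℕ.* prodFrom1 (omit e f) N) eq)
        (trans (cong (ℕ._* prodFrom1 (omit e f) N) (trans (^ℕ-distrib-* c p e) (ℕP.*-comm (c ℕ.^ e) (p ℕ.^ e))))
        (trans (ℕP.*-assoc (p ℕ.^ e) (c ℕ.^ e) _) (cong (p ℕ.^ e ℕ.*_) (ℕP.*-comm (c ℕ.^ e) _))))))
      ∤omit : ¬ p ∣ℕ prodFrom1 (omit e f) N
      ∤omit = omit-∤ f N e pr (λ i 1≤i i<N i≢e → ∤-^ℕ pr (A i) i (others i 1≤i i<N i≢e))
      ∤y : ¬ p ∣ℕ y
      ∤y h = either (euclid (prodFrom1 (omit e f) N) (c ℕ.^ e) h)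
        where
        euclid : ∀ x z → p ∣ℕ x ℕ.* z → p ∣ℕ x ⊎ p ∣ℕ z
        euclid x z = euclidsLemma x z pr
        either : p ∣ℕ prodFrom1 (omit e f) N ⊎ p ∣ℕ c ℕ.^ e → ⊥
        either (inj₁ h) = ∤omit h
        either (inj₂ h) = ∤-^ℕ pr c e ∤c h
      0<y : 0 < y
      0<y = ℕP.n≢0⇒n>0 (λ y≡0 → ∤y (subst (p ∣ℕ_) (sym y≡0) (p ℕD.∣0)))

cancel-coprime : ∀ {p} → Prime p → ∀ s u → ¬ p ∣ℕ u → ∀ m → p ℕ.^ s ∣ℕ u ℕ.* m → p ℕ.^ s ∣ℕ m
cancel-coprime pr s u ∤ m = coprime-divisor (prime-power-coprime pr ∤ s)

-- The indices k_m and the prescribed congruences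

module KSearch (p s : ℕ) (a : ℤ) (A : ℕ → ℕ) where
  open Thm13 p s a A

  kSearch-≤ : ∀ m D → kSearch m D ≤ D
  kSearch-≤ m zero = z≤n
  kSearch-≤ m (suc D) with (N ∸ p ℕ.^ (s ∸ suc D)) ℕ.≤? m
  ... | yes _ = ℕP.≤-refl
  ... | no _  = ℕP.m≤n⇒m≤1+n (kSearch-≤ m D)

  kSearch-start : ∀ m D → N ∸ p ℕ.^ (s ∸ kSearch m D) ≤ m
  kSearch-start m zero = subst (_≤ m) (sym (ℕP.n∸n≡0 N)) z≤n
  kSearch-start m (suc D) with (N ∸ p ℕ.^ (s ∸ suc D)) ℕ.≤? m
  ... | yes le = le
  ... | no _   = kSearch-start m D

  kSearch-max : ∀ m D l → kSearch m D < l → l ≤ D → m < N ∸ p ℕ.^ (s ∸ l)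
  kSearch-max m zero l lt le = ⊥-elim (ℕP.<⇒≱ lt le)
  kSearch-max m (suc D) l lt le with (N ∸ p ℕ.^ (s ∸ suc D)) ℕ.≤? m
  ... | yes _ = ⊥-elim (ℕP.<⇒≱ lt le)
  ... | no ≰  = go (ℕP.m≤n⇒m<n∨m≡n le)
    where
    go : l < suc D ⊎ l ≡ suc D → m < N ∸ p ℕ.^ (s ∸ l)
    go (inj₁ l<)   = kSearch-max m D l lt (ℕP.<⇒≤pred l<)
    go (inj₂ refl) = ℕP.≰⇒> ≰

  φ≤ : Prime p → 1 ≤ s → ∀ m → 1 ≤ k m → φ N ≤ m
  φ≤ pr 1≤s m 1≤k = ℕP.≤-trans (φ-bound pr 1≤s) (ℕP.≤-trans
    (ℕP.∸-monoʳ-≤ N (ℕP.^-monoʳ-≤ p {{ℕ.>-nonZero (prime>0 pr)}} (ℕP.∸-monoʳ-≤ s 1≤k))) (kSearch-start m d))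

  A'Cond-cases : ∀ m a' → A'Cond m a' →
    (k m ≡ s × (a' ≡ a ℤ.^ (p ∸ 2) [mod p ℕ.^ suc (k m) ])) ⊎
    (k m ≢ s × (a' ≡ a ℤ.^ ((p ∸ 2) ℕ.* p ℕ.^ (s ∸ suc (k m))) [mod p ℕ.^ suc (k m) ]))
  A'Cond-cases m a' h with k m ℕ.≟ s
  ... | yes e = inj₁ (e , h)
  ... | no ne = inj₂ (ne , h)

∣p^-mono : ∀ p {i j} → i ≤ j → + (p ℕ.^ i) ∣ℤ + (p ℕ.^ j)
∣p^-mono p {i} {j} i≤j = ℤS.∣ᵤ⇒∣ (subst (p ℕ.^ i ∣ℕ_) (trans (sym (ℕP.^-distribˡ-+-* p i (j ∸ i))) (cong (p ℕ.^_) (ℕP.m+[n∸m]≡n i≤j))) (ℕD.m∣m*n _))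

-- The `p`-th power of `a ^ u` is `a ^ u` times a power of `a ^ (p ∸ 1)`, which is 1 modulo `M`.
-- This links the prescribed residue of `a'`, where `k m < s`, with its `p`-th power, the power of
-- `aa` that occurs in the powers of `x`.
∣x^p-x : ∀ {M} a p u → 0 < p → M ∣ℤ a ℤ.^ (p ∸ 1) ℤ.- + 1 → M ∣ℤ (a ℤ.^ u) ℤ.^ p ℤ.- a ℤ.^ u
∣x^p-x {M} a (suc p) u _ h = subst (M ∣ℤ_) (ℤS′.solve 2 (λ X Y → X ℤS′.:* (Y ℤS′.:- ℤS′.con (+ 1)) ℤS′.:= X ℤS′.:* Y ℤS′.:- X) refl X (X ℤ.^ p))
  (ℤS.∣n⇒∣m*n X (subst (λ Y → M ∣ℤ Y ℤ.- + 1) swap (∣y-1⇒∣y^n-1 u h)))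
  where
  X = a ℤ.^ u
  swap : (a ℤ.^ p) ℤ.^ u ≡ X ℤ.^ p
  swap = trans (ℤP.^-*-assoc a p u) (trans (cong (a ℤ.^_) (ℕP.*-comm p u)) (sym (ℤP.^-*-assoc a u p)))

congruent : ∀ {M} (x y z : ℤ) → M ∣ℤ x ℤ.- y → M ∣ℤ z ℤ.- y → M ∣ℤ x ℤ.- z
congruent {M} x y z h h′ = subst (M ∣ℤ_) (ℤS′.solve 3 (λ x y z → (x ℤS′.:- y) ℤS′.:- (z ℤS′.:- y) ℤS′.:= x ℤS′.:- z) refl x y z) (ℤS.∣m∣n⇒∣m-n h h′)

mod⇒∣ : ∀ {x y M} → x ≡ y [mod M ] → + M ∣ℤ x ℤ.- y
mod⇒∣ = ℤS.∣ᵤ⇒∣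

module UnitCase {p s : ℕ} (pr : Prime p) (1≤s : 1 ≤ s) (a : ℤ) (A : ℕ → ℕ) (p∤a : ¬ + p ∣ℤ a) (a^≢1 : a ℤ.^ (p ∸ 1) ≢ + 1) where
  open Thm13 p s a A
  open KSearch p s a A
  open UnitNorm pr 1≤s a p∤a a^≢1 using (p^1+d∣y; d≤s)

  aa : ℤ
  aa = a ℤ.^ (p ∸ 2)

  A'Cond⇒ : ∀ m a' → A'Cond m a' → + (p ℕ.^ k m) ∣ℤ aa ℤ.^ (p ℕ.^ (s ∸ k m)) ℤ.- a'
  A'Cond⇒ m a' h = go (A'Cond-cases m a' h)
    where
    p^k∣ : ∀ {z} → + (p ℕ.^ suc (k m)) ∣ℤ z → + (p ℕ.^ k m) ∣ℤ z
    p^k∣ = ℤS.∣-trans (∣p^-mono p (ℕP.n≤1+n (k m)))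
    go : (k m ≡ s × (a' ≡ a ℤ.^ (p ∸ 2) [mod p ℕ.^ suc (k m) ])) ⊎
         (k m ≢ s × (a' ≡ a ℤ.^ ((p ∸ 2) ℕ.* p ℕ.^ (s ∸ suc (k m))) [mod p ℕ.^ suc (k m) ])) →
         + (p ℕ.^ k m) ∣ℤ aa ℤ.^ (p ℕ.^ (s ∸ k m)) ℤ.- a'
    go (inj₁ (k≡s , c)) = congruent (aa ℤ.^ (p ℕ.^ (s ∸ k m))) aa a' (subst (λ x → + (p ℕ.^ k m) ∣ℤ x ℤ.- aa) (sym aa^1) (divides (+ 0) (ℤP.+-inverseʳ aa)))
        (p^k∣ (mod⇒∣ {a'} {aa} c))
      where
      aa^1 : aa ℤ.^ (p ℕ.^ (s ∸ k m)) ≡ aa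
      aa^1 = trans (cong (λ l → aa ℤ.^ (p ℕ.^ l)) (trans (cong (s ∸_) k≡s) (ℕP.n∸n≡0 s))) (ℤP.*-identityʳ aa)
    go (inj₂ (k≢s , c)) = congruent (aa ℤ.^ (p ℕ.^ (s ∸ k m))) X a' (subst (λ x → + (p ℕ.^ k m) ∣ℤ x ℤ.- X) (sym aa^q)
        (∣x^p-x a p u (prime>0 pr) (ℤS.∣-trans (∣p^-mono p (ℕP.m≤n⇒m≤1+n (kSearch-≤ m d))) p^1+d∣y)))
        (p^k∣ (mod⇒∣ {a'} {X} c))
      where
      P = p ℕ.^ (s ∸ suc (k m))
      u = (p ∸ 2) ℕ.* P
      X = a ℤ.^ u
      k<s : k m < s
      k<s = ℕP.≤∧≢⇒< (ℕP.≤-trans (kSearch-≤ m d) d≤s) k≢s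
      aa^q : aa ℤ.^ (p ℕ.^ (s ∸ k m)) ≡ X ℤ.^ p
      aa^q = begin
        aa ℤ.^ (p ℕ.^ (s ∸ k m))        ≡⟨ cong (λ l → aa ℤ.^ (p ℕ.^ l)) (trans (sym (ℕP.suc-pred (s ∸ k m) {{ℕ.>-nonZero (ℕP.m<n⇒0<n∸m k<s)}})) (cong suc (ℕP.pred[m∸n]≡m∸[1+n] s (k m)))) ⟩
        aa ℤ.^ (p ℕ.* P)                ≡⟨ cong (aa ℤ.^_) (ℕP.*-comm p P) ⟩
        aa ℤ.^ (P ℕ.* p)                ≡⟨ ℤP.^-*-assoc aa P p ⟨
        (aa ℤ.^ P) ℤ.^ p                ≡⟨ cong (ℤ._^ p) (ℤP.^-*-assoc a (p ∸ 2) P) ⟩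
        X ℤ.^ p                         ∎
        where open ≡-Reasoning

-- The cases p ∣ a and p ∤ a

module PureRadical {p s : ℕ} (pr : Prime p) (1≤s : 1 ≤ s) (a : ℤ) (A : ℕ → ℕ)
    (sqf : ∀ j → 1 ≤ j → j < p ℕ.^ s → Squarefree (A j) × 1 ≤ A j)
    (cop : ∀ i j → 1 ≤ i → i < p ℕ.^ s → 1 ≤ j → j < p ℕ.^ s → i ≢ j → Coprime (A i) (A j))
    (∣a∣≡ : ℤ.∣ a ∣ ≡ prodFrom1 (λ j → A j ℕ.^ j) (p ℕ.^ s)) where

  open Thm13 p s a A

  0<N : 0 < N
  0<N = ℕP.m^n>0 p {{ℕ.>-nonZero (prime>0 pr)}} s

  open KTheory N 0<N a
  open NumberField N 0<N a
  open T using (AI; ι) renaming (_^_ to _^ᴿ_)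
  open Triangular Kring N a radical using (Zθ)

  A≥1 : ∀ i → 1 ≤ i → i < N → 1 ≤ A i
  A≥1 i 1≤i i<N = proj₂ (sqf i 1≤i i<N)

  σ : ℤ
  σ = proj₁ (sign-split a)

  a≡ : a ≡ σ ℤ.* + prodFrom1 (λ i → A i ℕ.^ i) N
  a≡ = trans (proj₁ (proj₂ (sign-split a))) (cong (λ m → σ ℤ.* + m) ∣a∣≡)

  open MonomialPart Kring N a radical A A≥1 σ a≡

  idx : ∀ {ℓ} → Prime ℓ → Index N A ℓ
  idx = index 0<N sqf cop

  local-at : ∀ {ℓ} (prℓ : Prime ℓ) → (∀ m → N ∣ℕ ℓ ℕ.* m → N ∣ℕ Index.e (idx prℓ) ℕ.* m → N ∣ℕ m) →
    ∀ {α} → AI Zθ α → ∃[ D ] (¬ ℓ ∣ℕ D) × Om (ι (+ D) ⊠ α)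
  local-at {ℓ} prℓ inj-ℓ = At.local ℓ prℓ (proj₂ (proj₂ (sign-split a)) prℓ) e e<N others simple inj-ℓ
    where open Index (idx prℓ)

  -- Here `ℓ` is prime to `N` and can be cancelled in the first divisibility; `Ramified.local-p`
  -- cancels the exponent of `p` in `a` in the second one instead.
  local-≢p : ∀ ℓ → Prime ℓ → ℓ ≢ p → ∀ {α} → AI Zθ α → ∃[ D ] (¬ ℓ ∣ℕ D) × Om (ι (+ D) ⊠ α)
  local-≢p ℓ prℓ ℓ≢p = local-at prℓ (λ m h _ → cancel-coprime pr s ℓ (prime∤prime pr prℓ ℓ≢p) m h)

  t≈θ/C : ∀ m → t m ≈ᴷ θ/C m
  t≈θ/C m = ≈ᴷ-trans (invK-· (C m) (θ^ 1 ^ᴿ m)) (·-cong (invℕ (C m)) (θ₁^ m))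

  module Ramified (∤gcd : ¬ (p ∣ℕ gcd ℤ.∣ a ∣ (vpℤ p a))) (p∣a : p ∣ℕ ℤ.∣ a ∣) where

    local-p : ∀ {α} → AI Zθ α → ∃[ D ] (¬ p ∣ℕ D) × Om (ι (+ D) ⊠ α)
    local-p = local-at pr (λ m _ → cancel-coprime pr s (Index.e (idx pr)) (index-prime a pr A≥1 ∣a∣≡ ∤gcd p∣a (idx pr)) m)

    basis : IntegralBasis basisI
    basis = integral-basis t (λ m _ → AI-Om (Omt m)) (integral⇒⟨t⟩ local) t-free basisI (λ i → ≈ᴷ-sym (t≈θ/C (toℕ i)))
      where
      local : ∀ ℓ → Prime ℓ → ∀ {α} → AI Zθ α → ∃[ D ] (¬ ℓ ∣ℕ D) × Om (ι (+ D) ⊠ α)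
      local ℓ prℓ = by (ℓ ℕ.≟ p)
        where
        by : Dec (ℓ ≡ p) → ∀ {α} → AI Zθ α → ∃[ D ] (¬ ℓ ∣ℕ D) × Om (ι (+ D) ⊠ α)
        by (yes refl) = local-p
        by (no ℓ≢p)   = local-≢p ℓ prℓ ℓ≢p

    -- If `p` divides `a`, then `a ^ (p ∸ 1) - 1` is prime to `p`; this is the value `r = -1`, which
    -- belongs to the first case of the theorem.
    vA≱2 : ¬ 2 ≤ vA
    vA≱2 2≤vA = prime∤1 pr (ℤS.∣⇒∣ᵤ (subst (+ p ∣ℤ_) (cancel₂ (a ℤ.^ (p ∸ 1))) (ℤS.∣m∣n⇒∣m-n p∣a^ p∣y)))
      where
      cancel₂ : ∀ x → x ℤ.- (x ℤ.- + 1) ≡ + 1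
      cancel₂ x = trans (cong (λ z → x ℤ.+ z) (ℤP.neg-distrib-+ x (ℤ.- + 1))) (trans (sym (ℤP.+-assoc x (ℤ.- x) (+ 1))) (cong (ℤ._+ + 1) (ℤP.+-inverseʳ x)))
      p∣y : + p ∣ℤ a ℤ.^ (p ∸ 1) ℤ.- + 1
      p∣y = ℤS.∣-trans (subst (λ m → + m ∣ℤ + (p ℕ.^ vA)) (ℕP.*-identityʳ p) (∣p^-mono p (ℕP.≤-trans (s≤s z≤n) 2≤vA)))
        (ℤS.∣ᵤ⇒∣ (vp-∣ p ℤ.∣ a ℤ.^ (p ∸ 1) ℤ.- + 1 ∣))
      p∣a^ : + p ∣ℤ a ℤ.^ (p ∸ 1)
      p∣a^ = subst (λ m → + p ∣ℤ a ℤ.^ m) (ℕP.suc-pred (p ∸ 1) {{ℕ.>-nonZero (ℕP.m<n⇒0<n∸m (prime>1 pr))}}) (ℤS.∣m⇒∣m*n {m = a} (a ℤ.^ ℕ.pred (p ∸ 1)) (ℤS.∣ᵤ⇒∣ {+ p} {a} p∣a))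

  module Unramified (irr : IrreducibleBinomial N a) (p∤a : ¬ + p ∣ℤ a) where

    open KSearch p s a A
    private
      module UC = UnitCase pr 1≤s a A p∤a (irreducible⇒a^[p-1]≢1 pr 1≤s a irr)
      module UN = UnitNorm pr 1≤s a p∤a (irreducible⇒a^[p-1]≢1 pr 1≤s a irr)

    p∤A : ∀ i → 1 ≤ i → i < N → ¬ p ∣ℕ A i
    p∤A i 1≤i i<N h = p∤a (ℤS.∣ᵤ⇒∣ (subst (p ∣ℕ_) (sym ∣a∣≡) (prod-∣ (λ j → A j ℕ.^ j) N i 1≤i i<N (∣-^ℕ (A i) i h 1≤i))))

    private
      module B = Basis Kring p s pr a radical A A≥1 σ a≡ UC.aa (λ h → p∤a (euclid^ pr a (p ∸ 2) h)) d UN.d≤s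
        (proj₁ UN.norm) (proj₂ (proj₂ UN.norm)) (proj₁ (proj₂ UN.norm)) p∤A

    module Chosen (a' w : ℕ → ℤ)
        (a'-cond : ∀ m → 1 ≤ k m → m < N → A'Cond m (a' m))
        (w-cond : ∀ m → 1 ≤ k m → m < N → WCond m (a' m) (w m)) where

      p^0∣ : ∀ m → ¬ 1 ≤ k m → ∀ z → + (p ℕ.^ k m) ∣ℤ z
      p^0∣ m ≱ z = subst (λ l → + (p ℕ.^ l) ∣ℤ z) (sym (ℕP.n<1⇒n≡0 (ℕP.≰⇒> ≱))) (divides z (sym (ℤP.*-identityʳ z)))

      A′≡ : ∀ m → m < N → + (p ℕ.^ k m) ∣ℤ UC.aa ℤ.^ (p ℕ.^ (s ∸ k m)) ℤ.- a' m
      A′≡ m m<N = go (1 ℕ.≤? k m)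
        where
        go : Dec (1 ≤ k m) → + (p ℕ.^ k m) ∣ℤ UC.aa ℤ.^ (p ℕ.^ (s ∸ k m)) ℤ.- a' m
        go (yes 1≤k) = UC.A'Cond⇒ m (a' m) (a'-cond m 1≤k m<N)
        go (no ≱)    = p^0∣ m ≱ _

      W≡ : ∀ m → m < N → + (p ℕ.^ k m) ∣ℤ w m ℤ.* + C m ℤ.* a' m ℤ.^ (p ℕ.^ k m ∸ 1) ℤ.- + 1
      W≡ m m<N = go (1 ℕ.≤? k m)
        where
        go : Dec (1 ≤ k m) → + (p ℕ.^ k m) ∣ℤ w m ℤ.* + C m ℤ.* a' m ℤ.^ (p ℕ.^ k m ∸ 1) ℤ.- + 1
        go (yes 1≤k) = mod⇒∣ {w m ℤ.* + C m ℤ.* a' m ℤ.^ (p ℕ.^ k m ∸ 1)} {+ 1} (w-cond m 1≤k m<N)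
        go (no ≱)    = p^0∣ m ≱ _

      open B.WithData k (λ m → kSearch-≤ m d) (λ m → kSearch-start m d) (λ m l → kSearch-max m d l) a' w A′≡ W≡ local-≢p public
        using (b; b≈t; b-free; b-integral; integral⇒Λ; S)

      basis : (β : Fin N → K) → (∀ i → β i ≈ᴷ b (toℕ i)) → IntegralBasis β
      basis = integral-basis b b-integral integral⇒Λ b-free

      b≈θ/C : ∀ m → ¬ 1 ≤ k m → b m ≈ᴷ θ/C m
      b≈θ/C m ≱ = ≈ᴷ-trans (b≈t m (ℕP.n<1⇒n≡0 (ℕP.≰⇒> ≱))) (t≈θ/C m)

      S≈ : ∀ m → S m ≈ᴷ (θ^ (j m) *K sumKℕ (p ℕ.^ k m ∸ 1) (λ i → (toℚ (a' m) · θ^ (p ℕ.^ (s ∸ k m))) ^K i))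
      S≈ m = ≈ᴷ-trans (T.*-cong (θ₁^ (j m)) (≈ᴷ-trans
          (T.Σ-cong Q (λ i _ → ≈ᴷ-trans (T.^-congˡ i (≈ᴷ-trans (ι-· (a' m) (θ^ 1 ^ᴿ q)) (·-cong (toℚ (a' m)) (θ₁^ q)))) (≈ᴷ-sym (^K-def x i))))
          (≈ᴷ-sym (sumKℕ-def Q (λ i → x ^K i)))))
        (⊠-def (θ^ (j m)) (sumKℕ Q (λ i → x ^K i)))
        where
        Q = p ℕ.^ k m ∸ 1
        q = p ℕ.^ (s ∸ k m)
        x : K
        x = toℚ (a' m) · θ^ q

      b≈δ : ∀ m → b m ≈ᴷ (invℕ (p ℕ.^ k m ℕ.* C m) · (θ^ m +K δ m (a' m) (w m)))
      b≈δ m = ≈ᴷ-trans (invK-· (p ℕ.^ k m ℕ.* C m) _) (·-cong (invℕ (p ℕ.^ k m ℕ.* C m))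
        (≈ᴷ-trans (⊞-def _ _) (+K-cong (θ₁^ m) (≈ᴷ-trans (ι-· (w m ℤ.* + C m) (S m)) (·-cong (toℚ (w m ℤ.* + C m)) (S≈ m))))))

    basis-I : vA ≤ 1 → IntegralBasis basisI
    basis-I vA≤1 = basis basisI (λ i → ≈ᴷ-sym (b≈θ/C (toℕ i) (k≱1 (toℕ i))))
      where
      k≱1 : ∀ m → ¬ 1 ≤ k m
      k≱1 m 1≤k = ℕP.<⇒≱ 1≤k (ℕP.≤-trans (kSearch-≤ m d) (ℕP.≤-trans (ℕP.m⊓n≤m (vA ∸ 1) s) (ℕP.∸-monoˡ-≤ 1 vA≤1)))
      -- With `d = 0` every `k m` is 0, so no condition is imposed on the multipliers and 0 can be
      -- taken for all of them.
      open Chosen (λ _ → + 0) (λ _ → + 0) (λ m 1≤k → ⊥-elim (k≱1 m 1≤k)) (λ m 1≤k → ⊥-elim (k≱1 m 1≤k))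

    basis-II : (a' w : ℕ → ℤ) →
      (∀ m → φ N ≤ m → m < N → A'Cond m (a' m)) → (∀ m → φ N ≤ m → m < N → WCond m (a' m) (w m)) → IntegralBasis (basisII a' w)
    basis-II a' w a'-cond w-cond = basis (basisII a' w) eq
      where
      open Chosen a' w (λ m 1≤k → a'-cond m (φ≤ pr 1≤s m 1≤k)) (λ m 1≤k → w-cond m (φ≤ pr 1≤s m 1≤k))
      eq : ∀ i → basisII a' w i ≈ᴷ b (toℕ i)
      eq i with φ N ℕ.≤? toℕ i
      ... | yes _ = ≈ᴷ-sym (b≈δ (toℕ i))
      -- Below `φ N` the index `k m` must be 0, and the uniform element `b` is the monomial.
      ... | no ≰  = ≈ᴷ-sym (b≈θ/C (toℕ i) (λ 1≤k → ≰ (φ≤ pr 1≤s (toℕ i) 1≤k)))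

open import Data.Nat using (ℕ; _≤_; _<_; _^_; _∸_)
open import Data.Nat.Primality using (Prime)
open import Data.Nat.Divisibility using (_∣_)
open import Data.Nat.Coprimality using (Coprime)
open import Data.Nat.GCD using (gcd)
open import Data.Integer using (ℤ; ∣_∣)
open import Data.Product using (_×_)
open import Relation.Nullary using (¬_)
open import Relation.Binary.PropositionalEquality using (_≡_; _≢_)

theorem1p3 : (p s : ℕ) (a : ℤ) (A : ℕ → ℕ) →
    Prime p → 1 ≤ s →
    IrreducibleBinomial (p ^ s) a →
    PowerFree (p ^ s) ∣ a ∣ →
    (∀ j → 1 ≤ j → j < p ^ s → Squarefree (A j) × 1 ≤ A j) →
    (∀ i j → 1 ≤ i → i < p ^ s → 1 ≤ j → j < p ^ s → i ≢ j → Coprime (A i) (A j)) →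
    ∣ a ∣ ≡ prodFrom1 (λ j → A j ^ j) (p ^ s) →
    ¬ (p ∣ (gcd (∣ a ∣) (vpℤ p a))) →
    (Thm13.vA p s a A ≤ 1 →
    Thm13.IntegralBasis p s a A (Thm13.basisI p s a A)) ×
    (2 ≤ Thm13.vA p s a A →
    (a' w : ℕ → ℤ) →
    (∀ m → φ (p ^ s) ≤ m → m < p ^ s → Thm13.A'Cond p s a A m (a' m)) →
    (∀ m → φ (p ^ s) ≤ m → m < p ^ s → Thm13.WCond p s a A m (a' m) (w m)) →
    Thm13.IntegralBasis p s a A (Thm13.basisII p s a A a' w))
theorem1p3 p s a A pr 1≤s irr _ sqf cop ∣a∣≡ ∤gcd = go (p ℕD.∣? ∣ a ∣)
  where
  open PureRadical pr 1≤s a A sqf cop ∣a∣≡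
  go : Dec (p ∣ ∣ a ∣) → _
  -- Both `r = -1` and `r = 0` are contained in `vA ≤ 1`; for `p ∣ a` the second case cannot occur.
  go (yes p∣a) = (λ _ → Ramified.basis ∤gcd p∣a) , (λ 2≤vA → ⊥-elim (Ramified.vA≱2 ∤gcd p∣a 2≤vA))
  go (no p∤a)  = Unramified.basis-I irr ∤a , (λ _ → Unramified.basis-II irr ∤a)
    where
    ∤a : ¬ + p ∣ℤ a
    ∤a h = p∤a (ℤS.∣⇒∣ᵤ h)
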